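{- Let $g\ge2$ and $G\in\Gamma_{\ge3}(g)$. For $n\ge0$ let $\mathscr G_n$ be the collection of graphs obtained from $G$ by subdividing each edge $e$ of $G$ with $n_e\ge0$ new vertices, one graph for each tuple $(n_e)_{e\in E(G)}$ with $\sum_e n_e=n$. Let $$\mathscr Z_G=\frac{1}{|\operatorname{Aut}G|}\sum_{n\ge0}\sum_{H\in\mathscr G_n}\widetilde W_H(b,w_-,w_+),$$ a formal power series in $b,w_-,w_+$, and let $\mathscr X_G(x)\in\mathbb{Q}[t][[x]]$ be the result of the substitution $b\gets\mathscr T_b$, $w_+\gets\mathscr T_w^++\mathscr T_w^-$, $w_-\gets t^{ -1}\mathscr T_w^++t\,\mathscr T_w^-$. Then $$\mathscr W_g(x)=\sum_{G\in\Gamma_{\ge3}(g)}\mathscr X_G(x).$$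
   Context: Graphs may have loops and parallel edges. A coloring is $c\colon V\to\{0,1\}$ ($0$ white, $1$ black). For a vertex $v$, its black-neighbor count is the number of edges joining $v$ to black vertices, with multiplicity, loops not counted. Full $W$-polynomial: $\widetilde W_K=\sum_c b^{\#\text{black}}w_+^{\#\text{white with even count}}w_-^{\#\text{white with odd count}}$; black-white polynomial $W_K(t)=\sum_c t^{\#\text{white vertices with even count}}$. $\operatorname{Aut}$ includes permutations of vertices and parallel edges and flips/permutations of loops. The degree of a vertex counts loops twice. $\Gamma(g)$ is the set of isomorphism classes of connected graphs with first Betti number $g$ ($=1-|V|+|E|$), $\Gamma_{\ge3}(g)\subseteq\Gamma(g)$ the (finite) subset with all vertex degrees at least $3$, and $\mathscr W_g(x)=\sum_{G\in\Gamma(g)}W_G(t)x^{v(G)}/|\operatorname{Aut}G|$, $v(G)$ the number of vertices. Rooted tree series: with sums over isomorphism classes of rooted trees $T$ (root-preserving automorphisms) and colorings $c$, $\mathscr T_w^+$ (resp. $\mathscr T_w^-$, $\mathscr T_b$) is $\sum t^{\#\{\text{white vertices with even count}\}}x^{v(T)}/|\operatorname{Aut}T|$ over pairs $(T,c)$ whose root is white with an even number of black children (resp. white with an odd number of black children; black). -}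

module Defs where

open import Data.Bool using (Bool; true; false; _∧_; _∨_; not; if_then_else_)
open import Data.Nat as ℕ using (ℕ; zero; suc; _+_; _∸_; _≤ᵇ_; _<?_)
import Data.Nat.Properties as ℕP
open import Data.Integer as ℤ using (ℤ)
import Data.Integer.Properties as ℤP
open import Data.Rational as ℚ using (ℚ; 0ℚ; 1ℚ)
open import Data.Fin as Fin using (Fin; toℕ; fromℕ<)
import Data.Fin.Properties as FinP
open import Data.List as List using (List; []; _∷_; _++_; map; concatMap; filterᵇ; length; allFin; upTo; foldr)
open import Data.Bool.ListAction using (all; any)
open import Data.Nat.ListAction using (sum)
open import Data.Product using (Σ; _×_; _,_; proj₁; proj₂)
import Data.Product.Properties as ProdP
open import Data.Sum using (_⊎_; inj₁; inj₂)
import Data.Sum.Properties as SumP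
open import Relation.Nullary.Decidable using (does; yes; no)
open import Relation.Binary.Definitions using (DecidableEquality)
open import Relation.Binary.PropositionalEquality using (_≡_)

allFuns : {A : Set} → (m : ℕ) → List A → List (Fin m → A)
allFuns zero    xs = (λ ()) ∷ []
allFuns (suc m) xs =
  concatMap (λ a → map (λ f → λ { Fin.zero → a ; (Fin.suc i) → f i }) (allFuns m xs)) xs

count : {A : Set} → (A → Bool) → List A → ℕ
count p xs = length (filterᵇ p xs)

sumℕ : {A : Set} → (A → ℕ) → List A → ℕ
sumℕ f xs = sum (map f xs)

bit : Bool → ℕ
bit true  = 1
bit false = 0

even? : ℕ → Bool
even? zero          = true
even? (suc zero)    = false
even? (suc (suc n)) = even? n

-- 1/d as a rational (only ever applied to positive d: automorphism
-- counts and isomorphism-class sizes); 1/0 is set to 0 by convention.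
recip : ℕ → ℚ
recip zero    = 0ℚ
recip (suc d) = ℤ.+ 1 ℚ./ suc d

-- Laurent polynomials in t (finite lists of terms q·t^k) and formal
-- power series in x with such coefficients.

LPoly : Set
LPoly = List (ℤ × ℚ)

coeff : ℤ → LPoly → ℚ
coeff k p = foldr ℚ._+_ 0ℚ (map proj₂ (filterᵇ (λ term → does (proj₁ term ℤ.≟ k)) p))

monoT : ℤ → LPoly
monoT k = (k , 1ℚ) ∷ []

scaleP : ℚ → LPoly → LPoly
scaleP q = map (λ { (k , a) → (k , q ℚ.* a) })

mulP : LPoly → LPoly → LPoly
mulP p r = concatMap (λ { (k , a) → map (λ { (l , b) → (k ℤ.+ l , a ℚ.* b) }) r }) p

shiftP : ℤ → LPoly → LPoly
shiftP j = map (λ { (k , a) → (j ℤ.+ k , a) })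

-- element of Q[t,t^{-1}][[x]] : coefficient of x^N
Series : Set
Series = ℕ → LPoly

oneS : Series
oneS zero    = monoT (ℤ.+ 0)
oneS (suc _) = []

_⊕_ : Series → Series → Series
(f ⊕ g) N = f N ++ g N

_⊗_ : Series → Series → Series
(f ⊗ g) N = concatMap (λ i → mulP (f i) (g (N ∸ i))) (upTo (suc N))

shiftS : ℤ → Series → Series
shiftS j f N = shiftP j (f N)

powS : Series → ℕ → Series
powS f zero    = oneS
powS f (suc n) = f ⊗ powS f n

record FGraph : Set₁ where
  field
    V     : Set
    E     : Set
    verts : List V          -- complete, duplicate-free listing of V
    edges : List E          -- complete, duplicate-free listing of E
    eqV   : DecidableEquality V
    ends  : E → V × V

module _ (G : FGraph) where
  open FGraph G

  -- all colourings V → Bool (true = black), one per assignment on verts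
  colourings : List (V → Bool)
  colourings = go verts
    where
    go : List V → List (V → Bool)
    go []       = (λ _ → false) ∷ []
    go (v ∷ vs) = concatMap (λ c → set c true ∷ set c false ∷ []) (go vs)
      where
      set : (V → Bool) → Bool → V → Bool
      set c b w = if does (eqV w v) then b else c w

  blackCount : (V → Bool) → V → ℕ
  blackCount c v = sumℕ contrib edges
    where
    contrib : E → ℕ
    contrib e with ends e
    ... | (a , b) = if does (eqV a b) then 0
                    else (if does (eqV a v) then bit (c b) else 0)
                         + (if does (eqV b v) then bit (c a) else 0)

  isWhiteEven isWhiteOdd : (V → Bool) → V → Bool
  isWhiteEven c v = not (c v) ∧ even? (blackCount c v)
  isWhiteOdd  c v = not (c v) ∧ not (even? (blackCount c v))

  #black #whiteEven #whiteOdd : (V → Bool) → ℕ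
  #black     c = count c verts
  #whiteEven c = count (isWhiteEven c) verts
  #whiteOdd  c = count (isWhiteOdd c) verts

  -- full W-polynomial, as the list of its monomials b^i w₊^j w₋^k
  -- (one per colouring; coefficients are the multiplicities)
  Wfull : List (ℕ × ℕ × ℕ)
  Wfull = map (λ c → (#black c , #whiteEven c , #whiteOdd c)) colourings

  Wbw : LPoly
  Wbw = map (λ c → (ℤ.+ #whiteEven c , 1ℚ)) colourings

-- Labelled multigraphs on vertex set Fin n with edge set Fin m;
-- each edge is stored with an ordered pair of endpoints (a loop has
-- equal endpoints).  Graphs may have loops and parallel edges.

LGraph : ℕ → ℕ → Set
LGraph n m = Fin m → Fin n × Fin n

pairs : (n : ℕ) → List (Fin n × Fin n)
pairs n = concatMap (λ a → map (λ b → (a , b)) (allFin n)) (allFin n)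

allGraphs : (n m : ℕ) → List (LGraph n m)
allGraphs n m = allFuns m (pairs n)

toFG : {n m : ℕ} → LGraph n m → FGraph
toFG {n} {m} G = record
  { V = Fin n ; E = Fin m ; verts = allFin n ; edges = allFin m
  ; eqV = FinP._≟_ ; ends = G }

_==_ : {n : ℕ} → Fin n → Fin n → Bool
a == b = does (a FinP.≟ b)

_==²_ : {n : ℕ} → Fin n × Fin n → Fin n × Fin n → Bool
(a , b) ==² (c , d) = (a == c) ∧ (b == d)

allF : (n : ℕ) → (Fin n → Bool) → Bool
allF n p = all p (allFin n)

anyF : (n : ℕ) → (Fin n → Bool) → Bool
anyF n p = any p (allFin n)

perms : (n : ℕ) → List (Fin n → Fin n)
perms n = filterᵇ (λ σ → allF n (λ i → allF n (λ j → not (σ i == σ j) ∨ (i == j))))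
                  (allFuns n (allFin n))

-- candidate isomorphisms: vertex permutation σ, edge permutation π,
-- and an orientation flip for every edge (half-edge swap)
IsoData : ℕ → ℕ → Set
IsoData n m = (Fin n → Fin n) × (Fin m → Fin m) × (Fin m → Bool)

isoData : (n m : ℕ) → List (IsoData n m)
isoData n m = concatMap (λ σ → concatMap (λ π → map (λ ε → (σ , π , ε))
                (allFuns m (true ∷ false ∷ []))) (perms m)) (perms n)

flipIf : {A : Set} → Bool → A × A → A × A
flipIf false p       = p
flipIf true  (a , b) = (b , a)

isIso : {n m : ℕ} → LGraph n m → LGraph n m → IsoData n m → Bool
isIso {n} {m} G G' (σ , π , ε) =
  allF m (λ e → G' (π e) ==² flipIf (ε e) (σ (proj₁ (G e)) , σ (proj₂ (G e))))

isomorphic : {n m : ℕ} → LGraph n m → LGraph n m → Bool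
isomorphic {n} {m} G G' = any (isIso G G') (isoData n m)

-- |Aut G|: vertex permutations together with permutations of parallel
-- edges and flips/permutations of loops
autCount : {n m : ℕ} → LGraph n m → ℕ
autCount {n} {m} G = count (isIso G G) (isoData n m)

classSize : {n m : ℕ} → LGraph n m → ℕ
classSize {n} {m} G = count (isomorphic G) (allGraphs n m)

isIsoR : {n m : ℕ} → LGraph n m → Fin n → LGraph n m → Fin n → IsoData n m → Bool
isIsoR G r G' r' d = isIso G G' d ∧ (proj₁ d r == r')

autCountR : {n m : ℕ} → LGraph n m → Fin n → ℕ
autCountR {n} {m} G r = count (isIsoR G r G r) (isoData n m)

classSizeR : {n m : ℕ} → LGraph n m → Fin n → ℕ
classSizeR {n} {m} G r =
  sumℕ (λ r' → count (λ G' → any (isIsoR G r G' r') (isoData n m)) (allGraphs n m)) (allFin n)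

-- connectivity: every pair of vertices joined by a walk (length ≤ n
-- suffices), and at least one vertex
adj : {n m : ℕ} → LGraph n m → Fin n → Fin n → Bool
adj {n} {m} G u v = anyF m (λ e → (G e ==² (u , v)) ∨ (G e ==² (v , u)))

reach : {n m : ℕ} → LGraph n m → ℕ → Fin n → Fin n → Bool
reach G zero    u v = u == v
reach {n} G (suc k) u v = reach G k u v ∨ anyF n (λ w → reach G k u w ∧ adj G w v)

connected : {n m : ℕ} → LGraph n m → Bool
connected {n} G = (1 ≤ᵇ n) ∧ allF n (λ u → allF n (λ v → reach G n u v))

degree : {n m : ℕ} → LGraph n m → Fin n → ℕ
degree {n} {m} G v = sumℕ (λ e → bit (proj₁ (G e) == v) + bit (proj₂ (G e) == v)) (allFin m)

minDeg3 : {n m : ℕ} → LGraph n m → Bool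
minDeg3 {n} G = allF n (λ v → 3 ≤ᵇ degree G v)

-- sum over isomorphism classes [G] of labelled graphs with n vertices,
-- m edges and an isomorphism-invariant property P, of F(G): realised as
-- the sum over all labelled G with P of F(G)/|[G]|.
sumClasses : (n m : ℕ) → (LGraph n m → Bool) → (LGraph n m → LPoly) → LPoly
sumClasses n m P F =
  concatMap (λ G → scaleP (recip (classSize G)) (F G)) (filterᵇ P (allGraphs n m))

-- 𝒲_g(x) : coefficient of x^N
-- (connected graphs with N vertices and Betti number g have N+g-1 edges)

𝒲 : ℕ → Series
𝒲 g N = sumClasses N (N + (g ∸ 1)) connected
          (λ G → scaleP (recip (autCount G)) (Wbw (toFG G)))

-- Rooted tree series.  Rooted trees with N vertices = connected graphs
-- with N vertices and N-1 edges, with a root; sum over isomorphism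
-- classes of rooted trees (T,r) and over colourings c satisfying a
-- condition on the root.

data RootType : Set where
  wPlus wMinus blk : RootType

rootOK : RootType → {N : ℕ} → (T : LGraph N (N ∸ 1)) → Fin N → (Fin N → Bool) → Bool
rootOK wPlus  T r c = isWhiteEven (toFG T) c r
rootOK wMinus T r c = isWhiteOdd  (toFG T) c r
rootOK blk    T r c = c r

treeSeries : RootType → Series
treeSeries ty N =
  concatMap (λ r →
    concatMap (λ T →
      scaleP (recip (classSizeR T r ℕ.* autCountR T r))
        (map (λ c → (ℤ.+ #whiteEven (toFG T) c , 1ℚ))
             (filterᵇ (rootOK ty T r) (colourings (toFG T)))))
      (filterᵇ connected (allGraphs N (N ∸ 1))))
    (allFin N)

𝒯b 𝒯w+ 𝒯w- : Series
𝒯b  = treeSeries blk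
𝒯w+ = treeSeries wPlus
𝒯w- = treeSeries wMinus

substMono : ℕ × ℕ × ℕ → Series
substMono (i , j , k) =
  powS 𝒯b i ⊗ (powS (𝒯w+ ⊕ 𝒯w-) j
    ⊗ powS (shiftS (ℤ.-[1+ 0 ]) 𝒯w+ ⊕ shiftS (ℤ.+ 1) 𝒯w-) k)

module _ {n m : ℕ} (G : LGraph n m) (ns : Fin m → ℕ) where

  SubV : Set
  SubV = Fin n ⊎ Σ (Fin m) (λ e → Fin (ns e))

  SubE : Set
  SubE = Σ (Fin m) (λ e → Fin (suc (ns e)))

  -- the i-th vertex along the subdivided edge e (0 = first endpoint,
  -- ns e + 1 = second endpoint)
  pos : (e : Fin m) → ℕ → SubV
  pos e zero    = inj₁ (proj₁ (G e))
  pos e (suc i) with i <? ns e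
  ... | yes i<  = inj₂ (e , fromℕ< i<)
  ... | no  _   = inj₁ (proj₂ (G e))

  subdivide : FGraph
  subdivide = record
    { V = SubV
    ; E = SubE
    ; verts = map inj₁ (allFin n)
              ++ concatMap (λ e → map (λ i → inj₂ (e , i)) (allFin (ns e))) (allFin m)
    ; edges = concatMap (λ e → map (λ j → (e , j)) (allFin (suc (ns e)))) (allFin m)
    ; eqV = SumP.≡-dec FinP._≟_ (ProdP.≡-dec FinP._≟_ FinP._≟_)
    ; ends = λ { (e , j) → (pos e (toℕ j) , pos e (suc (toℕ j))) }
    }

tuples : (m k : ℕ) → List (Fin m → ℕ)
tuples zero    zero    = (λ ()) ∷ []
tuples zero    (suc k) = []
tuples (suc m) k =
  concatMap (λ i → map (λ f → λ { Fin.zero → i ; (Fin.suc e) → f e }) (tuples m (k ∸ i)))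
            (upTo (suc k))

-- 𝒵_G, graded by the number k of subdivision vertices: the list of
-- weighted monomials (1/|Aut G|) · b^i w₊^j w₋^l making up
-- (1/|Aut G|) Σ_{H ∈ 𝒢_k} W̃_H
𝒵 : {n m : ℕ} → LGraph n m → ℕ → List (ℚ × (ℕ × ℕ × ℕ))
𝒵 G k = concatMap (λ ns → map (λ mono → (recip (autCount G) , mono))
                              (Wfull (subdivide G ns)))
                  (tuples _ k)

-- 𝒳_G(x), coefficient of x^N.  Subdivisions with k > N subdivision
-- vertices have more than N vertices, and each substituted series has
-- zero constant term, so they do not contribute to x^N.
𝒳 : {n m : ℕ} → LGraph n m → Series
𝒳 G N = concatMap (λ k → concatMap (λ { (q , mono) → scaleP q (substMono mono N) }) (𝒵 G k))
                  (upTo (suc N))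

-- Σ_{G ∈ Γ_{≥3}(g)} 𝒳_G(x), coefficient of x^N.  Graphs in Γ_{≥3}(g)
-- have v ≤ 2g-2 vertices (2(v+g-1) = Σ deg ≥ 3v).
sumΓ≥3𝒳 : ℕ → Series
sumΓ≥3𝒳 g N =
  concatMap (λ v → sumClasses v (v + (g ∸ 1)) (λ G → connected G ∧ minDeg3 G) (λ G → 𝒳 G N))
            (upTo (suc (2 ℕ.* g ∸ 2)))

-- Both sides are the values, at the invariant f = [t^k] Σ_c t^#{white vertices with even count}, of two functionals on
-- isomorphism invariants of graphs: Λ is the weighted sum of f over connected graphs with N vertices, Φ the one over
-- subdivisions of graphs of minimum degree 3 with rooted trees attached at all vertices.  For every invariant f, deleting
-- a leaf gives the same recursion in N for Λ and Φ, and so does smoothing a vertex of degree 2 when f vanishes on graphs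
-- with leaves.  Let L and J count the leaves and the vertices of degree 2.  Writing f = L · (f / L) + J · (f₀ / J) + rest,
-- where f₀ is the restriction of f to graphs with L = 0, one gets Λ f = Φ f by induction on N, since a connected graph
-- of Betti number at least 2 with L = J = 0 has minimum degree 3.  The orbit-stabiliser theorem turns sums over
-- isomorphism classes into sums over labelled graphs, and once the subdivided graph is coloured, the sum over the
-- attached trees factors over its vertices into the substituted series.

module Submission where

open import Defs
open import Data.Bool using (Bool; true; false; _∧_; _∨_; not; if_then_else_; T)
open import Data.Bool.ListAction using (any)
import Data.Bool.Properties as BoolP
open import Data.Empty using (⊥; ⊥-elim)
open import Data.Fin as Fin using (Fin; toℕ; punchIn)
import Data.Fin.Properties as FinP
open import Data.Integer as ℤ using (ℤ)
import Data.Integer.Properties as ℤP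
open import Data.List as List using (List; []; _∷_; _++_; map; concatMap; filterᵇ; length; allFin; upTo; tabulate)
open import Data.List.Membership.Propositional using (_∈_)
import Data.List.Membership.Propositional.Properties as ∈P
import Data.List.Membership.Propositional.Properties.WithK as ∈K
import Data.List.Properties as ListP
import Data.List.Relation.Binary.BagAndSetEquality as Bag
open import Data.List.Relation.Binary.Permutation.Propositional using (_↭_; refl; prep; swap; trans; ↭-sym)
import Data.List.Relation.Binary.Permutation.Propositional.Properties as ↭P
open import Data.List.Relation.Unary.All as All using (All; []; _∷_)
import Data.List.Relation.Unary.All.Properties as AllP
open import Data.List.Relation.Unary.Any as Any using (Any; here; there)
import Data.List.Relation.Unary.Any.Properties as AnyP
open import Data.List.Relation.Unary.Unique.Propositional using (Unique; []; _∷_)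
import Data.List.Relation.Unary.Unique.Propositional.Properties as UniqueP
open import Data.Maybe using (Maybe; just; nothing)
import Data.Maybe.Properties as MaybeP
open import Data.Nat as ℕ using (ℕ; zero; suc; _∸_; _≤_; _<_; z≤n; s≤s; _!)
import Data.Nat.Properties as ℕP
import Data.Nat.Solver as ℕS
open import Data.Product using (Σ; ∃; _×_; _,_; proj₁; proj₂)
import Data.Product.Properties as ProdP
open import Data.Rational as ℚ using (ℚ; 0ℚ; 1ℚ)
import Data.Rational.Properties as ℚP
import Data.Rational.Unnormalised as ℚᵘ
import Data.Rational.Unnormalised.Properties as ℚᵘP
open import Data.Sum using (_⊎_; inj₁; inj₂; [_,_]′)
import Data.Sum.Properties as SumP
open import Data.Unit using (tt)
open import Function using (_∘_; id)
open import Function.Bundles using (mk⇔; Equivalence)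
import Algebra.Properties.Group
open import Relation.Binary.Construct.Closure.ReflexiveTransitive as Star using (Star; ε; _◅_; _◅◅_)
open import Relation.Binary.Definitions using (DecidableEquality)
open import Relation.Binary.PropositionalEquality as ≡ using (_≡_; _≢_; refl; cong; cong₂; sym; subst; module ≡-Reasoning)
open import Relation.Nullary using (¬_; Dec; yes; no; does)

open ≡-Reasoning
-- Finite sums

-- The unique decomposition of a connected graph into core, subdivision and trees is never
-- constructed. Two functionals agree if they obey the same recursions and agree on invariants
-- supported on graphs without leaves and vertices to smooth, so only the removal of a single marked
-- vertex has to be counted. The price is an induction over all invariants at once: f/L and the sums
-- over leaf additions or subdivisions are no longer counts of colourings. Smoothing is confined to
-- invariants that vanish on graphs with leaves because a vertex of degree 2 may also lie inside an
-- attached tree. Without leaves all trees are single vertices, and the vertices to smooth are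
-- exactly the subdivision vertices. A labelled graph with n vertices and m edges has weight 1/(n!
-- m! 2^m). Removing a vertex together with one edge changes this weight by exactly the number of
-- ways to label the vertex and to place and orient the edge. J counts a vertex to smooth once for
-- each of its two edges, so that an edge can be marked; a vertex whose two ends form a loop counts
-- 0.

infixl 6 _+_
infixl 7 _*_

-- Opaque copies of the operations of ℚ, so that unification never unfolds them.
opaque
  _+_ _*_ : ℚ → ℚ → ℚ
  _+_ = ℚ._+_
  _*_ = ℚ._*_

opaque
  unfolding _+_

  +-def : ∀ a b → a + b ≡ a ℚ.+ b
  +-def a b = refl

  *-def : ∀ a b → a * b ≡ a ℚ.* b
  *-def a b = refl

  +-assoc : ∀ a b c → (a + b) + c ≡ a + (b + c)
  +-assoc = ℚP.+-assoc

  +-comm : ∀ a b → a + b ≡ b + a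
  +-comm = ℚP.+-comm

  +-identityˡ : ∀ a → 0ℚ + a ≡ a
  +-identityˡ = ℚP.+-identityˡ

  +-identityʳ : ∀ a → a + 0ℚ ≡ a
  +-identityʳ = ℚP.+-identityʳ

  *-assoc : ∀ a b c → (a * b) * c ≡ a * (b * c)
  *-assoc = ℚP.*-assoc

  *-comm : ∀ a b → a * b ≡ b * a
  *-comm = ℚP.*-comm

  *-identityˡ : ∀ a → 1ℚ * a ≡ a
  *-identityˡ = ℚP.*-identityˡ

  *-identityʳ : ∀ a → a * 1ℚ ≡ a
  *-identityʳ = ℚP.*-identityʳ

  *-zeroˡ : ∀ a → 0ℚ * a ≡ 0ℚ
  *-zeroˡ = ℚP.*-zeroˡ

  *-zeroʳ : ∀ a → a * 0ℚ ≡ 0ℚ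
  *-zeroʳ = ℚP.*-zeroʳ

  *-distribˡ-+ : ∀ a b c → a * (b + c) ≡ a * b + a * c
  *-distribˡ-+ = ℚP.*-distribˡ-+

  *-distribʳ-+ : ∀ c a b → (a + b) * c ≡ a * c + b * c
  *-distribʳ-+ = ℚP.*-distribʳ-+

  +-cancelˡ : ∀ a {b c} → a + b ≡ a + c → b ≡ c
  +-cancelˡ a = ℚG.∙-cancelˡ a _ _
    where module ℚG = Algebra.Properties.Group ℚP.+-0-group

+-left-comm : ∀ a b c → a + (b + c) ≡ b + (a + c)
+-left-comm a b c = ≡.trans (sym (+-assoc a b c)) (≡.trans (cong (_+ c) (+-comm a b)) (+-assoc b a c))

*-left-comm : ∀ a b c → a * (b * c) ≡ b * (a * c)
*-left-comm a b c = ≡.trans (sym (*-assoc a b c)) (≡.trans (cong (_* c) (*-comm a b)) (*-assoc b a c))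

+-interchange : ∀ a b c d → (a + b) + (c + d) ≡ (a + c) + (b + d)
+-interchange a b c d =
  ≡.trans (+-assoc a b _) (≡.trans (cong (a +_) (+-left-comm b c d)) (sym (+-assoc a c _)))

variable
  A B C : Set

Injective : (A → B) → Set
Injective f = ∀ {a b} → f a ≡ f b → a ≡ b

nat : ℕ → ℚ
nat zero    = 0ℚ
nat (suc n) = 1ℚ + nat n

χ : Bool → ℚ
χ true  = 1ℚ
χ false = 0ℚ

∑ : List A → (A → ℚ) → ℚ
∑ []       f = 0ℚ
∑ (x ∷ xs) f = f x + ∑ xs f

∑-cong : ∀ {f g : A → ℚ} xs → (∀ x → f x ≡ g x) → ∑ xs f ≡ ∑ xs g
∑-cong []       eq = refl
∑-cong (x ∷ xs) eq = cong₂ _+_ (eq x) (∑-cong xs eq)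

∑-cong-All : ∀ {f g : A → ℚ} {xs} → All (λ x → f x ≡ g x) xs → ∑ xs f ≡ ∑ xs g
∑-cong-All []         = refl
∑-cong-All (eq ∷ eqs) = cong₂ _+_ eq (∑-cong-All eqs)

∑-0 : ∀ {f : A → ℚ} xs → (∀ x → f x ≡ 0ℚ) → ∑ xs f ≡ 0ℚ
∑-0 []       eq = refl
∑-0 (x ∷ xs) eq = ≡.trans (cong₂ _+_ (eq x) (∑-0 xs eq)) (+-identityˡ 0ℚ)

∑-+ : ∀ (f g : A → ℚ) xs → ∑ xs (λ x → f x + g x) ≡ ∑ xs f + ∑ xs g
∑-+ f g []       = sym (+-identityˡ 0ℚ)
∑-+ f g (x ∷ xs) = ≡.trans (cong ((f x + g x) +_) (∑-+ f g xs)) (+-interchange (f x) (g x) _ _)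

∑-*ˡ : ∀ c (f : A → ℚ) xs → c * ∑ xs f ≡ ∑ xs (λ x → c * f x)
∑-*ˡ c f []       = *-zeroʳ c
∑-*ˡ c f (x ∷ xs) = ≡.trans (*-distribˡ-+ c (f x) _) (cong (c * f x +_) (∑-*ˡ c f xs))

∑-*ʳ : ∀ c (f : A → ℚ) xs → ∑ xs f * c ≡ ∑ xs (λ x → f x * c)
∑-*ʳ c f []       = *-zeroˡ c
∑-*ʳ c f (x ∷ xs) = ≡.trans (*-distribʳ-+ c (f x) _) (cong (f x * c +_) (∑-*ʳ c f xs))

∑-swap : ∀ (xs : List A) (ys : List B) (f : A → B → ℚ) →
         ∑ xs (λ x → ∑ ys (f x)) ≡ ∑ ys (λ y → ∑ xs (λ x → f x y))
∑-swap []       ys f = sym (∑-0 ys (λ _ → refl))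
∑-swap (x ∷ xs) ys f = ≡.trans (cong (∑ ys (f x) +_) (∑-swap xs ys f)) (sym (∑-+ (f x) _ ys))

∑-++ : ∀ (xs ys : List A) (f : A → ℚ) → ∑ (xs ++ ys) f ≡ ∑ xs f + ∑ ys f
∑-++ []       ys f = sym (+-identityˡ _)
∑-++ (x ∷ xs) ys f = ≡.trans (cong (f x +_) (∑-++ xs ys f)) (sym (+-assoc (f x) _ _))

∑-map : ∀ (h : A → B) xs (f : B → ℚ) → ∑ (map h xs) f ≡ ∑ xs (f ∘ h)
∑-map h []       f = refl
∑-map h (x ∷ xs) f = cong (f (h x) +_) (∑-map h xs f)

∑-concatMap : ∀ (h : A → List B) xs (f : B → ℚ) →
              ∑ (concatMap h xs) f ≡ ∑ xs (λ x → ∑ (h x) f)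
∑-concatMap h []       f = refl
∑-concatMap h (x ∷ xs) f = ≡.trans (∑-++ (h x) _ f) (cong (∑ (h x) f +_) (∑-concatMap h xs f))

∑-concatMap-mapᵈ : ∀ (g : A → B → C) xs (ys : A → List B) (f : C → ℚ) →
                   ∑ (concatMap (λ x → map (g x) (ys x)) xs) f ≡ ∑ xs (λ x → ∑ (ys x) (λ y → f (g x y)))
∑-concatMap-mapᵈ g xs ys f =
  ≡.trans (∑-concatMap (λ x → map (g x) (ys x)) xs f) (∑-cong xs (λ x → ∑-map (g x) (ys x) f))

∑-concatMap-map : ∀ (g : A → B → C) xs ys (f : C → ℚ) →
                  ∑ (concatMap (λ x → map (g x) ys) xs) f ≡ ∑ xs (λ x → ∑ ys (λ y → f (g x y)))
∑-concatMap-map g xs ys = ∑-concatMap-mapᵈ g xs (λ _ → ys)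

∑-filter : ∀ p (xs : List A) (f : A → ℚ) → ∑ (filterᵇ p xs) f ≡ ∑ xs (λ x → χ (p x) * f x)
∑-filter p []       f = refl
∑-filter p (x ∷ xs) f with p x
... | true  = cong₂ _+_ (sym (*-identityˡ (f x))) (∑-filter p xs f)
... | false = ≡.trans (∑-filter p xs f)
                (sym (≡.trans (cong (_+ _) (*-zeroˡ (f x))) (+-identityˡ _)))

∑-↭ : ∀ {xs ys : List A} (f : A → ℚ) → xs ↭ ys → ∑ xs f ≡ ∑ ys f
∑-↭ f refl         = refl
∑-↭ f (prep x p)   = cong (f x +_) (∑-↭ f p)
∑-↭ f (swap x y p) = ≡.trans (cong (λ s → f x + (f y + s)) (∑-↭ f p)) (+-left-comm (f x) (f y) _)
∑-↭ f (trans p q)  = ≡.trans (∑-↭ f p) (∑-↭ f q)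

∑-const : ∀ c (xs : List A) → ∑ xs (λ _ → c) ≡ nat (length xs) * c
∑-const c []       = sym (*-zeroˡ c)
∑-const c (x ∷ xs) = sym (begin
  (1ℚ + nat (length xs)) * c        ≡⟨ *-distribʳ-+ c 1ℚ _ ⟩
  1ℚ * c + nat (length xs) * c      ≡⟨ cong₂ _+_ (*-identityˡ c) (sym (∑-const c xs)) ⟩
  c + ∑ xs (λ _ → c)                ∎)

nat-+ : ∀ m n → nat (m ℕ.+ n) ≡ nat m + nat n
nat-+ zero    n = sym (+-identityˡ _)
nat-+ (suc m) n = ≡.trans (cong (1ℚ +_) (nat-+ m n)) (sym (+-assoc 1ℚ _ _))

nat-* : ∀ m n → nat (m ℕ.* n) ≡ nat m * nat n
nat-* zero    n = sym (*-zeroˡ _)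
nat-* (suc m) n = begin
  nat (n ℕ.+ m ℕ.* n)          ≡⟨ nat-+ n (m ℕ.* n) ⟩
  nat n + nat (m ℕ.* n)        ≡⟨ cong₂ _+_ (sym (*-identityˡ _)) (nat-* m n) ⟩
  1ℚ * nat n + nat m * nat n   ≡⟨ sym (*-distribʳ-+ (nat n) 1ℚ _) ⟩
  (1ℚ + nat m) * nat n         ∎

nat-bit : ∀ b → nat (bit b) ≡ χ b
nat-bit true  = +-identityʳ 1ℚ
nat-bit false = refl

nat-sumℕ : ∀ (f : A → ℕ) xs → nat (sumℕ f xs) ≡ ∑ xs (nat ∘ f)
nat-sumℕ f []       = refl
nat-sumℕ f (x ∷ xs) = ≡.trans (nat-+ (f x) _) (cong (nat (f x) +_) (nat-sumℕ f xs))

nat-count : ∀ p (xs : List A) → nat (count p xs) ≡ ∑ xs (χ ∘ p)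
nat-count p []       = refl
nat-count p (x ∷ xs) with p x
... | true  = cong (1ℚ +_) (nat-count p xs)
... | false = ≡.trans (nat-count p xs) (sym (+-identityˡ _))

χ-∧ : ∀ a b → χ (a ∧ b) ≡ χ a * χ b
χ-∧ true  b = sym (*-identityˡ _)
χ-∧ false b = sym (*-zeroˡ _)

∑-upTo-suc : ∀ n (f : ℕ → ℚ) → ∑ (upTo (suc n)) f ≡ f 0 + ∑ (upTo n) (f ∘ suc)
∑-upTo-suc n f = cong (f 0 +_) (≡.trans (cong (λ l → ∑ l f) (sym (ListP.map-upTo suc n))) (∑-map suc (upTo n) f))

∑-allFin-suc : ∀ n (f : Fin (suc n) → ℚ) →
               ∑ (allFin (suc n)) f ≡ f Fin.zero + ∑ (allFin n) (f ∘ Fin.suc)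
∑-allFin-suc n f =
  cong (f Fin.zero +_) (≡.trans (cong (λ l → ∑ l f) (sym (ListP.map-tabulate id Fin.suc))) (∑-map Fin.suc (allFin n) f))

-- ⨁ N F = ∑_{i+j=N} F i j
⨁ : ℕ → (ℕ → ℕ → ℚ) → ℚ
⨁ zero    F = F 0 0
⨁ (suc N) F = F 0 (suc N) + ⨁ N (λ i j → F (suc i) j)

⨁-upTo : ∀ N (F : ℕ → ℕ → ℚ) → ∑ (upTo (suc N)) (λ i → F i (N ∸ i)) ≡ ⨁ N F
⨁-upTo zero    F = +-identityʳ _
⨁-upTo (suc N) F = ≡.trans (∑-upTo-suc (suc N) (λ i → F i (suc N ∸ i)))
                           (cong (F 0 (suc N) +_) (⨁-upTo N (λ i j → F (suc i) j)))

⨁-cong : ∀ N {F G : ℕ → ℕ → ℚ} → (∀ i j → F i j ≡ G i j) → ⨁ N F ≡ ⨁ N G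
⨁-cong zero    eq = eq 0 0
⨁-cong (suc N) eq = cong₂ _+_ (eq 0 (suc N)) (⨁-cong N (λ i j → eq (suc i) j))

⨁-0 : ∀ N {F : ℕ → ℕ → ℚ} → (∀ i j → F i j ≡ 0ℚ) → ⨁ N F ≡ 0ℚ
⨁-0 zero    eq = eq 0 0
⨁-0 (suc N) eq = ≡.trans (cong₂ _+_ (eq 0 (suc N)) (⨁-0 N (λ i j → eq (suc i) j))) (+-identityˡ 0ℚ)

⨁-head : ∀ N (F : ℕ → ℕ → ℚ) → (∀ i j → F (suc i) j ≡ 0ℚ) → ⨁ N F ≡ F 0 N
⨁-head zero    F eq = refl
⨁-head (suc N) F eq = ≡.trans (cong (F 0 (suc N) +_) (⨁-0 N eq)) (+-identityʳ _)

⨁-+ : ∀ N (F G : ℕ → ℕ → ℚ) → ⨁ N (λ i j → F i j + G i j) ≡ ⨁ N F + ⨁ N G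
⨁-+ zero    F G = refl
⨁-+ (suc N) F G = ≡.trans (cong ((F 0 (suc N) + G 0 (suc N)) +_) (⨁-+ N _ _)) (+-interchange (F 0 (suc N)) _ _ _)

⨁-*ˡ : ∀ N c (F : ℕ → ℕ → ℚ) → c * ⨁ N F ≡ ⨁ N (λ i j → c * F i j)
⨁-*ˡ zero    c F = refl
⨁-*ˡ (suc N) c F = ≡.trans (*-distribˡ-+ c (F 0 (suc N)) _) (cong (c * F 0 (suc N) +_) (⨁-*ˡ N c _))

⨁-∑ : ∀ N (xs : List A) (F : A → ℕ → ℕ → ℚ) →
      ∑ xs (λ x → ⨁ N (F x)) ≡ ⨁ N (λ i j → ∑ xs (λ x → F x i j))
⨁-∑ zero    xs F = refl
⨁-∑ (suc N) xs F = ≡.trans (∑-+ _ _ xs) (cong (∑ xs (λ x → F x 0 (suc N)) +_) (⨁-∑ N xs _))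

⨁-last : ∀ N (F : ℕ → ℕ → ℚ) → ⨁ (suc N) F ≡ F (suc N) 0 + ⨁ N (λ i j → F i (suc j))
⨁-last zero    F = +-comm (F 0 1) (F 1 0)
⨁-last (suc N) F = begin
  F 0 (suc (suc N)) + ⨁ (suc N) (λ i j → F (suc i) j)                     ≡⟨ cong (F 0 (suc (suc N)) +_) (⨁-last N (λ i j → F (suc i) j)) ⟩
  F 0 (suc (suc N)) + (F (suc (suc N)) 0 + ⨁ N (λ i j → F (suc i) (suc j))) ≡⟨ +-left-comm (F 0 (suc (suc N))) _ _ ⟩
  F (suc (suc N)) 0 + (F 0 (suc (suc N)) + ⨁ N (λ i j → F (suc i) (suc j))) ∎

⨁-comm : ∀ N (F : ℕ → ℕ → ℚ) → ⨁ N F ≡ ⨁ N (λ i j → F j i)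
⨁-comm zero    F = refl
⨁-comm (suc N) F = ≡.trans (cong (F 0 (suc N) +_) (⨁-comm N _)) (sym (⨁-last N (λ i j → F j i)))

⨁-assoc : ∀ N (G : ℕ → ℕ → ℕ → ℚ) →
          ⨁ N (λ i j → ⨁ j (G i)) ≡ ⨁ N (λ m l → ⨁ m (λ i k → G i k l))
⨁-assoc zero    G = refl
⨁-assoc (suc N) G = begin
  (G 0 0 (suc N) + ⨁ N (λ k l → G 0 (suc k) l)) + ⨁ N (λ i j → ⨁ j (G (suc i)))
    ≡⟨ +-assoc (G 0 0 (suc N)) _ _ ⟩
  G 0 0 (suc N) + (⨁ N (λ k l → G 0 (suc k) l) + ⨁ N (λ i j → ⨁ j (G (suc i))))
    ≡⟨ cong (λ s → G 0 0 (suc N) + (⨁ N (λ k l → G 0 (suc k) l) + s)) (⨁-assoc N (λ i → G (suc i))) ⟩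
  G 0 0 (suc N) + (⨁ N (λ k l → G 0 (suc k) l) + ⨁ N (λ m l → ⨁ m (λ i k → G (suc i) k l)))
    ≡⟨ cong (G 0 0 (suc N) +_) (sym (⨁-+ N _ _)) ⟩
  G 0 0 (suc N) + ⨁ N (λ m l → G 0 (suc m) l + ⨁ m (λ i k → G (suc i) k l)) ∎

-- Multiplication by x on coefficient sequences. The recursions in N are stated through it, so that
-- removing a vertex also makes sense at N = 0.
shift : (ℕ → ℚ) → ℕ → ℚ
shift s zero    = 0ℚ
shift s (suc n) = s n

⨁-shiftˡ : ∀ N (F : ℕ → ℕ → ℚ) →
           ⨁ N (λ i j → shift (λ i′ → F i′ j) i) ≡ shift (λ N′ → ⨁ N′ F) N
⨁-shiftˡ zero    F = refl
⨁-shiftˡ (suc N) F = +-identityˡ _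

⨁-shiftʳ : ∀ N (F : ℕ → ℕ → ℚ) →
           ⨁ N (λ i j → shift (F i) j) ≡ shift (λ N′ → ⨁ N′ F) N
⨁-shiftʳ zero    F = refl
⨁-shiftʳ (suc N) F = ≡.trans (⨁-last N (λ i j → shift (F i) j)) (+-identityˡ _)

-- Words over a finite list, with one marked entry

lists : ℕ → List A → List (List A)
lists zero    xs = [] ∷ []
lists (suc m) xs = concatMap (λ x → map (x ∷_) (lists m xs)) xs

∑-lists-suc : ∀ m (xs : List A) (F : List A → ℚ) →
              ∑ (lists (suc m) xs) F ≡ ∑ xs (λ x → ∑ (lists m xs) (λ l → F (x ∷ l)))
∑-lists-suc m xs F = ∑-concatMap-map _∷_ xs (lists m xs) F

-- The hypothesis on sums expresses that `s` permutes `xs`, in the form in which a change of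
-- variables uses it.
∑-lists-map : ∀ m (xs : List A) (s : A → A) → (∀ f → ∑ xs f ≡ ∑ xs (f ∘ s)) →
              (F : List A → ℚ) → ∑ (lists m xs) F ≡ ∑ (lists m xs) (F ∘ map s)
∑-lists-map zero    xs s inv F = refl
∑-lists-map (suc m) xs s inv F = begin
  ∑ (lists (suc m) xs) F                                  ≡⟨ ∑-lists-suc m xs F ⟩
  ∑ xs (λ x → ∑ (lists m xs) (λ l → F (x ∷ l)))           ≡⟨ inv _ ⟩
  ∑ xs (λ x → ∑ (lists m xs) (λ l → F (s x ∷ l)))         ≡⟨ ∑-cong xs (λ x → ∑-lists-map m xs s inv _) ⟩
  ∑ xs (λ x → ∑ (lists m xs) (λ l → F (s x ∷ map s l)))   ≡⟨ sym (∑-lists-suc m xs _) ⟩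
  ∑ (lists (suc m) xs) (F ∘ map s)                        ∎

picks : List A → List (A × List A)
picks []       = []
picks (x ∷ xs) = (x , xs) ∷ map (λ (y , ys) → (y , x ∷ ys)) (picks xs)

∑-picks-∷ : ∀ (x : A) xs (F : A × List A → ℚ) →
            ∑ (picks (x ∷ xs)) F ≡ F (x , xs) + ∑ (picks xs) (λ (y , ys) → F (y , x ∷ ys))
∑-picks-∷ x xs F = cong (F (x , xs) +_) (∑-map _ (picks xs) F)

∑-picks-proj₁ : ∀ xs (F : A → ℚ) → ∑ (picks xs) (F ∘ proj₁) ≡ ∑ xs F
∑-picks-proj₁ []       F = refl
∑-picks-proj₁ (x ∷ xs) F = ≡.trans (∑-picks-∷ x xs (F ∘ proj₁)) (cong (F x +_) (∑-picks-proj₁ xs F))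

-- All m + 1 positions of the marked entry contribute equally, because `F` does not see the order of
-- the other entries; so the mark may be moved to the head.
∑-lists-picks : ∀ m (xs : List A) (F : A × List A → ℚ) →
                (∀ x {l l′} → l ↭ l′ → F (x , l) ≡ F (x , l′)) →
                ∑ (lists (suc m) xs) (λ l → ∑ (picks l) F) ≡
                nat (suc m) * ∑ xs (λ x → ∑ (lists m xs) (λ l → F (x , l)))
∑-lists-picks zero    xs F sw = begin
  ∑ (lists 1 xs) (λ l → ∑ (picks l) F)      ≡⟨ ∑-lists-suc 0 xs _ ⟩
  ∑ xs (λ x → (F (x , []) + 0ℚ) + 0ℚ)       ≡⟨ ∑-cong xs (λ x → +-identityʳ _) ⟩
  ∑ xs (λ x → F (x , []) + 0ℚ)              ≡⟨ sym (*-identityˡ _) ⟩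
  1ℚ * ∑ xs (λ x → F (x , []) + 0ℚ)         ≡⟨ cong (_* ∑ xs (λ x → F (x , []) + 0ℚ)) (sym (+-identityʳ 1ℚ)) ⟩
  nat 1 * ∑ xs (λ x → F (x , []) + 0ℚ)      ∎
∑-lists-picks (suc m) xs F sw = begin
  ∑ (lists (suc (suc m)) xs) (λ l → ∑ (picks l) F)
    ≡⟨ ∑-lists-suc (suc m) xs _ ⟩
  ∑ xs (λ x → ∑ (lists (suc m) xs) (λ l → ∑ (picks (x ∷ l)) F))
    ≡⟨ ∑-cong xs (λ x → ∑-cong (lists (suc m) xs) (λ l → ∑-picks-∷ x l F)) ⟩
  ∑ xs (λ x → ∑ (lists (suc m) xs) (λ l → F (x , l) + ∑ (picks l) (λ (y , ys) → F (y , x ∷ ys))))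
    ≡⟨ ∑-cong xs (λ x → ∑-+ _ _ (lists (suc m) xs)) ⟩
  ∑ xs (λ x → ∑ (lists (suc m) xs) (λ l → F (x , l)) + ∑ (lists (suc m) xs) (λ l → ∑ (picks l) (λ (y , ys) → F (y , x ∷ ys))))
    ≡⟨ ∑-+ _ _ xs ⟩
  total + ∑ xs (λ x → ∑ (lists (suc m) xs) (λ l → ∑ (picks l) (λ (y , ys) → F (y , x ∷ ys))))
    ≡⟨ cong (total +_) rest ⟩
  total + nat (suc m) * total
    ≡⟨ cong (_+ (nat (suc m) * total)) (sym (*-identityˡ total)) ⟩
  1ℚ * total + nat (suc m) * total
    ≡⟨ sym (*-distribʳ-+ total 1ℚ (nat (suc m))) ⟩
  nat (suc (suc m)) * total ∎
  where
  total = ∑ xs (λ x → ∑ (lists (suc m) xs) (λ l → F (x , l)))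
  -- The mark lies behind the head. After the induction hypothesis for the tail, exchanging the sums
  -- over the head and over the marked entry absorbs the head into the remaining list.
  rest : ∑ xs (λ x → ∑ (lists (suc m) xs) (λ l → ∑ (picks l) (λ (y , ys) → F (y , x ∷ ys)))) ≡ nat (suc m) * total
  rest = begin
    ∑ xs (λ x → ∑ (lists (suc m) xs) (λ l → ∑ (picks l) (λ (y , ys) → F (y , x ∷ ys))))
      ≡⟨ ∑-cong xs (λ x → ∑-lists-picks m xs (λ (y , ys) → F (y , x ∷ ys)) (λ y p → sw y (prep x p))) ⟩
    ∑ xs (λ x → nat (suc m) * ∑ xs (λ y → ∑ (lists m xs) (λ l → F (y , x ∷ l))))
      ≡⟨ sym (∑-*ˡ (nat (suc m)) _ xs) ⟩
    nat (suc m) * ∑ xs (λ x → ∑ xs (λ y → ∑ (lists m xs) (λ l → F (y , x ∷ l))))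
      ≡⟨ cong (nat (suc m) *_) (∑-swap xs xs _) ⟩
    nat (suc m) * ∑ xs (λ y → ∑ xs (λ x → ∑ (lists m xs) (λ l → F (y , x ∷ l))))
      ≡⟨ cong (nat (suc m) *_) (∑-cong xs (λ y → sym (∑-lists-suc m xs _))) ⟩
    nat (suc m) * total ∎

-- Graphs, renamings and degrees

-- The vertex type is left free because attaching trees and subdividing edges enlarge it by `Maybe`
-- or `⊎`. Parallel edges are repeated entries of `es`, loops are diagonal ones.
record Gr : Set₁ where
  constructor mkGr
  field
    V   : Set
    _≟_ : DecidableEquality V
    vs  : List V
    es  : List (V × V)

map² : (A → B) → A × A → B × B
map² θ (a , b) = θ a , θ b

infix 3 _≋_

-- Equality of multisets of undirected edges: the order and the orientation of the entries are
-- forgotten.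
data _≋_ {A : Set} : List (A × A) → List (A × A) → Set where
  ≋-refl  : ∀ {xs} → xs ≋ xs
  ≋-prep  : ∀ x {xs ys} → xs ≋ ys → x ∷ xs ≋ x ∷ ys
  ≋-flip  : ∀ a b {xs ys} → xs ≋ ys → (a , b) ∷ xs ≋ (b , a) ∷ ys
  ≋-swap  : ∀ x y {xs ys} → xs ≋ ys → x ∷ y ∷ xs ≋ y ∷ x ∷ ys
  ≋-trans : ∀ {xs ys zs} → xs ≋ ys → ys ≋ zs → xs ≋ zs

↭⇒≋ : ∀ {xs ys : List (A × A)} → xs ↭ ys → xs ≋ ys
↭⇒≋ refl         = ≋-refl
↭⇒≋ (prep x p)   = ≋-prep x (↭⇒≋ p)
↭⇒≋ (swap x y p) = ≋-swap x y (↭⇒≋ p)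
↭⇒≋ (trans p q)  = ≋-trans (↭⇒≋ p) (↭⇒≋ q)

≡⇒≋ : ∀ {xs ys : List (A × A)} → xs ≡ ys → xs ≋ ys
≡⇒≋ refl = ≋-refl

≡⇒↭ : ∀ {xs ys : List A} → xs ≡ ys → xs ↭ ys
≡⇒↭ refl = refl

≋-sym : ∀ {xs ys : List (A × A)} → xs ≋ ys → ys ≋ xs
≋-sym ≋-refl         = ≋-refl
≋-sym (≋-prep x p)   = ≋-prep x (≋-sym p)
≋-sym (≋-flip a b p) = ≋-flip b a (≋-sym p)
≋-sym (≋-swap x y p) = ≋-swap y x (≋-sym p)
≋-sym (≋-trans p q)  = ≋-trans (≋-sym q) (≋-sym p)

≋-map : ∀ (θ : A → B) {xs ys} → xs ≋ ys → map (map² θ) xs ≋ map (map² θ) ys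
≋-map θ ≋-refl         = ≋-refl
≋-map θ (≋-prep x p)   = ≋-prep _ (≋-map θ p)
≋-map θ (≋-flip a b p) = ≋-flip _ _ (≋-map θ p)
≋-map θ (≋-swap x y p) = ≋-swap _ _ (≋-map θ p)
≋-map θ (≋-trans p q)  = ≋-trans (≋-map θ p) (≋-map θ q)

≋-++ʳ : ∀ {xs ys : List (A × A)} zs → xs ≋ ys → xs ++ zs ≋ ys ++ zs
≋-++ʳ zs ≋-refl         = ≋-refl
≋-++ʳ zs (≋-prep x p)   = ≋-prep x (≋-++ʳ zs p)
≋-++ʳ zs (≋-flip a b p) = ≋-flip a b (≋-++ʳ zs p)
≋-++ʳ zs (≋-swap x y p) = ≋-swap x y (≋-++ʳ zs p)
≋-++ʳ zs (≋-trans p q)  = ≋-trans (≋-++ʳ zs p) (≋-++ʳ zs q)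

≋-++ˡ : ∀ (zs : List (A × A)) {xs ys} → xs ≋ ys → zs ++ xs ≋ zs ++ ys
≋-++ˡ []       p = p
≋-++ˡ (z ∷ zs) p = ≋-prep z (≋-++ˡ zs p)

map-∘ : ∀ {f : B → C} {g : A → B} {h : A → C} → (∀ x → f (g x) ≡ h x) → ∀ xs → map f (map g xs) ≡ map h xs
map-∘ eq xs = ≡.trans (sym (ListP.map-∘ xs)) (ListP.map-cong eq xs)

Symmetric² : (A × A → B) → Set
Symmetric² g = ∀ a b → g (a , b) ≡ g (b , a)

sumℕ-cong : ∀ {f g : A → ℕ} xs → (∀ x → f x ≡ g x) → sumℕ f xs ≡ sumℕ g xs
sumℕ-cong []       eq = refl
sumℕ-cong (x ∷ xs) eq = cong₂ ℕ._+_ (eq x) (sumℕ-cong xs eq)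

sumℕ-map : ∀ (h : A → B) (f : B → ℕ) xs → sumℕ f (map h xs) ≡ sumℕ (f ∘ h) xs
sumℕ-map h f []       = refl
sumℕ-map h f (x ∷ xs) = cong (f (h x) ℕ.+_) (sumℕ-map h f xs)

sumℕ-++ : ∀ (f : A → ℕ) xs ys → sumℕ f (xs ++ ys) ≡ sumℕ f xs ℕ.+ sumℕ f ys
sumℕ-++ f []       ys = refl
sumℕ-++ f (x ∷ xs) ys = ≡.trans (cong (f x ℕ.+_) (sumℕ-++ f xs ys)) (sym (ℕP.+-assoc (f x) _ _))

sumℕ-0 : ∀ {f : A → ℕ} xs → (∀ x → f x ≡ 0) → sumℕ f xs ≡ 0
sumℕ-0 []       eq = refl
sumℕ-0 (x ∷ xs) eq = cong₂ ℕ._+_ (eq x) (sumℕ-0 xs eq)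

sumℕ-+ : ∀ (f g : A → ℕ) xs → sumℕ (λ x → f x ℕ.+ g x) xs ≡ sumℕ f xs ℕ.+ sumℕ g xs
sumℕ-+ f g []       = refl
sumℕ-+ f g (x ∷ xs) = ≡.trans (cong ((f x ℕ.+ g x) ℕ.+_) (sumℕ-+ f g xs))
  (solve 4 (λ a b c d → (a :+ b) :+ (c :+ d) := (a :+ c) :+ (b :+ d)) refl (f x) (g x) _ _)
  where open ℕS.+-*-Solver

ℕ-left-comm : ∀ a b c → a ℕ.+ (b ℕ.+ c) ≡ b ℕ.+ (a ℕ.+ c)
ℕ-left-comm = solve 3 (λ a b c → a :+ (b :+ c) := b :+ (a :+ c)) refl
  where open ℕS.+-*-Solver

sumℕ-≋ : ∀ (f : A × A → ℕ) → Symmetric² f → ∀ {xs ys} → xs ≋ ys → sumℕ f xs ≡ sumℕ f ys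
sumℕ-≋ f s ≋-refl         = refl
sumℕ-≋ f s (≋-prep x p)   = cong (f x ℕ.+_) (sumℕ-≋ f s p)
sumℕ-≋ f s (≋-flip a b p) = cong₂ ℕ._+_ (s a b) (sumℕ-≋ f s p)
sumℕ-≋ f s (≋-swap x y p) = ≡.trans (cong (λ t → f x ℕ.+ (f y ℕ.+ t)) (sumℕ-≋ f s p)) (ℕ-left-comm (f x) (f y) _)
sumℕ-≋ f s (≋-trans p q)  = ≡.trans (sumℕ-≋ f s p) (sumℕ-≋ f s q)

sumℕ-↭ : ∀ (f : A → ℕ) {xs ys} → xs ↭ ys → sumℕ f xs ≡ sumℕ f ys
sumℕ-↭ f refl         = refl
sumℕ-↭ f (prep x p)   = cong (f x ℕ.+_) (sumℕ-↭ f p)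
sumℕ-↭ f (swap x y p) = ≡.trans (cong (λ t → f x ℕ.+ (f y ℕ.+ t)) (sumℕ-↭ f p)) (ℕ-left-comm (f x) (f y) _)
sumℕ-↭ f (trans p q)  = ≡.trans (sumℕ-↭ f p) (sumℕ-↭ f q)

∑-picks-≋ : ∀ (F : (A × A) × List (A × A) → ℚ) →
            (∀ a b r → F ((a , b) , r) ≡ F ((b , a) , r)) →
            (∀ e {r r′} → r ≋ r′ → F (e , r) ≡ F (e , r′)) →
            ∀ {xs ys} → xs ≋ ys → ∑ (picks xs) F ≡ ∑ (picks ys) F
∑-picks-≋ F s i ≋-refl = refl
∑-picks-≋ F s i {x ∷ xs} {_ ∷ ys} (≋-prep x p) = begin
  ∑ (picks (x ∷ xs)) F                                 ≡⟨ ∑-picks-∷ x xs F ⟩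
  F (x , xs) + ∑ (picks xs) (λ (y , r) → F (y , x ∷ r)) ≡⟨ cong₂ _+_ (i x p) (∑-picks-≋ _ (λ a b r → s a b (x ∷ r)) (λ e q → i e (≋-prep x q)) p) ⟩
  F (x , ys) + ∑ (picks ys) (λ (y , r) → F (y , x ∷ r)) ≡⟨ sym (∑-picks-∷ x ys F) ⟩
  ∑ (picks (x ∷ ys)) F                                 ∎
∑-picks-≋ F s i {_ ∷ xs} {_ ∷ ys} (≋-flip a b p) = begin
  ∑ (picks ((a , b) ∷ xs)) F                                        ≡⟨ ∑-picks-∷ _ xs F ⟩
  F ((a , b) , xs) + ∑ (picks xs) (λ (y , r) → F (y , (a , b) ∷ r)) ≡⟨ cong₂ _+_ (≡.trans (s a b xs) (i (b , a) p))
                                                                         (∑-cong (picks xs) (λ (y , r) → i y (≋-flip a b ≋-refl))) ⟩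
  F ((b , a) , ys) + ∑ (picks xs) (λ (y , r) → F (y , (b , a) ∷ r)) ≡⟨ cong (F ((b , a) , ys) +_)
                                                                         (∑-picks-≋ _ (λ c d r → s c d ((b , a) ∷ r)) (λ e q → i e (≋-prep _ q)) p) ⟩
  F ((b , a) , ys) + ∑ (picks ys) (λ (y , r) → F (y , (b , a) ∷ r)) ≡⟨ sym (∑-picks-∷ _ ys F) ⟩
  ∑ (picks ((b , a) ∷ ys)) F                                        ∎
∑-picks-≋ F s i {_ ∷ _ ∷ xs} {_ ∷ _ ∷ ys} (≋-swap x y p) = begin
  ∑ (picks (x ∷ y ∷ xs)) F
    ≡⟨ two x y xs ⟩
  F (x , y ∷ xs) + (F (y , x ∷ xs) + ∑ (picks xs) (λ (z , r) → F (z , x ∷ y ∷ r)))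
    ≡⟨ +-left-comm (F (x , y ∷ xs)) (F (y , x ∷ xs)) _ ⟩
  F (y , x ∷ xs) + (F (x , y ∷ xs) + ∑ (picks xs) (λ (z , r) → F (z , x ∷ y ∷ r)))
    ≡⟨ cong₂ _+_ (i y (≋-prep x p)) (cong₂ _+_ (i x (≋-prep y p))
         (≡.trans (∑-picks-≋ _ (λ a b r → s a b (x ∷ y ∷ r)) (λ e q → i e (≋-prep x (≋-prep y q))) p)
                  (∑-cong (picks ys) (λ (z , r) → i z (≋-swap x y ≋-refl))))) ⟩
  F (y , x ∷ ys) + (F (x , y ∷ ys) + ∑ (picks ys) (λ (z , r) → F (z , y ∷ x ∷ r)))
    ≡⟨ sym (two y x ys) ⟩
  ∑ (picks (y ∷ x ∷ ys)) F ∎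
  where
  two : ∀ x y zs → ∑ (picks (x ∷ y ∷ zs)) F ≡
        F (x , y ∷ zs) + (F (y , x ∷ zs) + ∑ (picks zs) (λ (z , r) → F (z , x ∷ y ∷ r)))
  two x y zs = ≡.trans (∑-picks-∷ x (y ∷ zs) F) (cong (F (x , y ∷ zs) +_) (∑-picks-∷ y zs _))
∑-picks-≋ F s i (≋-trans p q) = ≡.trans (∑-picks-≋ F s i p) (∑-picks-≋ F s i q)

picks-↭ : ∀ (xs : List A) → All (λ (y , r) → xs ↭ y ∷ r) (picks xs)
picks-↭ []       = []
picks-↭ (x ∷ xs) = refl ∷ lift (picks-↭ xs)
  where
  lift : ∀ {ps} → All (λ (y , r) → xs ↭ y ∷ r) ps →
         All (λ (y , r) → x ∷ xs ↭ y ∷ r) (map (λ (y , r) → (y , x ∷ r)) ps)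
  lift []       = []
  lift (p ∷ ps) = trans (prep x p) (swap x _ refl) ∷ lift ps

picks-map : ∀ (h : A → B) xs → picks (map h xs) ≡ map (λ (y , r) → (h y , map h r)) (picks xs)
picks-map h []       = refl
picks-map h (x ∷ xs) = cong ((h x , map h xs) ∷_) (begin
  map (λ (y , r) → (y , h x ∷ r)) (picks (map h xs))                        ≡⟨ cong (map _) (picks-map h xs) ⟩
  map (λ (y , r) → (y , h x ∷ r)) (map (λ (y , r) → (h y , map h r)) (picks xs)) ≡⟨ map-∘ (λ _ → refl) (picks xs) ⟩
  map (λ (y , r) → (h y , h x ∷ map h r)) (picks xs)                        ≡⟨ sym (map-∘ (λ _ → refl) (picks xs)) ⟩
  map (λ (y , r) → (h y , map h r)) (map (λ (y , r) → (y , x ∷ r)) (picks xs)) ∎)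

∑-picks-++ : ∀ (xs ys : List A) (F : A × List A → ℚ) →
             ∑ (picks (xs ++ ys)) F ≡
             ∑ (picks xs) (λ (y , r) → F (y , r ++ ys)) + ∑ (picks ys) (λ (y , r) → F (y , xs ++ r))
∑-picks-++ []       ys F = sym (+-identityˡ _)
∑-picks-++ (x ∷ xs) ys F = begin
  ∑ (picks (x ∷ xs ++ ys)) F
    ≡⟨ ∑-picks-∷ x (xs ++ ys) F ⟩
  F (x , xs ++ ys) + ∑ (picks (xs ++ ys)) (λ (y , r) → F (y , x ∷ r))
    ≡⟨ cong (F (x , xs ++ ys) +_) (∑-picks-++ xs ys _) ⟩
  F (x , xs ++ ys) + (∑ (picks xs) (λ (y , r) → F (y , x ∷ r ++ ys)) + ∑ (picks ys) (λ (y , r) → F (y , x ∷ xs ++ r)))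
    ≡⟨ sym (+-assoc (F (x , xs ++ ys)) _ _) ⟩
  (F (x , xs ++ ys) + ∑ (picks xs) (λ (y , r) → F (y , x ∷ r ++ ys))) + ∑ (picks ys) (λ (y , r) → F (y , x ∷ xs ++ r))
    ≡⟨ cong (_+ ∑ (picks ys) (λ (y , r) → F (y , x ∷ xs ++ r))) (sym (∑-picks-∷ x xs _)) ⟩
  ∑ (picks (x ∷ xs)) (λ (y , r) → F (y , r ++ ys)) + ∑ (picks ys) (λ (y , r) → F (y , x ∷ xs ++ r)) ∎

-- Isomorphism of graphs. On the vertex types the map is only injective, since a type may contain
-- elements outside `vs`, such as the unlisted copy of the root in `attach`.
record Ren (G G′ : Gr) : Set where
  constructor ren
  private
    module G  = Gr G
    module G′ = Gr G′
  field
    θ     : G.V → G′.V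
    inj   : Injective θ
    verts : G′.vs ↭ map θ G.vs
    edges : G′.es ≋ map (map² θ) G.es

Inv : (Gr → A) → Set₁
Inv f = ∀ {G G′} → Ren G G′ → f G ≡ f G′

does-inj : (d : DecidableEquality A) (d′ : DecidableEquality B) (θ : A → B) → Injective θ →
           ∀ a b → does (d′ (θ a) (θ b)) ≡ does (d a b)
does-inj d d′ θ inj a b with d a b | d′ (θ a) (θ b)
... | yes _    | yes _ = refl
... | yes refl | no ¬p = ⊥-elim (¬p refl)
... | no ¬p    | yes p = ⊥-elim (¬p (inj p))
... | no _     | no _  = refl

does-refl : (d : DecidableEquality A) → ∀ a → does (d a a) ≡ true
does-refl d a with d a a
... | yes _ = refl
... | no ¬p = ⊥-elim (¬p refl)

does-≢ : (d : DecidableEquality A) → ∀ {a b} → a ≢ b → does (d a b) ≡ false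
does-≢ d {a} {b} a≢b with d a b
... | yes p = ⊥-elim (a≢b p)
... | no _  = refl

module Degree {A : Set} (_≟_ : DecidableEquality A) where

  inc : A → A × A → ℕ
  inc u (a , b) = bit (does (a ≟ u)) ℕ.+ bit (does (b ≟ u))

  deg : A → List (A × A) → ℕ
  deg u = sumℕ (inc u)

  -- A loop at `u` has `inc` 2, so only the edges from `u` to other vertices are counted.
  simpleDeg : A → List (A × A) → ℕ
  simpleDeg u = sumℕ (λ e → bit (inc u e ℕ.≡ᵇ 1))

  inc-sym : ∀ u → Symmetric² (inc u)
  inc-sym u a b = ℕP.+-comm (bit (does (a ≟ u))) _

  deg-≋ : ∀ u {xs ys} → xs ≋ ys → deg u xs ≡ deg u ys
  deg-≋ u = sumℕ-≋ (inc u) (inc-sym u)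

  simpleDeg-≋ : ∀ u {xs ys} → xs ≋ ys → simpleDeg u xs ≡ simpleDeg u ys
  simpleDeg-≋ u = sumℕ-≋ _ (λ a b → cong (λ i → bit (i ℕ.≡ᵇ 1)) (inc-sym u a b))

  deg≡0⇒simpleDeg≡0 : ∀ u es → deg u es ≡ 0 → simpleDeg u es ≡ 0
  deg≡0⇒simpleDeg≡0 u []       eq = refl
  deg≡0⇒simpleDeg≡0 u (e ∷ es) eq rewrite ℕP.m+n≡0⇒m≡0 (inc u e) eq =
    deg≡0⇒simpleDeg≡0 u es (ℕP.m+n≡0⇒n≡0 (inc u e) eq)

  deg≡1⇒simpleDeg≡1 : ∀ u es → deg u es ≡ 1 → simpleDeg u es ≡ 1
  deg≡1⇒simpleDeg≡1 u (e ∷ es) eq with inc u e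
  ... | 0           = deg≡1⇒simpleDeg≡1 u es eq
  ... | 1           = cong suc (deg≡0⇒simpleDeg≡0 u es (ℕP.suc-injective eq))
  deg≡1⇒simpleDeg≡1 u (e ∷ es) () | suc (suc i)

open Degree using (inc; deg; simpleDeg; inc-sym; deg-≋; simpleDeg-≋; deg≡1⇒simpleDeg≡1) public

module _ (d : DecidableEquality A) (d′ : DecidableEquality B) (θ : A → B) (inj : Injective θ) where

  inc-map : ∀ u e → inc d′ (θ u) (map² θ e) ≡ inc d u e
  inc-map u (a , b) = cong₂ (λ s t → bit s ℕ.+ bit t) (does-inj d d′ θ inj a u) (does-inj d d′ θ inj b u)

  deg-map : ∀ u es → deg d′ (θ u) (map (map² θ) es) ≡ deg d u es
  deg-map u es = ≡.trans (sumℕ-map (map² θ) _ es) (sumℕ-cong es (inc-map u))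

  simpleDeg-map : ∀ u es → simpleDeg d′ (θ u) (map (map² θ) es) ≡ simpleDeg d u es
  simpleDeg-map u es = ≡.trans (sumℕ-map (map² θ) _ es) (sumℕ-cong es (λ e → cong (λ i → bit (i ℕ.≡ᵇ 1)) (inc-map u e)))

module _ (d : DecidableEquality A) where

  isLeaf : List (A × A) → A → ℕ
  isLeaf es u = bit (deg d u es ℕ.≡ᵇ 1)

  -- The factor `simpleDeg` sends a vertex with a single loop to 0; at any other vertex of degree 2
  -- it counts the choices of one of the two edges, which is the mark that `∑-joints` removes.
  isJoint : List (A × A) → A → ℕ
  isJoint es u = bit (deg d u es ℕ.≡ᵇ 2) ℕ.* simpleDeg d u es

leaves : Gr → ℕ
leaves G = sumℕ (isLeaf _≟_ es) vs where open Gr G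

-- each vertex with two non-loop ends is counted twice
joints : Gr → ℕ
joints G = sumℕ (isJoint _≟_ es) vs where open Gr G

leaves-Inv : Inv leaves
leaves-Inv {G} {G′} (ren θ inj v e) = sym (≡.trans (sumℕ-↭ _ v) (≡.trans (sumℕ-map θ _ (Gr.vs G)) (sumℕ-cong (Gr.vs G) λ u →
  cong (λ i → bit (i ℕ.≡ᵇ 1)) (≡.trans (deg-≋ (Gr._≟_ G′) (θ u) e) (deg-map (Gr._≟_ G) (Gr._≟_ G′) θ inj u (Gr.es G))))))

joints-Inv : Inv joints
joints-Inv {G} {G′} (ren θ inj v e) = sym (≡.trans (sumℕ-↭ _ v) (≡.trans (sumℕ-map θ _ (Gr.vs G)) (sumℕ-cong (Gr.vs G) λ u →
  cong₂ (λ i j → bit (i ℕ.≡ᵇ 2) ℕ.* j)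
    (≡.trans (deg-≋ (Gr._≟_ G′) (θ u) e) (deg-map (Gr._≟_ G) (Gr._≟_ G′) θ inj u (Gr.es G)))
    (≡.trans (simpleDeg-≋ (Gr._≟_ G′) (θ u) e) (simpleDeg-map (Gr._≟_ G) (Gr._≟_ G′) θ inj u (Gr.es G))))))

addLeaf : (G : Gr) → Gr.V G → Gr
addLeaf G v = mkGr (Maybe V) (MaybeP.≡-dec _≟_) (nothing ∷ map just vs) ((nothing , just v) ∷ map (map² just) es)
  where open Gr G

-- The edges of `G` enter only through a splitting into the chosen edge and the rest `r`, as
-- supplied by `picks`.
subdivideEdge : (G : Gr) → Gr.V G × Gr.V G → List (Gr.V G × Gr.V G) → Gr
subdivideEdge G (a , b) r =
  mkGr (Maybe V) (MaybeP.≡-dec _≟_) (nothing ∷ map just vs) ((nothing , just a) ∷ (nothing , just b) ∷ map (map² just) r)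
  where open Gr G

-- `leafSum` and `edgeSum` are the transposes of leaf deletion and of smoothing: after a vertex has
-- been removed, `f` is still evaluated on the graph that contained it.
leafSum : (Gr → ℚ) → Gr → ℚ
leafSum f G = ∑ (Gr.vs G) (λ v → f (addLeaf G v))

edgeSum : (Gr → ℚ) → Gr → ℚ
edgeSum f G = ∑ (picks (Gr.es G)) (λ (e , r) → f (subdivideEdge G e r))

maybe-inj : ∀ {θ : A → B} → Injective θ → ∀ {a b} → Data.Maybe.map θ a ≡ Data.Maybe.map θ b → a ≡ b
maybe-inj inj {just a}  {just b}  eq = cong just (inj (MaybeP.just-injective eq))
maybe-inj inj {nothing} {nothing} eq = refl

vs-just : ∀ {θ : A → B} {xs ys} → ys ↭ map θ xs →
          nothing ∷ map just ys ↭ map (Data.Maybe.map θ) (nothing ∷ map just xs)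
vs-just {xs = xs} p =
  prep nothing (trans (↭P.map⁺ just p) (≡⇒↭ (≡.trans (sym (ListP.map-∘ xs)) (ListP.map-∘ xs))))

es-just : ∀ {θ : A → B} {xs ys} → ys ≋ map (map² θ) xs →
          map (map² just) ys ≋ map (map² (Data.Maybe.map θ)) (map (map² just) xs)
es-just {xs = xs} p = ≋-trans (≋-map just p) (≡⇒≋ (≡.trans (sym (ListP.map-∘ xs)) (ListP.map-∘ xs)))

Ren-addLeaf : ∀ {G G′} (r : Ren G G′) v → Ren (addLeaf G v) (addLeaf G′ (Ren.θ r v))
Ren-addLeaf (ren θ inj vp ep) v = ren (Data.Maybe.map θ) (maybe-inj inj) (vs-just vp) (≋-prep _ (es-just ep))

Ren-subdivideEdge : ∀ {G G′} (ρ : Ren G G′) e {r r′} → r′ ≋ map (map² (Ren.θ ρ)) r →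
                    Ren (subdivideEdge G e r) (subdivideEdge G′ (map² (Ren.θ ρ) e) r′)
Ren-subdivideEdge (ren θ inj vp ep) e rp =
  ren (Data.Maybe.map θ) (maybe-inj inj) (vs-just vp) (≋-prep _ (≋-prep _ (es-just rp)))

Ren-refl : ∀ {G} → Ren G G
Ren-refl {G} = ren id id (≡⇒↭ (sym (ListP.map-id (Gr.vs G)))) (≡⇒≋ (sym (ListP.map-id (Gr.es G))))

subdivideEdge-≋ : ∀ {f : Gr → ℚ} → Inv f → ∀ G e {r r′} → r ≋ r′ → f (subdivideEdge G e r) ≡ f (subdivideEdge G e r′)
subdivideEdge-≋ f-inv G e {r} p =
  f-inv (Ren-subdivideEdge {G} {G} Ren-refl e (≋-trans (≋-sym p) (≡⇒≋ (sym (ListP.map-id r)))))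

subdivideEdge-flip : ∀ {f : Gr → ℚ} → Inv f → ∀ G a b r → f (subdivideEdge G (a , b) r) ≡ f (subdivideEdge G (b , a) r)
subdivideEdge-flip f-inv G a b r = f-inv (ren id id (≡⇒↭ (sym (ListP.map-id _)))
  (≋-trans (≋-swap _ _ ≋-refl) (≡⇒≋ (sym (ListP.map-id _)))))

leafSum-Inv : ∀ {f} → Inv f → Inv (leafSum f)
leafSum-Inv {f} f-inv {G} {G′} ρ = sym (begin
  ∑ (Gr.vs G′) (λ v → f (addLeaf G′ v))               ≡⟨ ∑-↭ _ (Ren.verts ρ) ⟩
  ∑ (map θ (Gr.vs G)) (λ v → f (addLeaf G′ v))        ≡⟨ ∑-map θ (Gr.vs G) _ ⟩
  ∑ (Gr.vs G) (λ v → f (addLeaf G′ (θ v)))            ≡⟨ ∑-cong (Gr.vs G) (λ v → sym (f-inv (Ren-addLeaf ρ v))) ⟩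
  ∑ (Gr.vs G) (λ v → f (addLeaf G v))                 ∎)
  where θ = Ren.θ ρ

edgeSum-Inv : ∀ {f} → Inv f → Inv (edgeSum f)
edgeSum-Inv {f} f-inv {G} {G′} ρ = sym (begin
  ∑ (picks (Gr.es G′)) F′                                 ≡⟨ ∑-picks-≋ F′ (subdivideEdge-flip f-inv G′) (subdivideEdge-≋ f-inv G′) (Ren.edges ρ) ⟩
  ∑ (picks (map (map² θ) (Gr.es G))) F′                   ≡⟨ cong (λ l → ∑ l F′) (picks-map (map² θ) (Gr.es G)) ⟩
  ∑ (map (λ (y , r) → (map² θ y , map (map² θ) r)) (picks (Gr.es G))) F′ ≡⟨ ∑-map _ (picks (Gr.es G)) F′ ⟩
  ∑ (picks (Gr.es G)) (λ (y , r) → F′ (map² θ y , map (map² θ) r))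
    ≡⟨ ∑-cong (picks (Gr.es G)) (λ (y , r) → sym (f-inv (Ren-subdivideEdge ρ y ≋-refl))) ⟩
  ∑ (picks (Gr.es G)) (λ (e , r) → f (subdivideEdge G e r)) ∎)
  where
  θ = Ren.θ ρ
  F′ : (Gr.V G′ × Gr.V G′) × List (Gr.V G′ × Gr.V G′) → ℚ
  F′ (e , r) = f (subdivideEdge G′ e r)

leaves-subdivideEdge : ∀ G e r → Gr.es G ↭ e ∷ r → leaves (subdivideEdge G e r) ≡ leaves G
leaves-subdivideEdge G (a , b) r p = begin
  leaves (subdivideEdge G (a , b) r)
    ≡⟨ cong₂ (λ i j → bit (i ℕ.≡ᵇ 1) ℕ.+ j) top (sumℕ-map just _ vs) ⟩
  sumℕ (λ u → isLeaf (MaybeP.≡-dec _≟_) es′ (just u)) vs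
    ≡⟨ sumℕ-cong vs (λ u → cong (λ i → bit (i ℕ.≡ᵇ 1)) (old u)) ⟩
  leaves G ∎
  where
  open Gr G
  d = MaybeP.≡-dec _≟_
  es′ = Gr.es (subdivideEdge G (a , b) r)
  top : deg d nothing es′ ≡ 2
  top = cong (λ i → suc (suc i)) (≡.trans (sumℕ-map (map² just) _ r) (sumℕ-0 r (λ _ → refl)))
  old : ∀ u → deg d (just u) es′ ≡ deg _≟_ u es
  old u = begin
    deg d (just u) es′
      ≡⟨ cong₂ (λ i j → i ℕ.+ (j ℕ.+ deg d (just u) (map (map² just) r)))
           (cong bit (does-inj _≟_ d just MaybeP.just-injective a u)) (cong bit (does-inj _≟_ d just MaybeP.just-injective b u)) ⟩
    bit (does (a ≟ u)) ℕ.+ (bit (does (b ≟ u)) ℕ.+ deg d (just u) (map (map² just) r))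
      ≡⟨ sym (ℕP.+-assoc (bit (does (a ≟ u))) _ _) ⟩
    inc _≟_ u (a , b) ℕ.+ deg d (just u) (map (map² just) r)
      ≡⟨ cong (inc _≟_ u (a , b) ℕ.+_) (deg-map _≟_ d just MaybeP.just-injective u r) ⟩
    deg _≟_ u ((a , b) ∷ r)
      ≡⟨ sym (deg-≋ _≟_ u (↭⇒≋ p)) ⟩
    deg _≟_ u es ∎

Leafless : (Gr → ℚ) → Set₁
Leafless f = ∀ G → leaves G ≢ 0 → f G ≡ 0ℚ

-- Subdividing an edge keeps all old degrees and creates a vertex of degree 2, so no leaf appears or
-- disappears. Hence both sides of the smoothing recursion can be evaluated with trivial trees.
edgeSum-Leafless : ∀ {f} → Leafless f → Leafless (edgeSum f)
edgeSum-Leafless {f} s G ne =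
  ≡.trans (∑-cong-All (All.map (λ {(e , r)} p → s (subdivideEdge G e r) (λ eq → ne (≡.trans (sym (leaves-subdivideEdge G e r p)) eq))) (picks-↭ (Gr.es G))))
          (∑-0 (picks (Gr.es G)) (λ _ → refl))

-- Connectivity

T-ext : ∀ {a b} → (T a → T b) → (T b → T a) → a ≡ b
T-ext {true}  {true}  f g = refl
T-ext {true}  {false} f g = ⊥-elim (f tt)
T-ext {false} {true}  f g = ⊥-elim (g tt)
T-ext {false} {false} f g = refl

T-∧⁺ : ∀ {a b} → T a → T b → T (a ∧ b)
T-∧⁺ p q = Equivalence.from BoolP.T-∧ (p , q)

T-∧⁻ : ∀ {a b} → T (a ∧ b) → T a × T b
T-∧⁻ = Equivalence.to BoolP.T-∧

allF⁻ : ∀ {n} p → T (allF n p) → ∀ i → T (p i)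
allF⁻ {n} p t i = All.lookup (AllP.all⁺ p (allFin n) t) (∈P.∈-allFin i)

allF⁺ : ∀ {n} p → (∀ i → T (p i)) → T (allF n p)
allF⁺ {n} p t = AllP.all⁻ p {allFin n} (All.tabulate (λ {i} _ → t i))

anyF⁻ : ∀ {n} p → T (anyF n p) → ∃ λ i → T (p i)
anyF⁻ {n} p t = Any.satisfied (AnyP.any⁻ p (allFin n) t)

anyF⁺ : ∀ {n} p i → T (p i) → T (anyF n p)
anyF⁺ p i t = AnyP.any⁺ p (AnyP.tabulate⁺ i t)

==⇒≡ : ∀ {n} {a b : Fin n} → T (a == b) → a ≡ b
==⇒≡ {a = a} {b} t with a FinP.≟ b
... | yes p = p

≡⇒== : ∀ {n} {a b : Fin n} → a ≡ b → T (a == b)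
≡⇒== {a = a} refl = subst T (sym (does-refl FinP._≟_ a)) tt

==²⇒≡ : ∀ {n} {p q : Fin n × Fin n} → T (p ==² q) → p ≡ q
==²⇒≡ {p = a , b} {c , d} t = let (t₁ , t₂) = T-∧⁻ {a == c} t in cong₂ _,_ (==⇒≡ t₁) (==⇒≡ t₂)

≡⇒==² : ∀ {n} {p q : Fin n × Fin n} → p ≡ q → T (p ==² q)
≡⇒==² {p = a , b} refl = T-∧⁺ {a == a} (≡⇒== {a = a} refl) (≡⇒== {a = b} refl)

Joins : A → A → A × A → Set
Joins u v e = e ≡ (u , v) ⊎ e ≡ (v , u)

Adj : List (A × A) → A → A → Set
Adj es u v = Any (Joins u v) es

Adj-sym : ∀ {es : List (A × A)} {u v} → Adj es u v → Adj es v u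
Adj-sym = Any.map [ inj₂ , inj₁ ]′

Adj-≋ : ∀ {es es′ : List (A × A)} {u v} → es ≋ es′ → Adj es u v → Adj es′ u v
Adj-≋ ≋-refl         a                 = a
Adj-≋ (≋-prep x p)   (here a)          = here a
Adj-≋ (≋-prep x p)   (there a)         = there (Adj-≋ p a)
Adj-≋ (≋-flip a b p) (here (inj₁ refl)) = here (inj₂ refl)
Adj-≋ (≋-flip a b p) (here (inj₂ refl)) = here (inj₁ refl)
Adj-≋ (≋-flip a b p) (there q)         = there (Adj-≋ p q)
Adj-≋ (≋-swap x y p) (here a)          = there (here a)
Adj-≋ (≋-swap x y p) (there (here a))  = here a
Adj-≋ (≋-swap x y p) (there (there a)) = there (there (Adj-≋ p a))
Adj-≋ (≋-trans p q)  a                 = Adj-≋ q (Adj-≋ p a)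

Path : List (A × A) → A → A → Set
Path es = Star (Adj es)

Path-sym : ∀ {es : List (A × A)} {u v} → Path es u v → Path es v u
Path-sym = Star.reverse Adj-sym

Path-map : ∀ {es : List (A × A)} {es′ : List (B × B)} (θ : A → B) →
           All (λ (a , b) → Path es′ (θ a) (θ b)) es → ∀ {u v} → Path es u v → Path es′ (θ u) (θ v)
Path-map {es′ = es′} θ ps = Star.kleisliStar θ (λ {u} {v} → step ps {u} {v})
  where
  step : ∀ {es} → All (λ (a , b) → Path es′ (θ a) (θ b)) es → ∀ {u v} → Adj es u v → Path es′ (θ u) (θ v)
  step (p ∷ ps) (here (inj₁ refl)) = p
  step (p ∷ ps) (here (inj₂ refl)) = Path-sym p
  step (p ∷ ps) (there a)          = step ps a

edge∈ : ∀ {es : List (A × A)} {a b} → (a , b) ∈ es → Path es a b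
edge∈ i = Any.map (λ eq → inj₁ (sym eq)) i ◅ ε

Connected : (n : ℕ) → List (Fin n × Fin n) → Set
Connected n es = (1 ≤ n) × (∀ u v → Path es u v)

module _ {n m : ℕ} (G : LGraph n m) where

  private
    es = tabulate G

  adj⁻ : ∀ {u v} → T (adj G u v) → Adj es u v
  adj⁻ {u} {v} t with anyF⁻ (λ e → (G e ==² (u , v)) ∨ (G e ==² (v , u))) t
  ... | e , t′ = AnyP.tabulate⁺ e ([ (λ s → inj₁ (==²⇒≡ s)) , (λ s → inj₂ (==²⇒≡ s)) ]′ (Equivalence.to (BoolP.T-∨ {G e ==² (u , v)}) t′))

  adj⁺ : ∀ {u v} → Adj es u v → T (adj G u v)
  adj⁺ {u} {v} a with AnyP.tabulate⁻ a
  ... | e , j = anyF⁺ (λ e → (G e ==² (u , v)) ∨ (G e ==² (v , u))) e (Equivalence.from (BoolP.T-∨ {G e ==² (u , v)}) ([ (λ s → inj₁ (≡⇒==² s)) , (λ s → inj₂ (≡⇒==² s)) ]′ j))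

  reach⁻ : ∀ k {u v} → T (reach G k u v) → Path es u v
  reach⁻ zero {u} t = subst (Path es u) (==⇒≡ t) ε
  reach⁻ (suc k) {u} {v} t with Equivalence.to (BoolP.T-∨ {reach G k u v}) t
  ... | inj₁ t′ = reach⁻ k t′
  ... | inj₂ t′ with anyF⁻ (λ w → reach G k u w ∧ adj G w v) t′
  ...   | w , s = let (s₁ , s₂) = T-∧⁻ {reach G k u w} {adj G w v} s in reach⁻ k s₁ ◅◅ (adj⁻ s₂ ◅ ε)

  module _ (u : Fin n) where

    Closed : ℕ → Set
    Closed k = ∀ v → T (reach G (suc k) u v) → T (reach G k u v)

    reach-suc : ∀ k {v} → T (reach G k u v) → T (reach G (suc k) u v)
    reach-suc k {v} t = Equivalence.from (BoolP.T-∨ {reach G k u v}) (inj₁ t)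

    reach-refl : ∀ k → T (reach G k u u)
    reach-refl zero    = ≡⇒== {a = u} refl
    reach-refl (suc k) = reach-suc k (reach-refl k)

    reach-mono : ∀ j {k v} → j ≤ k → T (reach G j u v) → T (reach G k u v)
    reach-mono j {k} j≤k t with ℕP.m≤n⇒∃[o]m+o≡n j≤k
    ... | o , refl = go j o t
      where
      go : ∀ j o {v} → T (reach G j u v) → T (reach G (j ℕ.+ o) u v)
      go j zero    t rewrite ℕP.+-identityʳ j = t
      go j (suc o) t rewrite ℕP.+-suc j o = go (suc j) o (reach-suc j t)

    closed-path : ∀ k → Closed k → ∀ {v w} → Path es v w → T (reach G k u v) → T (reach G k u w)
    closed-path k c ε        t = t
    closed-path k c {v} (_◅_ {j = x} a p) t =
      closed-path k c p (c x (Equivalence.from (BoolP.T-∨ {reach G k u x})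
        (inj₂ (anyF⁺ (λ w → reach G k u w ∧ adj G w x) v (T-∧⁺ {reach G k u v} t (adj⁺ a))))))

    reached : ℕ → ℕ
    reached k = sumℕ (λ v → bit (reach G k u v)) (allFin n)

    -- Either the reached set has stabilised at some step up to k, or it has gained a vertex at
    -- every step and so has more than k elements. For k = n the second case is impossible, hence n
    -- steps reach everything joined to `u` by a path.
    closed-or-grows : ∀ k → (∃ λ j → j ≤ k × Closed j) ⊎ (suc k ≤ reached k)
    closed-or-grows zero = inj₂ (lower-bound (∈P.∈-allFin u))
      where
      lower-bound : ∀ {xs} → u ∈ xs → 1 ≤ sumℕ (λ v → bit (u == v)) xs
      lower-bound (here refl) rewrite does-refl FinP._≟_ u = s≤s z≤n
      lower-bound (there i)   = ℕP.≤-trans (lower-bound i) (ℕP.m≤n+m _ _)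
    closed-or-grows (suc k) with closed-or-grows k
    ... | inj₁ (j , j≤k , c) = inj₁ (j , ℕP.m≤n⇒m≤1+n j≤k , c)
    ... | inj₂ big with FinP.all? (λ v → BoolP.T? (reach G (suc k) u v) →? BoolP.T? (reach G k u v))
      where
      infixr 2 _→?_
      _→?_ : ∀ {P Q : Set} → Dec P → Dec Q → Dec (P → Q)
      _     →? yes q = yes (λ _ → q)
      no ¬p →? no _  = yes (λ p → ⊥-elim (¬p p))
      yes p →? no ¬q = no (λ f → ¬q (f p))
    ...   | yes c = inj₁ (k , ℕP.n≤1+n k , c)
    ...   | no ¬c with FinP.¬∀⟶∃¬ n _ (λ v → BoolP.T? (not (reach G (suc k) u v) ∨ reach G k u v))
                         (λ c → ¬c (λ v → imp (reach G (suc k) u v) (reach G k u v) (c v)))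
      where
      imp : ∀ a b → T (not a ∨ b) → T a → T b
      imp true b t _ = t
    ...     | v , ¬t = inj₂ (ℕP.≤-trans (s≤s big) (strict (∈P.∈-allFin v)))
      where
      bit-mono : ∀ w → bit (reach G k u w) ≤ bit (reach G (suc k) u w)
      bit-mono w = go (reach G (suc k) u w) (reach G k u w) (reach-suc k)
        where
        go : ∀ a b → (T b → T a) → bit b ≤ bit a
        go a     false f = z≤n
        go true  true  f = ℕP.≤-refl
        go false true  f = ⊥-elim (f tt)
      mono : ∀ xs → sumℕ (λ v → bit (reach G k u v)) xs ≤ sumℕ (λ v → bit (reach G (suc k) u v)) xs
      mono []       = z≤n
      mono (w ∷ xs) = ℕP.+-mono-≤ (bit-mono w) (mono xs)
      gap : bit (reach G k u v) < bit (reach G (suc k) u v)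
      gap = go (reach G (suc k) u v) (reach G k u v) ¬t
        where
        go : ∀ a b → ¬ T (not a ∨ b) → bit b < bit a
        go true  false f = s≤s z≤n
        go true  true  f = ⊥-elim (f tt)
        go false b     f = ⊥-elim (f tt)
      strict : ∀ {xs} → v ∈ xs → sumℕ (λ v → bit (reach G k u v)) xs < sumℕ (λ v → bit (reach G (suc k) u v)) xs
      strict {_ ∷ xs} (here refl) = ℕP.+-mono-<-≤ gap (mono xs)
      strict {w ∷ xs} (there i)   = ℕP.+-mono-≤-< (bit-mono w) (strict i)

    reached≤n : ∀ k → reached k ≤ n
    reached≤n k = ℕP.≤-trans (bound (allFin n)) (ℕP.≤-reflexive (ListP.length-tabulate id))
      where
      bound : ∀ xs → sumℕ (λ v → bit (reach G k u v)) xs ≤ length xs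
      bound []       = z≤n
      bound (v ∷ xs) with reach G k u v
      ... | true  = s≤s (bound xs)
      ... | false = ℕP.m≤n⇒m≤1+n (bound xs)

    reach⁺ : ∀ {v} → Path es u v → T (reach G n u v)
    reach⁺ p with closed-or-grows n
    ... | inj₁ (j , j≤n , c) = reach-mono j j≤n (closed-path j c p (reach-refl j))
    ... | inj₂ big           = ⊥-elim (ℕP.<-irrefl refl (ℕP.≤-trans big (reached≤n n)))

  connected⁻ : T (connected G) → Connected n es
  connected⁻ t = let (t₁ , t₂) = T-∧⁻ {1 ℕ.≤ᵇ n} t in
    ℕP.≤ᵇ⇒≤ 1 n t₁ , λ u v → reach⁻ n (allF⁻ _ (allF⁻ _ t₂ u) v)

  connected⁺ : Connected n es → T (connected G)
  connected⁺ (1≤n , p) = T-∧⁺ (ℕP.≤⇒≤ᵇ 1≤n) (allF⁺ _ (λ u → allF⁺ _ (λ v → reach⁺ u (p u v))))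

connᵇ : (n : ℕ) → List (Fin n × Fin n) → Bool
connᵇ n es = connected (List.lookup es)

connᵇ⁻ : ∀ {n} es → T (connᵇ n es) → Connected n es
connᵇ⁻ {n} es t = subst (Connected n) (ListP.tabulate-lookup es) (connected⁻ (List.lookup es) t)

connᵇ⁺ : ∀ {n} es → Connected n es → T (connᵇ n es)
connᵇ⁺ {n} es c = connected⁺ (List.lookup es) (subst (Connected n) (sym (ListP.tabulate-lookup es)) c)

connected-tabulate : ∀ {n m} (G : LGraph n m) → connected G ≡ connᵇ n (tabulate G)
connected-tabulate G = T-ext (λ t → connᵇ⁺ (tabulate G) (connected⁻ G t)) (λ t → connected⁺ G (connᵇ⁻ (tabulate G) t))

connᵇ-≋ : ∀ {n} {es es′ : List (Fin n × Fin n)} → es ≋ es′ → connᵇ n es ≡ connᵇ n es′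
connᵇ-≋ {n} p = T-ext (go p) (go (≋-sym p))
  where
  go : ∀ {es es′} → es ≋ es′ → T (connᵇ n es) → T (connᵇ n es′)
  go {es} {es′} p t = let (1≤n , c) = connᵇ⁻ es t in connᵇ⁺ es′ (1≤n , λ u v → Star.map (Adj-≋ p) (c u v))

-- Relabelling vertices, and connectivity under elementary changes

injective⇒surjective : ∀ {n} (s : Fin n → Fin n) → Injective s → ∀ j → ∃ λ i → s i ≡ j
injective⇒surjective {suc n} s inj j with FinP.any? (λ i → s i FinP.≟ j)
... | yes p = p
... | no ¬p = ⊥-elim (ℕP.1+n≰n (FinP.injective⇒≤ {f = λ i → Fin.punchOut (≢j i)}
                (λ {a} {b} eq → inj (FinP.punchOut-injective (≢j a) (≢j b) eq))))
  where
  ≢j : ∀ i → j ≢ s i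
  ≢j i eq = ¬p (i , sym eq)

allFin-↭ : ∀ {n} (s : Fin n → Fin n) → Injective s → allFin n ↭ map s (allFin n)
allFin-↭ {n} s inj = Bag.∼bag⇒↭ (∈K.unique∧set⇒bag (UniqueP.allFin⁺ n) (UniqueP.map⁺ inj (UniqueP.allFin⁺ n))
  (mk⇔ to (λ _ → ∈P.∈-allFin _)))
  where
  to : ∀ {j} → j ∈ allFin n → j ∈ map s (allFin n)
  to {j} _ = let (i , eq) = injective⇒surjective s inj j in subst (_∈ map s (allFin n)) eq (∈P.∈-map⁺ s (∈P.∈-allFin i))

∑-permute : ∀ {n} (s : Fin n → Fin n) → Injective s → ∀ h → ∑ (allFin n) h ≡ ∑ (allFin n) (h ∘ s)
∑-permute {n} s inj h = ≡.trans (∑-↭ h (allFin-↭ s inj)) (∑-map s (allFin n) h)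

∑-pairs : ∀ n (f : Fin n × Fin n → ℚ) → ∑ (pairs n) f ≡ ∑ (allFin n) (λ a → ∑ (allFin n) (λ b → f (a , b)))
∑-pairs n f = ∑-concatMap-map _,_ (allFin n) (allFin n) f

∑-pairs-permute : ∀ {n} (s : Fin n → Fin n) → Injective s →
                  ∀ h → ∑ (pairs n) h ≡ ∑ (pairs n) (h ∘ map² s)
∑-pairs-permute {n} s inj h = begin
  ∑ (pairs n) h                                            ≡⟨ ∑-pairs n h ⟩
  ∑ (allFin n) (λ a → ∑ (allFin n) (λ b → h (a , b)))      ≡⟨ ∑-permute s inj _ ⟩
  ∑ (allFin n) (λ a → ∑ (allFin n) (λ b → h (s a , b)))    ≡⟨ ∑-cong (allFin n) (λ a → ∑-permute s inj _) ⟩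
  ∑ (allFin n) (λ a → ∑ (allFin n) (λ b → h (s a , s b)))  ≡⟨ sym (∑-pairs n _) ⟩
  ∑ (pairs n) (h ∘ map² s)                                 ∎

connᵇ-permute : ∀ {n} (s : Fin n → Fin n) → Injective s →
                ∀ es → connᵇ n (map (map² s) es) ≡ connᵇ n es
connᵇ-permute {n} s inj es = T-ext from to
  where
  t : Fin n → Fin n
  t j = proj₁ (injective⇒surjective s inj j)
  s-t : ∀ j → s (t j) ≡ j
  s-t j = proj₂ (injective⇒surjective s inj j)
  t-s : ∀ i → t (s i) ≡ i
  t-s i = inj (s-t (s i))
  to : T (connᵇ n es) → T (connᵇ n (map (map² s) es))
  to c = let (1≤n , p) = connᵇ⁻ es c in connᵇ⁺ _ (1≤n , λ u v →
    ≡.subst₂ (Path _) (s-t u) (s-t v) (Path-map s (All.tabulate (λ i → edge∈ (∈P.∈-map⁺ (map² s) i))) (p (t u) (t v))))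
  from : T (connᵇ n (map (map² s) es)) → T (connᵇ n es)
  from c = let (1≤n , p) = connᵇ⁻ (map (map² s) es) c in connᵇ⁺ es (1≤n , λ u v →
    ≡.subst₂ (Path _) (t-s u) (t-s v) (Path-map t (AllP.map⁺ (All.tabulate (λ {(a , b)} i →
      ≡.subst₂ (Path es) (sym (t-s a)) (sym (t-s b)) (edge∈ i)))) (p (s u) (s v))))

suc² : ∀ {n} → Fin n × Fin n → Fin (suc n) × Fin (suc n)
suc² = map² Fin.suc

retract : ∀ {n} → Fin n → Fin (suc n) → Fin n
retract v Fin.zero    = v
retract v (Fin.suc i) = i

-- Covers leaf addition and subdivision together: the new vertex 0 collapses onto `v`, every edge
-- goes to a path under the collapse as well as under the inclusion, and connectivity travels along
-- both maps.
connᵇ-retract : ∀ {n} (v : Fin n) es es′ →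
  All (λ (a , b) → Path es (Fin.suc a) (Fin.suc b)) es′ →
  All (λ (a , b) → Path es′ (retract v a) (retract v b)) es →
  Path es Fin.zero (Fin.suc v) → connᵇ (suc n) es ≡ connᵇ n es′
connᵇ-retract {suc n} v es es′ up down new = T-ext
  (λ c → let (_ , p) = connᵇ⁻ es c in connᵇ⁺ es′ (s≤s z≤n , λ a b → Path-map (retract v) down (p (Fin.suc a) (Fin.suc b))))
  (λ c → let (_ , p) = connᵇ⁻ es′ c
             lift : ∀ a b → Path es (Fin.suc a) (Fin.suc b)
             lift a b = Path-map Fin.suc up (p a b)
             to-v : ∀ a → Path es a (Fin.suc v)
             to-v = λ { Fin.zero → new ; (Fin.suc a) → lift a v }
         in connᵇ⁺ es (s≤s z≤n , λ a b → to-v a ◅◅ Path-sym (to-v b)))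

connᵇ-addLeaf : ∀ {n} (v : Fin n) es → connᵇ (suc n) ((Fin.zero , Fin.suc v) ∷ map suc² es) ≡ connᵇ n es
connᵇ-addLeaf v es = connᵇ-retract v _ es
  (All.tabulate (λ i → edge∈ (there (∈P.∈-map⁺ suc² i))))
  (ε ∷ AllP.map⁺ (All.tabulate edge∈))
  (edge∈ (here refl))

connᵇ-subdivide : ∀ {n} (v w : Fin n) es →
  connᵇ (suc n) ((Fin.zero , Fin.suc v) ∷ (Fin.zero , Fin.suc w) ∷ map suc² es) ≡ connᵇ n ((v , w) ∷ es)
connᵇ-subdivide v w es = connᵇ-retract v _ _
  ((Path-sym (edge∈ (here refl)) ◅◅ edge∈ (there (here refl))) ∷ All.tabulate (λ i → edge∈ (there (there (∈P.∈-map⁺ suc² i)))))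
  (ε ∷ edge∈ (here refl) ∷ AllP.map⁺ (All.tabulate (λ i → edge∈ (there i))))
  (edge∈ (here refl))

-- Labelled graphs with a marked vertex

two : ℚ
two = nat 2

two* : ∀ a → two * a ≡ a + a
two* a = begin
  (1ℚ + (1ℚ + 0ℚ)) * a  ≡⟨ cong (λ z → (1ℚ + z) * a) (+-identityʳ 1ℚ) ⟩
  (1ℚ + 1ℚ) * a         ≡⟨ *-distribʳ-+ a 1ℚ 1ℚ ⟩
  1ℚ * a + 1ℚ * a       ≡⟨ cong₂ _+_ (*-identityˡ a) (*-identityˡ a) ⟩
  a + a                 ∎

χ-false* : ∀ {b} a → b ≡ false → χ b * a ≡ 0ℚ
χ-false* a refl = *-zeroˡ a

χ-true* : ∀ {b} a → b ≡ true → χ b * a ≡ a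
χ-true* a refl = *-identityˡ a

gr : ∀ n → List (Fin n × Fin n) → Gr
gr n es = mkGr (Fin n) FinP._≟_ (allFin n) es

Ren-permute : ∀ {n} (s : Fin n → Fin n) → Injective s → ∀ es → Ren (gr n es) (gr n (map (map² s) es))
Ren-permute s inj es = ren s inj (allFin-↭ s inj) ≋-refl

Ren-≋ : ∀ {n} {es es′ : List (Fin n × Fin n)} → es ≋ es′ → Ren (gr n es) (gr n es′)
Ren-≋ {es = es} p = ren id id (≡⇒↭ (sym (ListP.map-id _))) (≋-trans (≋-sym p) (≡⇒≋ (sym (ListP.map-id es))))

fromMaybe : ∀ {n} → Maybe (Fin n) → Fin (suc n)
fromMaybe nothing  = Fin.zero
fromMaybe (just i) = Fin.suc i

fromMaybe-inj : ∀ {n} {a b : Maybe (Fin n)} → fromMaybe a ≡ fromMaybe b → a ≡ b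
fromMaybe-inj {a = nothing} {nothing} eq = refl
fromMaybe-inj {a = just i}  {just j}  eq = cong just (FinP.suc-injective eq)

allFin-suc : ∀ n → allFin (suc n) ≡ Fin.zero ∷ map Fin.suc (allFin n)
allFin-suc n = cong (Fin.zero ∷_) (sym (ListP.map-tabulate id Fin.suc))

allFin-fromMaybe : ∀ n → allFin (suc n) ≡ map fromMaybe (nothing ∷ map just (allFin n))
allFin-fromMaybe n = ≡.trans (allFin-suc n) (cong (Fin.zero ∷_) (ListP.map-∘ (allFin n)))

Ren-addLeaf-gr : ∀ {n} es (v : Fin n) → Ren (addLeaf (gr n es) v) (gr (suc n) ((Fin.zero , Fin.suc v) ∷ map suc² es))
Ren-addLeaf-gr {n} es v = ren fromMaybe fromMaybe-inj (≡⇒↭ (allFin-fromMaybe n))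
  (≋-prep _ (≡⇒≋ (ListP.map-∘ es)))

Ren-subdivideEdge-gr : ∀ {n} es (v w : Fin n) r →
  Ren (subdivideEdge (gr n es) (v , w) r) (gr (suc n) ((Fin.zero , Fin.suc v) ∷ (Fin.zero , Fin.suc w) ∷ map suc² r))
Ren-subdivideEdge-gr {n} es v w r = ren fromMaybe fromMaybe-inj (≡⇒↭ (allFin-fromMaybe n))
  (≋-prep _ (≋-prep _ (≡⇒≋ (ListP.map-∘ r))))

place : ∀ {n} → Fin (suc n) → Fin (suc n) → Fin (suc n)
place u Fin.zero    = u
place u (Fin.suc i) = punchIn u i

place-inj : ∀ {n} (u : Fin (suc n)) {a b} → place u a ≡ place u b → a ≡ b
place-inj u {Fin.zero}  {Fin.zero}  eq = refl
place-inj u {Fin.zero}  {Fin.suc b} eq = ⊥-elim (FinP.punchInᵢ≢i u b (sym eq))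
place-inj u {Fin.suc a} {Fin.zero}  eq = ⊥-elim (FinP.punchInᵢ≢i u a eq)
place-inj u {Fin.suc a} {Fin.suc b} eq = cong Fin.suc (FinP.punchIn-injective u a b eq)

PermInv : ∀ {n} → (Fin n → List (Fin n × Fin n) → ℚ) → Set
PermInv {n} G = ∀ (s : Fin n → Fin n) → Injective s → ∀ u es → G (s u) (map (map² s) es) ≡ G u es

-- by symmetry the marked vertex may be taken to be 0
∑-mark-vertex : ∀ n m (G : Fin (suc n) → List (Fin (suc n) × Fin (suc n)) → ℚ) → PermInv G →
  ∑ (lists m (pairs (suc n))) (λ es → ∑ (allFin (suc n)) (λ u → G u es)) ≡
  nat (suc n) * ∑ (lists m (pairs (suc n))) (G Fin.zero)
∑-mark-vertex n m G inv = begin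
  ∑ (lists m (pairs (suc n))) (λ es → ∑ (allFin (suc n)) (λ u → G u es))
    ≡⟨ ∑-swap (lists m (pairs (suc n))) (allFin (suc n)) _ ⟩
  ∑ (allFin (suc n)) (λ u → ∑ (lists m (pairs (suc n))) (G u))
    ≡⟨ ∑-cong (allFin (suc n)) (λ u → ≡.trans
         (∑-lists-map m (pairs (suc n)) (map² (place u)) (∑-pairs-permute (place u) (place-inj u)) (G u))
         (∑-cong (lists m (pairs (suc n))) (λ es → inv (place u) (place-inj u) Fin.zero es))) ⟩
  ∑ (allFin (suc n)) (λ u → ∑ (lists m (pairs (suc n))) (G Fin.zero))
    ≡⟨ ∑-const _ (allFin (suc n)) ⟩
  nat (length (allFin (suc n))) * ∑ (lists m (pairs (suc n))) (G Fin.zero)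
    ≡⟨ cong (λ l → nat l * ∑ (lists m (pairs (suc n))) (G Fin.zero)) (ListP.length-tabulate {n = suc n} id) ⟩
  nat (suc n) * ∑ (lists m (pairs (suc n))) (G Fin.zero) ∎

module _ {n : ℕ} where

  private
    𝟘 : Fin (suc n)
    𝟘 = Fin.zero
    Edge = Fin (suc n) × Fin (suc n)
    deg₀ : List Edge → ℕ
    deg₀ = deg FinP._≟_ 𝟘
    inc₀ : Edge → ℕ
    inc₀ = inc FinP._≟_ 𝟘

  -- A non-loop edge at 0 is stored in one of two orientations, whence the factor 2; the loop at 0
  -- is excluded because its `inc` is 2.
  ∑-pairs-at-0 : ∀ (H : Edge → ℚ) → Symmetric² H →
    ∑ (pairs (suc n)) (λ e → χ (inc₀ e ℕ.≡ᵇ 1) * H e) ≡ two * ∑ (allFin n) (λ v → H (𝟘 , Fin.suc v))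
  ∑-pairs-at-0 H H-sym = begin
    ∑ (pairs (suc n)) h
      ≡⟨ ∑-pairs (suc n) h ⟩
    ∑ (allFin (suc n)) (λ a → ∑ (allFin (suc n)) (λ b → h (a , b)))
      ≡⟨ ∑-allFin-suc n _ ⟩
    ∑ (allFin (suc n)) (λ b → h (𝟘 , b)) + ∑ (allFin n) (λ a → ∑ (allFin (suc n)) (λ b → h (Fin.suc a , b)))
      ≡⟨ cong₂ _+_ (∑-allFin-suc n _) (∑-cong (allFin n) (λ a → ∑-allFin-suc n _)) ⟩
    (h (𝟘 , 𝟘) + ∑ (allFin n) (λ b → h (𝟘 , Fin.suc b))) +
      ∑ (allFin n) (λ a → h (Fin.suc a , 𝟘) + ∑ (allFin n) (λ b → h (Fin.suc a , Fin.suc b)))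
      ≡⟨ cong₂ _+_ (cong₂ _+_ (*-zeroˡ (H (𝟘 , 𝟘))) (∑-cong (allFin n) (λ b → *-identityˡ _)))
           (∑-cong (allFin n) (λ a → cong₂ _+_ (≡.trans (*-identityˡ _) (H-sym _ _))
              (∑-0 (allFin n) (λ b → *-zeroˡ (H (Fin.suc a , Fin.suc b)))))) ⟩
    (0ℚ + S) + ∑ (allFin n) (λ a → H (𝟘 , Fin.suc a) + 0ℚ)
      ≡⟨ cong₂ _+_ (+-identityˡ _) (∑-cong (allFin n) (λ a → +-identityʳ _)) ⟩
    S + S
      ≡⟨ sym (two* S) ⟩
    two * S ∎
    where
    h : Edge → ℚ
    h e = χ (inc₀ e ℕ.≡ᵇ 1) * H e
    S = ∑ (allFin n) (λ v → H (𝟘 , Fin.suc v))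

  module _ (F : List Edge → ℚ) (F-≋ : ∀ {es es′} → es ≋ es′ → F es ≡ F es′) where

    -- The factor `simpleDeg` chooses a non-loop edge at 0. It can occupy m + 1 positions and have
    -- two orientations, and taking it away lowers the degree of 0 from d + 1 to d.
    ∑-mark-edge : ∀ d m →
      ∑ (lists (suc m) (pairs (suc n))) (λ es → χ (deg₀ es ℕ.≡ᵇ suc d) * (nat (simpleDeg FinP._≟_ 𝟘 es) * F es)) ≡
      nat (suc m) * (two * ∑ (allFin n) (λ v → ∑ (lists m (pairs (suc n))) (λ es → χ (deg₀ es ℕ.≡ᵇ d) * F ((𝟘 , Fin.suc v) ∷ es))))
    ∑-mark-edge d m = begin
      ∑ (lists (suc m) (pairs (suc n))) (λ es → χ (deg₀ es ℕ.≡ᵇ suc d) * (nat (simpleDeg FinP._≟_ 𝟘 es) * F es))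
        ≡⟨ ∑-cong (lists (suc m) (pairs (suc n))) pointwise ⟩
      ∑ (lists (suc m) (pairs (suc n))) (λ es → ∑ (picks es) H)
        ≡⟨ ∑-lists-picks m (pairs (suc n)) H (λ e p → cong₂ (λ i z → χ (inc₀ e ℕ.≡ᵇ 1) * (χ (i ℕ.≡ᵇ d) * z))
             (deg-≋ FinP._≟_ 𝟘 (↭⇒≋ p)) (F-≋ (≋-prep e (↭⇒≋ p)))) ⟩
      nat (suc m) * ∑ (pairs (suc n)) (λ e → ∑ (lists m (pairs (suc n))) (λ l → H (e , l)))
        ≡⟨ cong (nat (suc m) *_) (∑-cong (pairs (suc n)) (λ e → sym (∑-*ˡ (χ (inc₀ e ℕ.≡ᵇ 1)) _ (lists m (pairs (suc n)))))) ⟩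
      nat (suc m) * ∑ (pairs (suc n)) (λ e → χ (inc₀ e ℕ.≡ᵇ 1) * ∑ (lists m (pairs (suc n))) (λ es → χ (deg₀ es ℕ.≡ᵇ d) * F (e ∷ es)))
        ≡⟨ cong (nat (suc m) *_) (∑-pairs-at-0 (λ e → ∑ (lists m (pairs (suc n))) (λ es → χ (deg₀ es ℕ.≡ᵇ d) * F (e ∷ es)))
             (λ a b → ∑-cong (lists m (pairs (suc n))) (λ es → cong (χ (deg₀ es ℕ.≡ᵇ d) *_) (F-≋ (≋-flip a b ≋-refl))))) ⟩
      nat (suc m) * (two * ∑ (allFin n) (λ v → ∑ (lists m (pairs (suc n))) (λ es → χ (deg₀ es ℕ.≡ᵇ d) * F ((𝟘 , Fin.suc v) ∷ es)))) ∎
      where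
      H : Edge × List Edge → ℚ
      H (e , r) = χ (inc₀ e ℕ.≡ᵇ 1) * (χ (deg₀ r ℕ.≡ᵇ d) * F (e ∷ r))

      pick : ∀ es e r → es ↭ e ∷ r → χ (inc₀ e ℕ.≡ᵇ 1) * (χ (deg₀ es ℕ.≡ᵇ suc d) * F es) ≡ H (e , r)
      pick es e r p rewrite deg-≋ FinP._≟_ 𝟘 (↭⇒≋ p) | F-≋ (↭⇒≋ p) with inc₀ e
      ... | 0           = ≡.trans (*-zeroˡ _) (sym (*-zeroˡ _))
      ... | 1           = refl
      ... | suc (suc i) = ≡.trans (*-zeroˡ _) (sym (*-zeroˡ _))

      pointwise : ∀ es → χ (deg₀ es ℕ.≡ᵇ suc d) * (nat (simpleDeg FinP._≟_ 𝟘 es) * F es) ≡ ∑ (picks es) H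
      pointwise es = begin
        χ (deg₀ es ℕ.≡ᵇ suc d) * (nat (simpleDeg FinP._≟_ 𝟘 es) * F es)
          ≡⟨ *-left-comm (χ (deg₀ es ℕ.≡ᵇ suc d)) (nat (simpleDeg FinP._≟_ 𝟘 es)) (F es) ⟩
        nat (simpleDeg FinP._≟_ 𝟘 es) * (χ (deg₀ es ℕ.≡ᵇ suc d) * F es)
          ≡⟨ cong (_* (χ (deg₀ es ℕ.≡ᵇ suc d) * F es)) (≡.trans (nat-sumℕ _ es)
               (≡.trans (∑-cong es (λ e → nat-bit (inc₀ e ℕ.≡ᵇ 1))) (sym (∑-picks-proj₁ es _)))) ⟩
        ∑ (picks es) (λ (e , r) → χ (inc₀ e ℕ.≡ᵇ 1)) * (χ (deg₀ es ℕ.≡ᵇ suc d) * F es)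
          ≡⟨ ∑-*ʳ _ _ (picks es) ⟩
        ∑ (picks es) (λ (e , r) → χ (inc₀ e ℕ.≡ᵇ 1) * (χ (deg₀ es ℕ.≡ᵇ suc d) * F es))
          ≡⟨ ∑-cong-All (All.map (λ {(e , r)} → pick es e r) (picks-↭ es)) ⟩
        ∑ (picks es) H ∎

  -- The last stage of a removal: when 0 has no edges left, the remaining list is an edge list on
  -- the other n vertices.
  ∑-avoid-0 : ∀ m (F : List Edge → ℚ) →
    ∑ (lists m (pairs (suc n))) (λ es → χ (deg₀ es ℕ.≡ᵇ 0) * F es) ≡ ∑ (lists m (pairs n)) (F ∘ map suc²)
  ∑-avoid-0 zero    F = cong (_+ 0ℚ) (*-identityˡ _)
  ∑-avoid-0 (suc m) F = begin
    ∑ (lists (suc m) (pairs (suc n))) (λ es → χ (deg₀ es ℕ.≡ᵇ 0) * F es)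
      ≡⟨ ∑-lists-suc m (pairs (suc n)) _ ⟩
    ∑ (pairs (suc n)) h
      ≡⟨ ∑-pairs (suc n) h ⟩
    ∑ (allFin (suc n)) (λ a → ∑ (allFin (suc n)) (λ b → h (a , b)))
      ≡⟨ ∑-allFin-suc n _ ⟩
    ∑ (allFin (suc n)) (λ b → h (𝟘 , b)) + ∑ (allFin n) (λ a → ∑ (allFin (suc n)) (λ b → h (Fin.suc a , b)))
      ≡⟨ cong₂ _+_ (∑-0 (allFin (suc n)) (λ b → ∑-0 (lists m (pairs (suc n))) (λ l → *-zeroˡ (F ((𝟘 , b) ∷ l)))))
                   (∑-cong (allFin n) (λ a → ∑-allFin-suc n _)) ⟩
    0ℚ + ∑ (allFin n) (λ a → h (Fin.suc a , 𝟘) + ∑ (allFin n) (λ b → h (Fin.suc a , Fin.suc b)))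
      ≡⟨ +-identityˡ _ ⟩
    ∑ (allFin n) (λ a → h (Fin.suc a , 𝟘) + ∑ (allFin n) (λ b → h (Fin.suc a , Fin.suc b)))
      ≡⟨ ∑-cong (allFin n) (λ a → ≡.trans (cong (_+ ∑ (allFin n) (λ b → h (Fin.suc a , Fin.suc b)))
           (∑-0 (lists m (pairs (suc n))) (λ l → *-zeroˡ (F ((Fin.suc a , 𝟘) ∷ l))))) (+-identityˡ _)) ⟩
    ∑ (allFin n) (λ a → ∑ (allFin n) (λ b → h (Fin.suc a , Fin.suc b)))
      ≡⟨ sym (∑-pairs n (h ∘ suc²)) ⟩
    ∑ (pairs n) (h ∘ suc²)
      ≡⟨ ∑-cong (pairs n) (λ e → ∑-avoid-0 m (λ l → F (suc² e ∷ l))) ⟩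
    ∑ (pairs n) (λ e → ∑ (lists m (pairs n)) (λ l → F (suc² e ∷ map suc² l)))
      ≡⟨ sym (∑-lists-suc m (pairs n) _) ⟩
    ∑ (lists (suc m) (pairs n)) (F ∘ map suc²) ∎
    where
    h : Edge → ℚ
    h e = ∑ (lists m (pairs (suc n))) (λ l → χ (deg₀ (e ∷ l) ℕ.≡ᵇ 0) * F (e ∷ l))

  -- At degree 1 the only edge is not a loop, so the factor `simpleDeg` required by `∑-mark-edge`
  -- can be inserted at no cost.
  leaf-as-simple : ∀ es u → nat (isLeaf FinP._≟_ es u) ≡ χ (deg FinP._≟_ u es ℕ.≡ᵇ 1) * nat (simpleDeg (FinP._≟_ {suc n}) u es)
  leaf-as-simple es u with deg FinP._≟_ u es ℕ.≡ᵇ 1 in eq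
  ... | true  = ≡.trans (+-identityʳ 1ℚ) (sym (≡.trans (*-identityˡ _)
                  (≡.trans (cong nat (deg≡1⇒simpleDeg≡1 FinP._≟_ u es (ℕP.≡ᵇ⇒≡ (deg FinP._≟_ u es) 1 (subst T (sym eq) tt)))) (+-identityʳ 1ℚ))))
  ... | false = sym (*-zeroˡ _)

module _ {n : ℕ} (s : Fin n → Fin n) (inj : Injective s) where

  isLeaf-permute : ∀ u es → isLeaf FinP._≟_ (map (map² s) es) (s u) ≡ isLeaf FinP._≟_ es u
  isLeaf-permute u es = cong (λ i → bit (i ℕ.≡ᵇ 1)) (deg-map FinP._≟_ FinP._≟_ s inj u es)

  isJoint-permute : ∀ u es → isJoint FinP._≟_ (map (map² s) es) (s u) ≡ isJoint FinP._≟_ es u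
  isJoint-permute u es = cong₂ (λ i j → bit (i ℕ.≡ᵇ 2) ℕ.* j) (deg-map FinP._≟_ FinP._≟_ s inj u es)
                               (simpleDeg-map FinP._≟_ FinP._≟_ s inj u es)

-- The factors are the n + 1 labels of the leaf and the m + 1 positions and two orientations of its
-- edge. The summand may depend on the leaf, because for rooted trees the leaf has to be different
-- from the root.
∑-leaves : ∀ n m (G : Fin (suc n) → List (Fin (suc n) × Fin (suc n)) → ℚ) → PermInv G →
  (∀ u {es es′} → es ≋ es′ → G u es ≡ G u es′) →
  ∑ (lists (suc m) (pairs (suc n))) (λ es → ∑ (allFin (suc n)) (λ u → nat (isLeaf FinP._≟_ es u) * G u es)) ≡
  nat (suc n) * (nat (suc m) * (two *
    ∑ (lists m (pairs n)) (λ es → ∑ (allFin n) (λ v → G Fin.zero ((Fin.zero , Fin.suc v) ∷ map suc² es)))))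
∑-leaves n m G perm G-≋ = begin
  ∑ (lists (suc m) (pairs (suc n))) (λ es → ∑ (allFin (suc n)) (λ u → nat (isLeaf FinP._≟_ es u) * G u es))
    ≡⟨ ∑-mark-vertex n (suc m) (λ u es → nat (isLeaf FinP._≟_ es u) * G u es)
         (λ s inj u es → cong₂ (λ i z → nat i * z) (isLeaf-permute s inj u es) (perm s inj u es)) ⟩
  nat (suc n) * ∑ (lists (suc m) (pairs (suc n))) (λ es → nat (isLeaf FinP._≟_ es Fin.zero) * G Fin.zero es)
    ≡⟨ cong (nat (suc n) *_) (≡.trans
         (∑-cong (lists (suc m) (pairs (suc n))) (λ es → ≡.trans (cong (_* G Fin.zero es) (leaf-as-simple es Fin.zero)) (*-assoc _ _ _)))
         (∑-mark-edge (G Fin.zero) (G-≋ Fin.zero) 0 m)) ⟩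
  nat (suc n) * (nat (suc m) * (two * ∑ (allFin n) (λ v → ∑ (lists m (pairs (suc n)))
    (λ es → χ (deg FinP._≟_ Fin.zero es ℕ.≡ᵇ 0) * G Fin.zero ((Fin.zero , Fin.suc v) ∷ es)))))
    ≡⟨ cong (λ z → nat (suc n) * (nat (suc m) * (two * z))) (≡.trans
         (∑-cong (allFin n) (λ v → ∑-avoid-0 m _)) (∑-swap (allFin n) (lists m (pairs n)) _)) ⟩
  nat (suc n) * (nat (suc m) * (two *
    ∑ (lists m (pairs n)) (λ es → ∑ (allFin n) (λ v → G Fin.zero ((Fin.zero , Fin.suc v) ∷ map suc² es))))) ∎

-- The two edges at the vertex are removed one after the other. The second removal brings a factor
-- m, which is just the number of positions for a marked edge in a list of length m; the pair of
-- edges thereby becomes one picked edge, while both factors 2 from the orientations remain.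
∑-joints : ∀ n m (F : List (Fin (suc n) × Fin (suc n)) → ℚ) →
  (∀ (s : Fin (suc n) → Fin (suc n)) → Injective s → ∀ es → F (map (map² s) es) ≡ F es) →
  (∀ {es es′} → es ≋ es′ → F es ≡ F es′) →
  ∑ (lists (suc m) (pairs (suc n))) (λ es → ∑ (allFin (suc n)) (λ u → nat (isJoint FinP._≟_ es u) * F es)) ≡
  nat (suc n) * (nat (suc m) * (two * (two *
    ∑ (lists m (pairs n)) (λ es → ∑ (picks es) (λ (e , r) →
      F ((Fin.zero , Fin.suc (proj₁ e)) ∷ (Fin.zero , Fin.suc (proj₂ e)) ∷ map suc² r))))))
∑-joints n m F perm F-≋ = begin
  ∑ (lists (suc m) (pairs (suc n))) (λ es → ∑ (allFin (suc n)) (λ u → nat (isJoint FinP._≟_ es u) * F es))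
    ≡⟨ ∑-mark-vertex n (suc m) (λ u es → nat (isJoint FinP._≟_ es u) * F es)
         (λ s inj u es → cong₂ (λ i z → nat i * z) (isJoint-permute s inj u es) (perm s inj es)) ⟩
  nat (suc n) * ∑ (lists (suc m) (pairs (suc n))) (λ es → nat (isJoint FinP._≟_ es Fin.zero) * F es)
    ≡⟨ cong (nat (suc n) *_) (≡.trans
         (∑-cong (lists (suc m) (pairs (suc n))) (λ es → ≡.trans
            (cong (_* F es) (≡.trans (nat-* (bit (deg FinP._≟_ Fin.zero es ℕ.≡ᵇ 2)) (simpleDeg FinP._≟_ Fin.zero es))
              (cong (_* nat (simpleDeg FinP._≟_ Fin.zero es)) (nat-bit (deg FinP._≟_ Fin.zero es ℕ.≡ᵇ 2))))) (*-assoc _ _ _)))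
         (∑-mark-edge F F-≋ 1 m)) ⟩
  nat (suc n) * (nat (suc m) * (two * ∑ (allFin n) (λ v → ∑ (lists m (pairs (suc n)))
    (λ es → χ (deg FinP._≟_ Fin.zero es ℕ.≡ᵇ 1) * F ((Fin.zero , Fin.suc v) ∷ es)))))
    ≡⟨ cong (λ z → nat (suc n) * (nat (suc m) * (two * z))) (second m) ⟩
  nat (suc n) * (nat (suc m) * (two * (two * R m))) ∎
  where
  sub : (Fin n × Fin n) × List (Fin n × Fin n) → ℚ
  sub (e , r) = F ((Fin.zero , Fin.suc (proj₁ e)) ∷ (Fin.zero , Fin.suc (proj₂ e)) ∷ map suc² r)
  R : ℕ → ℚ
  R m = ∑ (lists m (pairs n)) (λ es → ∑ (picks es) sub)
  second : ∀ m → ∑ (allFin n) (λ v → ∑ (lists m (pairs (suc n)))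
    (λ es → χ (deg FinP._≟_ Fin.zero es ℕ.≡ᵇ 1) * F ((Fin.zero , Fin.suc v) ∷ es))) ≡ two * R m
  -- No edge is left after the first removal, so 0 cannot have degree 1; on the right there is no
  -- edge to pick.
  second zero = ≡.trans (∑-0 (allFin n) (λ v → ≡.trans (cong (_+ 0ℚ) (*-zeroˡ (F ((Fin.zero , Fin.suc v) ∷ [])))) (+-identityˡ 0ℚ)))
                        (sym (≡.trans (cong (two *_) (+-identityˡ 0ℚ)) (*-zeroʳ two)))
  second (suc m) = begin
    ∑ (allFin n) (λ v → ∑ (lists (suc m) (pairs (suc n))) (λ es → χ (deg FinP._≟_ Fin.zero es ℕ.≡ᵇ 1) * F ((Fin.zero , Fin.suc v) ∷ es)))
      ≡⟨ ∑-cong (allFin n) (λ v → ≡.trans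
           (∑-cong (lists (suc m) (pairs (suc n))) (λ es → ≡.trans
              (cong (_* F ((Fin.zero , Fin.suc v) ∷ es)) (≡.trans (sym (nat-bit (deg FinP._≟_ Fin.zero es ℕ.≡ᵇ 1))) (leaf-as-simple es Fin.zero)))
              (*-assoc _ _ _)))
           (∑-mark-edge (λ es → F ((Fin.zero , Fin.suc v) ∷ es)) (λ p → F-≋ (≋-prep _ p)) 0 m)) ⟩
    ∑ (allFin n) (λ v → nat (suc m) * (two * ∑ (allFin n) (λ w → ∑ (lists m (pairs (suc n)))
        (λ es → χ (deg FinP._≟_ Fin.zero es ℕ.≡ᵇ 0) * F ((Fin.zero , Fin.suc v) ∷ (Fin.zero , Fin.suc w) ∷ es)))))
      ≡⟨ ∑-cong (allFin n) (λ v → ≡.trans (*-left-comm (nat (suc m)) two _) (cong (λ z → two * (nat (suc m) * z))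
           (∑-cong (allFin n) (λ w → ∑-avoid-0 m _)))) ⟩
    ∑ (allFin n) (λ v → two * (nat (suc m) * ∑ (allFin n) (λ w → ∑ (lists m (pairs n)) (λ es → sub ((v , w) , es)))))
      ≡⟨ ≡.trans (sym (∑-*ˡ two _ (allFin n))) (cong (two *_) (sym (∑-*ˡ (nat (suc m)) _ (allFin n)))) ⟩
    two * (nat (suc m) * ∑ (allFin n) (λ v → ∑ (allFin n) (λ w → ∑ (lists m (pairs n)) (λ es → sub ((v , w) , es)))))
      ≡⟨ cong (λ z → two * (nat (suc m) * z)) (sym (∑-pairs n _)) ⟩
    two * (nat (suc m) * ∑ (pairs n) (λ e → ∑ (lists m (pairs n)) (λ es → sub (e , es))))
      ≡⟨ cong (two *_) (sym (∑-lists-picks m (pairs n) sub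
           (λ e p → F-≋ (≋-prep _ (≋-prep _ (≋-map Fin.suc (↭⇒≋ p))))))) ⟩
    two * R (suc m) ∎

-- Weighted sums over connected graphs

opaque
  unfolding _+_

  nat-recip : ∀ d → nat (suc d) * recip (suc d) ≡ 1ℚ
  nat-recip d = ℚP.toℚᵘ-injective (ℚᵘP.≃-trans (ℚP.toℚᵘ-homo-* (nat (suc d)) (recip (suc d)))
    (ℚᵘP.≃-trans (ℚᵘP.*-cong (toℚᵘ-nat (suc d)) (ℚP.toℚᵘ-fromℚᵘ (ℚᵘ.mkℚᵘ (ℤ.+ 1) d)))
      (ℚᵘ.*≡* (cong ℤ.+_ (unit d)))))
    where
    unit : ∀ d → (suc d ℕ.* 1) ℕ.* 1 ≡ 1 ℕ.* (1 ℕ.* suc d)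
    unit = solve 1 (λ d → ((con 1 :+ d) :* con 1) :* con 1 := con 1 :* (con 1 :* (con 1 :+ d))) refl
      where open ℕS.+-*-Solver
    toℚᵘ-nat : ∀ n → ℚ.toℚᵘ (nat n) ℚᵘ.≃ ℚᵘ.mkℚᵘ (ℤ.+ n) 0
    toℚᵘ-nat zero    = ℚᵘP.≃-refl
    toℚᵘ-nat (suc n) = ℚᵘP.≃-trans (ℚP.toℚᵘ-homo-+ 1ℚ (nat n))
      (ℚᵘP.≃-trans (ℚᵘP.+-congʳ (ℚ.toℚᵘ 1ℚ) (toℚᵘ-nat n)) (ℚᵘ.*≡* (cong (λ z → (ℤ.+ 1 ℤ.+ z) ℤ.* ℤ.+ 1) (ℤP.*-identityʳ (ℤ.+ n)))))

nat-recip-* : ∀ c d → c ≢ 0 → d ≢ 0 → nat c * recip (c ℕ.* d) ≡ recip d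
nat-recip-* zero    d       c≢0 d≢0 = ⊥-elim (c≢0 refl)
nat-recip-* (suc c) zero    c≢0 d≢0 = ⊥-elim (d≢0 refl)
nat-recip-* (suc c) (suc d) c≢0 d≢0 = begin
  nat (suc c) * r                                          ≡⟨ sym (*-identityˡ _) ⟩
  1ℚ * (nat (suc c) * r)                                   ≡⟨ cong (_* (nat (suc c) * r)) (sym (nat-recip d)) ⟩
  (nat (suc d) * recip (suc d)) * (nat (suc c) * r)        ≡⟨ cong (_* (nat (suc c) * r)) (*-comm (nat (suc d)) (recip (suc d))) ⟩
  (recip (suc d) * nat (suc d)) * (nat (suc c) * r)        ≡⟨ *-assoc (recip (suc d)) (nat (suc d)) _ ⟩
  recip (suc d) * (nat (suc d) * (nat (suc c) * r))        ≡⟨ cong (recip (suc d) *_) (≡.trans (*-left-comm (nat (suc d)) (nat (suc c)) r)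
                                                                (≡.trans (sym (*-assoc (nat (suc c)) (nat (suc d)) r))
                                                                         (cong (_* r) (sym (nat-* (suc c) (suc d)))))) ⟩
  recip (suc d) * (nat (suc c ℕ.* suc d) * r)              ≡⟨ cong (recip (suc d) *_) (nat-recip (d ℕ.+ c ℕ.* suc d)) ⟩
  recip (suc d) * 1ℚ                                       ≡⟨ *-identityʳ _ ⟩
  recip (suc d)                                            ∎
  where r = recip (suc c ℕ.* suc d)

-- the number of relabellings of n vertices and m oriented edges
vol : ℕ → ℕ → ℕ
vol n m = n ! ℕ.* (m ! ℕ.* 2 ℕ.^ m)

wt : ℕ → ℕ → ℚ
wt n m = recip (vol n m)

vol≢0 : ∀ n m → vol n m ≢ 0
vol≢0 n m eq = [ ℕP.m<n⇒n≢0 (ℕP.1≤n! n)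
               , (λ eq′ → [ ℕP.m<n⇒n≢0 (ℕP.1≤n! m) , ℕP.m<n⇒n≢0 (ℕP.m^n>0 2 m) ]′ (ℕP.m*n≡0⇒m≡0∨n≡0 (m !) eq′)) ]′
               (ℕP.m*n≡0⇒m≡0∨n≡0 (n !) eq)

-- The factor is exactly the one produced by marking a vertex and one of its edges, which is the
-- purpose of the weights.
wt-suc : ∀ n m X → wt (suc n) (suc m) * (nat (suc n) * (nat (suc m) * (two * X))) ≡ wt n m * X
wt-suc n m X = begin
  wt (suc n) (suc m) * (nat (suc n) * (nat (suc m) * (two * X)))
    ≡⟨ cong (wt (suc n) (suc m) *_) (≡.trans (cong (nat (suc n) *_) (sym (*-assoc (nat (suc m)) two X))) (sym (*-assoc (nat (suc n)) _ X))) ⟩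
  wt (suc n) (suc m) * ((nat (suc n) * (nat (suc m) * two)) * X)
    ≡⟨ sym (*-assoc (wt (suc n) (suc m)) _ X) ⟩
  (wt (suc n) (suc m) * (nat (suc n) * (nat (suc m) * two))) * X
    ≡⟨ cong (_* X) (≡.trans (*-comm (wt (suc n) (suc m)) _) (cong₂ _*_
         (≡.trans (cong (nat (suc n) *_) (sym (nat-* (suc m) 2))) (sym (nat-* (suc n) (suc m ℕ.* 2))))
         (cong recip (rearrange (suc n) (n !) (suc m) (m !) (2 ℕ.^ m))))) ⟩
  (nat (suc n ℕ.* (suc m ℕ.* 2)) * recip ((suc n ℕ.* (suc m ℕ.* 2)) ℕ.* vol n m)) * X
    ≡⟨ cong (_* X) (nat-recip-* (suc n ℕ.* (suc m ℕ.* 2)) (vol n m) (λ ()) (vol≢0 n m)) ⟩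
  wt n m * X ∎
  where
  rearrange : ∀ a b c d e → (a ℕ.* b) ℕ.* ((c ℕ.* d) ℕ.* (2 ℕ.* e)) ≡ (a ℕ.* (c ℕ.* 2)) ℕ.* (b ℕ.* (d ℕ.* e))
  rearrange = solve 5 (λ a b c d e → (a :* b) :* ((c :* d) :* (con 2 :* e)) := (a :* (c :* con 2)) :* (b :* (d :* e))) refl
    where open ℕS.+-*-Solver

module _ (h : ℕ) where

  -- the weighted sum over connected graphs with N vertices and Betti number h + 2
  Λ : (Gr → ℚ) → ℕ → ℚ
  Λ f N = wt N (N ℕ.+ suc h) * ∑ (lists (N ℕ.+ suc h) (pairs N)) (λ es → χ (connᵇ N es) * f (gr N es))

  Λ-cong : ∀ {f g} N → (∀ G → f G ≡ g G) → Λ f N ≡ Λ g N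
  Λ-cong N eq = cong (wt N (N ℕ.+ suc h) *_) (∑-cong (lists (N ℕ.+ suc h) (pairs N)) (λ es → cong (χ (connᵇ N es) *_) (eq (gr N es))))

  Λ-+ : ∀ f g N → Λ (λ G → f G + g G) N ≡ Λ f N + Λ g N
  Λ-+ f g N = ≡.trans (cong (wt N (N ℕ.+ suc h) *_) (≡.trans
      (∑-cong (lists (N ℕ.+ suc h) (pairs N)) (λ es → *-distribˡ-+ (χ (connᵇ N es)) _ _))
      (∑-+ _ _ (lists (N ℕ.+ suc h) (pairs N)))))
    (*-distribˡ-+ (wt N (N ℕ.+ suc h)) _ _)

  Λ-zero : ∀ f → Λ f 0 ≡ 0ℚ
  Λ-zero f = *-zeroʳ (wt 0 (suc h))

  module _ {f : Gr → ℚ} (f-inv : Inv f) where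

    private
      F : ∀ n → List (Fin n × Fin n) → ℚ
      F n es = χ (connᵇ n es) * f (gr n es)

      F-≋ : ∀ n {es es′} → es ≋ es′ → F n es ≡ F n es′
      F-≋ n p = cong₂ (λ b z → χ b * z) (connᵇ-≋ p) (f-inv (Ren-≋ p))

      F-permute : ∀ n (s : Fin n → Fin n) → Injective s → ∀ es → F n (map (map² s) es) ≡ F n es
      F-permute n s inj es = cong₂ (λ b z → χ b * z) (connᵇ-permute s inj es) (sym (f-inv (Ren-permute s inj es)))

      distribute : ∀ n (c : Fin n → ℕ) es → χ (connᵇ n es) * (nat (sumℕ c (allFin n)) * f (gr n es)) ≡ ∑ (allFin n) (λ u → nat (c u) * F n es)
      distribute n c es = ≡.trans (*-left-comm (χ (connᵇ n es)) _ _)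
        (≡.trans (cong (_* F n es) (nat-sumℕ c (allFin n))) (∑-*ʳ (F n es) _ (allFin n)))

    -- The counting factors of `∑-leaves` cancel against the weights. One vertex and one edge
    -- disappear, so the Betti number stays fixed.
    Λ-leaves : ∀ N → Λ (λ G → nat (leaves G) * f G) N ≡ shift (Λ (leafSum f)) N
    Λ-leaves zero    = Λ-zero (λ G → nat (leaves G) * f G)
    Λ-leaves (suc n) = begin
      wt (suc n) (suc m) * ∑ (lists (suc m) (pairs (suc n))) (λ es → χ (connᵇ (suc n) es) * (nat (leaves (gr (suc n) es)) * f (gr (suc n) es)))
        ≡⟨ cong (wt (suc n) (suc m) *_) (≡.trans
             (∑-cong (lists (suc m) (pairs (suc n))) (λ es → distribute (suc n) (isLeaf FinP._≟_ es) es))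
             (∑-leaves n m (λ _ → F (suc n)) (λ s inj _ → F-permute (suc n) s inj) (λ _ → F-≋ (suc n)))) ⟩
      wt (suc n) (suc m) * (nat (suc n) * (nat (suc m) * (two * ∑ (lists m (pairs n)) (λ es → ∑ (allFin n) (λ v → F (suc n) ((Fin.zero , Fin.suc v) ∷ map suc² es))))))
        ≡⟨ wt-suc n m _ ⟩
      wt n m * ∑ (lists m (pairs n)) (λ es → ∑ (allFin n) (λ v → F (suc n) ((Fin.zero , Fin.suc v) ∷ map suc² es)))
        ≡⟨ cong (wt n m *_) (∑-cong (lists m (pairs n)) (λ es → ≡.trans
             (∑-cong (allFin n) (λ v → cong₂ (λ b z → χ b * z) (connᵇ-addLeaf v es) (sym (f-inv (Ren-addLeaf-gr es v)))))
             (sym (∑-*ˡ (χ (connᵇ n es)) _ (allFin n))))) ⟩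
      Λ (leafSum f) n ∎
      where m = n ℕ.+ suc h

    -- Smoothing removes two edges and creates one, so the weights cancel only one of the two
    -- orientation factors; the other 2 matches the double count in `joints`.
    Λ-joints : ∀ N → Λ (λ G → nat (joints G) * f G) N ≡ shift (λ n → two * Λ (edgeSum f) n) N
    Λ-joints zero    = Λ-zero (λ G → nat (joints G) * f G)
    Λ-joints (suc n) = begin
      wt (suc n) (suc m) * ∑ (lists (suc m) (pairs (suc n))) (λ es → χ (connᵇ (suc n) es) * (nat (joints (gr (suc n) es)) * f (gr (suc n) es)))
        ≡⟨ cong (wt (suc n) (suc m) *_) (≡.trans
             (∑-cong (lists (suc m) (pairs (suc n))) (λ es → distribute (suc n) (isJoint FinP._≟_ es) es))
             (∑-joints n m (F (suc n)) (F-permute (suc n)) (F-≋ (suc n)))) ⟩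
      wt (suc n) (suc m) * (nat (suc n) * (nat (suc m) * (two * (two * ∑ (lists m (pairs n)) (λ es → ∑ (picks es) (λ (e , r) → sub e r))))))
        ≡⟨ wt-suc n m _ ⟩
      wt n m * (two * ∑ (lists m (pairs n)) (λ es → ∑ (picks es) (λ (e , r) → sub e r)))
        ≡⟨ *-left-comm (wt n m) two _ ⟩
      two * (wt n m * ∑ (lists m (pairs n)) (λ es → ∑ (picks es) (λ (e , r) → sub e r)))
        ≡⟨ cong (λ z → two * (wt n m * z)) (∑-cong (lists m (pairs n)) (λ es → ≡.trans
             (∑-cong-All (All.map (λ {(e , r)} → smooth es e r) (picks-↭ es)))
             (sym (∑-*ˡ (χ (connᵇ n es)) _ (picks es))))) ⟩
      two * Λ (edgeSum f) n ∎
      where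
      m = n ℕ.+ suc h
      sub : Fin n × Fin n → List (Fin n × Fin n) → ℚ
      sub e r = F (suc n) ((Fin.zero , Fin.suc (proj₁ e)) ∷ (Fin.zero , Fin.suc (proj₂ e)) ∷ map suc² r)
      smooth : ∀ es e r → es ↭ e ∷ r → sub e r ≡ χ (connᵇ n es) * f (subdivideEdge (gr n es) e r)
      smooth es (v , w) r p = cong₂ (λ b z → χ b * z)
        (≡.trans (connᵇ-subdivide v w r) (connᵇ-≋ (≋-sym (↭⇒≋ p))))
        (sym (f-inv (Ren-subdivideEdge-gr es v w r)))

-- Rooted trees

nonroots : ∀ {a} → Fin (suc a) → List (Fin (suc a))
nonroots {a} r = map (punchIn r) (allFin a)

map-place : ∀ {a} (r : Fin (suc a)) → map (place r) (allFin (suc a)) ≡ r ∷ nonroots r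
map-place {a} r = ≡.trans (cong (map (place r)) (allFin-suc a)) (cong (r ∷_) (sym (ListP.map-∘ (allFin a))))

allFin-root : ∀ {a} (r : Fin (suc a)) → allFin (suc a) ↭ r ∷ nonroots r
allFin-root r = trans (allFin-↭ (place r) (place-inj r)) (≡⇒↭ (map-place r))

nonroots-permute : ∀ {a} (s : Fin (suc a) → Fin (suc a)) → Injective s →
                   ∀ r → nonroots (s r) ↭ map s (nonroots r)
nonroots-permute s inj r = ↭P.drop-∷ (trans (↭-sym (allFin-root (s r))) (trans (allFin-↭ s inj) (↭P.map⁺ s (allFin-root r))))

nonroots-suc : ∀ {a} (r : Fin (suc a)) → nonroots (Fin.suc r) ≡ Fin.zero ∷ map Fin.suc (nonroots r)
nonroots-suc {a} r = ≡.trans (cong (map (punchIn (Fin.suc r))) (allFin-suc a))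
  (cong (Fin.zero ∷_) (≡.trans (sym (ListP.map-∘ (allFin a))) (ListP.map-∘ (allFin a))))

∑-nonroots : ∀ {a} (r : Fin (suc a)) (g : Fin (suc a) → ℚ) →
             ∑ (nonroots r) g ≡ ∑ (allFin (suc a)) (λ u → χ (not (u == r)) * g u)
∑-nonroots {a} r g = sym (begin
  ∑ (allFin (suc a)) (λ u → χ (not (u == r)) * g u)
    ≡⟨ ∑-↭ _ (allFin-root r) ⟩
  χ (not (r == r)) * g r + ∑ (nonroots r) (λ u → χ (not (u == r)) * g u)
    ≡⟨ cong₂ _+_ (χ-false* (g r) (cong not (does-refl FinP._≟_ r))) (∑-map (punchIn r) (allFin a) _) ⟩
  0ℚ + ∑ (allFin a) (λ i → χ (not (punchIn r i == r)) * g (punchIn r i))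
    ≡⟨ ≡.trans (+-identityˡ _) (∑-cong (allFin a) (λ i → χ-true* _ (cong not (does-≢ FinP._≟_ (FinP.punchInᵢ≢i r i))))) ⟩
  ∑ (allFin a) (g ∘ punchIn r)
    ≡⟨ sym (∑-map (punchIn r) (allFin a) g) ⟩
  ∑ (nonroots r) g ∎)

sumℕ-allFin-suc : ∀ n (f : Fin (suc n) → ℕ) → sumℕ f (allFin (suc n)) ≡ f Fin.zero ℕ.+ sumℕ (f ∘ Fin.suc) (allFin n)
sumℕ-allFin-suc n f = ≡.trans (cong (sumℕ f) (allFin-suc n)) (cong (f Fin.zero ℕ.+_) (sumℕ-map Fin.suc f (allFin n)))

sumℕ-≟ : ∀ {n} (a : Fin n) → sumℕ (λ u → bit (does (a FinP.≟ u))) (allFin n) ≡ 1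
sumℕ-≟ {suc n} Fin.zero    = ≡.trans (sumℕ-allFin-suc n (λ u → bit (does (Fin.zero FinP.≟ u)))) (cong suc (sumℕ-0 (allFin n) (λ _ → refl)))
sumℕ-≟ {suc n} (Fin.suc a) = ≡.trans (sumℕ-allFin-suc n (λ u → bit (does (Fin.suc a FinP.≟ u)))) (sumℕ-≟ a)

handshake : ∀ {n} (es : List (Fin n × Fin n)) → sumℕ (λ u → deg FinP._≟_ u es) (allFin n) ≡ length es ℕ.* 2
handshake {n} []             = sumℕ-0 (allFin n) (λ _ → refl)
handshake {n} ((a , b) ∷ es) = ≡.trans (sumℕ-+ (λ u → inc FinP._≟_ u (a , b)) (λ u → deg FinP._≟_ u es) (allFin n)) (cong₂ ℕ._+_
  (≡.trans (sumℕ-+ (λ u → bit (does (a FinP.≟ u))) (λ u → bit (does (b FinP.≟ u))) (allFin n)) (cong₂ ℕ._+_ (sumℕ-≟ a) (sumℕ-≟ b))) (handshake es))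

sumℕ-≥ : ∀ c (f : A → ℕ) xs → All (λ x → c ≤ f x) xs → length xs ℕ.* c ≤ sumℕ f xs
sumℕ-≥ c f []       []       = z≤n
sumℕ-≥ c f (x ∷ xs) (p ∷ ps) = ℕP.+-mono-≤ p (sumℕ-≥ c f xs ps)

sumℕ≡0 : ∀ (f : A → ℕ) xs → sumℕ f xs ≡ 0 → All (λ x → f x ≡ 0) xs
sumℕ≡0 f []       eq = []
sumℕ≡0 f (x ∷ xs) eq = ℕP.m+n≡0⇒m≡0 (f x) eq ∷ sumℕ≡0 f xs (ℕP.m+n≡0⇒n≡0 (f x) eq)

length-lists : ∀ m (xs : List A) → All (λ l → length l ≡ m) (lists m xs)
length-lists zero    xs = refl ∷ []
length-lists (suc m) xs = AllP.concat⁺ (AllP.map⁺ (All.universal (λ x → AllP.map⁺ (All.map (cong suc) (length-lists m xs))) xs))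

module _ (d : DecidableEquality A) where

  adjacent⇒deg≥1 : ∀ {es u v} → Adj es u v → 1 ≤ deg d u es
  adjacent⇒deg≥1 {(a , b) ∷ es} {u} (here (inj₁ refl)) rewrite does-refl d u = s≤s z≤n
  adjacent⇒deg≥1 {(a , b) ∷ es} {u} {v} (here (inj₂ refl)) rewrite does-refl d u =
    ℕP.≤-trans (ℕP.m≤n+m 1 (bit (does (d v u)))) (ℕP.m≤m+n _ _)
  adjacent⇒deg≥1 (there a) = ℕP.≤-trans (adjacent⇒deg≥1 a) (ℕP.m≤n+m _ _)

  adjacent⇒simpleDeg≥1 : ∀ {es u v} → u ≢ v → Adj es u v → 1 ≤ simpleDeg d u es
  adjacent⇒simpleDeg≥1 {_ ∷ es} {u} {v} u≢v (here (inj₁ refl)) rewrite does-refl d u | does-≢ d (u≢v ∘ sym) = s≤s z≤n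
  adjacent⇒simpleDeg≥1 {_ ∷ es} {u} {v} u≢v (here (inj₂ refl)) rewrite does-refl d u | does-≢ d (u≢v ∘ sym) = s≤s z≤n
  adjacent⇒simpleDeg≥1 u≢v (there a) = ℕP.≤-trans (adjacent⇒simpleDeg≥1 u≢v a) (ℕP.m≤n+m _ _)

  leaving-edge : ∀ {es u v} → u ≢ v → Path es u v → ∃ λ w → u ≢ w × Adj es u w
  leaving-edge u≢v ε = ⊥-elim (u≢v refl)
  leaving-edge {u = u} u≢v (_◅_ {j = w} a p) with d u w
  ... | yes refl = leaving-edge u≢v p
  ... | no u≢w   = w , u≢w , a

other : ∀ {n} (u : Fin (suc (suc n))) → ∃ λ v → u ≢ v
other Fin.zero    = Fin.suc Fin.zero , λ ()
other (Fin.suc u) = Fin.zero , λ ()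

connected-leaving : ∀ {n} es → Connected (suc (suc n)) es → ∀ u → ∃ λ w → u ≢ w × Adj es u w
connected-leaving es (_ , p) u = let (v , u≢v) = other u in leaving-edge FinP._≟_ u≢v (p u v)

not-leaf : ∀ d → 1 ≤ d → bit (d ℕ.≡ᵇ 1) ≡ 0 → 2 ≤ d
not-leaf (suc (suc d)) p eq = s≤s (s≤s z≤n)

-- otherwise the degree sum is too large
tree-leaf : ∀ {a} (r : Fin (suc (suc a))) es → length es ≡ suc a → Connected (suc (suc a)) es →
            sumℕ (isLeaf FinP._≟_ es) (nonroots r) ≢ 0
tree-leaf {a} r es len c eq = ℕP.1+n≰n (ℕP.≤-trans large (ℕP.≤-reflexive total))
  where
  deg≥1 : ∀ u → 1 ≤ deg FinP._≟_ u es
  deg≥1 u = let (w , _ , a) = connected-leaving es c u in adjacent⇒deg≥1 FinP._≟_ a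
  deg≥2 : All (λ u → 2 ≤ deg FinP._≟_ u es) (nonroots r)
  deg≥2 = All.map (λ {u} → not-leaf _ (deg≥1 u)) (sumℕ≡0 (isLeaf FinP._≟_ es) (nonroots r) eq)
  total : sumℕ (λ u → deg FinP._≟_ u es) (r ∷ nonroots r) ≡ suc a ℕ.* 2
  total = ≡.trans (sym (sumℕ-↭ (λ u → deg FinP._≟_ u es) (allFin-root r))) (≡.trans (handshake es) (cong (ℕ._* 2) len))
  len-nonroots : suc a ≡ length (nonroots r)
  len-nonroots = sym (≡.trans (ListP.length-map (punchIn r) (allFin (suc a))) (ListP.length-tabulate {n = suc a} id))
  large : 1 ℕ.+ suc a ℕ.* 2 ≤ sumℕ (λ u → deg FinP._≟_ u es) (r ∷ nonroots r)
  large = ℕP.+-mono-≤ (deg≥1 r) (ℕP.≤-trans (ℕP.≤-reflexive (cong (ℕ._* 2) len-nonroots)) (sumℕ-≥ 2 _ (nonroots r) deg≥2))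

-- number of edges, root, list of edges
Tree : Set
Tree = Σ ℕ λ a → Fin (suc a) × List (Fin (suc a) × Fin (suc a))

-- Edge lists with one edge fewer than vertices; among these, the connectivity factor of `tw`
-- selects the trees. The empty list at 0 vertices is the vanishing constant term of the tree
-- series.
rtrees : ℕ → List Tree
rtrees zero    = []
rtrees (suc a) = concatMap (λ es → map (λ r → (a , r , es)) (allFin (suc a))) (lists a (pairs (suc a)))

tw : Tree → ℚ
tw (a , r , es) = wt (suc a) a * χ (connᵇ (suc a) es)

𝕋 : ℕ → (Tree → ℚ) → ℚ
𝕋 i φ = ∑ (rtrees i) (λ t → tw t * φ t)

𝕋-cong : ∀ i {φ ψ} → (∀ t → φ t ≡ ψ t) → 𝕋 i φ ≡ 𝕋 i ψ
𝕋-cong i eq = ∑-cong (rtrees i) (λ t → cong (tw t *_) (eq t))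

𝕋-+ : ∀ i φ ψ → 𝕋 i (λ t → φ t + ψ t) ≡ 𝕋 i φ + 𝕋 i ψ
𝕋-+ i φ ψ = ≡.trans (∑-cong (rtrees i) (λ t → *-distribˡ-+ (tw t) _ _)) (∑-+ _ _ (rtrees i))

𝕋-0 : ∀ i {φ} → (∀ t → φ t ≡ 0ℚ) → 𝕋 i φ ≡ 0ℚ
𝕋-0 i eq = ∑-0 (rtrees i) (λ t → ≡.trans (cong (tw t *_) (eq t)) (*-zeroʳ _))

𝕋-*ˡ : ∀ i c φ → 𝕋 i (λ t → c * φ t) ≡ c * 𝕋 i φ
𝕋-*ˡ i c φ = ≡.trans (∑-cong (rtrees i) (λ t → *-left-comm (tw t) c _)) (sym (∑-*ˡ c _ (rtrees i)))

𝕋-∑ : ∀ i (xs : List A) (φ : A → Tree → ℚ) → 𝕋 i (λ t → ∑ xs (λ x → φ x t)) ≡ ∑ xs (λ x → 𝕋 i (φ x))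
𝕋-∑ i xs φ = ≡.trans (∑-cong (rtrees i) (λ t → ∑-*ˡ (tw t) _ xs)) (∑-swap (rtrees i) xs _)

𝕋-shift : ∀ i (F : Tree → ℕ → ℚ) j → 𝕋 i (λ t → shift (F t) j) ≡ shift (λ j → 𝕋 i (λ t → F t j)) j
𝕋-shift i F zero    = 𝕋-0 i (λ _ → refl)
𝕋-shift i F (suc j) = refl

𝕋-suc : ∀ a φ → 𝕋 (suc a) φ ≡ ∑ (lists a (pairs (suc a))) (λ es → ∑ (allFin (suc a)) (λ r → tw (a , r , es) * φ (a , r , es)))
𝕋-suc a φ = ∑-concatMap-map (λ es r → (a , r , es)) (lists a (pairs (suc a))) (allFin (suc a)) _

𝕋-one : ∀ φ → 𝕋 1 φ ≡ φ (0 , Fin.zero , [])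
𝕋-one φ = ≡.trans (+-identityʳ _) (≡.trans (cong (_* φ (0 , Fin.zero , [])) (*-identityˡ 1ℚ)) (*-identityˡ _))

-- The root is left out even if it has degree 1, because it will be identified with a vertex that
-- already has degree at least 2.
leavesᵣ : Tree → ℕ
leavesᵣ (a , r , es) = sumℕ (isLeaf FinP._≟_ es) (nonroots r)

growAt : (t : Tree) → Fin (suc (proj₁ t)) → Tree
growAt (a , r , es) v = (suc a , Fin.suc r , (Fin.zero , Fin.suc v) ∷ map suc² es)

growSum : (Tree → ℚ) → Tree → ℚ
growSum φ t = ∑ (allFin (suc (proj₁ t))) (λ v → φ (growAt t v))

module _ (φ : Tree → ℚ)
  (φ-permute : ∀ {a} (s : Fin (suc a) → Fin (suc a)) → Injective s →
               ∀ r es → φ (a , s r , map (map² s) es) ≡ φ (a , r , es))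
  (φ-≋ : ∀ {a} r {es es′ : List (Fin (suc a) × Fin (suc a))} → es ≋ es′ → φ (a , r , es) ≡ φ (a , r , es′))
  where

  -- The leaf recursion for rooted trees: deleting a leaf other than the root leaves a rooted tree,
  -- and the leaf can be put back at any of its vertices. The single vertex has no such leaf.
  𝕋-leaves : ∀ i → 𝕋 i (λ t → nat (leavesᵣ t) * φ t) ≡ shift (λ i → 𝕋 i (growSum φ)) i
  𝕋-leaves zero          = refl
  𝕋-leaves (suc zero)    = ≡.trans (𝕋-one (λ t → nat (leavesᵣ t) * φ t)) (*-zeroˡ _)
  𝕋-leaves (suc (suc a)) = begin
    𝕋 (suc (suc a)) (λ t → nat (leavesᵣ t) * φ t)
      ≡⟨ 𝕋-suc (suc a) (λ t → nat (leavesᵣ t) * φ t) ⟩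
    ∑ L (λ es → ∑ R (λ r → (w * conn es) * (nat (leavesᵣ (suc a , r , es)) * φ (suc a , r , es))))
      ≡⟨ ∑-cong L pointwise ⟩
    ∑ L (λ es → w * ∑ R (λ u → nat (isLeaf FinP._≟_ es u) * G u es))
      ≡⟨ sym (∑-*ˡ w _ L) ⟩
    w * ∑ L (λ es → ∑ R (λ u → nat (isLeaf FinP._≟_ es u) * G u es))
      ≡⟨ cong (w *_) (∑-leaves (suc a) a G G-permute G-≋) ⟩
    w * (nat (suc (suc a)) * (nat (suc a) * (two *
      ∑ (lists a (pairs (suc a))) (λ es → ∑ (allFin (suc a)) (λ v → G Fin.zero ((Fin.zero , Fin.suc v) ∷ map suc² es))))))
      ≡⟨ wt-suc (suc a) a _ ⟩
    wt (suc a) a * ∑ (lists a (pairs (suc a))) (λ es → ∑ (allFin (suc a)) (λ v → G Fin.zero ((Fin.zero , Fin.suc v) ∷ map suc² es)))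
      ≡⟨ ∑-*ˡ (wt (suc a) a) _ (lists a (pairs (suc a))) ⟩
    ∑ (lists a (pairs (suc a))) (λ es → wt (suc a) a * ∑ (allFin (suc a)) (λ v → G Fin.zero ((Fin.zero , Fin.suc v) ∷ map suc² es)))
      ≡⟨ ∑-cong (lists a (pairs (suc a))) grown ⟩
    ∑ (lists a (pairs (suc a))) (λ es → ∑ (allFin (suc a)) (λ r → tw (a , r , es) * growSum φ (a , r , es)))
      ≡⟨ sym (𝕋-suc a (growSum φ)) ⟩
    𝕋 (suc a) (growSum φ) ∎
    where
    n = suc (suc a)
    L = lists (suc a) (pairs n)
    R = allFin n
    w = wt n (suc a)
    conn : List (Fin n × Fin n) → ℚ
    conn es = χ (connᵇ n es)
    -- The leaf is the marked vertex here and the root is summed over, restricted to vertices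
    -- different from the leaf. For the leaf 0 this makes every admissible root a successor, as in
    -- `growAt`.
    G : Fin n → List (Fin n × Fin n) → ℚ
    G u es = conn es * ∑ R (λ r → χ (not (u == r)) * φ (suc a , r , es))

    G-permute : PermInv G
    G-permute s inj u es = cong₂ (λ b z → χ b * z) (connᵇ-permute s inj es)
      (≡.trans (∑-permute s inj _) (∑-cong R (λ r → cong₂ (λ b z → χ (not b) * z)
        (does-inj FinP._≟_ FinP._≟_ s inj u r) (φ-permute s inj r es))))

    G-≋ : ∀ u {es es′} → es ≋ es′ → G u es ≡ G u es′
    G-≋ u p = cong₂ (λ b z → χ b * z) (connᵇ-≋ p) (∑-cong R (λ r → cong (χ (not (u == r)) *_) (φ-≋ r p)))

    pointwise : ∀ es → ∑ R (λ r → (w * conn es) * (nat (leavesᵣ (suc a , r , es)) * φ (suc a , r , es))) ≡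
                       w * ∑ R (λ u → nat (isLeaf FinP._≟_ es u) * G u es)
    pointwise es = begin
      ∑ R (λ r → (w * conn es) * (nat (leavesᵣ (suc a , r , es)) * Φ r))
        ≡⟨ ∑-cong R (λ r → cong (λ z → (w * conn es) * (z * Φ r)) (≡.trans (nat-sumℕ (isLeaf FinP._≟_ es) (nonroots r)) (∑-nonroots r _))) ⟩
      ∑ R (λ r → (w * conn es) * (∑ R (λ u → χ (not (u == r)) * l u) * Φ r))
        ≡⟨ ∑-cong R (λ r → ≡.trans (cong ((w * conn es) *_) (∑-*ʳ (Φ r) _ R)) (∑-*ˡ (w * conn es) _ R)) ⟩
      ∑ R (λ r → ∑ R (λ u → (w * conn es) * ((χ (not (u == r)) * l u) * Φ r)))
        ≡⟨ ∑-swap R R _ ⟩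
      ∑ R (λ u → ∑ R (λ r → (w * conn es) * ((χ (not (u == r)) * l u) * Φ r)))
        ≡⟨ ∑-cong R (λ u → ∑-cong R (λ r → shuffle w (conn es) (χ (not (u == r))) (l u) (Φ r))) ⟩
      ∑ R (λ u → ∑ R (λ r → w * (l u * (conn es * (χ (not (u == r)) * Φ r)))))
        ≡⟨ ∑-cong R (λ u → ≡.trans (sym (∑-*ˡ w _ R)) (cong (w *_) (≡.trans (sym (∑-*ˡ (l u) _ R))
             (cong (l u *_) (sym (∑-*ˡ (conn es) _ R)))))) ⟩
      ∑ R (λ u → w * (l u * G u es))
        ≡⟨ sym (∑-*ˡ w _ R) ⟩
      w * ∑ R (λ u → l u * G u es) ∎
      where
      l : Fin n → ℚ
      l u = nat (isLeaf FinP._≟_ es u)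
      Φ : Fin n → ℚ
      Φ r = φ (suc a , r , es)
      shuffle : ∀ w c x l p → (w * c) * ((x * l) * p) ≡ w * (l * (c * (x * p)))
      shuffle w c x l p = begin
        (w * c) * ((x * l) * p)  ≡⟨ *-assoc w c _ ⟩
        w * (c * ((x * l) * p))  ≡⟨ cong (λ z → w * (c * z)) (≡.trans (cong (_* p) (*-comm x l)) (*-assoc l x p)) ⟩
        w * (c * (l * (x * p)))  ≡⟨ cong (w *_) (*-left-comm c l _) ⟩
        w * (l * (c * (x * p)))  ∎

    grown : ∀ es → wt (suc a) a * ∑ (allFin (suc a)) (λ v → G Fin.zero ((Fin.zero , Fin.suc v) ∷ map suc² es)) ≡
                   ∑ (allFin (suc a)) (λ r → tw (a , r , es) * growSum φ (a , r , es))
    grown es = begin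
      wt (suc a) a * ∑ F (λ v → G Fin.zero ((Fin.zero , Fin.suc v) ∷ map suc² es))
        ≡⟨ cong (wt (suc a) a *_) (∑-cong F (λ v → cong₂ (λ b z → χ b * z) (connᵇ-addLeaf v es)
             (≡.trans (∑-allFin-suc (suc a) _) (≡.trans (cong₂ _+_ (*-zeroˡ _) (∑-cong F (λ r → *-identityˡ _))) (+-identityˡ _))))) ⟩
      wt (suc a) a * ∑ F (λ v → χ (connᵇ (suc a) es) * ∑ F (λ r → φ (growAt (a , r , es) v)))
        ≡⟨ cong (wt (suc a) a *_) (≡.trans (sym (∑-*ˡ (χ (connᵇ (suc a) es)) _ F)) (cong (χ (connᵇ (suc a) es) *_) (∑-swap F F _))) ⟩
      wt (suc a) a * (χ (connᵇ (suc a) es) * ∑ F (λ r → growSum φ (a , r , es)))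
        ≡⟨ sym (*-assoc (wt (suc a) a) _ _) ⟩
      (wt (suc a) a * χ (connᵇ (suc a) es)) * ∑ F (λ r → growSum φ (a , r , es))
        ≡⟨ ∑-*ˡ _ _ F ⟩
      ∑ F (λ r → tw (a , r , es) * growSum φ (a , r , es)) ∎
      where F = allFin (suc a)

-- Attaching trees

-- the image of a tree vertex after the root r has been identified with the vertex h
graft : ∀ {a} → A → Fin (suc a) → Fin (suc a) → A ⊎ Fin (suc a)
graft h r j = if j == r then inj₁ h else inj₂ j

-- Identification without a quotient: edges at the root are redirected to `h` by `graft`, and the
-- copy `inj₂ r` of the root stays in the vertex type without being listed.
attach : (K : Gr) → Gr.V K → Tree → Gr
attach K h (a , r , tes) = mkGr (V ⊎ Fin (suc a)) (SumP.≡-dec _≟_ FinP._≟_)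
  (map inj₁ vs ++ map inj₂ (nonroots r))
  (map (map² inj₁) es ++ map (map² (graft h r)) tes)
  where open Gr K

graft-root : ∀ {a} (h : A) (r : Fin (suc a)) → graft h r r ≡ inj₁ h
graft-root h r rewrite does-refl FinP._≟_ r = refl

graft-nonroot : ∀ {a} (h : A) {r j : Fin (suc a)} → j ≢ r → graft h r j ≡ inj₂ j
graft-nonroot h j≢r rewrite does-≢ FinP._≟_ j≢r = refl

map-graft : ∀ {a} (h : A) (r : Fin (suc a)) → map (graft h r) (nonroots r) ≡ map inj₂ (nonroots r)
map-graft {a = a} h r = ≡.trans (sym (ListP.map-∘ (allFin a)))
  (≡.trans (ListP.map-cong (λ i → graft-nonroot h (FinP.punchInᵢ≢i r i)) (allFin a)) (ListP.map-∘ (allFin a)))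

map-++-∘ : ∀ {A B C D : Set} (θ : C → D) (f : A → C) (g : B → C) xs ys →
           map θ (map f xs ++ map g ys) ≡ map (θ ∘ f) xs ++ map (θ ∘ g) ys
map-++-∘ θ f g xs ys = ≡.trans (ListP.map-++ θ (map f xs) (map g ys)) (cong₂ _++_ (sym (ListP.map-∘ xs)) (sym (ListP.map-∘ ys)))

sum-map-inj : ∀ {C D : Set} {θ : A → C} {η : B → D} → Injective θ → Injective η →
              ∀ {x y} → Data.Sum.map θ η x ≡ Data.Sum.map θ η y → x ≡ y
sum-map-inj i j {inj₁ x} {inj₁ y} eq = cong inj₁ (i (SumP.inj₁-injective eq))
sum-map-inj i j {inj₂ x} {inj₂ y} eq = cong inj₂ (j (SumP.inj₂-injective eq))

map²-∘ : ∀ {f : B → C} {g : A → B} {h : A → C} → (∀ x → f (g x) ≡ h x) → ∀ xs → map (map² f) (map (map² g) xs) ≡ map (map² h) xs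
map²-∘ eq = map-∘ (λ (a , b) → cong₂ _,_ (eq a) (eq b))

module _ {K K′ : Gr} (ρ : Ren K K′) (h : Gr.V K) where

  private
    θ = Ren.θ ρ

  Ren-attach : ∀ t → Ren (attach K h t) (attach K′ (θ h) t)
  Ren-attach (a , r , tes) = ren (Data.Sum.map θ id) (sum-map-inj (Ren.inj ρ) id)
    (trans (↭P.++⁺ʳ _ (↭P.map⁺ inj₁ (Ren.verts ρ)))
      (≡⇒↭ (≡.trans (cong (_++ map inj₂ (nonroots r)) (sym (ListP.map-∘ (Gr.vs K)))) (sym (map-++-∘ (Data.Sum.map θ id) inj₁ inj₂ (Gr.vs K) (nonroots r))))))
    (≋-trans (≋-++ʳ _ (≋-map inj₁ (Ren.edges ρ)))
      (≡⇒≋ (sym (≡.trans (ListP.map-++ (map² (Data.Sum.map θ id)) (map (map² inj₁) (Gr.es K)) _)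
        (cong₂ _++_ (≡.trans (map²-∘ (λ _ → refl) (Gr.es K)) (sym (map²-∘ (λ _ → refl) (Gr.es K)))) (map²-∘ graft-natural tes))))))
    where
    graft-natural : ∀ j → Data.Sum.map θ id (graft h r j) ≡ graft (θ h) r j
    graft-natural j with j == r
    ... | true  = refl
    ... | false = refl

module _ (K : Gr) (h : Gr.V K) {a : ℕ} where

  open Gr K

  Ren-attach-permute : ∀ (s : Fin (suc a) → Fin (suc a)) → Injective s → ∀ r tes →
    Ren (attach K h (a , r , tes)) (attach K h (a , s r , map (map² s) tes))
  Ren-attach-permute s inj r tes = ren θ (sum-map-inj id inj)
    (trans (↭P.++⁺ˡ _ (↭P.map⁺ inj₂ (nonroots-permute s inj r)))
      (≡⇒↭ (≡.trans (cong (map inj₁ vs ++_) (sym (ListP.map-∘ (nonroots r)))) (sym (map-++-∘ θ inj₁ inj₂ vs (nonroots r))))))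
    (≡⇒≋ (sym (≡.trans (ListP.map-++ (map² θ) (map (map² inj₁) es) _)
      (cong₂ _++_ (map²-∘ (λ _ → refl) es) (≡.trans (map²-∘ (λ j → graft-natural j) tes) (sym (map²-∘ (λ _ → refl) tes)))))))
    where
    θ : V ⊎ Fin (suc a) → V ⊎ Fin (suc a)
    θ = Data.Sum.map id s
    graft-natural : ∀ j → θ (graft h r j) ≡ graft h (s r) (s j)
    graft-natural j rewrite does-inj FinP._≟_ FinP._≟_ s inj j r with j == r
    ... | true  = refl
    ... | false = refl

  Ren-attach-≋ : ∀ r {tes tes′} → tes ≋ tes′ → Ren (attach K h (a , r , tes)) (attach K h (a , r , tes′))
  Ren-attach-≋ r p = ren id id (≡⇒↭ (sym (ListP.map-id _)))
    (≋-trans (≋-++ˡ (map (map² inj₁) es) (≋-map (graft h r) (≋-sym p))) (≡⇒≋ (sym (ListP.map-id _))))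

  Ren-addLeaf-attach : ∀ r tes v → let t = (a , r , tes) in
    Ren (addLeaf (attach K h t) (inj₁ v)) (attach (addLeaf K v) (just h) t)
  Ren-addLeaf-attach r tes v = ren θ (λ {x} {y} → θ-inj x y)
    (≡⇒↭ (cong (inj₁ nothing ∷_) (sym (≡.trans (sym (ListP.map-∘ (map inj₁ vs ++ map inj₂ (nonroots r))))
      (≡.trans (map-++-∘ (θ ∘ just) inj₁ inj₂ vs (nonroots r)) (cong (_++ map inj₂ (nonroots r)) (ListP.map-∘ vs)))))))
    (≡⇒≋ (cong ((inj₁ nothing , inj₁ (just v)) ∷_) (sym (≡.trans (map²-∘ (λ _ → refl) (map (map² inj₁) es ++ _))
      (≡.trans (ListP.map-++ (map² (θ ∘ just)) (map (map² inj₁) es) _)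
        (cong₂ _++_ (≡.trans (map²-∘ (λ _ → refl) es) (sym (map²-∘ (λ _ → refl) es))) (map²-∘ graft-natural tes)))))))
    where
    θ : Maybe (V ⊎ Fin (suc a)) → Maybe V ⊎ Fin (suc a)
    θ nothing         = inj₁ nothing
    θ (just (inj₁ x)) = inj₁ (just x)
    θ (just (inj₂ j)) = inj₂ j
    θ-inj : ∀ x y → θ x ≡ θ y → x ≡ y
    θ-inj nothing         nothing         eq   = refl
    θ-inj nothing         (just (inj₁ _)) ()
    θ-inj nothing         (just (inj₂ _)) ()
    θ-inj (just (inj₁ x)) (just (inj₁ _)) refl = refl
    θ-inj (just (inj₂ j)) (just (inj₂ _)) refl = refl
    graft-natural : ∀ j → θ (just (graft h r j)) ≡ graft (just h) r j
    graft-natural j with j == r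
    ... | true  = refl
    ... | false = refl

  -- A leaf added at a vertex of the attached tree, the host included as its root, is a leaf of a
  -- larger attached tree. A leaf added elsewhere commutes with the attachment by
  -- `Ren-addLeaf-attach`; `τ-leaves-step` separates these two cases.
  Ren-addLeaf-grow : ∀ r tes v → let t = (a , r , tes) in
    Ren (addLeaf (attach K h t) (graft h r v)) (attach K h (growAt t v))
  Ren-addLeaf-grow r tes v = ren θ (λ {x} {y} → θ-inj x y)
    (trans (↭P.++⁺ˡ (map inj₁ vs) (≡⇒↭ (≡.trans (cong (map inj₂) (nonroots-suc r)) (cong (inj₂ Fin.zero ∷_) (sym (ListP.map-∘ (nonroots r)))))))
      (trans (↭P.shift (inj₂ Fin.zero) (map inj₁ vs) _)
        (≡⇒↭ (cong (inj₂ Fin.zero ∷_) (sym (≡.trans (sym (ListP.map-∘ (map inj₁ vs ++ map inj₂ (nonroots r)))) (map-++-∘ (θ ∘ just) inj₁ inj₂ vs (nonroots r))))))))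
    (≋-trans (↭⇒≋ (↭P.shift (map² (graft h (Fin.suc r)) (Fin.zero , Fin.suc v)) (map (map² inj₁) es) _))
      (≡⇒≋ (cong₂ _∷_ (cong₂ _,_ refl (sym (graft-natural v)))
        (sym (≡.trans (map²-∘ (λ _ → refl) (map (map² inj₁) es ++ _)) (≡.trans (ListP.map-++ (map² (θ ∘ just)) (map (map² inj₁) es) _)
          (cong₂ _++_ (map²-∘ (λ _ → refl) es) (≡.trans (map²-∘ graft-natural tes) (sym (map²-∘ (λ _ → refl) tes))))))))))
    where
    θ : Maybe (V ⊎ Fin (suc a)) → V ⊎ Fin (suc (suc a))
    θ nothing         = inj₂ Fin.zero
    θ (just (inj₁ x)) = inj₁ x
    θ (just (inj₂ j)) = inj₂ (Fin.suc j)
    θ-inj : ∀ x y → θ x ≡ θ y → x ≡ y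
    θ-inj nothing         nothing         eq   = refl
    θ-inj nothing         (just (inj₁ _)) ()
    θ-inj nothing         (just (inj₂ _)) ()
    θ-inj (just (inj₁ x)) (just (inj₁ _)) refl = refl
    θ-inj (just (inj₂ j)) (just (inj₂ _)) refl = refl
    graft-natural : ∀ j → θ (just (graft h r j)) ≡ graft h (Fin.suc r) (Fin.suc j)
    graft-natural j with j FinP.≟ r
    ... | yes _ = refl
    ... | no _  = refl

Ren-attach-one : ∀ K h → Ren K (attach K h (0 , Fin.zero , []))
Ren-attach-one K h = ren inj₁ SumP.inj₁-injective (≡⇒↭ (ListP.++-identityʳ _)) (≡⇒≋ (ListP.++-identityʳ _))

-- τ K ι hs N f sums f over all ways of attaching rooted trees with N vertices in total at the vertices ι h of K
τ : (K : Gr) → (A → Gr.V K) → List A → ℕ → (Gr → ℚ) → ℚ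
τ K ι []       zero    f = f K
τ K ι []       (suc N) f = 0ℚ
τ K ι (h ∷ hs) N       f = ⨁ N (λ i j → 𝕋 i (λ t → τ (attach K (ι h) t) (inj₁ ∘ ι) hs j f))

τ-cong : ∀ K (ι : A → Gr.V K) hs N {f g} → (∀ G → f G ≡ g G) → τ K ι hs N f ≡ τ K ι hs N g
τ-cong K ι []       zero    eq = eq K
τ-cong K ι []       (suc N) eq = refl
τ-cong K ι (h ∷ hs) N       eq = ⨁-cong N (λ i j → 𝕋-cong i (λ t → τ-cong _ _ hs j eq))

τ-+ : ∀ K (ι : A → Gr.V K) hs N f g → τ K ι hs N (λ G → f G + g G) ≡ τ K ι hs N f + τ K ι hs N g
τ-+ K ι []       zero    f g = refl
τ-+ K ι []       (suc N) f g = sym (+-identityˡ 0ℚ)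
τ-+ K ι (h ∷ hs) N       f g = ≡.trans (⨁-cong N (λ i j → ≡.trans (𝕋-cong i (λ t → τ-+ _ _ hs j f g)) (𝕋-+ i _ _))) (⨁-+ N _ _)

τ-Ren : ∀ {f} → Inv f → ∀ {K K′} (ρ : Ren K K′) {ι : A → Gr.V K} {ι′ : A → Gr.V K′} → (∀ a → ι′ a ≡ Ren.θ ρ (ι a)) →
        ∀ hs N → τ K ι hs N f ≡ τ K′ ι′ hs N f
τ-Ren f-inv ρ eq []       zero    = f-inv ρ
τ-Ren f-inv ρ eq []       (suc N) = refl
τ-Ren f-inv {K} {K′} ρ {ι} eq (h ∷ hs) N = ⨁-cong N (λ i j → 𝕋-cong i (λ t →
  ≡.trans (τ-Ren f-inv (Ren-attach ρ (ι h) t) (λ a → cong inj₁ (eq a)) hs j)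
          (cong (λ x → τ (attach K′ x t) _ hs j _) (sym (eq h)))))

Unique-↭ : ∀ {xs ys : List A} → xs ↭ ys → Unique xs → Unique ys
Unique-↭ refl         u                          = u
Unique-↭ (prep x p)   (px ∷ u)                   = ↭P.All-resp-↭ p px ∷ Unique-↭ p u
Unique-↭ (swap x y p) ((x≢y ∷ px) ∷ (py ∷ u))    = ((x≢y ∘ sym) ∷ ↭P.All-resp-↭ p py) ∷ (↭P.All-resp-↭ p px ∷ Unique-↭ p u)
Unique-↭ (trans p q)  u                          = Unique-↭ q (Unique-↭ p u)

Unique-head : ∀ {x : A} {xs} → Unique (x ∷ xs) → All (x ≢_) xs
Unique-head (p ∷ _) = p

Unique-⊎ : ∀ {xs : List A} {ys : List B} → Unique xs → Unique ys → Unique (map inj₁ xs ++ map inj₂ ys)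
Unique-⊎ u u′ = UniqueP.++⁺ (UniqueP.map⁺ SumP.inj₁-injective u) (UniqueP.map⁺ SumP.inj₂-injective u′)
  (λ (p , q) → disjoint (∈P.∈-map⁻ inj₁ p) (∈P.∈-map⁻ inj₂ q))
  where
  disjoint : ∀ {x : A ⊎ B} {xs ys} → ∃ (λ y → y ∈ xs × x ≡ inj₁ y) → ∃ (λ j → j ∈ ys × x ≡ inj₂ j) → ⊥
  disjoint (_ , _ , refl) (_ , _ , ())

sumℕ-cong-All : ∀ {f g : A → ℕ} {xs} → All (λ x → f x ≡ g x) xs → sumℕ f xs ≡ sumℕ g xs
sumℕ-cong-All []         = refl
sumℕ-cong-All (eq ∷ eqs) = cong₂ ℕ._+_ eq (sumℕ-cong-All eqs)

shift-cong : ∀ N {f g : ℕ → ℚ} → (∀ n → f n ≡ g n) → shift f N ≡ shift g N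
shift-cong zero    eq = refl
shift-cong (suc N) eq = eq N

shift-+ : ∀ N (f g : ℕ → ℚ) → shift (λ n → f n + g n) N ≡ shift f N + shift g N
shift-+ zero    f g = sym (+-identityˡ 0ℚ)
shift-+ (suc N) f g = refl

-- The leaf recursion for attached trees

leavesIn : (K : Gr) → List (Gr.V K) → ℕ
leavesIn K = sumℕ (isLeaf (Gr._≟_ K) (Gr.es K))

-- the vertices of K are those which already carry their tree (ds) and those which still await one (ι hs)
record Partition (K : Gr) (ι : A → Gr.V K) (ds : List (Gr.V K)) (hs : List A) : Set where
  constructor partition
  open Gr K
  field
    split  : vs ↭ ds ++ map ι hs
    unique : Unique vs

-- Guarantees that a vertex awaiting its tree never becomes a leaf, whichever tree it receives.
Stable : (K : Gr) (ι : A → Gr.V K) (hs : List A) → Set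
Stable K ι hs = All (λ a → 2 ≤ deg (Gr._≟_ K) (ι a) (Gr.es K)) hs

nonroots-unique : ∀ {a} (r : Fin (suc a)) → Unique (nonroots r)
nonroots-unique {a} r = UniqueP.map⁺ (λ {i} {j} → FinP.punchIn-injective r i j) (UniqueP.allFin⁺ a)

module Attached (K : Gr) (h : Gr.V K) (t : Tree) where

  open Gr K
  private
    a   = proj₁ t
    r   = proj₁ (proj₂ t)
    tes = proj₂ (proj₂ t)

  Kₜ : Gr
  Kₜ = attach K h t
  d : DecidableEquality (V ⊎ Fin (suc a))
  d = SumP.≡-dec _≟_ FinP._≟_

  treeVertices : List (V ⊎ Fin (suc a))
  treeVertices = map (graft h r) (allFin (suc a))

  treeVertices-↭ : treeVertices ↭ inj₁ h ∷ map inj₂ (nonroots r)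
  treeVertices-↭ = trans (↭P.map⁺ (graft h r) (allFin-root r)) (≡⇒↭ (cong₂ _∷_ (graft-root h r) (map-graft h r)))

  deg-split : ∀ x → deg d x (Gr.es Kₜ) ≡ deg d x (map (map² inj₁) es) ℕ.+ deg d x (map (map² (graft h r)) tes)
  deg-split x = sumℕ-++ (inc d x) (map (map² inj₁) es) _

  deg-old : ∀ u → deg d (inj₁ u) (map (map² inj₁) es) ≡ deg _≟_ u es
  deg-old u = deg-map _≟_ d inj₁ SumP.inj₁-injective u es

  deg-inj₁ : ∀ {u} → u ≢ h → deg d (inj₁ u) (Gr.es Kₜ) ≡ deg _≟_ u es
  deg-inj₁ {u} u≢h = ≡.trans (deg-split (inj₁ u)) (≡.trans (cong₂ ℕ._+_ (deg-old u)
      (≡.trans (sumℕ-map (map² (graft h r)) (inc d (inj₁ u)) tes) (sumℕ-0 tes (λ (x , y) → cong₂ (λ p q → bit p ℕ.+ bit q) (off x) (off y)))))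
    (ℕP.+-identityʳ _))
    where
    off : ∀ x → does (d (graft h r x) (inj₁ u)) ≡ false
    off x with x == r
    ... | true  = does-≢ d (λ eq → u≢h (sym (SumP.inj₁-injective eq)))
    ... | false = refl

  deg-inj₁-≥ : ∀ u → deg _≟_ u es ≤ deg d (inj₁ u) (Gr.es Kₜ)
  deg-inj₁-≥ u = ℕP.≤-trans (ℕP.≤-trans (ℕP.≤-reflexive (sym (deg-old u))) (ℕP.m≤m+n _ _)) (ℕP.≤-reflexive (sym (deg-split (inj₁ u))))

  deg-inj₂ : ∀ {j} → j ≢ r → deg d (inj₂ j) (Gr.es Kₜ) ≡ deg FinP._≟_ j tes
  deg-inj₂ {j} j≢r = ≡.trans (deg-split (inj₂ j)) (cong₂ ℕ._+_
    (≡.trans (sumℕ-map (map² inj₁) (inc d (inj₂ j)) es) (sumℕ-0 es (λ _ → refl)))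
    (≡.trans (sumℕ-map (map² (graft h r)) (inc d (inj₂ j)) tes) (sumℕ-cong tes (λ (x , y) → cong₂ (λ p q → bit p ℕ.+ bit q) (on x) (on y)))))
    where
    on : ∀ x → does (d (graft h r x) (inj₂ j)) ≡ does (x FinP.≟ j)
    on x with x FinP.≟ r
    ... | yes refl = sym (does-≢ FinP._≟_ (j≢r ∘ sym))
    ... | no _     = does-inj FinP._≟_ d inj₂ SumP.inj₂-injective x j

  module _ {ι : A → V} {ds : List V} {k : A} {hs : List A} (P : Partition K ι ds (k ∷ hs)) (h≡ : ι k ≡ h) where

    done : List (V ⊎ Fin (suc a))
    done = map inj₁ ds ++ treeVertices

    Partition-attach : Partition Kₜ (inj₁ ∘ ι) done hs
    Partition-attach = partition
      (trans (↭P.++⁺ʳ (map inj₂ (nonroots r)) (↭P.map⁺ inj₁ (Partition.split P)))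
      (trans (≡⇒↭ (≡.trans (cong (_++ map inj₂ (nonroots r)) (≡.trans (ListP.map-++ inj₁ ds _)
                (cong (map inj₁ ds ++_) (cong₂ _∷_ (cong inj₁ h≡) (sym (ListP.map-∘ hs))))))
              (ListP.++-assoc (map inj₁ ds) _ _)))
      (trans (↭P.++⁺ˡ (map inj₁ ds) (prep (inj₁ h) (↭P.++-comm (map (inj₁ ∘ ι) hs) (map inj₂ (nonroots r)))))
      (trans (↭P.++⁺ˡ (map inj₁ ds) (↭P.++⁺ʳ (map (inj₁ ∘ ι) hs) (↭-sym treeVertices-↭)))
      (≡⇒↭ (sym (ListP.++-assoc (map inj₁ ds) treeVertices _)))))))
      (Unique-⊎ (Partition.unique P) (nonroots-unique r))

    ds≢h : All (_≢ h) ds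
    ds≢h = AllP.++⁻ˡ ds (All.map (λ ne eq → ne (≡.trans h≡ (sym eq))) (Unique-head (Unique-↭ (trans (Partition.split P) (↭P.shift (ι k) ds (map ι hs))) (Partition.unique P))))

    leavesIn-done : leavesIn Kₜ done ≡ leavesIn K ds ℕ.+ leavesIn Kₜ treeVertices
    leavesIn-done = ≡.trans (sumℕ-++ (isLeaf d (Gr.es Kₜ)) (map inj₁ ds) treeVertices) (cong (ℕ._+ leavesIn Kₜ treeVertices)
      (≡.trans (sumℕ-map inj₁ (isLeaf d (Gr.es Kₜ)) ds) (sumℕ-cong-All (All.map (λ ne → cong (λ i → bit (i ℕ.≡ᵇ 1)) (deg-inj₁ ne)) ds≢h))))

    module _ (st : Stable K ι (k ∷ hs)) where

      -- The host keeps degree at least 2, and every other tree vertex has in the new graph the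
      -- degree that it has in the tree.
      leavesIn-tree : leavesIn Kₜ treeVertices ≡ leavesᵣ t
      leavesIn-tree = ≡.trans (sumℕ-↭ (isLeaf d (Gr.es Kₜ)) treeVertices-↭) (cong₂ ℕ._+_
        (big _ (ℕP.≤-trans (subst (λ x → 2 ≤ deg _≟_ x es) h≡ (All.head st)) (deg-inj₁-≥ h)))
        (≡.trans (sumℕ-map inj₂ (isLeaf d (Gr.es Kₜ)) (nonroots r))
          (≡.trans (sumℕ-map (punchIn r) _ (allFin a)) (≡.trans
            (sumℕ-cong (allFin a) (λ i → cong (λ i → bit (i ℕ.≡ᵇ 1)) (deg-inj₂ (FinP.punchInᵢ≢i r i))))
            (sym (sumℕ-map (punchIn r) (isLeaf FinP._≟_ tes) (allFin a)))))))
        where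
        big : ∀ i → 2 ≤ i → bit (i ℕ.≡ᵇ 1) ≡ 0
        big (suc zero)    (s≤s ())
        big (suc (suc i)) _ = refl

      Stable-attach : Stable Kₜ (inj₁ ∘ ι) hs
      Stable-attach = All.map (λ {b} p → ℕP.≤-trans p (deg-inj₁-≥ (ι b))) (All.tail st)

+-cancel-middle : ∀ {a b c d} x → a + (b + x) ≡ (c + x) + d → a + b ≡ c + d
+-cancel-middle {a} {b} {c} {d} x eq = +-cancelˡ x (begin
  x + (a + b)    ≡⟨ +-comm x (a + b) ⟩
  (a + b) + x    ≡⟨ +-assoc a b x ⟩
  a + (b + x)    ≡⟨ eq ⟩
  (c + x) + d    ≡⟨ cong (_+ d) (+-comm c x) ⟩
  (x + c) + d    ≡⟨ +-assoc x c d ⟩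
  x + (c + d)    ∎)

module _ {f : Gr → ℚ} (f-inv : Inv f) where

  -- A leaf of the final graph belongs to one of the attached trees, and removing it leaves a graph of the same kind.
  τ-leaves-step : ∀ (hs : List A) K (ι : A → Gr.V K) ds → Partition K ι ds hs → Stable K ι hs → ∀ N →
    shift (λ n → τ K ι hs n (leafSum f)) N + nat (leavesIn K ds) * τ K ι hs N f ≡
    shift (λ n → ∑ ds (λ u → τ (addLeaf K u) (just ∘ ι) hs n f)) N + τ K ι hs N (λ G → nat (leaves G) * f G)
  τ-leaves-step [] K ι ds P st zero =
    cong (λ l → 0ℚ + nat l * f K) (sym (sumℕ-↭ (isLeaf (Gr._≟_ K) (Gr.es K)) (trans (Partition.split P) (≡⇒↭ (ListP.++-identityʳ ds)))))
  -- When no vertex awaits a tree, `τ` is concentrated at N = 0. The shift moves this to N = 1,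
  -- where both sides add a leaf at each finished vertex.
  τ-leaves-step [] K ι ds P st (suc zero) = cong₂ _+_
    (∑-↭ _ (trans (Partition.split P) (≡⇒↭ (ListP.++-identityʳ ds)))) (*-zeroʳ _)
  τ-leaves-step [] K ι ds P st (suc (suc N)) = cong₂ _+_ (sym (∑-0 ds (λ _ → refl))) (*-zeroʳ _)
  -- The induction hypothesis treats `h` and its tree as finished. Compared with the claim, this
  -- adds on the left the leaves of that tree and on the right the leaf additions to it. Both equal
  -- `X`, the first by `𝕋-leaves`, so `X` cancels; keeping the finished part on both sides of the
  -- statement avoids subtraction.
  τ-leaves-step (k ∷ hs) K ι ds P st N = +-cancel-middle X (begin
    shift (λ n → τ K ι (k ∷ hs) n (leafSum f)) N + (nat (leavesIn K ds) * τ K ι (k ∷ hs) N f + X)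
      ≡⟨ sym (cong₂ _+_ ΨA ΨB) ⟩
    Ψ (λ t j → shift (λ n → τ (Kₜ t) ι′ hs n (leafSum f)) j) + Ψ (λ t j → nat (leavesIn (Kₜ t) (done t)) * τ (Kₜ t) ι′ hs j f)
      ≡⟨ sym (Ψ-+ _ _) ⟩
    Ψ (λ t j → shift (λ n → τ (Kₜ t) ι′ hs n (leafSum f)) j + nat (leavesIn (Kₜ t) (done t)) * τ (Kₜ t) ι′ hs j f)
      ≡⟨ Ψ-cong (λ t j → τ-leaves-step hs (Kₜ t) ι′ (done t) (Attached.Partition-attach K h t P refl) (Attached.Stable-attach K h t P refl st) j) ⟩
    Ψ (λ t j → shift (λ n → ∑ (done t) (λ u → τ (addLeaf (Kₜ t) u) (just ∘ ι′) hs n f)) j + τ (Kₜ t) ι′ hs j (λ G → nat (leaves G) * f G))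
      ≡⟨ Ψ-+ _ _ ⟩
    Ψ (λ t j → shift (λ n → ∑ (done t) (λ u → τ (addLeaf (Kₜ t) u) (just ∘ ι′) hs n f)) j) + τ K ι (k ∷ hs) N (λ G → nat (leaves G) * f G)
      ≡⟨ cong (_+ τ K ι (k ∷ hs) N (λ G → nat (leaves G) * f G)) ΨC ⟩
    (shift (λ n → ∑ ds (λ u → τ (addLeaf K u) (just ∘ ι) (k ∷ hs) n f)) N + X) + τ K ι (k ∷ hs) N (λ G → nat (leaves G) * f G) ∎)
    where
    h : Gr.V K
    h = ι k
    Kₜ : Tree → Gr
    Kₜ = attach K h
    ι′ : ∀ {a} → _ → Gr.V K ⊎ Fin (suc a)
    ι′ = inj₁ ∘ ι
    done : (t : Tree) → List (Gr.V (Kₜ t))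
    done t = Attached.done K h t P refl

    Ψ : (Tree → ℕ → ℚ) → ℚ
    Ψ F = ⨁ N (λ i j → 𝕋 i (λ t → F t j))
    Ψ-cong : ∀ {F G} → (∀ t j → F t j ≡ G t j) → Ψ F ≡ Ψ G
    Ψ-cong eq = ⨁-cong N (λ i j → 𝕋-cong i (λ t → eq t j))
    Ψ-+ : ∀ F G → Ψ (λ t j → F t j + G t j) ≡ Ψ F + Ψ G
    Ψ-+ F G = ≡.trans (⨁-cong N (λ i j → 𝕋-+ i (λ t → F t j) (λ t → G t j))) (⨁-+ N _ _)
    Ψ-shift : ∀ F → Ψ (λ t j → shift (F t) j) ≡ shift (λ n → ⨁ n (λ i j → 𝕋 i (λ t → F t j))) N
    Ψ-shift F = ≡.trans (⨁-cong N (λ i j → 𝕋-shift i F j)) (⨁-shiftʳ N _)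

    grown : ℕ → ℚ
    grown n = ⨁ n (λ i j → 𝕋 i (λ t → ∑ (allFin (suc (proj₁ t))) (λ v → τ (addLeaf (Kₜ t) (graft h (proj₁ (proj₂ t)) v)) (just ∘ ι′) hs j f)))
    X : ℚ
    X = shift grown N

    ΨA : Ψ (λ t j → shift (λ n → τ (Kₜ t) ι′ hs n (leafSum f)) j) ≡ shift (λ n → τ K ι (k ∷ hs) n (leafSum f)) N
    ΨA = Ψ-shift _

    φ : ℕ → Tree → ℚ
    φ j t = τ (Kₜ t) ι′ hs j f

    ΨB : Ψ (λ t j → nat (leavesIn (Kₜ t) (done t)) * τ (Kₜ t) ι′ hs j f) ≡ nat (leavesIn K ds) * τ K ι (k ∷ hs) N f + X
    ΨB = begin
      Ψ (λ t j → nat (leavesIn (Kₜ t) (done t)) * φ j t)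
        ≡⟨ Ψ-cong (λ t j → ≡.trans (cong (λ l → nat l * φ j t) (≡.trans (Attached.leavesIn-done K h t P refl)
             (cong (leavesIn K ds ℕ.+_) (Attached.leavesIn-tree K h t P refl st))))
             (≡.trans (cong (_* φ j t) (nat-+ (leavesIn K ds) (leavesᵣ t))) (*-distribʳ-+ (φ j t) _ _))) ⟩
      Ψ (λ t j → nat (leavesIn K ds) * φ j t + nat (leavesᵣ t) * φ j t)
        ≡⟨ Ψ-+ _ _ ⟩
      Ψ (λ t j → nat (leavesIn K ds) * φ j t) + Ψ (λ t j → nat (leavesᵣ t) * φ j t)
        ≡⟨ cong₂ _+_ (≡.trans (⨁-cong N (λ i j → 𝕋-*ˡ i (nat (leavesIn K ds)) (φ j))) (sym (⨁-*ˡ N (nat (leavesIn K ds)) _)))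
             (≡.trans (⨁-cong N (λ i j → 𝕋-leaves (φ j) (λ s inj r es → sym (τ-Ren f-inv (Ren-attach-permute K h s inj r es) (λ _ → refl) hs j))
                                                      (λ r p → τ-Ren f-inv (Ren-attach-≋ K h r p) (λ _ → refl) hs j) i))
             (≡.trans (⨁-shiftˡ N (λ i j → 𝕋 i (growSum (φ j))))
               (shift-cong N (λ n → ⨁-cong n (λ i j → 𝕋-cong i (λ (a , r , es) → ∑-cong (allFin (suc a)) (λ v →
                  sym (τ-Ren f-inv (Ren-addLeaf-grow K h r es v) (λ _ → refl) hs j)))))))) ⟩
      nat (leavesIn K ds) * τ K ι (k ∷ hs) N f + X ∎

    ΨC : Ψ (λ t j → shift (λ n → ∑ (done t) (λ u → τ (addLeaf (Kₜ t) u) (just ∘ ι′) hs n f)) j) ≡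
         shift (λ n → ∑ ds (λ u → τ (addLeaf K u) (just ∘ ι) (k ∷ hs) n f)) N + X
    ΨC = begin
      Ψ (λ t j → shift (λ n → ∑ (done t) (λ u → τ (addLeaf (Kₜ t) u) (just ∘ ι′) hs n f)) j)
        ≡⟨ Ψ-shift _ ⟩
      shift (λ n → ⨁ n (λ i j → 𝕋 i (λ t → ∑ (done t) (λ u → τ (addLeaf (Kₜ t) u) (just ∘ ι′) hs j f)))) N
        ≡⟨ shift-cong N old-and-grown ⟩
      shift (λ n → ∑ ds (λ u → τ (addLeaf K u) (just ∘ ι) (k ∷ hs) n f) + grown n) N
        ≡⟨ shift-+ N _ _ ⟩
      shift (λ n → ∑ ds (λ u → τ (addLeaf K u) (just ∘ ι) (k ∷ hs) n f)) N + X ∎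
      where
      old-and-grown : ∀ n → ⨁ n (λ i j → 𝕋 i (λ t → ∑ (done t) (λ u → τ (addLeaf (Kₜ t) u) (just ∘ ι′) hs j f))) ≡
                            ∑ ds (λ u → τ (addLeaf K u) (just ∘ ι) (k ∷ hs) n f) + grown n
      old-and-grown n = begin
        ⨁ n (λ i j → 𝕋 i (λ t → ∑ (done t) (λ u → τ (addLeaf (Kₜ t) u) (just ∘ ι′) hs j f)))
          ≡⟨ ⨁-cong n (λ i j → 𝕋-cong i (λ t@(a , r , es) → ≡.trans (∑-++ (map inj₁ ds) (Attached.treeVertices K h t) _)
               (cong₂ _+_ (≡.trans (∑-map inj₁ ds _) (∑-cong ds (λ u → τ-Ren f-inv (Ren-addLeaf-attach K h r es u) (λ _ → refl) hs j)))
                          (∑-map (graft h r) (allFin (suc a)) _)))) ⟩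
        ⨁ n (λ i j → 𝕋 i (λ t → ∑ ds (λ u → old u t j) + new t j))
          ≡⟨ ⨁-cong n (λ i j → 𝕋-+ i _ _) ⟩
        ⨁ n (λ i j → 𝕋 i (λ t → ∑ ds (λ u → old u t j)) + 𝕋 i (λ t → new t j))
          ≡⟨ ⨁-+ n _ _ ⟩
        ⨁ n (λ i j → 𝕋 i (λ t → ∑ ds (λ u → old u t j))) + grown n
          ≡⟨ cong (_+ grown n) (≡.trans (⨁-cong n (λ i j → 𝕋-∑ i ds (λ u t → old u t j))) (sym (⨁-∑ n ds _))) ⟩
        ∑ ds (λ u → τ (addLeaf K u) (just ∘ ι) (k ∷ hs) n f) + grown n ∎
        where
        old : Gr.V K → Tree → ℕ → ℚ
        old u t j = τ (attach (addLeaf K u) (just h) t) (inj₁ ∘ just ∘ ι) hs j f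
        new : Tree → ℕ → ℚ
        new t j = ∑ (allFin (suc (proj₁ t))) (λ v → τ (addLeaf (Kₜ t) (graft h (proj₁ (proj₂ t)) v)) (just ∘ ι′) hs j f)

  -- With no finished vertices at the start, the two terms of `τ-leaves-step` that refer to them
  -- vanish.
  τ-leaves : ∀ K → Unique (Gr.vs K) → Stable K id (Gr.vs K) → ∀ N →
    τ K id (Gr.vs K) N (λ G → nat (leaves G) * f G) ≡ shift (λ n → τ K id (Gr.vs K) n (leafSum f)) N
  τ-leaves K u st N = sym (begin
    S                                             ≡⟨ sym (+-identityʳ S) ⟩
    S + 0ℚ                                        ≡⟨ cong (S +_) (sym (*-zeroˡ _)) ⟩
    S + nat 0 * τ K id (Gr.vs K) N f              ≡⟨ τ-leaves-step (Gr.vs K) K id [] (partition (≡⇒↭ (sym (ListP.map-id (Gr.vs K)))) u) st N ⟩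
    shift (λ _ → 0ℚ) N + R                        ≡⟨ cong (_+ R) (shift-zero N) ⟩
    0ℚ + R                                        ≡⟨ +-identityˡ R ⟩
    R                                             ∎)
    where
    S = shift (λ n → τ K id (Gr.vs K) n (leafSum f)) N
    R = τ K id (Gr.vs K) N (λ G → nat (leaves G) * f G)
    shift-zero : ∀ N → shift (λ _ → 0ℚ) N ≡ 0ℚ
    shift-zero zero    = refl
    shift-zero (suc N) = refl

  module _ (leafless : Leafless f) where

    -- A finished vertex receives no further edges, so a leaf among the finished vertices survives
    -- in every final graph.
    τ-leaf-0 : ∀ (hs : List A) K (ι : A → Gr.V K) ds → Partition K ι ds hs → leavesIn K ds ≢ 0 → ∀ N → τ K ι hs N f ≡ 0ℚ
    τ-leaf-0 [] K ι ds P ne zero = leafless K (λ eq → ne (≡.trans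
      (sym (sumℕ-↭ (isLeaf (Gr._≟_ K) (Gr.es K)) (trans (Partition.split P) (≡⇒↭ (ListP.++-identityʳ ds))))) eq))
    τ-leaf-0 [] K ι ds P ne (suc N) = refl
    τ-leaf-0 (k ∷ hs) K ι ds P ne N = ⨁-0 N (λ i j → 𝕋-0 i (λ t →
      τ-leaf-0 hs (attach K (ι k) t) (inj₁ ∘ ι) _ (Attached.Partition-attach K (ι k) t P refl)
        (λ eq → ne (ℕP.m+n≡0⇒m≡0 _ (≡.trans (sym (Attached.leavesIn-done K (ι k) t P refl)) eq))) j))

    -- A tree with at least two vertices brings a leaf different from its root, by `tree-leaf`. So
    -- only one-vertex trees survive, and N must be the number of hosts.
    τ-leafless : ∀ (hs : List A) K (ι : A → Gr.V K) ds → Partition K ι ds hs → Stable K ι hs → ∀ N →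
                 τ K ι hs N f ≡ χ (N ℕ.≡ᵇ length hs) * f K
    τ-leafless []       K ι ds P st zero    = sym (*-identityˡ _)
    τ-leafless []       K ι ds P st (suc N) = sym (*-zeroˡ _)
    τ-leafless (k ∷ hs) K ι ds P st zero    = sym (*-zeroˡ _)
    τ-leafless (k ∷ hs) K ι ds P st (suc N) = begin
      0ℚ + ⨁ N (λ i j → 𝕋 (suc i) (λ t → τ (attach K h t) (inj₁ ∘ ι) hs j f))
        ≡⟨ +-identityˡ _ ⟩
      ⨁ N (λ i j → 𝕋 (suc i) (λ t → τ (attach K h t) (inj₁ ∘ ι) hs j f))
        ≡⟨ ⨁-head N (λ i j → 𝕋 (suc i) (λ t → τ (attach K h t) (inj₁ ∘ ι) hs j f)) nontrivial ⟩
      𝕋 1 (λ t → τ (attach K h t) (inj₁ ∘ ι) hs N f)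
        ≡⟨ 𝕋-one (λ t → τ (attach K h t) (inj₁ ∘ ι) hs N f) ⟩
      τ K₁ (inj₁ ∘ ι) hs N f
        ≡⟨ τ-leafless hs K₁ (inj₁ ∘ ι) _ (Attached.Partition-attach K h t₁ P refl) (Attached.Stable-attach K h t₁ P refl st) N ⟩
      χ (N ℕ.≡ᵇ length hs) * f K₁
        ≡⟨ cong (χ (N ℕ.≡ᵇ length hs) *_) (sym (f-inv (Ren-attach-one K h))) ⟩
      χ (N ℕ.≡ᵇ length hs) * f K ∎
      where
      h = ι k
      t₁ : Tree
      t₁ = (0 , Fin.zero , [])
      K₁ = attach K h t₁
      nontrivial : ∀ i j → 𝕋 (suc (suc i)) (λ t → τ (attach K h t) (inj₁ ∘ ι) hs j f) ≡ 0ℚ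
      nontrivial i j = ≡.trans (𝕋-suc (suc i) _) (≡.trans
        (∑-cong-All (All.map (λ {es} len → ∑-cong (allFin (suc (suc i))) (λ r → vanish r es len)) (length-lists (suc i) (pairs (suc (suc i))))))
        (∑-0 (lists (suc i) (pairs (suc (suc i)))) (λ es → ∑-0 (allFin (suc (suc i))) (λ _ → refl))))
        where
        vanish : ∀ r es → length es ≡ suc i → tw (suc i , r , es) * τ (attach K h (suc i , r , es)) (inj₁ ∘ ι) hs j f ≡ 0ℚ
        vanish r es len with connᵇ (suc (suc i)) es in eq
        ... | false = ≡.trans (cong (_* τ (attach K h (suc i , r , es)) (inj₁ ∘ ι) hs j f) (*-zeroʳ (wt (suc (suc i)) (suc i)))) (*-zeroˡ _)
        ... | true  = ≡.trans (cong ((wt (suc (suc i)) (suc i) * χ true) *_) (τ-leaf-0 hs (attach K h t) (inj₁ ∘ ι) _ (Attached.Partition-attach K h t P refl) has-leaf j)) (*-zeroʳ _)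
          where
          t : Tree
          t = (suc i , r , es)
          has-leaf : leavesIn (attach K h t) (Attached.done K h t P refl) ≢ 0
          has-leaf z = tree-leaf r es len (connᵇ⁻ es (subst T (sym eq) tt))
            (≡.trans (sym (Attached.leavesIn-tree K h t P refl st)) (ℕP.m+n≡0⇒n≡0 (leavesIn K ds) (≡.trans (sym (Attached.leavesIn-done K h t P refl)) z)))

-- Subdivisions

path : ∀ {A : Set} → A → (n : ℕ) → (Fin n → A) → A → List (A × A)
path x zero    g y = (x , y) ∷ []
path x (suc n) g y = (x , g Fin.zero) ∷ path (g Fin.zero) n (g ∘ Fin.suc) y

path-cong : ∀ {A : Set} (x : A) n {g g′ : Fin n → A} y → (∀ i → g i ≡ g′ i) → path x n g y ≡ path x n g′ y
path-cong x zero    y eq = refl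
path-cong x (suc n) {g} {g′} y eq = cong₂ (λ z p → (x , z) ∷ p) (eq Fin.zero)
  (≡.trans (path-cong (g Fin.zero) n y (eq ∘ Fin.suc)) (cong (λ z → path z n (g′ ∘ Fin.suc) y) (eq Fin.zero)))

path-map : ∀ {A B : Set} (θ : A → B) x n g y → map (map² θ) (path x n g y) ≡ path (θ x) n (θ ∘ g) (θ y)
path-map θ x zero    g y = refl
path-map θ x (suc n) g y = cong ((θ x , θ (g Fin.zero)) ∷_) (path-map θ (g Fin.zero) n (g ∘ Fin.suc) y)

length-path : ∀ {A : Set} (x : A) n g y → length (path x n g y) ≡ suc n
length-path x zero    g y = refl
length-path x (suc n) g y = cong suc (length-path (g Fin.zero) n (g ∘ Fin.suc) y)

insertAt : ∀ {A : Set} {n} → Fin (suc n) → A → (Fin n → A) → Fin (suc n) → A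
insertAt Fin.zero            z g Fin.zero    = z
insertAt Fin.zero            z g (Fin.suc k) = g k
insertAt {n = suc n} (Fin.suc j) z g Fin.zero    = g Fin.zero
insertAt {n = suc n} (Fin.suc j) z g (Fin.suc k) = insertAt j z (g ∘ Fin.suc) k

insertAt-punchIn : ∀ {A : Set} {n} (j : Fin (suc n)) (h : Fin (suc n) → A) → ∀ k → insertAt j (h j) (h ∘ punchIn j) k ≡ h k
insertAt-punchIn Fin.zero                h Fin.zero    = refl
insertAt-punchIn Fin.zero                h (Fin.suc k) = refl
insertAt-punchIn {n = suc n} (Fin.suc j) h Fin.zero    = refl
insertAt-punchIn {n = suc n} (Fin.suc j) h (Fin.suc k) = insertAt-punchIn j (h ∘ Fin.suc) k

-- subdividing one segment of a path inserts a vertex into the path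
picks-path : ∀ {A B : Set} x n (g : Fin n → A) y (θ : Fin (suc n) → A → B) (z : Fin (suc n) → B) →
  All (λ (e , r) → Σ (Fin (suc n)) λ j →
         path (θ j x) (suc n) (insertAt j (z j) (θ j ∘ g)) (θ j y) ≋ (z j , θ j (proj₁ e)) ∷ (z j , θ j (proj₂ e)) ∷ map (map² (θ j)) r)
      (picks (path x n g y))
-- The renaming of the old vertices depends on the place j where the new one is inserted, which is
-- why `θ` and `z` are families. In the application the inner vertices are renumbered by
-- `punchIn j`.
picks-path x zero    g y θ z = (Fin.zero , ≋-flip _ _ ≋-refl) ∷ []
picks-path x (suc n) g y θ z =
  (Fin.zero , ≋-flip _ _ (≋-prep _ (≡⇒≋ (sym (path-map (θ Fin.zero) (g Fin.zero) n (g ∘ Fin.suc) y))))) ∷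
  AllP.map⁺ (All.map (λ (j , p) → Fin.suc j ,
    ≋-trans (≋-prep _ p) (≋-trans (≋-swap _ _ ≋-refl) (≋-prep _ (≋-swap _ _ ≋-refl))))
    (picks-path (g Fin.zero) n (g ∘ Fin.suc) y (θ ∘ Fin.suc) (z ∘ Fin.suc)))

addPath : (K : Gr) → Gr.V K → Gr.V K → ℕ → Gr
addPath K a b i = mkGr (V ⊎ Fin i) (SumP.≡-dec _≟_ FinP._≟_) (map inj₁ vs ++ map inj₂ (allFin i))
  (map (map² inj₁) es ++ path (inj₁ a) i inj₂ (inj₁ b))
  where open Gr K

-- the edges of `todo`, subdivided ns times respectively, are added to K
build : (K : Gr) → (A → Gr.V K) → List (A × A) → List ℕ → Gr
build K ι []               ns       = K
build K ι (_ ∷ _)          []       = K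
build K ι ((a , b) ∷ todo) (i ∷ ns) = build (addPath K (ι a) (ι b) i) (inj₁ ∘ ι) todo ns

Ren-addPath : ∀ {K K′} (ρ : Ren K K′) a b i → Ren (addPath K a b i) (addPath K′ (Ren.θ ρ a) (Ren.θ ρ b) i)
Ren-addPath {K} {K′} ρ a b i = ren (Data.Sum.map θ id) (sum-map-inj (Ren.inj ρ) id)
  (trans (↭P.++⁺ʳ _ (↭P.map⁺ inj₁ (Ren.verts ρ)))
    (≡⇒↭ (≡.trans (cong (_++ map inj₂ (allFin i)) (sym (ListP.map-∘ (Gr.vs K)))) (sym (map-++-∘ (Data.Sum.map θ id) inj₁ inj₂ (Gr.vs K) (allFin i))))))
  (≋-trans (≋-++ʳ _ (≋-map inj₁ (Ren.edges ρ)))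
    (≡⇒≋ (sym (≡.trans (ListP.map-++ (map² (Data.Sum.map θ id)) (map (map² inj₁) (Gr.es K)) _)
      (cong₂ _++_ (≡.trans (map²-∘ (λ _ → refl) (Gr.es K)) (sym (map²-∘ (λ _ → refl) (Gr.es K))))
                  (path-map (Data.Sum.map θ id) (inj₁ a) i inj₂ (inj₁ b)))))))
  where θ = Ren.θ ρ

build-Ren : ∀ {f : Gr → ℚ} → Inv f → ∀ {K K′} (ρ : Ren K K′) {ι : A → Gr.V K} {ι′ : A → Gr.V K′} → (∀ a → ι′ a ≡ Ren.θ ρ (ι a)) →
            ∀ todo ns → f (build K ι todo ns) ≡ f (build K′ ι′ todo ns)
build-Ren f-inv ρ eq []               ns       = f-inv ρ
build-Ren f-inv ρ eq (_ ∷ _)          []       = f-inv ρ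
build-Ren {f = f} f-inv {K} {K′} ρ {ι} {ι′} eq ((a , b) ∷ todo) (i ∷ ns) =
  ≡.trans (build-Ren f-inv (Ren-addPath ρ (ι a) (ι b) i) (λ x → cong inj₁ (eq x)) todo ns)
          (cong₂ (λ x y → f (build (addPath K′ x y i) (inj₁ ∘ ι′) todo ns)) (sym (eq a)) (sym (eq b)))

module _ (K : Gr) (a b : Gr.V K) (i : ℕ) where

  open Gr K

  private
    segments = path {V ⊎ Fin i} (inj₁ a) i inj₂ (inj₁ b)

  Ren-subdivideEdge-addPath : ∀ e r →
    Ren (subdivideEdge (addPath K a b i) (map² inj₁ e) (map (map² inj₁) r ++ segments)) (addPath (subdivideEdge K e r) (just a) (just b) i)
  Ren-subdivideEdge-addPath e r = ren θ (λ {x} {y} → θ-inj x y)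
    (≡⇒↭ (cong (inj₁ nothing ∷_) (sym (≡.trans (sym (ListP.map-∘ (map inj₁ vs ++ map inj₂ (allFin i))))
      (≡.trans (map-++-∘ (θ ∘ just) inj₁ inj₂ vs (allFin i)) (cong (_++ map inj₂ (allFin i)) (ListP.map-∘ vs)))))))
    (≡⇒≋ (cong (λ l → (inj₁ nothing , inj₁ (just (proj₁ e))) ∷ (inj₁ nothing , inj₁ (just (proj₂ e))) ∷ l)
      (sym (≡.trans (map²-∘ (λ _ → refl) (map (map² inj₁) r ++ segments))
        (≡.trans (ListP.map-++ (map² (θ ∘ just)) (map (map² inj₁) r) segments)
          (cong₂ _++_ (≡.trans (map²-∘ (λ _ → refl) r) (sym (map²-∘ (λ _ → refl) r))) (path-map (θ ∘ just) (inj₁ a) i inj₂ (inj₁ b))))))))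
    where
    θ : Maybe (V ⊎ Fin i) → Maybe V ⊎ Fin i
    θ nothing         = inj₁ nothing
    θ (just (inj₁ x)) = inj₁ (just x)
    θ (just (inj₂ j)) = inj₂ j
    θ-inj : ∀ x y → θ x ≡ θ y → x ≡ y
    θ-inj nothing         nothing         eq   = refl
    θ-inj nothing         (just (inj₁ _)) ()
    θ-inj nothing         (just (inj₂ _)) ()
    θ-inj (just (inj₁ x)) (just (inj₁ _)) refl = refl
    θ-inj (just (inj₂ j)) (just (inj₂ _)) refl = refl

  -- Whichever segment is subdivided, the result is the path with one more inner vertex. The second
  -- component records that the vertices of `K` and the old endpoints stay fixed, so that the
  -- remaining edges can be built on top.
  Ren-subdivideEdge-path : All (λ (e , r) → Σ (Ren (subdivideEdge (addPath K a b i) e (map (map² inj₁) es ++ r)) (addPath K a b (suc i)))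
      λ ρ → ∀ x → inj₁ x ≡ Ren.θ ρ (just (inj₁ x)))
    (picks segments)
  Ren-subdivideEdge-path = All.map (λ {(e , r)} (j , p) → ren (θ j) (λ {x} {y} → θ-inj j x y)
      (trans (↭P.++⁺ˡ (map inj₁ vs) (trans (↭P.map⁺ inj₂ (allFin-root j)) (prep (inj₂ j) (≡⇒↭ (sym (ListP.map-∘ (allFin i)))))))
        (trans (↭P.shift (inj₂ j) (map inj₁ vs) _)
          (≡⇒↭ (cong (inj₂ j ∷_) (sym (≡.trans (sym (ListP.map-∘ (map inj₁ vs ++ map inj₂ (allFin i)))) (map-++-∘ (θ j ∘ just) inj₁ inj₂ vs (allFin i))))))))
      (≋-trans (≋-++ˡ (map (map² inj₁) es) (≋-trans (≡⇒≋ (sym (path-cong (inj₁ a) (suc i) (inj₁ b) (insertAt-punchIn j inj₂)))) p))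
        (≋-trans (↭⇒≋ (trans (↭P.shift _ (map (map² inj₁) es) _) (prep _ (↭P.shift _ (map (map² inj₁) es) _))))
          (≡⇒≋ (cong (λ l → (inj₂ j , θ j (just (proj₁ e))) ∷ (inj₂ j , θ j (just (proj₂ e))) ∷ l)
            (sym (≡.trans (map²-∘ (λ _ → refl) (map (map² inj₁) es ++ r))
              (≡.trans (ListP.map-++ (map² (θ j ∘ just)) (map (map² inj₁) es) r) (cong (_++ map (map² (θ j ∘ just)) r) (map²-∘ (λ _ → refl) es)))))))))
      , λ _ → refl)
    (picks-path (inj₁ a) i inj₂ (inj₁ b) (λ j → θ j ∘ just) inj₂)
    where
    θ : Fin (suc i) → Maybe (V ⊎ Fin i) → V ⊎ Fin (suc i)
    θ j nothing         = inj₂ j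
    θ j (just (inj₁ x)) = inj₁ x
    θ j (just (inj₂ k)) = inj₂ (punchIn j k)
    θ-inj : ∀ j x y → θ j x ≡ θ j y → x ≡ y
    θ-inj j nothing         nothing         eq   = refl
    θ-inj j nothing         (just (inj₂ k)) eq   = ⊥-elim (FinP.punchInᵢ≢i j k (sym (SumP.inj₂-injective eq)))
    θ-inj j (just (inj₂ k)) nothing         eq   = ⊥-elim (FinP.punchInᵢ≢i j k (SumP.inj₂-injective eq))
    θ-inj j (just (inj₁ x)) (just (inj₁ _)) refl = refl
    θ-inj j (just (inj₂ k)) (just (inj₂ l)) eq   = cong (just ∘ inj₂) (FinP.punchIn-injective j k l (SumP.inj₂-injective eq))

-- An edge with i subdivision vertices consists of i + 1 segments, and subdividing any of them gives
-- the edge with i + 1 subdivision vertices.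
incSum : List ℕ → (List ℕ → ℚ) → ℚ
incSum []       φ = 0ℚ
incSum (i ∷ ns) φ = nat (suc i) * φ (suc i ∷ ns) + incSum ns (λ ns′ → φ (i ∷ ns′))

length-picks : ∀ (xs : List A) → length (picks xs) ≡ length xs
length-picks []       = refl
length-picks (x ∷ xs) = cong suc (≡.trans (ListP.length-map _ (picks xs)) (length-picks xs))

-- An edge of the built graph is either an edge of `K` or a segment of an added path. The first sum
-- is carried along because the induction moves paths into `K`; it is empty when the construction
-- starts from a graph without edges.
edgeSum-build : ∀ {f} → Inv f → ∀ K (ι : A → Gr.V K) todo ns → length ns ≡ length todo →
  edgeSum f (build K ι todo ns) ≡
  ∑ (picks (Gr.es K)) (λ (e , r) → f (build (subdivideEdge K e r) (just ∘ ι) todo ns)) + incSum ns (λ ns′ → f (build K ι todo ns′))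
edgeSum-build f-inv K ι []               []       len = sym (+-identityʳ _)
edgeSum-build {f = f} f-inv K ι ((a , b) ∷ todo) (i ∷ ns) len = begin
  edgeSum f (build K′ ι′ todo ns)
    ≡⟨ edgeSum-build f-inv K′ ι′ todo ns (ℕP.suc-injective len) ⟩
  ∑ (picks (map (map² inj₁) (Gr.es K) ++ segments)) (λ (e , r) → F e r) + rest
    ≡⟨ cong (_+ rest) (∑-picks-++ (map (map² inj₁) (Gr.es K)) segments _) ⟩
  (∑ (picks (map (map² inj₁) (Gr.es K))) (λ (e , r) → F e (r ++ segments)) +
   ∑ (picks segments) (λ (e , r) → F e (map (map² inj₁) (Gr.es K) ++ r))) + rest
    ≡⟨ cong (_+ rest) (cong₂ _+_ old new) ⟩
  (∑ (picks (Gr.es K)) (λ (e , r) → f (build (subdivideEdge K e r) (just ∘ ι) ((a , b) ∷ todo) (i ∷ ns))) +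
   nat (suc i) * f (build K ι ((a , b) ∷ todo) (suc i ∷ ns))) + rest
    ≡⟨ +-assoc (∑ (picks (Gr.es K)) (λ (e , r) → f (build (subdivideEdge K e r) (just ∘ ι) ((a , b) ∷ todo) (i ∷ ns)))) _ rest ⟩
  ∑ (picks (Gr.es K)) (λ (e , r) → f (build (subdivideEdge K e r) (just ∘ ι) ((a , b) ∷ todo) (i ∷ ns))) +
    incSum (i ∷ ns) (λ ns′ → f (build K ι ((a , b) ∷ todo) ns′)) ∎
  where
  K′ = addPath K (ι a) (ι b) i
  ι′ : _ → Gr.V K′
  ι′ = inj₁ ∘ ι
  segments = path {Gr.V K′} (inj₁ (ι a)) i inj₂ (inj₁ (ι b))
  rest = incSum ns (λ ns′ → f (build K′ ι′ todo ns′))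
  F : Gr.V K′ × Gr.V K′ → List (Gr.V K′ × Gr.V K′) → ℚ
  F e r = f (build (subdivideEdge K′ e r) (just ∘ ι′) todo ns)
  old : ∑ (picks (map (map² inj₁) (Gr.es K))) (λ (e , r) → F e (r ++ segments)) ≡
        ∑ (picks (Gr.es K)) (λ (e , r) → f (build (subdivideEdge K e r) (just ∘ ι) ((a , b) ∷ todo) (i ∷ ns)))
  old = ≡.trans (cong (λ l → ∑ l (λ (e , r) → F e (r ++ segments))) (picks-map (map² inj₁) (Gr.es K)))
    (≡.trans (∑-map _ (picks (Gr.es K)) _) (∑-cong (picks (Gr.es K)) (λ (e , r) →
      build-Ren f-inv (Ren-subdivideEdge-addPath K (ι a) (ι b) i e r) (λ _ → refl) todo ns)))
  c = f (build K ι ((a , b) ∷ todo) (suc i ∷ ns))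
  new : ∑ (picks segments) (λ (e , r) → F e (map (map² inj₁) (Gr.es K) ++ r)) ≡ nat (suc i) * c
  new = begin
    ∑ (picks segments) (λ (e , r) → F e (map (map² inj₁) (Gr.es K) ++ r))
      ≡⟨ ∑-cong-All (All.map (λ (ρ , eq) → build-Ren f-inv ρ (λ x → eq (ι x)) todo ns) (Ren-subdivideEdge-path K (ι a) (ι b) i)) ⟩
    ∑ (picks segments) (λ _ → c)                ≡⟨ ∑-const c (picks segments) ⟩
    nat (length (picks segments)) * c           ≡⟨ cong (λ l → nat l * c) (≡.trans (length-picks segments) (length-path (inj₁ (ι a)) i inj₂ (inj₁ (ι b)))) ⟩
    nat (suc i) * c                             ∎

-- Degrees in subdivided graphs

module _ {A : Set} (d : DecidableEquality A) where

  deg-path : ∀ {x} p n (g : Fin n → A) q → (∀ i → g i ≢ x) → deg d x (path p n g q) ≡ bit (does (d p x)) ℕ.+ bit (does (d q x))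
  deg-path p zero    g q g≢x = ℕP.+-identityʳ _
  deg-path {x} p (suc n) g q g≢x = begin
    (bit (does (d p x)) ℕ.+ bit (does (d (g Fin.zero) x))) ℕ.+ deg d x (path (g Fin.zero) n (g ∘ Fin.suc) q)
      ≡⟨ cong₂ (λ b z → (bit (does (d p x)) ℕ.+ bit b) ℕ.+ z) off (deg-path (g Fin.zero) n (g ∘ Fin.suc) q (g≢x ∘ Fin.suc)) ⟩
    (bit (does (d p x)) ℕ.+ 0) ℕ.+ (bit (does (d (g Fin.zero) x)) ℕ.+ bit (does (d q x)))
      ≡⟨ cong₂ (λ y b → y ℕ.+ (bit b ℕ.+ bit (does (d q x)))) (ℕP.+-identityʳ _) off ⟩
    bit (does (d p x)) ℕ.+ bit (does (d q x)) ∎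
    where
    off : does (d (g Fin.zero) x) ≡ false
    off = does-≢ d (g≢x Fin.zero)

  TwoSimple : A → List (A × A) → Set
  TwoSimple x es = (deg d x es ≡ 2) × (simpleDeg d x es ≡ 2)

  private
    path-start : ∀ {x} n (g : Fin n → A) q → q ≢ x → (∀ i → g i ≢ x) → deg d x (path x n g q) ≡ 1 × simpleDeg d x (path x n g q) ≡ 1
    path-start {x} n g q q≢x g≢x = deg≡1 , deg≡1⇒simpleDeg≡1 d x (path x n g q) deg≡1
      where
      deg≡1 : deg d x (path x n g q) ≡ 1
      deg≡1 = ≡.trans (deg-path x n g q g≢x) (cong₂ (λ b c → bit b ℕ.+ bit c) (does-refl d x) (does-≢ d q≢x))

  path-inner : ∀ p n (g : Fin n → A) q → (∀ {i j} → g i ≡ g j → i ≡ j) → (∀ i → p ≢ g i) → (∀ i → q ≢ g i) →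
               ∀ k → TwoSimple (g k) (path p n g q)
  path-inner p (suc n) g q inj p≢ q≢ Fin.zero =
    cong₂ ℕ._+_ one (proj₁ rest) , cong₂ (λ i z → bit (i ℕ.≡ᵇ 1) ℕ.+ z) one (proj₂ rest)
    where
    one : inc d (g Fin.zero) (p , g Fin.zero) ≡ 1
    one = cong₂ (λ b c → bit b ℕ.+ bit c) (does-≢ d (p≢ Fin.zero)) (does-refl d (g Fin.zero))
    rest = path-start {g Fin.zero} n (g ∘ Fin.suc) q (q≢ Fin.zero) (λ i eq → FinP.0≢1+n (sym (inj eq)))
  path-inner p (suc n) g q inj p≢ q≢ (Fin.suc k) =
    cong₂ ℕ._+_ none (proj₁ rest) , cong₂ (λ i z → bit (i ℕ.≡ᵇ 1) ℕ.+ z) none (proj₂ rest)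
    where
    none : inc d (g (Fin.suc k)) (p , g Fin.zero) ≡ 0
    none = cong₂ (λ b c → bit b ℕ.+ bit c) (does-≢ d (p≢ (Fin.suc k))) (does-≢ d (λ eq → FinP.0≢1+n (inj eq)))
    rest = path-inner (g Fin.zero) n (g ∘ Fin.suc) q (λ eq → FinP.suc-injective (inj eq))
             (λ i eq → FinP.0≢1+n (inj eq)) (q≢ ∘ Fin.suc) k

-- The final degree of u, once the edges of `todo` have been added, is at least 3, or u is a subdivision vertex;
-- the index is the contribution of u to `joints`.
data State (K : Gr) (ι : A → Gr.V K) (todo : List (A × A)) (u : Gr.V K) : ℕ → Set where
  core  : 3 ≤ deg (Gr._≟_ K) u (Gr.es K) ℕ.+ deg (Gr._≟_ K) u (map (map² ι) todo) → State K ι todo u 0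
  inner : TwoSimple (Gr._≟_ K) u (Gr.es K) → (∀ a → ι a ≢ u) → State K ι todo u 2

sumℕ-inner : ∀ i → sumℕ {Fin i} (λ _ → 2) (allFin i) ≡ i ℕ.* 2
sumℕ-inner zero    = refl
sumℕ-inner (suc i) = ≡.trans (sumℕ-allFin-suc i (λ _ → 2)) (cong (2 ℕ.+_) (sumℕ-inner i))

module _ (K : Gr) (ι : A → Gr.V K) (a b : A) (todo : List (A × A)) (i : ℕ) where

  private
    module K = Gr K
    K′ = addPath K (ι a) (ι b) i
    d : DecidableEquality (K.V ⊎ Fin i)
    d = Gr._≟_ K′
    segments = path {K.V ⊎ Fin i} (inj₁ (ι a)) i inj₂ (inj₁ (ι b))

    split : ∀ (f : (K.V ⊎ Fin i) × (K.V ⊎ Fin i) → ℕ) → sumℕ f (Gr.es K′) ≡ sumℕ f (map (map² inj₁) K.es) ℕ.+ sumℕ f segments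
    split f = sumℕ-++ f (map (map² inj₁) K.es) segments

    deg-todo : ∀ u → deg d (inj₁ u) (map (map² (inj₁ ∘ ι)) todo) ≡ deg K._≟_ u (map (map² ι) todo)
    deg-todo u = ≡.trans (cong (deg d (inj₁ u)) (sym (map²-∘ {f = inj₁} {g = ι} (λ _ → refl) todo))) (deg-map K._≟_ d inj₁ SumP.inj₁-injective u (map (map² ι) todo))

    deg-segments : ∀ u → deg d (inj₁ u) segments ≡ inc K._≟_ u (ι a , ι b)
    deg-segments u = ≡.trans (deg-path d (inj₁ (ι a)) i inj₂ (inj₁ (ι b)) (λ _ ()))
      (cong₂ (λ x y → bit x ℕ.+ bit y) (does-inj K._≟_ d inj₁ SumP.inj₁-injective (ι a) u) (does-inj K._≟_ d inj₁ SumP.inj₁-injective (ι b) u))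

  State-old : ∀ {u c} → State K ι ((a , b) ∷ todo) u c → State K′ (inj₁ ∘ ι) todo (inj₁ u) c
  State-old {u} (core p) = core (subst (3 ≤_) (sym (begin
    deg d (inj₁ u) (Gr.es K′) ℕ.+ deg d (inj₁ u) (map (map² (inj₁ ∘ ι)) todo)
      ≡⟨ cong₂ ℕ._+_ (split (inc d (inj₁ u))) (deg-todo u) ⟩
    (deg d (inj₁ u) (map (map² inj₁) K.es) ℕ.+ deg d (inj₁ u) segments) ℕ.+ deg K._≟_ u (map (map² ι) todo)
      ≡⟨ cong₂ (λ x y → (x ℕ.+ y) ℕ.+ deg K._≟_ u (map (map² ι) todo)) (deg-map K._≟_ d inj₁ SumP.inj₁-injective u K.es) (deg-segments u) ⟩
    (deg K._≟_ u K.es ℕ.+ inc K._≟_ u (ι a , ι b)) ℕ.+ deg K._≟_ u (map (map² ι) todo)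
      ≡⟨ ℕP.+-assoc (deg K._≟_ u K.es) _ _ ⟩
    deg K._≟_ u K.es ℕ.+ deg K._≟_ u (map (map² ι) ((a , b) ∷ todo)) ∎)) p)
  State-old {u} (inner (p , q) ne) = inner
    ( ≡.trans (split (inc d (inj₁ u))) (≡.trans (cong₂ ℕ._+_ (≡.trans (deg-map K._≟_ d inj₁ SumP.inj₁-injective u K.es) p) none) refl)
    , ≡.trans (split _) (cong₂ ℕ._+_ (≡.trans (simpleDeg-map K._≟_ d inj₁ SumP.inj₁-injective u K.es) q) (Degree.deg≡0⇒simpleDeg≡0 d (inj₁ u) segments none)))
    (λ x eq → ne x (SumP.inj₁-injective eq))
    where
    none : deg d (inj₁ u) segments ≡ 0
    none = ≡.trans (deg-segments u) (cong₂ (λ x y → bit x ℕ.+ bit y) (does-≢ K._≟_ (ne a)) (does-≢ K._≟_ (ne b)))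

  State-new : ∀ k → State K′ (inj₁ ∘ ι) todo (inj₂ k) 2
  State-new k = inner
    ( ≡.trans (split (inc d (inj₂ k))) (cong₂ ℕ._+_ none (proj₁ new))
    , ≡.trans (split _) (cong₂ ℕ._+_ (Degree.deg≡0⇒simpleDeg≡0 d (inj₂ k) (map (map² inj₁) K.es) none) (proj₂ new)))
    (λ x ())
    where
    new = path-inner d (inj₁ (ι a)) i inj₂ (inj₁ (ι b)) SumP.inj₂-injective (λ _ ()) (λ _ ()) k
    none : deg d (inj₂ k) (map (map² inj₁) K.es) ≡ 0
    none = ≡.trans (sumℕ-map (map² inj₁) (inc d (inj₂ k)) K.es) (sumℕ-0 K.es (λ _ → refl))

total : List ℕ → ℕ
total = sumℕ id

-- Core vertices end with degree at least 3 and contribute 0, subdivision vertices contribute 2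
-- each; the same case distinction shows that every vertex can carry a tree in the sense of
-- `Stable`.
build-joints : ∀ K (ι : A → Gr.V K) todo ns → length ns ≡ length todo → (c : Gr.V K → ℕ) → All (λ u → State K ι todo u (c u)) (Gr.vs K) →
  (joints (build K ι todo ns) ≡ sumℕ c (Gr.vs K) ℕ.+ total ns ℕ.* 2) × Stable (build K ι todo ns) id (Gr.vs (build K ι todo ns))
build-joints K ι [] [] len c st =
  ≡.trans (sumℕ-cong-All (All.map joint st)) (sym (ℕP.+-identityʳ _)) , All.map stable st
  where
  joint : ∀ {u c} → State K ι [] u c → isJoint (Gr._≟_ K) (Gr.es K) u ≡ c
  joint {u} (core p)          = big _ (subst (3 ≤_) (ℕP.+-identityʳ _) p)
    where
    big : ∀ i → 3 ≤ i → bit (i ℕ.≡ᵇ 2) ℕ.* simpleDeg (Gr._≟_ K) u (Gr.es K) ≡ 0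
    big (suc zero)          (s≤s ())
    big (suc (suc zero))    (s≤s (s≤s ()))
    big (suc (suc (suc i))) _ = refl
  joint {u} (inner (p , q) _) = cong₂ (λ i j → bit (i ℕ.≡ᵇ 2) ℕ.* j) p q
  stable : ∀ {u c} → State K ι [] u c → 2 ≤ deg (Gr._≟_ K) u (Gr.es K)
  stable (core p)          = ℕP.≤-trans (s≤s (s≤s z≤n)) (subst (3 ≤_) (ℕP.+-identityʳ _) p)
  stable (inner (p , q) _) = ℕP.≤-reflexive (sym p)
build-joints K ι ((a , b) ∷ todo) (i ∷ ns) len c st =
  let (eq , s) = build-joints (addPath K (ι a) (ι b) i) (inj₁ ∘ ι) todo ns (ℕP.suc-injective len) c′ st′
  in ≡.trans eq (begin
       sumℕ c′ (map inj₁ (Gr.vs K) ++ map inj₂ (allFin i)) ℕ.+ total ns ℕ.* 2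
         ≡⟨ cong (ℕ._+ total ns ℕ.* 2) (≡.trans (sumℕ-++ c′ (map inj₁ (Gr.vs K)) _)
              (cong₂ ℕ._+_ (sumℕ-map inj₁ c′ (Gr.vs K)) (≡.trans (sumℕ-map inj₂ c′ (allFin i)) (sumℕ-inner i)))) ⟩
       (sumℕ c (Gr.vs K) ℕ.+ i ℕ.* 2) ℕ.+ total ns ℕ.* 2
         ≡⟨ ≡.trans (ℕP.+-assoc (sumℕ c (Gr.vs K)) _ _) (cong (sumℕ c (Gr.vs K) ℕ.+_) (sym (ℕP.*-distribʳ-+ 2 i (total ns)))) ⟩
       sumℕ c (Gr.vs K) ℕ.+ total (i ∷ ns) ℕ.* 2 ∎)
   , s
  where
  c′ : Gr.V K ⊎ Fin i → ℕ
  c′ = [ c , (λ _ → 2) ]′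
  st′ = AllP.++⁺ (AllP.map⁺ (All.map (State-old K ι a b todo i) st)) (AllP.map⁺ (All.universal (State-new K ι a b todo i) (allFin i)))

build-unique : ∀ K (ι : A → Gr.V K) todo ns → Unique (Gr.vs K) → Unique (Gr.vs (build K ι todo ns))
build-unique K ι []               ns       u = u
build-unique K ι (_ ∷ _)          []       u = u
build-unique K ι ((a , b) ∷ todo) (i ∷ ns) u = build-unique (addPath K (ι a) (ι b) i) (inj₁ ∘ ι) todo ns
  (Unique-⊎ u (UniqueP.allFin⁺ i))

build-length : ∀ K (ι : A → Gr.V K) todo ns → length ns ≡ length todo → length (Gr.vs (build K ι todo ns)) ≡ length (Gr.vs K) ℕ.+ total ns
build-length K ι []               []       len = sym (ℕP.+-identityʳ _)
build-length K ι ((a , b) ∷ todo) (i ∷ ns) len = begin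
  length (Gr.vs (build (addPath K (ι a) (ι b) i) (inj₁ ∘ ι) todo ns))
    ≡⟨ build-length (addPath K (ι a) (ι b) i) (inj₁ ∘ ι) todo ns (ℕP.suc-injective len) ⟩
  length (map inj₁ (Gr.vs K) ++ map inj₂ (allFin i)) ℕ.+ total ns
    ≡⟨ cong (ℕ._+ total ns) (≡.trans (ListP.length-++ (map inj₁ (Gr.vs K)))
         (cong₂ ℕ._+_ (ListP.length-map inj₁ (Gr.vs K)) (≡.trans (ListP.length-map inj₂ (allFin i)) (ListP.length-tabulate {n = i} id)))) ⟩
  (length (Gr.vs K) ℕ.+ i) ℕ.+ total ns
    ≡⟨ ℕP.+-assoc (length (Gr.vs K)) i (total ns) ⟩
  length (Gr.vs K) ℕ.+ total (i ∷ ns) ∎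

-- Sum over the tuples of the statement: m edges receive k new vertices in total.
∑ᵗ : ℕ → ℕ → (List ℕ → ℚ) → ℚ
∑ᵗ zero    zero    F = F []
∑ᵗ zero    (suc k) F = 0ℚ
∑ᵗ (suc m) k       F = ⨁ k (λ i j → ∑ᵗ m j (λ ns → F (i ∷ ns)))

⨁-cong-≡ : ∀ N {F G : ℕ → ℕ → ℚ} → (∀ i j → i ℕ.+ j ≡ N → F i j ≡ G i j) → ⨁ N F ≡ ⨁ N G
⨁-cong-≡ zero    eq = eq 0 0 refl
⨁-cong-≡ (suc N) eq = cong₂ _+_ (eq 0 (suc N) refl) (⨁-cong-≡ N (λ i j p → eq (suc i) j (cong suc p)))

∑ᵗ-cong : ∀ m k {F G} → (∀ ns → length ns ≡ m → total ns ≡ k → F ns ≡ G ns) → ∑ᵗ m k F ≡ ∑ᵗ m k G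
∑ᵗ-cong zero    zero    eq = eq [] refl refl
∑ᵗ-cong zero    (suc k) eq = refl
∑ᵗ-cong (suc m) k       eq = ⨁-cong-≡ k (λ i j p → ∑ᵗ-cong m j (λ ns q r → eq (i ∷ ns) (cong suc q) (≡.trans (cong (i ℕ.+_) r) p)))

∑ᵗ-+ : ∀ m k F G → ∑ᵗ m k (λ ns → F ns + G ns) ≡ ∑ᵗ m k F + ∑ᵗ m k G
∑ᵗ-+ zero    zero    F G = refl
∑ᵗ-+ zero    (suc k) F G = sym (+-identityˡ 0ℚ)
∑ᵗ-+ (suc m) k       F G = ≡.trans (⨁-cong k (λ i j → ∑ᵗ-+ m j _ _)) (⨁-+ k _ _)

∑ᵗ-*ˡ : ∀ m k c F → ∑ᵗ m k (λ ns → c * F ns) ≡ c * ∑ᵗ m k F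
∑ᵗ-*ˡ zero    zero    c F = refl
∑ᵗ-*ˡ zero    (suc k) c F = sym (*-zeroʳ c)
∑ᵗ-*ˡ (suc m) k       c F = ≡.trans (⨁-cong k (λ i j → ∑ᵗ-*ˡ m j c _)) (sym (⨁-*ˡ k c _))

∑ᵗ-0 : ∀ m k {F} → (∀ ns → length ns ≡ m → total ns ≡ k → F ns ≡ 0ℚ) → ∑ᵗ m k F ≡ 0ℚ
∑ᵗ-0 m k {F} eq = ≡.trans (∑ᵗ-cong m k {F} {λ _ → 0ℚ * 0ℚ} (λ ns p q → ≡.trans (eq ns p q) (sym (*-zeroˡ 0ℚ)))) (≡.trans (∑ᵗ-*ˡ m k 0ℚ (λ _ → 0ℚ)) (*-zeroˡ _))

∑ᵗ-shift : ∀ m k (F : List ℕ → ℕ → ℚ) N → ∑ᵗ m k (λ ns → shift (F ns) N) ≡ shift (λ n → ∑ᵗ m k (λ ns → F ns n)) N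
∑ᵗ-shift m k F zero    = ∑ᵗ-0 m k (λ _ _ _ → refl)
∑ᵗ-shift m k F (suc N) = refl

-- a list of total k arises in k ways by increasing one entry of a list of total k - 1
∑ᵗ-incSum : ∀ m k φ → shift (λ k → ∑ᵗ m k (λ ns → incSum ns φ)) k ≡ nat k * ∑ᵗ m k φ
∑ᵗ-incSum zero    zero          φ = sym (*-zeroˡ _)
∑ᵗ-incSum zero    (suc zero)    φ = sym (*-zeroʳ _)
∑ᵗ-incSum zero    (suc (suc k)) φ = sym (*-zeroʳ _)
∑ᵗ-incSum (suc m) k             φ = begin
  shift (λ k → ⨁ k (λ i j → ∑ᵗ m j (λ ns → nat (suc i) * φ (suc i ∷ ns) + incSum ns (λ ns′ → φ (i ∷ ns′))))) k
    ≡⟨ shift-cong k (λ k → ≡.trans (⨁-cong k (λ i j → ≡.trans (∑ᵗ-+ m j _ _) (cong (_+ I i j) (∑ᵗ-*ˡ m j (nat (suc i)) _)))) (⨁-+ k _ _)) ⟩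
  shift (λ k → ⨁ k (λ i j → nat (suc i) * S (suc i) j) + ⨁ k I) k
    ≡⟨ shift-+ k _ _ ⟩
  shift (λ k → ⨁ k (λ i j → nat (suc i) * S (suc i) j)) k + shift (λ k → ⨁ k I) k
    ≡⟨ cong₂ _+_ (first k) (≡.trans (sym (⨁-shiftʳ k I)) (⨁-cong k (λ i j → ∑ᵗ-incSum m j (λ ns → φ (i ∷ ns))))) ⟩
  ⨁ k (λ i j → nat i * S i j) + ⨁ k (λ i j → nat j * S i j)
    ≡⟨ sym (⨁-+ k _ _) ⟩
  ⨁ k (λ i j → nat i * S i j + nat j * S i j)
    ≡⟨ ⨁-cong-≡ k (λ i j p → ≡.trans (sym (*-distribʳ-+ (S i j) (nat i) (nat j))) (cong (_* S i j) (≡.trans (sym (nat-+ i j)) (cong nat p)))) ⟩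
  ⨁ k (λ i j → nat k * S i j)
    ≡⟨ sym (⨁-*ˡ k (nat k) S) ⟩
  nat k * ⨁ k S ∎
  where
  S I : ℕ → ℕ → ℚ
  S i j = ∑ᵗ m j (λ ns → φ (i ∷ ns))
  I i j = ∑ᵗ m j (λ ns → incSum ns (λ ns′ → φ (i ∷ ns′)))
  first : ∀ k → shift (λ k → ⨁ k (λ i j → nat (suc i) * S (suc i) j)) k ≡ ⨁ k (λ i j → nat i * S i j)
  first zero    = sym (*-zeroˡ _)
  first (suc k) = sym (≡.trans (cong (_+ ⨁ k (λ i j → nat (suc i) * S (suc i) j)) (*-zeroˡ (S 0 (suc k)))) (+-identityˡ _))

-- Weighted sums over subdivisions with trees

∑-upTo-last : ∀ n (F : ℕ → ℚ) → ∑ (upTo (suc n)) F ≡ ∑ (upTo n) F + F n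
∑-upTo-last zero    F = +-comm (F 0) 0ℚ
∑-upTo-last (suc n) F = begin
  ∑ (upTo (suc (suc n))) F                            ≡⟨ ∑-upTo-suc (suc n) F ⟩
  F 0 + ∑ (upTo (suc n)) (F ∘ suc)                    ≡⟨ cong (F 0 +_) (∑-upTo-last n (F ∘ suc)) ⟩
  F 0 + (∑ (upTo n) (F ∘ suc) + F (suc n))            ≡⟨ sym (+-assoc (F 0) _ _) ⟩
  (F 0 + ∑ (upTo n) (F ∘ suc)) + F (suc n)            ≡⟨ cong (_+ F (suc n)) (sym (∑-upTo-suc n F)) ⟩
  ∑ (upTo (suc n)) F + F (suc n)                      ∎

∑-upTo-χ : ∀ M N (Q : ℕ → ℚ) → ∑ (upTo M) (λ v → χ (N ℕ.≡ᵇ v) * Q v) ≡ χ (N ℕ.<ᵇ M) * Q N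
∑-upTo-χ zero    N       Q = sym (*-zeroˡ (Q N))
∑-upTo-χ (suc M) zero    Q = ≡.trans (∑-upTo-suc M _) (≡.trans (cong (1ℚ * Q 0 +_) (∑-0 (upTo M) (λ v → *-zeroˡ (Q (suc v))))) (+-identityʳ _))
∑-upTo-χ (suc M) (suc N) Q = ≡.trans (∑-upTo-suc M _) (≡.trans (cong₂ _+_ (*-zeroˡ (Q 0)) (∑-upTo-χ M N (Q ∘ suc))) (+-identityˡ _))

∑-shift : ∀ (xs : List A) (F : A → ℕ → ℚ) N → ∑ xs (λ x → shift (F x) N) ≡ shift (λ n → ∑ xs (λ x → F x n)) N
∑-shift xs F zero    = ∑-0 xs (λ _ → refl)
∑-shift xs F (suc N) = refl

shift-*ˡ : ∀ N c (f : ℕ → ℚ) → shift (λ n → c * f n) N ≡ c * shift f N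
shift-*ˡ zero    c f = sym (*-zeroʳ c)
shift-*ˡ (suc N) c f = refl

∑ᵗ-zeros : ∀ m F → ∑ᵗ m 0 F ≡ F (List.replicate m 0)
∑ᵗ-zeros zero    F = refl
∑ᵗ-zeros (suc m) F = ∑ᵗ-zeros m (λ ns → F (0 ∷ ns))

build-zeros : ∀ {f : Gr → ℚ} → Inv f → ∀ K (ι : A → Gr.V K) todo →
              f (build K ι todo (List.replicate (length todo) 0)) ≡ f (mkGr (Gr.V K) (Gr._≟_ K) (Gr.vs K) (Gr.es K ++ map (map² ι) todo))
build-zeros f-inv K ι []               = f-inv (ren id id (≡⇒↭ (sym (ListP.map-id _)))
  (≡⇒≋ (≡.trans (ListP.++-identityʳ _) (sym (ListP.map-id (Gr.es K))))))
build-zeros f-inv K ι ((a , b) ∷ todo) = ≡.trans (build-zeros f-inv (addPath K (ι a) (ι b) 0) (inj₁ ∘ ι) todo)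
  (sym (f-inv (ren inj₁ SumP.inj₁-injective (≡⇒↭ (ListP.++-identityʳ _))
    (≡⇒≋ (≡.trans (ListP.++-assoc (map (map² inj₁) (Gr.es K)) _ _)
      (sym (≡.trans (ListP.map-++ (map² inj₁) (Gr.es K) _) (cong (map (map² inj₁) (Gr.es K) ++_) (cong (_ ∷_) (map²-∘ (λ _ → refl) todo))))))))))

md3 : (n : ℕ) → List (Fin n × Fin n) → Bool
md3 n es = allF n (λ u → 3 ℕ.≤ᵇ deg FinP._≟_ u es)

-- The construction starts from the edgeless graph, and every edge, subdivided or not, is added as a
-- path. Thus all edges of the result are segments of paths.
subdivided : (v : ℕ) → List (Fin v × Fin v) → List ℕ → Gr
subdivided v es ns = build (gr v []) id es ns

module _ (v : ℕ) (es : List (Fin v × Fin v)) (md : T (md3 v es)) (ns : List ℕ) (len : length ns ≡ length es) where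

  private
    initial : All (λ u → State (gr v []) id es u 0) (allFin v)
    initial = All.universal (λ u → core (subst (3 ≤_)
      (cong (deg FinP._≟_ u) (sym (ListP.map-id es))) (ℕP.≤ᵇ⇒≤ 3 _ (allF⁻ (λ u → 3 ℕ.≤ᵇ deg FinP._≟_ u es) md u)))) (allFin v)
    result = build-joints (gr v []) id es ns len (λ _ → 0) initial

  subdivided-joints : joints (subdivided v es ns) ≡ total ns ℕ.* 2
  subdivided-joints = ≡.trans (proj₁ result) (cong (ℕ._+ total ns ℕ.* 2) (sumℕ-0 (allFin v) (λ _ → refl)))

  subdivided-stable : Stable (subdivided v es ns) id (Gr.vs (subdivided v es ns))
  subdivided-stable = proj₂ result

  subdivided-unique : Unique (Gr.vs (subdivided v es ns))
  subdivided-unique = build-unique (gr v []) id es ns (UniqueP.allFin⁺ v)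

  subdivided-length : length (Gr.vs (subdivided v es ns)) ≡ v ℕ.+ total ns
  subdivided-length = ≡.trans (build-length (gr v []) id es ns len) (cong (ℕ._+ total ns) (ListP.length-tabulate {n = v} id))

-- Here the Betti number h + 2 matters: a single vertex carries h + 2 loops and has degree at least
-- 4. With more vertices connectivity gives each one a non-loop edge, so degree 1 makes a leaf and
-- degree 2 a joint.
no-leaves-no-joints : ∀ h n es → length es ≡ n ℕ.+ suc h → Connected n es → leaves (gr n es) ≡ 0 → joints (gr n es) ≡ 0 → T (md3 n es)
no-leaves-no-joints h (suc zero)    es len c l j = allF⁺ (λ u → 3 ℕ.≤ᵇ deg FinP._≟_ u es) (λ { Fin.zero → ℕP.≤⇒≤ᵇ
  (ℕP.≤-trans (s≤s (s≤s (s≤s z≤n))) (ℕP.≤-reflexive (sym (begin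
    deg FinP._≟_ Fin.zero es                              ≡⟨ sym (ℕP.+-identityʳ _) ⟩
    sumℕ (λ u → deg FinP._≟_ u es) (allFin 1)             ≡⟨ handshake es ⟩
    length es ℕ.* 2                                       ≡⟨ cong (ℕ._* 2) len ⟩
    (2 ℕ.+ h) ℕ.* 2                                       ∎)))) })
no-leaves-no-joints h (suc (suc n)) es len c l j = allF⁺ (λ u → 3 ℕ.≤ᵇ deg FinP._≟_ u es) (λ u →
  let (w , u≢w , a) = connected-leaving es c u
  in ℕP.≤⇒≤ᵇ (three _ _ (adjacent⇒deg≥1 FinP._≟_ a) (at (isLeaf FinP._≟_ es) l u) (at (isJoint FinP._≟_ es) j u) (adjacent⇒simpleDeg≥1 FinP._≟_ u≢w a)))
  where
  at : ∀ (f : Fin (suc (suc n)) → ℕ) → sumℕ f (allFin (suc (suc n))) ≡ 0 → ∀ u → f u ≡ 0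
  at f eq u = All.lookup (sumℕ≡0 f (allFin (suc (suc n))) eq) (∈P.∈-allFin u)
  three : ∀ d s → 1 ≤ d → bit (d ℕ.≡ᵇ 1) ≡ 0 → bit (d ℕ.≡ᵇ 2) ℕ.* s ≡ 0 → 1 ≤ s → 3 ≤ d
  three (suc (suc (suc d))) s       p q r t = s≤s (s≤s (s≤s z≤n))
  three (suc (suc zero))    (suc s) p q () t

-- The degree sum gives 3n ≤ 2(n + h + 1), hence n ≤ 2(h + 1) = 2g - 2 for g = h + 2.
md3-bound : ∀ h n es → length es ≡ n ℕ.+ suc h → T (md3 n es) → n < suc (2 ℕ.* suc (suc h) ∸ 2)
md3-bound h n es len md = s≤s (ℕP.≤-trans (ℕP.+-cancelˡ-≤ (n ℕ.* 2) n (suc h ℕ.* 2) (≡.subst₂ _≤_ (triple n) (rearrange n (suc h)) bound)) (ℕP.≤-reflexive (simplify h)))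
  where
  triple : ∀ n → n ℕ.* 3 ≡ n ℕ.* 2 ℕ.+ n
  triple = solve 1 (λ n → n :* con 3 := n :* con 2 :+ n) refl
    where open ℕS.+-*-Solver
  rearrange : ∀ n m → (n ℕ.+ m) ℕ.* 2 ≡ n ℕ.* 2 ℕ.+ m ℕ.* 2
  rearrange n m = ℕP.*-distribʳ-+ 2 n m
  simplify : ∀ h → suc h ℕ.* 2 ≡ 2 ℕ.* suc (suc h) ∸ 2
  simplify h = sym (≡.trans (cong (_∸ 2) (double h)) (ℕP.m+n∸m≡n 2 (suc h ℕ.* 2)))
    where
    double : ∀ h → 2 ℕ.* suc (suc h) ≡ 2 ℕ.+ suc h ℕ.* 2
    double = solve 1 (λ h → con 2 :* (con 2 :+ h) := con 2 :+ (con 1 :+ h) :* con 2) refl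
      where open ℕS.+-*-Solver
  bound : n ℕ.* 3 ≤ (n ℕ.+ suc h) ℕ.* 2
  bound = ≡.subst₂ _≤_ (cong (ℕ._* 3) (ListP.length-tabulate {n = n} id)) (≡.trans (handshake es) (cong (ℕ._* 2) len))
    (sumℕ-≥ 3 (λ u → deg FinP._≟_ u es) (allFin n) (All.universal (λ u → ℕP.≤ᵇ⇒≤ 3 _ (allF⁻ (λ u → 3 ℕ.≤ᵇ deg FinP._≟_ u es) md u)) (allFin n)))

-- Used with n the number of leaves and of joints: the first term is ready for a removal, and the
-- second lives where nothing can be removed.
split-by : ∀ n x → x ≡ nat n * (x * recip n) + χ (n ℕ.≡ᵇ 0) * x
split-by zero    x = sym (≡.trans (cong₂ _+_ (*-zeroˡ (x * recip 0)) (*-identityˡ x)) (+-identityˡ x))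
split-by (suc n) x = sym (begin
  nat (suc n) * (x * recip (suc n)) + 0ℚ * x  ≡⟨ cong₂ _+_ (*-left-comm (nat (suc n)) x (recip (suc n))) (*-zeroˡ x) ⟩
  x * (nat (suc n) * recip (suc n)) + 0ℚ      ≡⟨ +-identityʳ _ ⟩
  x * (nat (suc n) * recip (suc n))           ≡⟨ cong (x *_) (nat-recip n) ⟩
  x * 1ℚ                                      ≡⟨ *-identityʳ x ⟩
  x                                           ∎)

χ-≢0 : ∀ {n} x → n ≢ 0 → χ (n ℕ.≡ᵇ 0) * x ≡ 0ℚ
χ-≢0 {zero}  x ne = ⊥-elim (ne refl)
χ-≢0 {suc n} x ne = *-zeroˡ x

module _ (h C : ℕ) where

  private
    M : ℕ → ℕ
    M v = v ℕ.+ suc h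

  -- Labelled form of the sum over Γ_{≥3}(g) with g = h + 2, in the same finite range of v as in the
  -- statement.
  Ω : (∀ v → List (Fin v × Fin v) → ℚ) → ℚ
  Ω Ξ = ∑ (upTo (suc (2 ℕ.* suc (suc h) ∸ 2))) (λ v → wt v (M v) * ∑ (lists (M v) (pairs v)) (λ es → χ (connᵇ v es ∧ md3 v es) * Ξ v es))

  Ω-cong : ∀ {Ξ Ξ′ : ∀ v → List (Fin v × Fin v) → ℚ} → (∀ v es → length es ≡ M v → T (md3 v es) → Ξ v es ≡ Ξ′ v es) → Ω Ξ ≡ Ω Ξ′
  Ω-cong {Ξ} {Ξ′} eq = ∑-cong (upTo (suc (2 ℕ.* suc (suc h) ∸ 2))) (λ v → cong (wt v (M v) *_) (∑-cong-All (All.map (λ {es} → go v es) (length-lists (M v) (pairs v)))))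
    where
    go : ∀ v es → length es ≡ M v → χ (connᵇ v es ∧ md3 v es) * Ξ v es ≡ χ (connᵇ v es ∧ md3 v es) * Ξ′ v es
    go v es len with connᵇ v es | md3 v es in e
    ... | true  | true  = cong (1ℚ *_) (eq v es len (subst T (sym e) tt))
    ... | true  | false = ≡.trans (*-zeroˡ _) (sym (*-zeroˡ _))
    ... | false | _     = ≡.trans (*-zeroˡ _) (sym (*-zeroˡ _))

  Ω-+ : ∀ (Ξ Ξ′ : ∀ v → List (Fin v × Fin v) → ℚ) → Ω (λ v es → Ξ v es + Ξ′ v es) ≡ Ω Ξ + Ω Ξ′
  Ω-+ Ξ Ξ′ = ≡.trans (∑-cong (upTo (suc (2 ℕ.* suc (suc h) ∸ 2))) (λ v → ≡.trans (cong (wt v (M v) *_)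
      (≡.trans (∑-cong (lists (M v) (pairs v)) (λ es → *-distribˡ-+ (χ (connᵇ v es ∧ md3 v es)) _ _)) (∑-+ _ _ (lists (M v) (pairs v)))))
      (*-distribˡ-+ (wt v (M v)) _ _)))
    (∑-+ _ _ (upTo (suc (2 ℕ.* suc (suc h) ∸ 2))))

  Ω-*ˡ : ∀ c (Ξ : ∀ v → List (Fin v × Fin v) → ℚ) → Ω (λ v es → c * Ξ v es) ≡ c * Ω Ξ
  Ω-*ˡ c Ξ = ≡.trans (∑-cong (upTo (suc (2 ℕ.* suc (suc h) ∸ 2))) (λ v → ≡.trans (cong (wt v (M v) *_)
      (≡.trans (∑-cong (lists (M v) (pairs v)) (λ es → *-left-comm (χ (connᵇ v es ∧ md3 v es)) c _)) (sym (∑-*ˡ c _ (lists (M v) (pairs v))))))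
      (*-left-comm (wt v (M v)) c _)))
    (sym (∑-*ˡ c _ (upTo (suc (2 ℕ.* suc (suc h) ∸ 2)))))

  Ω-shift : ∀ (Ξ : ∀ v → List (Fin v × Fin v) → ℕ → ℚ) N → Ω (λ v es → shift (Ξ v es) N) ≡ shift (λ n → Ω (λ v es → Ξ v es n)) N
  Ω-shift Ξ zero    = ≡.trans (Ω-cong (λ v es _ _ → sym (*-zeroˡ 0ℚ))) (≡.trans (Ω-*ˡ 0ℚ (λ _ _ → 0ℚ)) (*-zeroˡ _))
  Ω-shift Ξ (suc N) = refl

  -- the sum over all subdivisions, with at most C new vertices, of the graph es, and all ways of attaching trees
  grow : (Gr → ℚ) → ∀ v → List (Fin v × Fin v) → ℕ → ℚ
  grow f v es N = ∑ (upTo (suc C)) (λ k → ∑ᵗ (M v) k (λ ns → τ (subdivided v es ns) id (Gr.vs (subdivided v es ns)) N f))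

  -- The bound `C` on the subdivision vertices stays fixed while N decreases in the induction. For N
  -- ≤ C it cuts nothing off, because each vertex of a subdivision carries a tree with at least one
  -- vertex.
  Φ : (Gr → ℚ) → ℕ → ℚ
  Φ f N = Ω (λ v es → grow f v es N)

  grow-cong : ∀ {f g} v es N → (∀ G → f G ≡ g G) → grow f v es N ≡ grow g v es N
  grow-cong v es N eq = ∑-cong (upTo (suc C)) (λ k → ∑ᵗ-cong (M v) k (λ ns _ _ → τ-cong _ id (Gr.vs (subdivided v es ns)) N eq))

  grow-+ : ∀ f g v es N → grow (λ G → f G + g G) v es N ≡ grow f v es N + grow g v es N
  grow-+ f g v es N = ≡.trans (∑-cong (upTo (suc C)) (λ k → ≡.trans
      (∑ᵗ-cong (M v) k (λ ns _ _ → τ-+ _ id (Gr.vs (subdivided v es ns)) N f g)) (∑ᵗ-+ (M v) k _ _)))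
    (∑-+ _ _ (upTo (suc C)))

  Φ-cong : ∀ {f g} N → (∀ G → f G ≡ g G) → Φ f N ≡ Φ g N
  Φ-cong N eq = Ω-cong (λ v es _ _ → grow-cong v es N eq)

  Φ-+ : ∀ f g N → Φ (λ G → f G + g G) N ≡ Φ f N + Φ g N
  Φ-+ f g N = ≡.trans (Ω-cong (λ v es _ _ → grow-+ f g v es N)) (Ω-+ (λ v es → grow f v es N) (λ v es → grow g v es N))

  module _ {f : Gr → ℚ} (f-inv : Inv f) (leafless : Leafless f) where

    grow-leafless : ∀ v es → length es ≡ M v → T (md3 v es) → ∀ N →
      grow f v es N ≡ ∑ (upTo (suc C)) (λ k → χ (N ℕ.≡ᵇ v ℕ.+ k) * ∑ᵗ (M v) k (λ ns → f (subdivided v es ns)))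
    grow-leafless v es len md N = ∑-cong (upTo (suc C)) (λ k → ≡.trans
      (∑ᵗ-cong (M v) k (λ ns p q → let len′ = ≡.trans p (sym len) in ≡.trans
        (τ-leafless f-inv leafless (Gr.vs (subdivided v es ns)) (subdivided v es ns) id []
          (partition (≡⇒↭ (sym (ListP.map-id _))) (subdivided-unique v es md ns len′)) (subdivided-stable v es md ns len′) N)
        (cong (λ l → χ (N ℕ.≡ᵇ l) * f (subdivided v es ns)) (≡.trans (subdivided-length v es md ns len′) (cong (v ℕ.+_) q)))))
      (∑ᵗ-*ˡ (M v) k (χ (N ℕ.≡ᵇ v ℕ.+ k)) _))

  module _ {f : Gr → ℚ} (f-inv : Inv f) where

    Φ-leaves : ∀ N → Φ (λ G → nat (leaves G) * f G) N ≡ shift (Φ (leafSum f)) N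
    Φ-leaves N = ≡.trans (Ω-cong step) (Ω-shift (λ v es n → grow (leafSum f) v es n) N)
      where
      step : ∀ v es → length es ≡ M v → T (md3 v es) → grow (λ G → nat (leaves G) * f G) v es N ≡ shift (grow (leafSum f) v es) N
      step v es len md = ≡.trans (∑-cong (upTo (suc C)) (λ k → ≡.trans
          (∑ᵗ-cong (M v) k (λ ns p _ → let len′ = ≡.trans p (sym len) in
             τ-leaves f-inv (subdivided v es ns) (subdivided-unique v es md ns len′) (subdivided-stable v es md ns len′) N))
          (∑ᵗ-shift (M v) k _ N)))
        (∑-shift (upTo (suc C)) _ N)

    -- Trees are trivial for such f, so a subdivision with k new vertices has `joints` equal to 2k.
    -- The factor k is traded by `∑ᵗ-incSum` for the ways to add one more new vertex, and these are
    -- the edge subdivisions by `edgeSum-build`.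
    Φ-joints : Leafless f → ∀ N → N ≤ C → Φ (λ G → nat (joints G) * f G) N ≡ shift (λ n → two * Φ (edgeSum f) n) N
    Φ-joints leafless N N≤C = ≡.trans (Ω-cong step) (≡.trans (Ω-shift (λ v es n → two * grow (edgeSum f) v es n) N)
                                (shift-cong N (λ n → Ω-*ˡ two (λ v es → grow (edgeSum f) v es n))))
      where
      step : ∀ v es → length es ≡ M v → T (md3 v es) → grow (λ G → nat (joints G) * f G) v es N ≡ shift (λ n → two * grow (edgeSum f) v es n) N
      step v es len md = begin
        grow (λ G → nat (joints G) * f G) v es N
          ≡⟨ grow-leafless (λ {G} {G′} ρ → cong₂ (λ j z → nat j * z) (joints-Inv ρ) (f-inv ρ)) (λ G ne → ≡.trans (cong (nat (joints G) *_) (leafless G ne)) (*-zeroʳ _)) v es len md N ⟩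
        ∑ (upTo (suc C)) (λ k → χ (N ℕ.≡ᵇ v ℕ.+ k) * ∑ᵗ (M v) k (λ ns → nat (joints (subdivided v es ns)) * f (subdivided v es ns)))
          ≡⟨ ∑-cong (upTo (suc C)) (λ k → cong (χ (N ℕ.≡ᵇ v ℕ.+ k) *_) (count-joints k)) ⟩
        ∑ (upTo (suc C)) (λ k → χ (N ℕ.≡ᵇ v ℕ.+ k) * (two * shift I k))
          ≡⟨ lower N N≤C ⟩
        shift (λ n → two * grow (edgeSum f) v es n) N ∎
        where
        I : ℕ → ℚ
        I k = ∑ᵗ (M v) k (λ ns → edgeSum f (subdivided v es ns))
        count-joints : ∀ k → ∑ᵗ (M v) k (λ ns → nat (joints (subdivided v es ns)) * f (subdivided v es ns)) ≡ two * shift I k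
        count-joints k = begin
          ∑ᵗ (M v) k (λ ns → nat (joints (subdivided v es ns)) * f (subdivided v es ns))
            ≡⟨ ∑ᵗ-cong (M v) k (λ ns p q → cong (_* f (subdivided v es ns)) (≡.trans
                 (cong nat (≡.trans (subdivided-joints v es md ns (≡.trans p (sym len))) (≡.trans (cong (ℕ._* 2) q) (ℕP.*-comm k 2)))) (nat-* 2 k))) ⟩
          ∑ᵗ (M v) k (λ ns → (two * nat k) * f (subdivided v es ns))
            ≡⟨ ≡.trans (∑ᵗ-*ˡ (M v) k (two * nat k) _) (*-assoc two (nat k) _) ⟩
          two * (nat k * ∑ᵗ (M v) k (λ ns → f (subdivided v es ns)))
            ≡⟨ cong (two *_) (sym (∑ᵗ-incSum (M v) k (λ ns → f (subdivided v es ns)))) ⟩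
          two * shift (λ k → ∑ᵗ (M v) k (λ ns → incSum ns (λ ns′ → f (subdivided v es ns′)))) k
            ≡⟨ cong (two *_) (shift-cong k (λ k → ∑ᵗ-cong (M v) k (λ ns p _ →
                 sym (≡.trans (edgeSum-build f-inv (gr v []) id es ns (≡.trans p (sym len))) (+-identityˡ _))))) ⟩
          two * shift I k ∎
        -- Lowering k by one leaves the range k < C. The term k = C can be put back because n < C ≤
        -- v + C makes it zero; this is where the bound on N enters.
        lower : ∀ N → N ≤ C → ∑ (upTo (suc C)) (λ k → χ (N ℕ.≡ᵇ v ℕ.+ k) * (two * shift I k)) ≡ shift (λ n → two * grow (edgeSum f) v es n) N
        lower zero    _    = ∑-0 (upTo (suc C)) (λ
          { zero    → ≡.trans (cong (χ (0 ℕ.≡ᵇ v ℕ.+ 0) *_) (*-zeroʳ two)) (*-zeroʳ _)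
          ; (suc k) → χ-false* (two * I k) (cong (0 ℕ.≡ᵇ_) (ℕP.+-suc v k)) })
        lower (suc n) n<C = begin
          ∑ (upTo (suc C)) (λ k → χ (suc n ℕ.≡ᵇ v ℕ.+ k) * (two * shift I k))
            ≡⟨ ∑-upTo-suc C _ ⟩
          χ (suc n ℕ.≡ᵇ v ℕ.+ 0) * (two * 0ℚ) + ∑ (upTo C) (λ k → χ (suc n ℕ.≡ᵇ v ℕ.+ suc k) * (two * I k))
            ≡⟨ cong₂ _+_ (≡.trans (cong (χ (suc n ℕ.≡ᵇ v ℕ.+ 0) *_) (*-zeroʳ two)) (*-zeroʳ _))
                 (∑-cong (upTo C) (λ k → cong (λ m → χ (suc n ℕ.≡ᵇ m) * (two * I k)) (ℕP.+-suc v k))) ⟩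
          0ℚ + ∑ (upTo C) (λ k → χ (n ℕ.≡ᵇ v ℕ.+ k) * (two * I k))
            ≡⟨ ≡.trans (+-comm 0ℚ _) (cong (∑ (upTo C) (λ k → χ (n ℕ.≡ᵇ v ℕ.+ k) * (two * I k)) +_) (sym (χ-false* (two * I C) beyond))) ⟩
          ∑ (upTo C) (λ k → χ (n ℕ.≡ᵇ v ℕ.+ k) * (two * I k)) + χ (n ℕ.≡ᵇ v ℕ.+ C) * (two * I C)
            ≡⟨ sym (∑-upTo-last C _) ⟩
          ∑ (upTo (suc C)) (λ k → χ (n ℕ.≡ᵇ v ℕ.+ k) * (two * I k))
            ≡⟨ ∑-cong (upTo (suc C)) (λ k → *-left-comm (χ (n ℕ.≡ᵇ v ℕ.+ k)) two (I k)) ⟩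
          ∑ (upTo (suc C)) (λ k → two * (χ (n ℕ.≡ᵇ v ℕ.+ k) * I k))
            ≡⟨ sym (∑-*ˡ two _ (upTo (suc C))) ⟩
          two * ∑ (upTo (suc C)) (λ k → χ (n ℕ.≡ᵇ v ℕ.+ k) * I k)
            ≡⟨ cong (two *_) (sym (grow-leafless (edgeSum-Inv f-inv) (edgeSum-Leafless leafless) v es len md n)) ⟩
          two * grow (edgeSum f) v es n ∎
          where
          beyond : (n ℕ.≡ᵇ v ℕ.+ C) ≡ false
          beyond with n ℕ.≡ᵇ v ℕ.+ C in eq
          ... | false = refl
          ... | true  = ⊥-elim (ℕP.<-irrefl (ℕP.≡ᵇ⇒≡ n (v ℕ.+ C) (subst T (sym eq) tt)) (ℕP.≤-trans n<C (ℕP.m≤n+m C v)))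

    module _ (leafless : Leafless f) (jointless : ∀ G → joints G ≢ 0 → f G ≡ 0ℚ) where

      private
        Q : ℕ → ℚ
        Q v = wt v (M v) * ∑ (lists (M v) (pairs v)) (λ es → χ (connᵇ v es ∧ md3 v es) * f (gr v es))

      grow-core : ∀ v es → length es ≡ M v → T (md3 v es) → ∀ N → grow f v es N ≡ χ (N ℕ.≡ᵇ v) * f (gr v es)
      grow-core v es len md N = begin
        grow f v es N
          ≡⟨ grow-leafless f-inv leafless v es len md N ⟩
        ∑ (upTo (suc C)) (λ k → χ (N ℕ.≡ᵇ v ℕ.+ k) * ∑ᵗ (M v) k (λ ns → f (subdivided v es ns)))
          ≡⟨ ∑-upTo-suc C _ ⟩
        χ (N ℕ.≡ᵇ v ℕ.+ 0) * ∑ᵗ (M v) 0 (λ ns → f (subdivided v es ns)) +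
          ∑ (upTo C) (λ k → χ (N ℕ.≡ᵇ v ℕ.+ suc k) * ∑ᵗ (M v) (suc k) (λ ns → f (subdivided v es ns)))
          ≡⟨ cong₂ _+_ (cong₂ (λ m z → χ (N ℕ.≡ᵇ m) * z) (ℕP.+-identityʳ v) trivial)
               (∑-0 (upTo C) (λ k → ≡.trans (cong (χ (N ℕ.≡ᵇ v ℕ.+ suc k) *_) (∑ᵗ-0 (M v) (suc k) (nontrivial k))) (*-zeroʳ _))) ⟩
        χ (N ℕ.≡ᵇ v) * f (gr v es) + 0ℚ
          ≡⟨ +-identityʳ _ ⟩
        χ (N ℕ.≡ᵇ v) * f (gr v es) ∎
        where
        trivial : ∑ᵗ (M v) 0 (λ ns → f (subdivided v es ns)) ≡ f (gr v es)
        trivial = ≡.trans (∑ᵗ-zeros (M v) _) (≡.trans (cong (λ m → f (subdivided v es (List.replicate m 0))) (sym len))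
          (≡.trans (build-zeros f-inv (gr v []) id es) (cong (f ∘ gr v) (ListP.map-id es))))
        nontrivial : ∀ k ns → length ns ≡ M v → total ns ≡ suc k → f (subdivided v es ns) ≡ 0ℚ
        nontrivial k ns p q = jointless _ (λ eq → impossible (≡.trans (sym (≡.trans (subdivided-joints v es md ns (≡.trans p (sym len))) (cong (ℕ._* 2) q))) eq))
          where
          impossible : suc k ℕ.* 2 ≢ 0
          impossible ()

      -- On the right only the graph without subdivisions and with trivial trees survives. On the
      -- left `no-leaves-no-joints` restricts the support to minimum degree 3, and `md3-bound` puts
      -- N into the range of `Ω` unless both sides vanish.
      Φ-core : ∀ N → Λ h f N ≡ Φ f N
      Φ-core N = sym (begin
        Φ f N
          ≡⟨ Ω-cong (λ v es len md → grow-core v es len md N) ⟩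
        Ω (λ v es → χ (N ℕ.≡ᵇ v) * f (gr v es))
          ≡⟨ ∑-cong (upTo (suc (2 ℕ.* suc (suc h) ∸ 2))) (λ v → ≡.trans (cong (wt v (M v) *_) (≡.trans
               (∑-cong (lists (M v) (pairs v)) (λ es → *-left-comm (χ (connᵇ v es ∧ md3 v es)) (χ (N ℕ.≡ᵇ v)) _)) (sym (∑-*ˡ (χ (N ℕ.≡ᵇ v)) _ (lists (M v) (pairs v))))))
               (*-left-comm (wt v (M v)) (χ (N ℕ.≡ᵇ v)) _)) ⟩
        ∑ (upTo (suc (2 ℕ.* suc (suc h) ∸ 2))) (λ v → χ (N ℕ.≡ᵇ v) * Q v)
          ≡⟨ ∑-upTo-χ (suc (2 ℕ.* suc (suc h) ∸ 2)) N Q ⟩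
        χ (N ℕ.<ᵇ suc (2 ℕ.* suc (suc h) ∸ 2)) * Q N
          ≡⟨ in-range ⟩
        Q N
          ≡⟨ cong (wt N (M N) *_) (∑-cong-All (All.map (λ {es} → core-only es) (length-lists (M N) (pairs N)))) ⟩
        Λ h f N ∎)
        where
        core-only : ∀ es → length es ≡ M N → χ (connᵇ N es ∧ md3 N es) * f (gr N es) ≡ χ (connᵇ N es) * f (gr N es)
        core-only es len with connᵇ N es in e | md3 N es in e′
        ... | false | _     = refl
        ... | true  | true  = refl
        ... | true  | false with leaves (gr N es) ℕ.≟ 0 | joints (gr N es) ℕ.≟ 0
        ...   | no l  | _     = ≡.trans (*-zeroˡ _) (sym (≡.trans (*-identityˡ _) (leafless _ l)))
        ...   | yes _ | no j  = ≡.trans (*-zeroˡ _) (sym (≡.trans (*-identityˡ _) (jointless _ j)))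
        ...   | yes l | yes j = ⊥-elim (subst T e′ (no-leaves-no-joints h N es len (connᵇ⁻ es (subst T (sym e) tt)) l j))
        in-range : χ (N ℕ.<ᵇ suc (2 ℕ.* suc (suc h) ∸ 2)) * Q N ≡ Q N
        in-range with N ℕ.<ᵇ suc (2 ℕ.* suc (suc h) ∸ 2) in e
        ... | true  = *-identityˡ _
        ... | false = ≡.trans (*-zeroˡ _) (sym (≡.trans (cong (wt N (M N) *_) (≡.trans
            (∑-cong-All (All.map (λ {es} → out es) (length-lists (M N) (pairs N)))) (∑-0 (lists (M N) (pairs N)) (λ _ → refl)))) (*-zeroʳ _)))
          where
          out : ∀ es → length es ≡ M N → χ (connᵇ N es ∧ md3 N es) * f (gr N es) ≡ 0ℚ
          out es len with connᵇ N es | md3 N es in e′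
          ... | false | _     = *-zeroˡ _
          ... | true  | false = *-zeroˡ _
          ... | true  | true  = ⊥-elim (subst T e (ℕP.<⇒<ᵇ (md3-bound h N es len (subst T (sym e′) tt))))

  -- The statement quantifies over f inside the induction on N, since N - 1 is used for `leafSum f₁`
  -- and `edgeSum f₂` and never for f itself.
  Λ≡Φ : ∀ N → N ≤ C → ∀ f → Inv f → Λ h f N ≡ Φ f N
  Λ≡Φ N N≤C f f-inv = begin
    Λ h f N
      ≡⟨ Λ-cong h N parts ⟩
    Λ h (λ G → nat (leaves G) * f₁ G + (nat (joints G) * f₂ G + f₃ G)) N
      ≡⟨ ≡.trans (Λ-+ h (λ G → nat (leaves G) * f₁ G) (λ G → nat (joints G) * f₂ G + f₃ G) N)
           (cong (Λ h (λ G → nat (leaves G) * f₁ G) N +_) (Λ-+ h (λ G → nat (joints G) * f₂ G) f₃ N)) ⟩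
    Λ h (λ G → nat (leaves G) * f₁ G) N + (Λ h (λ G → nat (joints G) * f₂ G) N + Λ h f₃ N)
      ≡⟨ cong₂ _+_ (≡.trans (Λ-leaves h f₁-inv N) (≡.trans (by-induction (leafSum-Inv f₁-inv)) (sym (Φ-leaves f₁-inv N))))
           (cong₂ _+_ (≡.trans (Λ-joints h f₂-inv N) (≡.trans (by-induction₂ (edgeSum-Inv f₂-inv)) (sym (Φ-joints f₂-inv f₂-leafless N N≤C))))
                      (Φ-core f₃-inv f₃-leafless (λ G ne → χ-≢0 _ ne) N)) ⟩
    Φ (λ G → nat (leaves G) * f₁ G) N + (Φ (λ G → nat (joints G) * f₂ G) N + Φ f₃ N)
      ≡⟨ sym (≡.trans (Φ-+ (λ G → nat (leaves G) * f₁ G) (λ G → nat (joints G) * f₂ G + f₃ G) N)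
           (cong (Φ (λ G → nat (leaves G) * f₁ G) N +_) (Φ-+ (λ G → nat (joints G) * f₂ G) f₃ N))) ⟩
    Φ (λ G → nat (leaves G) * f₁ G + (nat (joints G) * f₂ G + f₃ G)) N
      ≡⟨ sym (Φ-cong N parts) ⟩
    Φ f N ∎
    where
    -- `f₂` is formed from `f₀` and not from `f` because `Φ-joints` demands an invariant that
    -- vanishes on graphs with leaves; for the same reason `f₃` satisfies both conditions of
    -- `Φ-core`.
    f₀ f₁ f₂ f₃ : Gr → ℚ
    f₀ G = χ (leaves G ℕ.≡ᵇ 0) * f G
    f₁ G = f G * recip (leaves G)
    f₂ G = f₀ G * recip (joints G)
    f₃ G = χ (joints G ℕ.≡ᵇ 0) * f₀ G
    parts : ∀ G → f G ≡ nat (leaves G) * f₁ G + (nat (joints G) * f₂ G + f₃ G)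
    parts G = ≡.trans (split-by (leaves G) (f G)) (cong (nat (leaves G) * f₁ G +_) (split-by (joints G) (f₀ G)))
    f₀-inv : Inv f₀
    f₀-inv ρ = cong₂ (λ l z → χ (l ℕ.≡ᵇ 0) * z) (leaves-Inv ρ) (f-inv ρ)
    f₁-inv : Inv f₁
    f₁-inv ρ = cong₂ (λ l z → z * recip l) (leaves-Inv ρ) (f-inv ρ)
    f₂-inv : Inv f₂
    f₂-inv ρ = cong₂ (λ l z → z * recip l) (joints-Inv ρ) (f₀-inv ρ)
    f₃-inv : Inv f₃
    f₃-inv ρ = cong₂ (λ l z → χ (l ℕ.≡ᵇ 0) * z) (joints-Inv ρ) (f₀-inv ρ)
    f₂-leafless : Leafless f₂
    f₂-leafless G ne = ≡.trans (cong (_* recip (joints G)) (χ-≢0 (f G) ne)) (*-zeroˡ _)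
    f₃-leafless : Leafless f₃
    f₃-leafless G ne = ≡.trans (cong (χ (joints G ℕ.≡ᵇ 0) *_) (χ-≢0 (f G) ne)) (*-zeroʳ _)
    by-induction : ∀ {g} → Inv g → shift (Λ h g) N ≡ shift (Φ g) N
    by-induction = go N N≤C
      where
      go : ∀ N → N ≤ C → ∀ {g} → Inv g → shift (Λ h g) N ≡ shift (Φ g) N
      go zero    _   g-inv = refl
      go (suc N) N<C g-inv = Λ≡Φ N (ℕP.≤-trans (ℕP.n≤1+n N) N<C) _ g-inv
    by-induction₂ : ∀ {g} → Inv g → shift (λ n → two * Λ h g n) N ≡ shift (λ n → two * Φ g n) N
    by-induction₂ {g} g-inv = ≡.trans (shift-*ˡ N two (Λ h g)) (≡.trans (cong (two *_) (by-induction g-inv)) (sym (shift-*ˡ N two (Φ g))))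

-- Laurent polynomials and power series

-- A list of terms represents a Laurent polynomial in many ways. Reading it as the functional that
-- sends t^k to φ k removes the ambiguity, and testing against `δ k` recovers the coefficient.
⟦_⟧ : LPoly → (ℤ → ℚ) → ℚ
⟦ p ⟧ φ = ∑ p (λ (k , a) → a * φ k)

δ : ℤ → ℤ → ℚ
δ k j = χ (does (j ℤ.≟ k))

coeff-⟦⟧ : ∀ k p → coeff k p ≡ ⟦ p ⟧ (δ k)
coeff-⟦⟧ k []            = refl
coeff-⟦⟧ k ((j , a) ∷ p) with does (j ℤ.≟ k)
... | true  = ≡.trans (sym (+-def a (coeff k p))) (cong₂ _+_ (sym (*-identityʳ a)) (coeff-⟦⟧ k p))
... | false = ≡.trans (coeff-⟦⟧ k p) (sym (≡.trans (cong (_+ ⟦ p ⟧ (δ k)) (*-zeroʳ a)) (+-identityˡ _)))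

⟦⟧-cong : ∀ p {φ ψ} → (∀ k → φ k ≡ ψ k) → ⟦ p ⟧ φ ≡ ⟦ p ⟧ ψ
⟦⟧-cong p eq = ∑-cong p (λ (k , a) → cong (a *_) (eq k))

⟦⟧-scaleP : ∀ q p φ → ⟦ scaleP q p ⟧ φ ≡ q * ⟦ p ⟧ φ
⟦⟧-scaleP q p φ = ≡.trans (∑-map _ p _) (≡.trans
  (∑-cong p (λ (k , a) → ≡.trans (cong (_* φ k) (sym (*-def q a))) (*-assoc q a (φ k)))) (sym (∑-*ˡ q _ p)))

⟦⟧-shiftP : ∀ j p φ → ⟦ shiftP j p ⟧ φ ≡ ⟦ p ⟧ (λ k → φ (j ℤ.+ k))
⟦⟧-shiftP j p φ = ∑-map _ p _

⟦⟧-∑ : ∀ p (xs : List A) (φ : A → ℤ → ℚ) → ⟦ p ⟧ (λ k → ∑ xs (λ x → φ x k)) ≡ ∑ xs (λ x → ⟦ p ⟧ (φ x))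
⟦⟧-∑ p xs φ = ≡.trans (∑-cong p (λ (k , a) → ∑-*ˡ a _ xs)) (∑-swap p xs _)

⟦⟧-⨁ : ∀ p N (φ : ℕ → ℕ → ℤ → ℚ) → ⟦ p ⟧ (λ k → ⨁ N (λ i j → φ i j k)) ≡ ⨁ N (λ i j → ⟦ p ⟧ (φ i j))
⟦⟧-⨁ p N φ = ≡.trans (∑-cong p (λ (k , a) → ⨁-*ˡ N a _)) (⨁-∑ N p _)

⟦⟧-swap : ∀ p r (φ : ℤ → ℤ → ℚ) → ⟦ p ⟧ (λ k → ⟦ r ⟧ (φ k)) ≡ ⟦ r ⟧ (λ l → ⟦ p ⟧ (λ k → φ k l))
⟦⟧-swap p r φ = ≡.trans (⟦⟧-∑ p r (λ (l , b) k → b * φ k l)) (∑-cong r (λ (l , b) →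
  ≡.trans (∑-cong p (λ (k , a) → *-left-comm a b (φ k l))) (sym (∑-*ˡ b _ p))))

⟦⟧-mulP : ∀ p r φ → ⟦ mulP p r ⟧ φ ≡ ⟦ p ⟧ (λ k → ⟦ r ⟧ (λ l → φ (k ℤ.+ l)))
⟦⟧-mulP p r φ = ≡.trans (∑-concatMap-map (λ (k , a) (l , b) → (k ℤ.+ l , a ℚ.* b)) p r _)
  (∑-cong p (λ (k , a) → ≡.trans (∑-cong r (λ (l , b) → ≡.trans (cong (_* φ (k ℤ.+ l)) (sym (*-def a b))) (*-assoc a b _))) (sym (∑-*ˡ a _ r))))

infix 3 _≈_

record _≈_ (s u : Series) : Set where
  constructor equal
  field
    at : ∀ N φ → ⟦ s N ⟧ φ ≡ ⟦ u N ⟧ φ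

open _≈_ public

≈-sym : ∀ {s u} → s ≈ u → u ≈ s
≈-sym p .at N φ = sym (at p N φ)

≈-trans : ∀ {s u w} → s ≈ u → u ≈ w → s ≈ w
≈-trans p q .at N φ = ≡.trans (at p N φ) (at q N φ)

⟦⟧-⊗ : ∀ s u N φ → ⟦ (s ⊗ u) N ⟧ φ ≡ ⨁ N (λ i j → ⟦ s i ⟧ (λ k → ⟦ u j ⟧ (λ l → φ (k ℤ.+ l))))
⟦⟧-⊗ s u N φ = ≡.trans (∑-concatMap (λ i → mulP (s i) (u (N ∸ i))) (upTo (suc N)) _)
  (≡.trans (∑-cong (upTo (suc N)) (λ i → ⟦⟧-mulP (s i) (u (N ∸ i)) φ)) (⨁-upTo N (λ i j → ⟦ s i ⟧ (λ k → ⟦ u j ⟧ (λ l → φ (k ℤ.+ l))))))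

⊗-congʳ : ∀ s {u w} → u ≈ w → s ⊗ u ≈ s ⊗ w
⊗-congʳ s {u} {w} p .at N φ = ≡.trans (⟦⟧-⊗ s u N φ) (≡.trans (⨁-cong N (λ i j → ⟦⟧-cong (s i) (λ k → at p j _))) (sym (⟦⟧-⊗ s w N φ)))

⊗-congˡ : ∀ {s u} w → s ≈ u → s ⊗ w ≈ u ⊗ w
⊗-congˡ {s} {u} w p .at N φ = ≡.trans (⟦⟧-⊗ s w N φ) (≡.trans (⨁-cong N (λ i j → at p i _)) (sym (⟦⟧-⊗ u w N φ)))

⊗-comm : ∀ s u → s ⊗ u ≈ u ⊗ s
⊗-comm s u .at N φ = begin
  ⟦ (s ⊗ u) N ⟧ φ                                                ≡⟨ ⟦⟧-⊗ s u N φ ⟩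
  ⨁ N (λ i j → ⟦ s i ⟧ (λ k → ⟦ u j ⟧ (λ l → φ (k ℤ.+ l))))      ≡⟨ ⨁-comm N _ ⟩
  ⨁ N (λ j i → ⟦ s i ⟧ (λ k → ⟦ u j ⟧ (λ l → φ (k ℤ.+ l))))      ≡⟨ ⨁-cong N (λ j i → ≡.trans (⟦⟧-swap (s i) (u j) _)
                                                                       (⟦⟧-cong (u j) (λ l → ⟦⟧-cong (s i) (λ k → cong φ (ℤP.+-comm k l))))) ⟩
  ⨁ N (λ j i → ⟦ u j ⟧ (λ l → ⟦ s i ⟧ (λ k → φ (l ℤ.+ k))))      ≡⟨ sym (⟦⟧-⊗ u s N φ) ⟩
  ⟦ (u ⊗ s) N ⟧ φ                                                ∎

⊗-assoc : ∀ s u w → (s ⊗ u) ⊗ w ≈ s ⊗ (u ⊗ w)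
⊗-assoc s u w .at N φ = begin
  ⟦ ((s ⊗ u) ⊗ w) N ⟧ φ
    ≡⟨ ⟦⟧-⊗ (s ⊗ u) w N φ ⟩
  ⨁ N (λ m l → ⟦ (s ⊗ u) m ⟧ (λ x → ⟦ w l ⟧ (λ z → φ (x ℤ.+ z))))
    ≡⟨ ⨁-cong N (λ m l → ⟦⟧-⊗ s u m _) ⟩
  ⨁ N (λ m l → ⨁ m (λ i k → ⟦ s i ⟧ (λ x → ⟦ u k ⟧ (λ y → ⟦ w l ⟧ (λ z → φ ((x ℤ.+ y) ℤ.+ z))))))
    ≡⟨ sym (⨁-assoc N _) ⟩
  ⨁ N (λ i j → ⨁ j (λ k l → ⟦ s i ⟧ (λ x → ⟦ u k ⟧ (λ y → ⟦ w l ⟧ (λ z → φ ((x ℤ.+ y) ℤ.+ z))))))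
    ≡⟨ ⨁-cong N (λ i j → sym (⟦⟧-⨁ (s i) j _)) ⟩
  ⨁ N (λ i j → ⟦ s i ⟧ (λ x → ⨁ j (λ k l → ⟦ u k ⟧ (λ y → ⟦ w l ⟧ (λ z → φ ((x ℤ.+ y) ℤ.+ z))))))
    ≡⟨ ⨁-cong N (λ i j → ⟦⟧-cong (s i) (λ x → ≡.trans
         (⨁-cong j (λ k l → ⟦⟧-cong (u k) (λ y → ⟦⟧-cong (w l) (λ z → cong φ (ℤP.+-assoc x y z)))))
         (sym (⟦⟧-⊗ u w j _)))) ⟩
  ⨁ N (λ i j → ⟦ s i ⟧ (λ x → ⟦ (u ⊗ w) j ⟧ (λ y → φ (x ℤ.+ y))))
    ≡⟨ sym (⟦⟧-⊗ s (u ⊗ w) N φ) ⟩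
  ⟦ (s ⊗ (u ⊗ w)) N ⟧ φ ∎

⊗-left-comm : ∀ s u w → s ⊗ (u ⊗ w) ≈ u ⊗ (s ⊗ w)
⊗-left-comm s u w = ≈-trans (≈-sym (⊗-assoc s u w)) (≈-trans (⊗-congˡ w (⊗-comm s u)) (⊗-assoc u s w))

⊗-identityˡ : ∀ s → oneS ⊗ s ≈ s
⊗-identityˡ s .at N φ = ≡.trans (⟦⟧-⊗ oneS s N φ) (≡.trans (⨁-head N _ (λ i j → refl))
  (≡.trans (+-identityʳ _) (≡.trans (*-identityˡ _) (⟦⟧-cong (s N) (λ l → cong φ (ℤP.+-identityˡ l))))))

prodS : List Series → Series
prodS []       = oneS
prodS (s ∷ ss) = s ⊗ prodS ss

-- the series substituted for a vertex, given whether it is black and whether its black-neighbour count is even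
vertexS : Bool → Bool → Series
vertexS true  _     = 𝒯b
vertexS false true  = 𝒯w+ ⊕ 𝒯w-
vertexS false false = shiftS (ℤ.-[1+ 0 ]) 𝒯w+ ⊕ shiftS (ℤ.+ 1) 𝒯w-

substMono-zero : substMono (0 , 0 , 0) ≈ oneS
substMono-zero = ≈-trans (⊗-identityˡ (oneS ⊗ oneS)) (⊗-identityˡ oneS)

-- Sorting the factors of a product over coloured vertices by type turns it into the substituted
-- monomial of that colouring.
prodS-substMono : ∀ (c e : A → Bool) xs →
  prodS (map (λ x → vertexS (c x) (e x)) xs) ≈
  substMono (sumℕ (bit ∘ c) xs , sumℕ (λ x → bit (not (c x) ∧ e x)) xs , sumℕ (λ x → bit (not (c x) ∧ not (e x))) xs)
prodS-substMono c e []       = ≈-sym substMono-zero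
prodS-substMono c e (x ∷ xs) = ≈-trans
  (⊗-congʳ (vertexS (c x) (e x)) (prodS-substMono c e xs)) (step (c x) (e x))
  where
  i = sumℕ (bit ∘ c) xs
  j = sumℕ (λ x → bit (not (c x) ∧ e x)) xs
  k = sumℕ (λ x → bit (not (c x) ∧ not (e x))) xs
  P = powS 𝒯b i
  Q = powS (𝒯w+ ⊕ 𝒯w-) j
  R = powS (shiftS (ℤ.-[1+ 0 ]) 𝒯w+ ⊕ shiftS (ℤ.+ 1) 𝒯w-) k
  step : ∀ b p → vertexS b p ⊗ substMono (i , j , k) ≈
         substMono (bit b ℕ.+ i , bit (not b ∧ p) ℕ.+ j , bit (not b ∧ not p) ℕ.+ k)
  step true  p     = ≈-sym (⊗-assoc 𝒯b P (Q ⊗ R))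
  step false true  = ≈-trans (⊗-left-comm s P (Q ⊗ R))
    (⊗-congʳ P (≈-sym (⊗-assoc s Q R)))
    where s = vertexS false true
  step false false = ≈-trans (⊗-left-comm s P (Q ⊗ R))
    (⊗-congʳ P (⊗-left-comm s Q R))
    where s = vertexS false false

-- Orbits of relabellings

-- The functions enumerated by `allFuns` agree with composites or with `cons` only pointwise, so
-- sums over them are transformed for summands that respect pointwise equality.
Ext : ∀ {X A B : Set} → ((X → A) → B) → Set
Ext F = ∀ {f g} → (∀ i → f i ≡ g i) → F f ≡ F g

cons : ∀ {m} {A : Set} → A → (Fin m → A) → Fin (suc m) → A
cons a f Fin.zero    = a
cons a f (Fin.suc i) = f i

cons-cong : ∀ {m} {A : Set} (a : A) {f g : Fin m → A} → (∀ i → f i ≡ g i) → ∀ i → cons a f i ≡ cons a g i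
cons-cong a eq Fin.zero    = refl
cons-cong a eq (Fin.suc i) = eq i

∑-allFuns-suc : ∀ m (xs : List A) (F : (Fin (suc m) → A) → ℚ) → Ext F →
                ∑ (allFuns (suc m) xs) F ≡ ∑ xs (λ a → ∑ (allFuns m xs) (λ f → F (cons a f)))
∑-allFuns-suc m xs F F-ext = ≡.trans (∑-concatMap-map _ xs (allFuns m xs) F)
  (∑-cong xs (λ a → ∑-cong (allFuns m xs) (λ f → F-ext (λ { Fin.zero → refl ; (Fin.suc i) → refl }))))

-- The permutation of the values may vary with the argument: the flips of edges are shifted by an
-- amount that depends on the edge.
∑-allFuns-map : ∀ m (xs : List A) (s : Fin m → A → A) → (∀ i f → ∑ xs f ≡ ∑ xs (f ∘ s i)) → (F : (Fin m → A) → ℚ) → Ext F →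
                ∑ (allFuns m xs) F ≡ ∑ (allFuns m xs) (λ f → F (λ i → s i (f i)))
∑-allFuns-map zero    xs s inv F F-ext = cong (_+ 0ℚ) (F-ext (λ ()))
∑-allFuns-map (suc m) xs s inv F F-ext = begin
  ∑ (allFuns (suc m) xs) F
    ≡⟨ ∑-allFuns-suc m xs F F-ext ⟩
  ∑ xs (λ a → ∑ (allFuns m xs) (λ f → F (cons a f)))
    ≡⟨ inv Fin.zero _ ⟩
  ∑ xs (λ a → ∑ (allFuns m xs) (λ f → F (cons (s Fin.zero a) f)))
    ≡⟨ ∑-cong xs (λ a → ∑-allFuns-map m xs (s ∘ Fin.suc) (inv ∘ Fin.suc) _ (λ eq → F-ext (cons-cong _ eq))) ⟩
  ∑ xs (λ a → ∑ (allFuns m xs) (λ f → F (cons (s Fin.zero a) (λ i → s (Fin.suc i) (f i)))))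
    ≡⟨ ∑-cong xs (λ a → ∑-cong (allFuns m xs) (λ f → F-ext (λ { Fin.zero → refl ; (Fin.suc i) → refl }))) ⟩
  ∑ xs (λ a → ∑ (allFuns m xs) (λ f → F (λ i → s i (cons a f i))))
    ≡⟨ sym (∑-allFuns-suc m xs _ (λ eq → F-ext (λ i → cong (s i) (eq i)))) ⟩
  ∑ (allFuns (suc m) xs) (λ f → F (λ i → s i (f i))) ∎

allF-suc : ∀ n p → allF (suc n) p ≡ (p Fin.zero ∧ allF n (p ∘ Fin.suc))
allF-suc n p = cong (λ l → p Fin.zero ∧ List.foldr _∧_ true l) (≡.trans (cong (map p) (sym (ListP.map-tabulate id Fin.suc))) (sym (ListP.map-∘ (allFin n))))

allF-cong : ∀ n {p q : Fin n → Bool} → (∀ i → p i ≡ q i) → allF n p ≡ allF n q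
allF-cong n eq = cong (List.foldr _∧_ true) (ListP.map-cong eq (allFin n))

injᵇ : ∀ {k n} → (Fin k → Fin n) → Bool
injᵇ {k} f = allF k (λ i → allF k (λ j → not (f i == f j) ∨ (i == j)))

injᵇ-ext : ∀ {k n} {f g : Fin k → Fin n} → (∀ i → f i ≡ g i) → injᵇ f ≡ injᵇ g
injᵇ-ext {k} eq = allF-cong k (λ i → allF-cong k (λ j → cong₂ (λ a b → not (a == b) ∨ (i == j)) (eq i) (eq j)))

injᵇ⁻ : ∀ {k n} (f : Fin k → Fin n) → T (injᵇ f) → Injective f
injᵇ⁻ {k} f t {a} {b} eq = ==⇒≡ (imp (f a == f b) (allF⁻ _ (allF⁻ _ t a) b) (≡⇒== eq))
  where
  imp : ∀ x {y} → T (not x ∨ y) → T x → T y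
  imp true t _ = t

injᵇ⁺ : ∀ {k n} (f : Fin k → Fin n) → Injective f → T (injᵇ f)
injᵇ⁺ {k} f inj = allF⁺ _ (λ i → allF⁺ _ (λ j → imp (f i == f j) (λ t → ≡⇒== (inj (==⇒≡ t)))))
  where
  imp : ∀ x {y} → (T x → T y) → T (not x ∨ y)
  imp true  f = f tt
  imp false f = tt

bools : List Bool
bools = true ∷ false ∷ []

xor : Bool → Bool → Bool
xor true  b = not b
xor false b = b

∑-perms : ∀ n F → ∑ (perms n) F ≡ ∑ (allFuns n (allFin n)) (λ σ → χ (injᵇ σ) * F σ)
∑-perms n F = ∑-filter injᵇ (allFuns n (allFin n)) F

∑-isoData : ∀ n m F → ∑ (isoData n m) F ≡ ∑ (perms n) (λ σ → ∑ (perms m) (λ π → ∑ (allFuns m bools) (λ κ → F (σ , π , κ))))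
∑-isoData n m F = ≡.trans (∑-concatMap _ (perms n) F) (∑-cong (perms n) (λ σ →
  ∑-concatMap-map (λ π κ → (σ , π , κ)) (perms m) (allFuns m bools) F))

∑-perms-compose : ∀ {n} (s : Fin n → Fin n) → Injective s → ∀ F → Ext F → ∑ (perms n) F ≡ ∑ (perms n) (λ σ → F (s ∘ σ))
∑-perms-compose {n} s inj F F-ext = begin
  ∑ (perms n) F                                                    ≡⟨ ∑-perms n F ⟩
  ∑ (allFuns n (allFin n)) (λ σ → χ (injᵇ σ) * F σ)                ≡⟨ ∑-allFuns-map n (allFin n) (λ _ → s) (λ _ → ∑-permute s inj) _
                                                                        (λ eq → cong₂ (λ b z → χ b * z) (injᵇ-ext eq) (F-ext eq)) ⟩
  ∑ (allFuns n (allFin n)) (λ σ → χ (injᵇ (s ∘ σ)) * F (s ∘ σ))    ≡⟨ ∑-cong (allFuns n (allFin n)) (λ σ → cong (λ b → χ b * F (s ∘ σ))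
                                                                        (T-ext (λ t → injᵇ⁺ σ (λ eq → injᵇ⁻ (s ∘ σ) t (cong s eq))) (λ t → injᵇ⁺ (s ∘ σ) (λ eq → injᵇ⁻ σ t (inj eq))))) ⟩
  ∑ (allFuns n (allFin n)) (λ σ → χ (injᵇ σ) * F (s ∘ σ))          ≡⟨ sym (∑-perms n _) ⟩
  ∑ (perms n) (λ σ → F (s ∘ σ))                                    ∎

perms-injective : ∀ n → All (λ σ → T (injᵇ σ)) (perms n)
perms-injective n = AllP.all-filter (λ σ → BoolP.T? (injᵇ σ)) (allFuns n (allFin n))

isoData-perms : ∀ n m → All (λ (σ , π , κ) → T (injᵇ σ) × T (injᵇ π)) (isoData n m)
isoData-perms n m = AllP.concat⁺ (AllP.map⁺ (All.map (λ tσ → AllP.concat⁺ (AllP.map⁺ (All.map (λ tπ → AllP.map⁺ (All.universal (λ κ → tσ , tπ) (allFuns m bools)))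
  (perms-injective m)))) (perms-injective n)))

isIso-cong : ∀ {n m} (G G′ : LGraph n m) σ σ′ π π′ κ κ′ → (∀ i → σ i ≡ σ′ i) → (∀ e → π e ≡ π′ e) → (∀ e → κ e ≡ κ′ e) →
             isIso G G′ (σ , π , κ) ≡ isIso G G′ (σ′ , π′ , κ′)
isIso-cong {m = m} G G′ σ σ′ π π′ κ κ′ σ≡ π≡ κ≡ = allF-cong m (λ e → cong₂ _==²_ (cong G′ (π≡ e))
  (cong₂ flipIf (κ≡ e) (cong₂ _,_ (σ≡ (proj₁ (G e))) (σ≡ (proj₂ (G e))))))

module _ {n m : ℕ} (G G′ : LGraph n m) {σ₀ : Fin n → Fin n} {π₀ : Fin m → Fin m} (κ₀ : Fin m → Bool)
  (σ₀-inj : Injective σ₀) (π₀-inj : Injective π₀) (iso : T (isIso G G′ (σ₀ , π₀ , κ₀))) where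

  -- Flips compose by exclusive or, where `κ₀` is read at the edge `π e` to which `π` has already
  -- moved e. Composition with a fixed isomorphism to `G′` thus turns automorphisms of `G` into
  -- isomorphisms, and only these.
  isIso-compose : ∀ σ π κ → isIso G G′ (σ₀ ∘ σ , π₀ ∘ π , λ e → xor (κ₀ (π e)) (κ e)) ≡ isIso G G (σ , π , κ)
  isIso-compose σ π κ = allF-cong m (λ e → ≡.trans
    (cong (_==² flipIf (xor (κ₀ (π e)) (κ e)) (map² (σ₀ ∘ σ) (G e))) (==²⇒≡ {p = G′ (π₀ (π e))} {q = flipIf (κ₀ (π e)) (σ₀ (proj₁ (G (π e))) , σ₀ (proj₂ (G (π e))))} (allF⁻ (λ e → G′ (π₀ e) ==² flipIf (κ₀ e) (σ₀ (proj₁ (G e)) , σ₀ (proj₂ (G e)))) iso (π e))))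
    (cancel (κ₀ (π e)) (κ e) (G (π e)) (map² σ (G e))))
    where
    same : ∀ a b c d → ((σ₀ a , σ₀ b) ==² (σ₀ c , σ₀ d)) ≡ ((a , b) ==² (c , d))
    same a b c d = cong₂ _∧_ (does-inj FinP._≟_ FinP._≟_ σ₀ σ₀-inj a c) (does-inj FinP._≟_ FinP._≟_ σ₀ σ₀-inj b d)
    cancel : ∀ x y p q → (flipIf x (σ₀ (proj₁ p) , σ₀ (proj₂ p)) ==² flipIf (xor x y) (σ₀ (proj₁ q) , σ₀ (proj₂ q))) ≡ (p ==² flipIf y q)
    cancel false false p       (c , d) = same _ _ c d
    cancel false true  p       (c , d) = same _ _ d c
    cancel true  false (a , b) (c , d) = ≡.trans (same b a d c) (BoolP.∧-comm (b == d) (a == c))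
    cancel true  true  (a , b) (c , d) = ≡.trans (same b a c d) (BoolP.∧-comm (b == c) (a == d))

  -- the isomorphisms G → G′ form a torsor under the automorphisms of G
  ∑-isIso-torsor : ∀ (w : (Fin n → Fin n) → ℚ) → Ext w →
    ∑ (isoData n m) (λ (σ , π , κ) → χ (isIso G G′ (σ , π , κ)) * w σ) ≡
    ∑ (isoData n m) (λ (σ , π , κ) → χ (isIso G G (σ , π , κ)) * w (σ₀ ∘ σ))
  ∑-isIso-torsor w w-ext = begin
    ∑ (isoData n m) (λ (σ , π , κ) → f σ π κ * w σ)
      ≡⟨ ∑-isoData n m _ ⟩
    ∑ (perms n) (λ σ → ∑ (perms m) (λ π → ∑ (allFuns m bools) (λ κ → f σ π κ * w σ)))
      ≡⟨ ∑-perms-compose σ₀ σ₀-inj _ (λ {σ} {σ′} eq → ∑-cong (perms m) (λ π → ∑-cong (allFuns m bools) (λ κ →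
           cong₂ _*_ (cong χ (isIso-cong G G′ σ σ′ π π κ κ eq (λ _ → refl) (λ _ → refl))) (w-ext eq)))) ⟩
    ∑ (perms n) (λ σ → ∑ (perms m) (λ π → ∑ (allFuns m bools) (λ κ → f (σ₀ ∘ σ) π κ * w (σ₀ ∘ σ))))
      ≡⟨ ∑-cong (perms n) (λ σ → ∑-perms-compose π₀ π₀-inj _ (λ {π} {π′} eq → ∑-cong (allFuns m bools) (λ κ →
           cong (λ b → χ b * w (σ₀ ∘ σ)) (isIso-cong G G′ (σ₀ ∘ σ) (σ₀ ∘ σ) π π′ κ κ (λ _ → refl) eq (λ _ → refl))))) ⟩
    ∑ (perms n) (λ σ → ∑ (perms m) (λ π → ∑ (allFuns m bools) (λ κ → f (σ₀ ∘ σ) (π₀ ∘ π) κ * w (σ₀ ∘ σ))))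
      ≡⟨ ∑-cong (perms n) (λ σ → ∑-cong (perms m) (λ π → ∑-allFuns-map m bools (λ e → xor (κ₀ (π e))) (λ e → xor-bijective (κ₀ (π e))) _
           (λ {κ} {κ′} eq → cong (λ b → χ b * w (σ₀ ∘ σ)) (isIso-cong G G′ (σ₀ ∘ σ) (σ₀ ∘ σ) (π₀ ∘ π) (π₀ ∘ π) κ κ′ (λ _ → refl) (λ _ → refl) eq)))) ⟩
    ∑ (perms n) (λ σ → ∑ (perms m) (λ π → ∑ (allFuns m bools) (λ κ → f (σ₀ ∘ σ) (π₀ ∘ π) (λ e → xor (κ₀ (π e)) (κ e)) * w (σ₀ ∘ σ))))
      ≡⟨ ∑-cong (perms n) (λ σ → ∑-cong (perms m) (λ π → ∑-cong (allFuns m bools) (λ κ → cong (λ b → χ b * w (σ₀ ∘ σ)) (isIso-compose σ π κ)))) ⟩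
    ∑ (perms n) (λ σ → ∑ (perms m) (λ π → ∑ (allFuns m bools) (λ κ → χ (isIso G G (σ , π , κ)) * w (σ₀ ∘ σ))))
      ≡⟨ sym (∑-isoData n m _) ⟩
    ∑ (isoData n m) (λ (σ , π , κ) → χ (isIso G G (σ , π , κ)) * w (σ₀ ∘ σ)) ∎
    where
    f : (Fin n → Fin n) → (Fin m → Fin m) → (Fin m → Bool) → ℚ
    f σ π κ = χ (isIso G G′ (σ , π , κ))
    xor-bijective : ∀ b (h : Bool → ℚ) → ∑ bools h ≡ ∑ bools (h ∘ xor b)
    xor-bijective false h = refl
    xor-bijective true  h = +-left-comm (h true) (h false) 0ℚ

∑-χ-== : ∀ {n} (y : Fin n) (h : Fin n → ℚ) → ∑ (allFin n) (λ a → χ (a == y) * h a) ≡ h y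
∑-χ-== {suc n} Fin.zero    h = ≡.trans (∑-allFin-suc n _) (≡.trans (cong₂ _+_ (*-identityˡ _) (∑-0 (allFin n) (λ a → *-zeroˡ (h (Fin.suc a))))) (+-identityʳ _))
∑-χ-== {suc n} (Fin.suc y) h = ≡.trans (∑-allFin-suc n _) (≡.trans (cong₂ _+_ (*-zeroˡ (h Fin.zero)) (∑-χ-== y (h ∘ Fin.suc))) (+-identityˡ _))

∑-χ-==² : ∀ {n} (y : Fin n × Fin n) → ∑ (pairs n) (λ a → χ (a ==² y)) ≡ 1ℚ
∑-χ-==² {n} (y , z) = begin
  ∑ (pairs n) (λ a → χ (a ==² (y , z)))                                    ≡⟨ ∑-pairs n _ ⟩
  ∑ (allFin n) (λ a → ∑ (allFin n) (λ b → χ ((a == y) ∧ (b == z))))         ≡⟨ ∑-cong (allFin n) (λ a → ≡.trans (∑-cong (allFin n) (λ b → ≡.trans (χ-∧ (a == y) (b == z)) (cong (χ (a == y) *_) (sym (*-identityʳ _)))))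
                                                                                 (sym (∑-*ˡ (χ (a == y)) _ (allFin n)))) ⟩
  ∑ (allFin n) (λ a → χ (a == y) * ∑ (allFin n) (λ b → χ (b == z) * 1ℚ))    ≡⟨ ∑-χ-== y _ ⟩
  ∑ (allFin n) (λ b → χ (b == z) * 1ℚ)                                      ≡⟨ ∑-χ-== z _ ⟩
  1ℚ                                                                        ∎

∑-χ-pointwise : ∀ {n} m (y : Fin m → Fin n × Fin n) → ∑ (allFuns m (pairs n)) (λ f → χ (allF m (λ e → f e ==² y e))) ≡ 1ℚ
∑-χ-pointwise {n} zero    y = +-identityʳ 1ℚ
∑-χ-pointwise {n} (suc m) y = begin
  ∑ (allFuns (suc m) (pairs n)) (λ f → χ (allF (suc m) (λ e → f e ==² y e)))
    ≡⟨ ∑-allFuns-suc m (pairs n) _ (λ eq → cong χ (allF-cong (suc m) (λ i → cong (_==² y i) (eq i)))) ⟩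
  ∑ (pairs n) (λ a → ∑ (allFuns m (pairs n)) (λ f → χ (allF (suc m) (λ e → cons a f e ==² y e))))
    ≡⟨ ∑-cong (pairs n) (λ a → ≡.trans (∑-cong (allFuns m (pairs n)) (λ f → ≡.trans (cong χ (allF-suc m (λ e → cons a f e ==² y e))) (χ-∧ (a ==² y Fin.zero) _)))
         (sym (∑-*ˡ (χ (a ==² y Fin.zero)) _ (allFuns m (pairs n))))) ⟩
  ∑ (pairs n) (λ a → χ (a ==² y Fin.zero) * ∑ (allFuns m (pairs n)) (λ f → χ (allF m (λ e → f e ==² y (Fin.suc e)))))
    ≡⟨ ∑-cong (pairs n) (λ a → ≡.trans (cong (χ (a ==² y Fin.zero) *_) (∑-χ-pointwise m (y ∘ Fin.suc))) (*-identityʳ _)) ⟩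
  ∑ (pairs n) (λ a → χ (a ==² y Fin.zero))
    ≡⟨ ∑-χ-==² (y Fin.zero) ⟩
  1ℚ ∎

-- Relabelling data determine their image: the edge of `G′` at each place is prescribed because `π`
-- is onto.
∑-isIso-target : ∀ {n m} (G : LGraph n m) σ π κ → Injective π → ∑ (allGraphs n m) (λ G′ → χ (isIso G G′ (σ , π , κ))) ≡ 1ℚ
∑-isIso-target {n} {m} G σ π κ inj = ≡.trans (∑-cong (allGraphs n m) (λ G′ → cong χ (T-ext (from G′) (to G′)))) (∑-χ-pointwise m (y ∘ π⁻))
  where
  π⁻ : Fin m → Fin m
  π⁻ e = proj₁ (injective⇒surjective π inj e)
  π-π⁻ : ∀ e → π (π⁻ e) ≡ e
  π-π⁻ e = proj₂ (injective⇒surjective π inj e)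
  y : Fin m → Fin n × Fin n
  y e = flipIf (κ e) (σ (proj₁ (G e)) , σ (proj₂ (G e)))
  from : ∀ G′ → T (isIso G G′ (σ , π , κ)) → T (allF m (λ e → G′ e ==² y (π⁻ e)))
  from G′ t = allF⁺ _ (λ e → subst (λ x → T (G′ x ==² y (π⁻ e))) (π-π⁻ e) (allF⁻ _ t (π⁻ e)))
  to : ∀ G′ → T (allF m (λ e → G′ e ==² y (π⁻ e))) → T (isIso G G′ (σ , π , κ))
  to G′ t = allF⁺ _ (λ e → subst (λ x → T (G′ (π e) ==² y x)) (inj (π-π⁻ (π e))) (allF⁻ _ t (π e)))

∑-bools : ∀ m → ∑ (allFuns m bools) (λ _ → 1ℚ) ≡ nat (2 ℕ.^ m)
∑-bools zero    = refl
∑-bools (suc m) = begin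
  ∑ (allFuns (suc m) bools) (λ _ → 1ℚ)              ≡⟨ ∑-allFuns-suc m bools _ (λ _ → refl) ⟩
  ∑ bools (λ _ → ∑ (allFuns m bools) (λ _ → 1ℚ))    ≡⟨ ∑-const _ bools ⟩
  two * ∑ (allFuns m bools) (λ _ → 1ℚ)              ≡⟨ cong (two *_) (∑-bools m) ⟩
  two * nat (2 ℕ.^ m)                               ≡⟨ sym (nat-* 2 (2 ℕ.^ m)) ⟩
  nat (2 ℕ.^ suc m)                                 ∎

∑-allFuns-avoid-0 : ∀ k n (F : (Fin k → Fin (suc n)) → ℚ) → Ext F → (∀ f i → f i ≡ Fin.zero → F f ≡ 0ℚ) →
  ∑ (allFuns k (allFin (suc n))) F ≡ ∑ (allFuns k (allFin n)) (λ f → F (Fin.suc ∘ f))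
∑-allFuns-avoid-0 zero    n F F-ext avoid = cong (_+ 0ℚ) (F-ext (λ ()))
∑-allFuns-avoid-0 (suc k) n F F-ext avoid = begin
  ∑ (allFuns (suc k) (allFin (suc n))) F
    ≡⟨ ∑-allFuns-suc k (allFin (suc n)) F F-ext ⟩
  ∑ (allFin (suc n)) (λ a → ∑ (allFuns k (allFin (suc n))) (λ f → F (cons a f)))
    ≡⟨ ∑-allFin-suc n _ ⟩
  ∑ (allFuns k (allFin (suc n))) (λ f → F (cons Fin.zero f)) + ∑ (allFin n) (λ a → ∑ (allFuns k (allFin (suc n))) (λ f → F (cons (Fin.suc a) f)))
    ≡⟨ cong₂ _+_ (∑-0 (allFuns k (allFin (suc n))) (λ f → avoid _ Fin.zero refl))
         (∑-cong (allFin n) (λ a → ∑-allFuns-avoid-0 k n _ (λ eq → F-ext (cons-cong _ eq)) (λ f i eq → avoid _ (Fin.suc i) eq))) ⟩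
  0ℚ + ∑ (allFin n) (λ a → ∑ (allFuns k (allFin n)) (λ f → F (cons (Fin.suc a) (Fin.suc ∘ f))))
    ≡⟨ +-identityˡ _ ⟩
  ∑ (allFin n) (λ a → ∑ (allFuns k (allFin n)) (λ f → F (cons (Fin.suc a) (Fin.suc ∘ f))))
    ≡⟨ ∑-cong (allFin n) (λ a → ∑-cong (allFuns k (allFin n)) (λ f → F-ext (λ { Fin.zero → refl ; (Fin.suc i) → refl }))) ⟩
  ∑ (allFin n) (λ a → ∑ (allFuns k (allFin n)) (λ f → F (Fin.suc ∘ cons a f)))
    ≡⟨ sym (∑-allFuns-suc k (allFin n) _ (λ eq → F-ext (λ i → cong Fin.suc (eq i)))) ⟩
  ∑ (allFuns (suc k) (allFin n)) (λ f → F (Fin.suc ∘ f)) ∎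

-- The permutation `place a` reduces any value a at 0 to the value 0; injectivity then forces the
-- other values to avoid 0, which leaves the injective maps on n elements.
∑-perms-1 : ∀ n → ∑ (perms n) (λ _ → 1ℚ) ≡ nat (n !)
∑-perms-1 n = ≡.trans (∑-perms n (λ _ → 1ℚ)) (≡.trans (∑-cong (allFuns n (allFin n)) (λ σ → *-identityʳ _)) (count-injective n))
  where
  count-injective : ∀ n → ∑ (allFuns n (allFin n)) (χ ∘ injᵇ) ≡ nat (n !)
  count-injective zero    = refl
  count-injective (suc n) = begin
    ∑ (allFuns (suc n) (allFin (suc n))) (χ ∘ injᵇ)
      ≡⟨ ∑-allFuns-suc n (allFin (suc n)) _ (λ eq → cong χ (injᵇ-ext eq)) ⟩
    ∑ (allFin (suc n)) (λ a → ∑ (allFuns n (allFin (suc n))) (λ f → χ (injᵇ (cons a f))))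
      ≡⟨ ∑-cong (allFin (suc n)) (λ a → ≡.trans
           (∑-allFuns-map n (allFin (suc n)) (λ _ → place a) (λ _ → ∑-permute (place a) (place-inj a)) _ (λ eq → cong χ (injᵇ-ext (cons-cong a eq))))
           (∑-cong (allFuns n (allFin (suc n))) (λ f → cong χ (T-ext
             (λ t → injᵇ⁺ (cons Fin.zero f) (λ {i} {j} eq → injᵇ⁻ (cons a (place a ∘ f)) t (≡.trans (sym (moved a f i)) (≡.trans (cong (place a) eq) (moved a f j)))))
             (λ t → injᵇ⁺ (cons a (place a ∘ f)) (λ {i} {j} eq → injᵇ⁻ (cons Fin.zero f) t (place-inj a (≡.trans (moved a f i) (≡.trans eq (sym (moved a f j))))))))))) ⟩
    ∑ (allFin (suc n)) (λ a → ∑ (allFuns n (allFin (suc n))) (λ f → χ (injᵇ (cons Fin.zero f))))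
      ≡⟨ ∑-const _ (allFin (suc n)) ⟩
    nat (length (allFin (suc n))) * ∑ (allFuns n (allFin (suc n))) (λ f → χ (injᵇ (cons Fin.zero f)))
      ≡⟨ cong₂ (λ l z → nat l * z) (ListP.length-tabulate {n = suc n} id)
           (∑-allFuns-avoid-0 n n _ (λ eq → cong χ (injᵇ-ext (cons-cong Fin.zero eq))) avoid) ⟩
    nat (suc n) * ∑ (allFuns n (allFin n)) (λ f → χ (injᵇ (cons Fin.zero (Fin.suc ∘ f))))
      ≡⟨ cong (nat (suc n) *_) (≡.trans (∑-cong (allFuns n (allFin n)) (λ f → cong χ (T-ext
           (λ t → injᵇ⁺ f (λ {i} {j} eq → FinP.suc-injective (injᵇ⁻ (cons Fin.zero (Fin.suc ∘ f)) t {Fin.suc i} {Fin.suc j} (cong Fin.suc eq))))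
           (λ t → injᵇ⁺ (cons Fin.zero (Fin.suc ∘ f)) (λ {i} {j} → extend f (injᵇ⁻ f t) i j))))) (count-injective n)) ⟩
    nat (suc n) * nat (n !)
      ≡⟨ sym (nat-* (suc n) (n !)) ⟩
    nat (suc n !) ∎
    where
    moved : ∀ a (f : Fin n → Fin (suc n)) i → place a (cons Fin.zero f i) ≡ cons a (place a ∘ f) i
    moved a f Fin.zero    = refl
    moved a f (Fin.suc i) = refl
    avoid : ∀ (f : Fin n → Fin (suc n)) i → f i ≡ Fin.zero → χ (injᵇ (cons Fin.zero f)) ≡ 0ℚ
    avoid f i eq with injᵇ (cons Fin.zero f) in e
    ... | false = refl
    ... | true  = ⊥-elim (FinP.0≢1+n (injᵇ⁻ (cons Fin.zero f) (subst T (sym e) tt) {Fin.zero} {Fin.suc i} (sym eq)))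
    extend : ∀ (f : Fin n → Fin n) → Injective f → ∀ i j → cons Fin.zero (Fin.suc ∘ f) i ≡ cons Fin.zero (Fin.suc ∘ f) j → i ≡ j
    extend f inj Fin.zero    Fin.zero    eq = refl
    extend f inj Fin.zero    (Fin.suc j) ()
    extend f inj (Fin.suc i) Fin.zero    ()
    extend f inj (Fin.suc i) (Fin.suc j) eq = cong Fin.suc (inj (FinP.suc-injective eq))

∑-isoData-1 : ∀ n m → ∑ (isoData n m) (λ _ → 1ℚ) ≡ nat (vol n m)
∑-isoData-1 n m = begin
  ∑ (isoData n m) (λ _ → 1ℚ)                                                      ≡⟨ ∑-isoData n m _ ⟩
  ∑ (perms n) (λ _ → ∑ (perms m) (λ _ → ∑ (allFuns m bools) (λ _ → 1ℚ)))         ≡⟨ ones (perms n) _ ⟩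
  ∑ (perms n) (λ _ → 1ℚ) * ∑ (perms m) (λ _ → ∑ (allFuns m bools) (λ _ → 1ℚ))    ≡⟨ cong₂ _*_ (∑-perms-1 n) (≡.trans (ones (perms m) _) (cong₂ _*_ (∑-perms-1 m) (∑-bools m))) ⟩
  nat (n !) * (nat (m !) * nat (2 ℕ.^ m))                                         ≡⟨ cong (nat (n !) *_) (sym (nat-* (m !) (2 ℕ.^ m))) ⟩
  nat (n !) * nat (m ! ℕ.* 2 ℕ.^ m)                                               ≡⟨ sym (nat-* (n !) _) ⟩
  nat (vol n m)                                                                   ∎
  where
  ones : ∀ {A : Set} (xs : List A) c → ∑ xs (λ _ → c) ≡ ∑ xs (λ _ → 1ℚ) * c
  ones xs c = ≡.trans (∑-cong xs (λ _ → sym (*-identityˡ c))) (sym (∑-*ʳ c _ xs))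

count-none : ∀ (p : A → Bool) xs → ¬ T (any p xs) → ∑ xs (χ ∘ p) ≡ 0ℚ
count-none p []       ne = refl
count-none p (x ∷ xs) ne with p x
... | true  = ⊥-elim (ne tt)
... | false = ≡.trans (+-identityˡ _) (count-none p xs ne)

witness : ∀ (p : A → Bool) {P : A → Set} xs → All P xs → T (any p xs) → ∃ λ x → P x × T (p x)
witness p xs ps t = let i = AnyP.any⁻ p xs t in Any.lookup i , All.lookupAny ps i

1≢0 : 1ℚ ≢ 0ℚ
1≢0 ()

nat≢0 : ∀ {v} → v ≢ 0 → nat v ≢ 0ℚ
nat≢0 {zero}  ne eq = ne refl
nat≢0 {suc v} ne eq = 1≢0 (≡.trans (sym (nat-recip v)) (≡.trans (cong (_* recip (suc v)) eq) (*-zeroˡ _)))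

recip-unique : ∀ c r → nat c * r ≡ 1ℚ → r ≡ recip c
recip-unique zero    r eq = ⊥-elim (1≢0 (≡.trans (sym eq) (*-zeroˡ r)))
recip-unique (suc c) r eq = begin
  r                                    ≡⟨ sym (*-identityˡ r) ⟩
  1ℚ * r                               ≡⟨ cong (_* r) (sym (nat-recip c)) ⟩
  (nat (suc c) * recip (suc c)) * r    ≡⟨ ≡.trans (cong (_* r) (*-comm (nat (suc c)) _)) (*-assoc (recip (suc c)) (nat (suc c)) r) ⟩
  recip (suc c) * (nat (suc c) * r)    ≡⟨ cong (recip (suc c) *_) eq ⟩
  recip (suc c) * 1ℚ                   ≡⟨ *-identityʳ _ ⟩
  recip (suc c)                        ∎

recip-cong : ∀ c {v} → v ≢ 0 → nat c ≡ nat v → recip c ≡ recip v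
recip-cong c {zero}  v≢0 eq = ⊥-elim (v≢0 refl)
recip-cong c {suc v} v≢0 eq = sym (recip-unique c (recip (suc v)) (≡.trans (cong (_* recip (suc v)) eq) (nat-recip v)))

recip-* : ∀ c a {v} → v ≢ 0 → nat c * nat a ≡ nat v → recip c * recip a ≡ recip v
recip-* zero    a       v≢0 eq = ⊥-elim (nat≢0 v≢0 (≡.trans (sym eq) (*-zeroˡ _)))
recip-* (suc c) zero    v≢0 eq = ⊥-elim (nat≢0 v≢0 (≡.trans (sym eq) (*-zeroʳ _)))
recip-* (suc c) (suc a) {v} v≢0 eq = recip-unique v _ (begin
  nat v * (recip (suc c) * recip (suc a))                              ≡⟨ cong (_* (recip (suc c) * recip (suc a))) (sym eq) ⟩
  (nat (suc c) * nat (suc a)) * (recip (suc c) * recip (suc a))        ≡⟨ *-assoc (nat (suc c)) (nat (suc a)) _ ⟩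
  nat (suc c) * (nat (suc a) * (recip (suc c) * recip (suc a)))        ≡⟨ cong (nat (suc c) *_) (*-left-comm (nat (suc a)) (recip (suc c)) (recip (suc a))) ⟩
  nat (suc c) * (recip (suc c) * (nat (suc a) * recip (suc a)))        ≡⟨ cong (λ z → nat (suc c) * (recip (suc c) * z)) (nat-recip a) ⟩
  nat (suc c) * (recip (suc c) * 1ℚ)                                   ≡⟨ cong (nat (suc c) *_) (*-identityʳ _) ⟩
  nat (suc c) * recip (suc c)                                          ≡⟨ nat-recip c ⟩
  1ℚ                                                                   ∎)

module _ {n m : ℕ} (G : LGraph n m) where

  private
    D = isoData n m

  -- Relabelling data are counted by their image: each has exactly one, and every graph in the class
  -- of `G` is the image of as many data as `G` has automorphisms.
  orbit-stabiliser : nat (classSize G) * nat (autCount G) ≡ nat (vol n m)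
  orbit-stabiliser = begin
    nat (classSize G) * nat (autCount G)
      ≡⟨ cong₂ _*_ (nat-count (isomorphic G) (allGraphs n m)) (nat-count (isIso G G) D) ⟩
    ∑ (allGraphs n m) (χ ∘ isomorphic G) * ∑ D (χ ∘ isIso G G)
      ≡⟨ ∑-*ʳ _ _ (allGraphs n m) ⟩
    ∑ (allGraphs n m) (λ G′ → χ (isomorphic G G′) * ∑ D (χ ∘ isIso G G))
      ≡⟨ ∑-cong (allGraphs n m) orbit ⟩
    ∑ (allGraphs n m) (λ G′ → ∑ D (χ ∘ isIso G G′))
      ≡⟨ ∑-swap (allGraphs n m) D _ ⟩
    ∑ D (λ d → ∑ (allGraphs n m) (λ G′ → χ (isIso G G′ d)))
      ≡⟨ ∑-cong-All (All.map (λ {(σ , π , κ)} (_ , tπ) → ∑-isIso-target G σ π κ (injᵇ⁻ π tπ)) (isoData-perms n m)) ⟩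
    ∑ D (λ _ → 1ℚ)
      ≡⟨ ∑-isoData-1 n m ⟩
    nat (vol n m) ∎
    where
    orbit : ∀ G′ → χ (isomorphic G G′) * ∑ D (χ ∘ isIso G G) ≡ ∑ D (χ ∘ isIso G G′)
    orbit G′ with isomorphic G G′ in eq
    ... | false = ≡.trans (*-zeroˡ _) (sym (count-none (isIso G G′) D (subst T eq)))
    ... | true  with witness (isIso G G′) D (isoData-perms n m) (subst T (sym eq) tt)
    ...   | (σ₀ , π₀ , κ₀) , (tσ , tπ) , iso = begin
      1ℚ * ∑ D (χ ∘ isIso G G)                    ≡⟨ *-identityˡ _ ⟩
      ∑ D (χ ∘ isIso G G)                         ≡⟨ ∑-cong D (λ _ → sym (*-identityʳ _)) ⟩
      ∑ D (λ d → χ (isIso G G d) * 1ℚ)            ≡⟨ sym (∑-isIso-torsor G G′ κ₀ (injᵇ⁻ σ₀ tσ) (injᵇ⁻ π₀ tπ) iso (λ _ → 1ℚ) (λ _ → refl)) ⟩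
      ∑ D (λ d → χ (isIso G G′ d) * 1ℚ)           ≡⟨ ∑-cong D (λ _ → *-identityʳ _) ⟩
      ∑ D (χ ∘ isIso G G′)                        ∎

  -- The same count with the image of the root recorded; the torsor identity is applied with the
  -- weight that tests where σ sends `r`.
  orbit-stabiliserᵣ : ∀ r → nat (classSizeR G r ℕ.* autCountR G r) ≡ nat (vol n m)
  orbit-stabiliserᵣ r = begin
    nat (classSizeR G r ℕ.* autCountR G r)
      ≡⟨ nat-* (classSizeR G r) (autCountR G r) ⟩
    nat (classSizeR G r) * nat (autCountR G r)
      ≡⟨ cong₂ _*_ (≡.trans (nat-sumℕ (λ r′ → count (λ G′ → any (isIsoR G r G′ r′) D) (allGraphs n m)) (allFin n))
           (∑-cong (allFin n) (λ r′ → nat-count (λ G′ → any (isIsoR G r G′ r′) D) (allGraphs n m)))) (nat-count (isIsoR G r G r) D) ⟩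
    ∑ (allFin n) (λ r′ → ∑ (allGraphs n m) (λ G′ → χ (any (isIsoR G r G′ r′) D))) * stabiliser
      ≡⟨ ≡.trans (∑-*ʳ _ _ (allFin n)) (∑-cong (allFin n) (λ r′ → ∑-*ʳ _ _ (allGraphs n m))) ⟩
    ∑ (allFin n) (λ r′ → ∑ (allGraphs n m) (λ G′ → χ (any (isIsoR G r G′ r′) D) * stabiliser))
      ≡⟨ ∑-cong (allFin n) (λ r′ → ∑-cong (allGraphs n m) (λ G′ → orbit G′ r′)) ⟩
    ∑ (allFin n) (λ r′ → ∑ (allGraphs n m) (λ G′ → ∑ D (χ ∘ isIsoR G r G′ r′)))
      ≡⟨ ≡.trans (∑-cong (allFin n) (λ r′ → ∑-swap (allGraphs n m) D _)) (∑-swap (allFin n) D _) ⟩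
    ∑ D (λ d → ∑ (allFin n) (λ r′ → ∑ (allGraphs n m) (λ G′ → χ (isIsoR G r G′ r′ d))))
      ≡⟨ ∑-cong-All (All.map (λ {(σ , π , κ)} (_ , tπ) → target σ π κ (injᵇ⁻ π tπ)) (isoData-perms n m)) ⟩
    ∑ D (λ _ → 1ℚ)
      ≡⟨ ∑-isoData-1 n m ⟩
    nat (vol n m) ∎
    where
    stabiliser : ℚ
    stabiliser = ∑ D (χ ∘ isIsoR G r G r)

    target : ∀ σ π κ → Injective π → ∑ (allFin n) (λ r′ → ∑ (allGraphs n m) (λ G′ → χ (isIsoR G r G′ r′ (σ , π , κ)))) ≡ 1ℚ
    target σ π κ inj = begin
      ∑ (allFin n) (λ r′ → ∑ (allGraphs n m) (λ G′ → χ (isIso G G′ (σ , π , κ) ∧ (σ r == r′))))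
        ≡⟨ ∑-cong (allFin n) (λ r′ → ≡.trans (∑-cong (allGraphs n m) (λ G′ → χ-∧ (isIso G G′ (σ , π , κ)) _)) (sym (∑-*ʳ _ _ (allGraphs n m)))) ⟩
      ∑ (allFin n) (λ r′ → ∑ (allGraphs n m) (λ G′ → χ (isIso G G′ (σ , π , κ))) * χ (σ r == r′))
        ≡⟨ ∑-cong (allFin n) (λ r′ → ≡.trans (cong (_* χ (σ r == r′)) (∑-isIso-target G σ π κ inj)) (*-identityˡ _)) ⟩
      ∑ (allFin n) (λ r′ → χ (σ r == r′))
        ≡⟨ ∑-cong (allFin n) (λ r′ → sym (nat-bit (σ r == r′))) ⟩
      ∑ (allFin n) (λ r′ → nat (bit (σ r == r′)))
        ≡⟨ sym (nat-sumℕ (λ r′ → bit (σ r == r′)) (allFin n)) ⟩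
      nat (sumℕ (λ r′ → bit (σ r == r′)) (allFin n))
        ≡⟨ cong nat (sumℕ-≟ (σ r)) ⟩
      nat 1
        ≡⟨ +-identityʳ 1ℚ ⟩
      1ℚ ∎

    orbit : ∀ G′ r′ → χ (any (isIsoR G r G′ r′) D) * stabiliser ≡ ∑ D (χ ∘ isIsoR G r G′ r′)
    orbit G′ r′ with any (isIsoR G r G′ r′) D in eq
    ... | false = ≡.trans (*-zeroˡ _) (sym (count-none (isIsoR G r G′ r′) D (subst T eq)))
    ... | true  with witness (isIsoR G r G′ r′) D (isoData-perms n m) (subst T (sym eq) tt)
    ...   | (σ₀ , π₀ , κ₀) , (tσ , tπ) , isoᵣ = begin
      1ℚ * stabiliser
        ≡⟨ *-identityˡ _ ⟩
      ∑ D (χ ∘ isIsoR G r G r)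
        ≡⟨ ∑-cong D (λ (σ , π , κ) → ≡.trans (χ-∧ (isIso G G (σ , π , κ)) (σ r == r)) (cong (λ b → χ (isIso G G (σ , π , κ)) * χ b)
             (≡.trans (sym (does-inj FinP._≟_ FinP._≟_ σ₀ (injᵇ⁻ σ₀ tσ) (σ r) r)) (cong (σ₀ (σ r) ==_) (==⇒≡ (proj₂ isoᵣ-parts)))))) ⟩
      ∑ D (λ (σ , π , κ) → χ (isIso G G (σ , π , κ)) * χ (σ₀ (σ r) == r′))
        ≡⟨ sym (∑-isIso-torsor G G′ κ₀ (injᵇ⁻ σ₀ tσ) (injᵇ⁻ π₀ tπ) (proj₁ isoᵣ-parts) (λ σ → χ (σ r == r′)) (λ eq → cong (λ x → χ (x == r′)) (eq r))) ⟩
      ∑ D (λ (σ , π , κ) → χ (isIso G G′ (σ , π , κ)) * χ (σ r == r′))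
        ≡⟨ ∑-cong D (λ (σ , π , κ) → sym (χ-∧ (isIso G G′ (σ , π , κ)) (σ r == r′))) ⟩
      ∑ D (χ ∘ isIsoR G r G′ r′) ∎
      where
      isoᵣ-parts : T (isIso G G′ (σ₀ , π₀ , κ₀)) × T (σ₀ r == r′)
      isoᵣ-parts = T-∧⁻ {isIso G G′ (σ₀ , π₀ , κ₀)} isoᵣ

-- Colourings

count≡sumℕ : ∀ (p : A → Bool) xs → count p xs ≡ sumℕ (bit ∘ p) xs
count≡sumℕ p []       = refl
count≡sumℕ p (x ∷ xs) with p x
... | true  = cong suc (count≡sumℕ p xs)
... | false = count≡sumℕ p xs

does-sym : (d : DecidableEquality A) → ∀ a b → does (d a b) ≡ does (d b a)
does-sym d a b with d a b | d b a
... | yes _    | yes _ = refl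
... | no _     | no _  = refl
... | yes refl | no ¬p = ⊥-elim (¬p refl)
... | no ¬p    | yes p = ⊥-elim (¬p (sym p))

module _ {V : Set} (d : DecidableEquality V) where

  upd : V → Bool → (V → Bool) → V → Bool
  upd v b c w = if does (d w v) then b else c w

  -- The recursion behind `colourings`, with the list of vertices as an argument, so that it can be
  -- followed through permutations, renamings and disjoint unions.
  cols : List V → List (V → Bool)
  cols []       = (λ _ → false) ∷ []
  cols (v ∷ vs) = concatMap (λ c → upd v true c ∷ upd v false c ∷ []) (cols vs)

  both : V → ((V → Bool) → ℚ) → (V → Bool) → ℚ
  both v F c = F (upd v true c) + F (upd v false c)

  ∑-cols-∷ : ∀ v vs F → ∑ (cols (v ∷ vs)) F ≡ ∑ (cols vs) (both v F)
  ∑-cols-∷ v vs F = ≡.trans (∑-concatMap _ (cols vs) F) (∑-cong (cols vs) (λ c → cong (F (upd v true c) +_) (+-identityʳ _)))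

  upd-ext : ∀ v b {c c′ : V → Bool} → (∀ x → c x ≡ c′ x) → ∀ x → upd v b c x ≡ upd v b c′ x
  upd-ext v b eq x with does (d x v)
  ... | true  = refl
  ... | false = eq x

  both-ext : ∀ v {F : (V → Bool) → ℚ} → Ext F → Ext (both v F)
  both-ext v F-ext eq = cong₂ _+_ (F-ext (upd-ext v true eq)) (F-ext (upd-ext v false eq))

  upd-swap : ∀ {v w} → v ≢ w → ∀ b b′ c x → upd v b (upd w b′ c) x ≡ upd w b′ (upd v b c) x
  upd-swap {v} {w} v≢w b b′ c x with d x v | d x w
  ... | yes refl | yes refl = ⊥-elim (v≢w refl)
  ... | yes _    | no _     = refl
  ... | no _     | yes _    = refl
  ... | no _     | no _     = refl

  upd-same : ∀ v b c → upd v b c v ≡ b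
  upd-same v b c rewrite does-refl d v = refl

  upd-other : ∀ {v x} b c → x ≢ v → upd v b c x ≡ c x
  upd-other b c x≢v rewrite does-≢ d x≢v = refl

  cols-↭ : ∀ {F : (V → Bool) → ℚ} → Ext F → ∀ {vs ws} → vs ↭ ws → ∑ (cols vs) F ≡ ∑ (cols ws) F
  cols-↭ F-ext refl = refl
  cols-↭ {F} F-ext {_ ∷ vs} {_ ∷ ws} (prep v p) = ≡.trans (∑-cols-∷ v vs F) (≡.trans (cols-↭ (both-ext v F-ext) p) (sym (∑-cols-∷ v ws F)))
  cols-↭ {F} F-ext {_ ∷ _ ∷ vs} {_ ∷ _ ∷ ws} (swap v w p) = begin
    ∑ (cols (v ∷ w ∷ vs)) F             ≡⟨ ≡.trans (∑-cols-∷ v (w ∷ vs) F) (∑-cols-∷ w vs (both v F)) ⟩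
    ∑ (cols vs) (both w (both v F))     ≡⟨ cols-↭ (both-ext w (both-ext v F-ext)) p ⟩
    ∑ (cols ws) (both w (both v F))     ≡⟨ ∑-cong (cols ws) exchange ⟩
    ∑ (cols ws) (both v (both w F))     ≡⟨ sym (≡.trans (∑-cols-∷ w (v ∷ ws) F) (∑-cols-∷ v ws (both w F))) ⟩
    ∑ (cols (w ∷ v ∷ ws)) F             ∎
    where
    exchange : ∀ c → both w (both v F) c ≡ both v (both w F) c
    exchange c with d v w
    ... | yes refl = refl
    ... | no v≢w   = ≡.trans (+-interchange (F (upd v true (upd w true c))) _ _ _)
      (cong₂ _+_ (cong₂ _+_ (F-ext (upd-swap v≢w true true c)) (F-ext (upd-swap v≢w true false c)))
                 (cong₂ _+_ (F-ext (upd-swap v≢w false true c)) (F-ext (upd-swap v≢w false false c))))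
  cols-↭ F-ext (trans p q) = ≡.trans (cols-↭ F-ext p) (cols-↭ F-ext q)

  contrib : (V → Bool) → V → V × V → ℕ
  contrib c v (a , b) = if does (d a b) then 0 else (if does (d a v) then bit (c b) else 0) ℕ.+ (if does (d b v) then bit (c a) else 0)

  -- the black-neighbour count of v
  bc : List (V × V) → (V → Bool) → V → ℕ
  bc es c v = sumℕ (contrib c v) es

  contrib-sym : ∀ c v → Symmetric² (contrib c v)
  contrib-sym c v a b rewrite does-sym d a b with does (d b a)
  ... | true  = refl
  ... | false = ℕP.+-comm (if does (d a v) then bit (c b) else 0) _

  contrib-ext : ∀ {c c′ : V → Bool} → (∀ x → c x ≡ c′ x) → ∀ v e → contrib c v e ≡ contrib c′ v e
  contrib-ext eq v (a , b) = cong₂ (λ x y → if does (d a b) then 0 else (if does (d a v) then bit x else 0) ℕ.+ (if does (d b v) then bit y else 0)) (eq b) (eq a)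

  bc-ext : ∀ es {c c′ : V → Bool} → (∀ x → c x ≡ c′ x) → ∀ v → bc es c v ≡ bc es c′ v
  bc-ext es eq v = sumℕ-cong es (contrib-ext eq v)

  bc-≋ : ∀ {es es′} c v → es ≋ es′ → bc es c v ≡ bc es′ c v
  bc-≋ c v = sumℕ-≋ (contrib c v) (contrib-sym c v)

  bc-++ : ∀ es es′ c v → bc (es ++ es′) c v ≡ bc es c v ℕ.+ bc es′ c v
  bc-++ es es′ c v = sumℕ-++ (contrib c v) es es′

  isWE isWO : List (V × V) → (V → Bool) → V → Bool
  isWE es c v = not (c v) ∧ even? (bc es c v)
  isWO es c v = not (c v) ∧ not (even? (bc es c v))

  isWE-ext : ∀ es {c c′ : V → Bool} → (∀ x → c x ≡ c′ x) → ∀ v → isWE es c v ≡ isWE es c′ v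
  isWE-ext es eq v = cong₂ (λ x y → not x ∧ even? y) (eq v) (bc-ext es eq v)

  isWO-ext : ∀ es {c c′ : V → Bool} → (∀ x → c x ≡ c′ x) → ∀ v → isWO es c v ≡ isWO es c′ v
  isWO-ext es eq v = cong₂ (λ x y → not x ∧ not (even? y)) (eq v) (bc-ext es eq v)

module _ {V W : Set} (d : DecidableEquality V) (d′ : DecidableEquality W) (θ : V → W) where

  contrib-out : ∀ c {w} → (∀ x → θ x ≢ w) → ∀ e → contrib d′ c w (map² θ e) ≡ 0
  contrib-out c {w} out (a , b) rewrite does-≢ d′ (out a) | does-≢ d′ (out b) with does (d′ (θ a) (θ b))
  ... | true  = refl
  ... | false = refl

  bc-out : ∀ c {w} → (∀ x → θ x ≢ w) → ∀ es → bc d′ (map (map² θ) es) c w ≡ 0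
  bc-out c {w} out es = ≡.trans (sumℕ-map (map² θ) (contrib d′ c w) es) (sumℕ-0 es (contrib-out c out))

  module _ (inj : Injective θ) where

    contrib-map : ∀ c v e → contrib d′ c (θ v) (map² θ e) ≡ contrib d (c ∘ θ) v e
    contrib-map c v (a , b) rewrite does-inj d d′ θ inj a b | does-inj d d′ θ inj a v | does-inj d d′ θ inj b v = refl

    bc-map : ∀ es c v → bc d′ (map (map² θ) es) c (θ v) ≡ bc d es (c ∘ θ) v
    bc-map es c v = ≡.trans (sumℕ-map (map² θ) (contrib d′ c (θ v)) es) (sumℕ-cong es (contrib-map c v))

    upd-map : ∀ v b c x → upd d′ (θ v) b c (θ x) ≡ upd d v b (c ∘ θ) x
    upd-map v b c x rewrite does-inj d d′ θ inj x v = refl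

    cols-map : ∀ {F : (V → Bool) → ℚ} → Ext F → ∀ {F′} → (∀ c → F′ c ≡ F (c ∘ θ)) → ∀ vs → ∑ (cols d′ (map θ vs)) F′ ≡ ∑ (cols d vs) F
    cols-map F-ext eq []       = cong (_+ 0ℚ) (eq _)
    cols-map {F} F-ext {F′} eq (v ∷ vs) = ≡.trans (∑-cols-∷ d′ (θ v) (map θ vs) F′)
      (≡.trans (cols-map (both-ext d v F-ext) (λ c → cong₂ _+_ (≡.trans (eq _) (F-ext (upd-map v true c))) (≡.trans (eq _) (F-ext (upd-map v false c)))) vs)
               (sym (∑-cols-∷ d v vs F)))

module _ {V W : Set} (d : DecidableEquality V) (d′ : DecidableEquality W) where

  private
    d⊎ : DecidableEquality (V ⊎ W)
    d⊎ = SumP.≡-dec d d′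

  cols-⊎ : ∀ {F : (V ⊎ W → Bool) → ℚ} → Ext F → ∀ xs ys →
           ∑ (cols d⊎ (map inj₁ xs ++ map inj₂ ys)) F ≡ ∑ (cols d xs) (λ c → ∑ (cols d′ ys) (λ c′ → F [ c , c′ ]′))
  cols-⊎ F-ext []       []       = ≡.trans (cong (_+ 0ℚ) (F-ext (λ { (inj₁ _) → refl ; (inj₂ _) → refl }))) (sym (+-identityʳ _))
  cols-⊎ {F} F-ext []       (y ∷ ys) = begin
    ∑ (cols d⊎ (inj₂ y ∷ map inj₂ ys)) F
      ≡⟨ ∑-cols-∷ d⊎ (inj₂ y) (map inj₂ ys) F ⟩
    ∑ (cols d⊎ (map inj₂ ys)) (both d⊎ (inj₂ y) F)
      ≡⟨ cols-⊎ (both-ext d⊎ (inj₂ y) F-ext) [] ys ⟩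
    ∑ (cols d′ ys) (λ c′ → both d⊎ (inj₂ y) F [ (λ _ → false) , c′ ]′) + 0ℚ
      ≡⟨ cong (_+ 0ℚ) (≡.trans (∑-cong (cols d′ ys) (λ c′ → cong₂ _+_ (F-ext (merge true c′)) (F-ext (merge false c′)))) (sym (∑-cols-∷ d′ y ys _))) ⟩
    ∑ (cols d′ (y ∷ ys)) (λ c′ → F [ (λ _ → false) , c′ ]′) + 0ℚ ∎
    where
    merge : ∀ b c′ x → upd d⊎ (inj₂ y) b [ (λ _ → false) , c′ ]′ x ≡ [ (λ _ → false) , upd d′ y b c′ ]′ x
    merge b c′ (inj₁ x) = refl
    merge b c′ (inj₂ z) rewrite does-inj d′ d⊎ inj₂ SumP.inj₂-injective z y = refl
  cols-⊎ {F} F-ext (x ∷ xs) ys = begin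
    ∑ (cols d⊎ (inj₁ x ∷ map inj₁ xs ++ map inj₂ ys)) F
      ≡⟨ ∑-cols-∷ d⊎ (inj₁ x) (map inj₁ xs ++ map inj₂ ys) F ⟩
    ∑ (cols d⊎ (map inj₁ xs ++ map inj₂ ys)) (both d⊎ (inj₁ x) F)
      ≡⟨ cols-⊎ (both-ext d⊎ (inj₁ x) F-ext) xs ys ⟩
    ∑ (cols d xs) (λ c → ∑ (cols d′ ys) (λ c′ → both d⊎ (inj₁ x) F [ c , c′ ]′))
      ≡⟨ ∑-cong (cols d xs) (λ c → ≡.trans (∑-cong (cols d′ ys) (λ c′ → cong₂ _+_ (F-ext (merge true c c′)) (F-ext (merge false c c′)))) (∑-+ _ _ (cols d′ ys))) ⟩
    ∑ (cols d xs) (both d x (λ c → ∑ (cols d′ ys) (λ c′ → F [ c , c′ ]′)))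
      ≡⟨ sym (∑-cols-∷ d x xs _) ⟩
    ∑ (cols d (x ∷ xs)) (λ c → ∑ (cols d′ ys) (λ c′ → F [ c , c′ ]′)) ∎
    where
    merge : ∀ b c c′ z → upd d⊎ (inj₁ x) b [ c , c′ ]′ z ≡ [ upd d x b c , c′ ]′ z
    merge b c c′ (inj₁ z) rewrite does-inj d d⊎ inj₁ SumP.inj₁-injective z x = refl
    merge b c c′ (inj₂ z) = refl

-- Both polynomials have this form: a `Q` that depends only on the number of white vertices with
-- even count gives the black-white polynomial, and `Q` obtained from `substMono` gives the full one
-- after substitution.
colourSum : (ℕ → ℕ → ℕ → ℚ) → Gr → ℚ
colourSum Q G = ∑ (cols _≟_ vs) (λ c → Q (sumℕ (bit ∘ c) vs) (sumℕ (bit ∘ isWE _≟_ es c) vs) (sumℕ (bit ∘ isWO _≟_ es c) vs))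
  where open Gr G

cong₃ : ∀ {A B C D : Set} (f : A → B → C → D) {a a′ b b′ c c′} → a ≡ a′ → b ≡ b′ → c ≡ c′ → f a b c ≡ f a′ b′ c′
cong₃ f refl refl refl = refl

colourSum-Inv : ∀ Q → Inv (colourSum Q)
colourSum-Inv Q {G} {G′} (ren θ inj vp ep) = sym (begin
  ∑ (cols G′._≟_ G′.vs) F′         ≡⟨ cols-↭ G′._≟_ (λ {c} {c′} eq → cong₃ Q (sumℕ-cong G′.vs (cong bit ∘ eq))
                                        (sumℕ-cong G′.vs (cong bit ∘ isWE-ext G′._≟_ G′.es eq)) (sumℕ-cong G′.vs (cong bit ∘ isWO-ext G′._≟_ G′.es eq))) vp ⟩
  ∑ (cols G′._≟_ (map θ G.vs)) F′  ≡⟨ cols-map G._≟_ G′._≟_ θ inj (λ {c} {c′} eq → cong₃ Q (sumℕ-cong G.vs (cong bit ∘ eq))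
                                        (sumℕ-cong G.vs (cong bit ∘ isWE-ext G._≟_ G.es eq)) (sumℕ-cong G.vs (cong bit ∘ isWO-ext G._≟_ G.es eq))) pull G.vs ⟩
  ∑ (cols G._≟_ G.vs) F            ∎)
  where
  module G = Gr G
  module G′ = Gr G′
  F : (G.V → Bool) → ℚ
  F c = Q (sumℕ (bit ∘ c) G.vs) (sumℕ (bit ∘ isWE G._≟_ G.es c) G.vs) (sumℕ (bit ∘ isWO G._≟_ G.es c) G.vs)
  F′ : (G′.V → Bool) → ℚ
  F′ c = Q (sumℕ (bit ∘ c) G′.vs) (sumℕ (bit ∘ isWE G′._≟_ G′.es c) G′.vs) (sumℕ (bit ∘ isWO G′._≟_ G′.es c) G′.vs)
  bc-pull : ∀ c v → bc G′._≟_ G′.es c (θ v) ≡ bc G._≟_ G.es (c ∘ θ) v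
  bc-pull c v = ≡.trans (bc-≋ G′._≟_ c (θ v) ep) (bc-map G._≟_ G′._≟_ θ inj G.es c v)
  sum-pull : ∀ {f : G′.V → ℕ} {g : G.V → ℕ} → (∀ v → f (θ v) ≡ g v) → sumℕ f G′.vs ≡ sumℕ g G.vs
  sum-pull {f} {g} eq = ≡.trans (sumℕ-↭ f vp) (≡.trans (sumℕ-map θ f G.vs) (sumℕ-cong G.vs eq))
  pull : ∀ c → F′ c ≡ F (c ∘ θ)
  pull c = cong₃ Q (sum-pull (λ v → refl))
    (sum-pull (λ v → cong (λ i → bit (not (c (θ v)) ∧ even? i)) (bc-pull c v)))
    (sum-pull (λ v → cong (λ i → bit (not (c (θ v)) ∧ not (even? i))) (bc-pull c v)))

fromFG : FGraph → Gr
fromFG G = mkGr V eqV verts (map ends edges) where open FGraph G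

mutual
  -- The left side is the recursion local to `colourings`, which has no name here; it is inferred
  -- from the use in `colourings≡cols`.
  colourings-go : ∀ (G : FGraph) (vs : List (FGraph.V G)) → _ ≡ cols (FGraph.eqV G) vs

  colourings≡cols : ∀ G → colourings G ≡ cols (FGraph.eqV G) (FGraph.verts G)
  colourings≡cols G with FGraph.verts G
  ... | vs = colourings-go G vs

  colourings-go G []       = refl
  colourings-go G (v ∷ vs) = cong (concatMap (λ c → upd (FGraph.eqV G) v true c ∷ upd (FGraph.eqV G) v false c ∷ [])) (colourings-go G vs)

mutual
  blackCount-contrib : ∀ (G : FGraph) c v (e : FGraph.E G) → _ ≡ contrib (FGraph.eqV G) c v (FGraph.ends G e)

  blackCount≡bc : ∀ G c v → blackCount G c v ≡ bc (FGraph.eqV G) (map (FGraph.ends G) (FGraph.edges G)) c v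
  blackCount≡bc G c v = ≡.trans (cong (List.foldr ℕ._+_ 0) (ListP.map-cong (blackCount-contrib G c v) (FGraph.edges G)))
    (sym (sumℕ-map (FGraph.ends G) (contrib (FGraph.eqV G) c v) (FGraph.edges G)))

  blackCount-contrib G c v e with FGraph.ends G e
  ... | (a , b) = refl

module _ (G : FGraph) where

  open FGraph G

  private
    es = map ends edges

  isWhiteEven≡isWE : ∀ c v → isWhiteEven G c v ≡ isWE eqV es c v
  isWhiteEven≡isWE c v = cong (λ i → not (c v) ∧ even? i) (blackCount≡bc G c v)

  isWhiteOdd≡isWO : ∀ c v → isWhiteOdd G c v ≡ isWO eqV es c v
  isWhiteOdd≡isWO c v = cong (λ i → not (c v) ∧ not (even? i)) (blackCount≡bc G c v)

  #black≡ : ∀ c → #black G c ≡ sumℕ (bit ∘ c) verts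
  #black≡ c = count≡sumℕ c verts

  #whiteEven≡ : ∀ c → #whiteEven G c ≡ sumℕ (bit ∘ isWE eqV es c) verts
  #whiteEven≡ c = ≡.trans (count≡sumℕ (isWhiteEven G c) verts) (sumℕ-cong verts (cong bit ∘ isWhiteEven≡isWE c))

  #whiteOdd≡ : ∀ c → #whiteOdd G c ≡ sumℕ (bit ∘ isWO eqV es c) verts
  #whiteOdd≡ c = ≡.trans (count≡sumℕ (isWhiteOdd G c) verts) (sumℕ-cong verts (cong bit ∘ isWhiteOdd≡isWO c))

  ∑-colourings : ∀ Q → ∑ (colourings G) (λ c → Q (#black G c) (#whiteEven G c) (#whiteOdd G c)) ≡ colourSum Q (fromFG G)
  ∑-colourings Q = ≡.trans (∑-cong (colourings G) (λ c → cong₃ Q (#black≡ c) (#whiteEven≡ c) (#whiteOdd≡ c)))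
    (cong (λ l → ∑ l (λ c → Q (sumℕ (bit ∘ c) verts) (sumℕ (bit ∘ isWE eqV es c) verts) (sumℕ (bit ∘ isWO eqV es c) verts))) (colourings≡cols G))

-- Tree series

∑-tabulate : ∀ m (xs : List A) (H : List A → ℚ) → ∑ (allFuns m xs) (H ∘ tabulate) ≡ ∑ (lists m xs) H
∑-tabulate zero    xs H = refl
∑-tabulate (suc m) xs H = ≡.trans (∑-concatMap-map _ xs (allFuns m xs) (H ∘ tabulate))
  (≡.trans (∑-cong xs (λ a → ∑-tabulate m xs (λ l → H (a ∷ l)))) (sym (∑-lists-suc m xs H)))

xnor : Bool → Bool → Bool
xnor true  b = b
xnor false b = not b

even?-suc : ∀ n → even? (suc n) ≡ not (even? n)
even?-suc zero          = refl
even?-suc (suc zero)    = refl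
even?-suc (suc (suc n)) = even?-suc n

even?-+ : ∀ m n → even? (m ℕ.+ n) ≡ xnor (even? m) (even? n)
even?-+ zero    n = refl
even?-+ (suc m) n = begin
  even? (suc (m ℕ.+ n))               ≡⟨ even?-suc (m ℕ.+ n) ⟩
  not (even? (m ℕ.+ n))               ≡⟨ cong not (even?-+ m n) ⟩
  not (xnor (even? m) (even? n))      ≡⟨ lemma (even? m) (even? n) ⟩
  xnor (not (even? m)) (even? n)      ≡⟨ cong (λ b → xnor b (even? n)) (sym (even?-suc m)) ⟩
  xnor (even? (suc m)) (even? n)      ∎
  where
  lemma : ∀ a b → not (xnor a b) ≡ xnor (not a) b
  lemma true  b     = refl
  lemma false true  = refl
  lemma false false = refl

module _ {a : ℕ} (es : List (Fin (suc a) × Fin (suc a))) where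

  private
    _≟F_ : DecidableEquality (Fin (suc a))
    _≟F_ = FinP._≟_

  rootType : RootType → Fin (suc a) → (Fin (suc a) → Bool) → Bool
  rootType wPlus  r c = isWE _≟F_ es c r
  rootType wMinus r c = isWO _≟F_ es c r
  rootType blk    r c = c r

  whiteEvens : List (Fin (suc a)) → (Fin (suc a) → Bool) → ℕ
  whiteEvens vs c = sumℕ (bit ∘ isWE _≟F_ es c) vs

treeColours : RootType → (ℤ → ℚ) → Tree → ℚ
treeColours ty ψ (a , r , es) = ∑ (cols FinP._≟_ (allFin (suc a))) (λ c → χ (rootType es ty r c) * ψ (ℤ.+ whiteEvens es (allFin (suc a)) c))

-- The rooted orbit count replaces class size times automorphisms by the uniform weight of labelled
-- trees, which brings the tree series into the form of `𝕋`.
treeSeries-⟦⟧ : ∀ ty i ψ → ⟦ treeSeries ty i ⟧ ψ ≡ 𝕋 i (treeColours ty ψ)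
treeSeries-⟦⟧ ty zero    ψ = refl
treeSeries-⟦⟧ ty (suc a) ψ = begin
  ⟦ treeSeries ty (suc a) ⟧ ψ
    ≡⟨ ∑-concatMap (λ r → concatMap (term r) (filterᵇ connected (allGraphs (suc a) a))) (allFin (suc a)) _ ⟩
  ∑ (allFin (suc a)) (λ r → ∑ (concatMap (term r) (filterᵇ connected (allGraphs (suc a) a))) (λ (k , q) → q * ψ k))
    ≡⟨ ∑-cong (allFin (suc a)) (λ r → ≡.trans (∑-concatMap (term r) (filterᵇ connected (allGraphs (suc a) a)) _) (∑-filter connected (allGraphs (suc a) a) _)) ⟩
  ∑ (allFin (suc a)) (λ r → ∑ (allGraphs (suc a) a) (λ G → χ (connected G) * ⟦ term r G ⟧ ψ))
    ≡⟨ ∑-cong (allFin (suc a)) (λ r → ≡.trans (∑-cong (allGraphs (suc a) a) (pointwise r)) (∑-tabulate a (pairs (suc a)) (λ es → tw (a , r , es) * treeColours ty ψ (a , r , es)))) ⟩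
  ∑ (allFin (suc a)) (λ r → ∑ (lists a (pairs (suc a))) (λ es → tw (a , r , es) * treeColours ty ψ (a , r , es)))
    ≡⟨ ∑-swap (allFin (suc a)) (lists a (pairs (suc a))) _ ⟩
  ∑ (lists a (pairs (suc a))) (λ es → ∑ (allFin (suc a)) (λ r → tw (a , r , es) * treeColours ty ψ (a , r , es)))
    ≡⟨ sym (𝕋-suc a (treeColours ty ψ)) ⟩
  𝕋 (suc a) (treeColours ty ψ) ∎
  where
  monomials : LGraph (suc a) a → Fin (suc a) → LPoly
  monomials G r = map (λ c → (ℤ.+ #whiteEven (toFG G) c , 1ℚ)) (filterᵇ (rootOK ty G r) (colourings (toFG G)))

  term : Fin (suc a) → LGraph (suc a) a → LPoly
  term r G = scaleP (recip (classSizeR G r ℕ.* autCountR G r)) (monomials G r)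

  rootOK≡ : ∀ ty G r c → rootOK ty {suc a} G r c ≡ rootType (map G (allFin a)) ty r c
  rootOK≡ wPlus  G r c = isWhiteEven≡isWE (toFG G) c r
  rootOK≡ wMinus G r c = isWhiteOdd≡isWO (toFG G) c r
  rootOK≡ blk    G r c = refl

  pointwise : ∀ r G → χ (connected G) * ⟦ term r G ⟧ ψ ≡ tw (a , r , tabulate G) * treeColours ty ψ (a , r , tabulate G)
  pointwise r G = begin
    χ (connected G) * ⟦ term r G ⟧ ψ
      ≡⟨ cong₂ _*_ (cong χ (connected-tabulate G)) (⟦⟧-scaleP (recip (classSizeR G r ℕ.* autCountR G r)) (monomials G r) ψ) ⟩
    χ (connᵇ (suc a) (tabulate G)) * (recip (classSizeR G r ℕ.* autCountR G r) * ⟦ monomials G r ⟧ ψ)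
      ≡⟨ cong (χ (connᵇ (suc a) (tabulate G)) *_) (cong₂ _*_ (recip-cong (classSizeR G r ℕ.* autCountR G r) (vol≢0 (suc a) a) (orbit-stabiliserᵣ G r)) colours) ⟩
    χ (connᵇ (suc a) (tabulate G)) * (wt (suc a) a * treeColours ty ψ (a , r , tabulate G))
      ≡⟨ ≡.trans (*-left-comm (χ (connᵇ (suc a) (tabulate G))) (wt (suc a) a) _) (sym (*-assoc (wt (suc a) a) _ _)) ⟩
    tw (a , r , tabulate G) * treeColours ty ψ (a , r , tabulate G) ∎
    where
    colours : ⟦ monomials G r ⟧ ψ ≡ treeColours ty ψ (a , r , tabulate G)
    colours = begin
      ⟦ monomials G r ⟧ ψ
        ≡⟨ ≡.trans (∑-map _ (filterᵇ (rootOK ty G r) (colourings (toFG G))) _) (∑-filter (rootOK ty G r) (colourings (toFG G)) _) ⟩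
      ∑ (colourings (toFG G)) (λ c → χ (rootOK ty G r c) * (1ℚ * ψ (ℤ.+ #whiteEven (toFG G) c)))
        ≡⟨ ∑-cong (colourings (toFG G)) (λ c → cong₂ _*_ (cong χ (rootOK≡ ty G r c)) (≡.trans (*-identityˡ _) (cong (ψ ∘ ℤ.+_) (#whiteEven≡ (toFG G) c)))) ⟩
      ∑ (colourings (toFG G)) (λ c → χ (rootType (map G (allFin a)) ty r c) * ψ (ℤ.+ whiteEvens (map G (allFin a)) (allFin (suc a)) c))
        ≡⟨ cong₂ (λ l es → ∑ l (λ c → χ (rootType es ty r c) * ψ (ℤ.+ whiteEvens es (allFin (suc a)) c))) (colourings≡cols (toFG G)) (ListP.map-tabulate id G) ⟩
      treeColours ty ψ (a , r , tabulate G) ∎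

-- The contribution of a tree to the number of white vertices with even count, when its root is identified with a vertex
-- of colour b whose count elsewhere has parity p.
graftedEvens : Bool → Bool → (t : Tree) → (Fin (suc (proj₁ t)) → Bool) → ℕ
graftedEvens b p (a , r , es) c = bit (not b ∧ xnor p (even? (bc FinP._≟_ es c r))) ℕ.+ whiteEvens es (nonroots r) c

module _ (a : ℕ) (r : Fin (suc a)) (es : List (Fin (suc a) × Fin (suc a))) where

  private
    _≟F_ : DecidableEquality (Fin (suc a))
    _≟F_ = FinP._≟_
    vertices = allFin (suc a)

  whiteEvens-ext : ∀ vs → ∀ {c c′ : Fin (suc a) → Bool} → (∀ x → c x ≡ c′ x) → whiteEvens es vs c ≡ whiteEvens es vs c′
  whiteEvens-ext vs eq = sumℕ-cong vs (cong bit ∘ isWE-ext _≟F_ es eq)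

  ∑-root : ∀ {F : (Fin (suc a) → Bool) → ℚ} → Ext F → ∑ (cols _≟F_ vertices) F ≡ ∑ (cols _≟F_ (nonroots r)) (λ c → F (upd _≟F_ r true c) + F (upd _≟F_ r false c))
  ∑-root F-ext = ≡.trans (cols-↭ _≟F_ F-ext (allFin-root r)) (∑-cols-∷ _≟F_ r (nonroots r) _)

  whiteEvens-root : ∀ c → whiteEvens es vertices c ≡ bit (isWE _≟F_ es c r) ℕ.+ whiteEvens es (nonroots r) c
  whiteEvens-root c = sumℕ-↭ (bit ∘ isWE _≟F_ es c) (allFin-root r)

  rootType-ext : ∀ ty → ∀ {c c′ : Fin (suc a) → Bool} → (∀ x → c x ≡ c′ x) → rootType es ty r c ≡ rootType es ty r c′
  rootType-ext wPlus  eq = isWE-ext _≟F_ es eq r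
  rootType-ext wMinus eq = isWO-ext _≟F_ es eq r
  rootType-ext blk    eq = eq r

  private
    graftedSum : Bool → Bool → (ℤ → ℚ) → ℚ
    graftedSum b p ψ = ∑ (cols _≟F_ (nonroots r)) (λ c → ψ (ℤ.+ graftedEvens b p (a , r , es) (upd _≟F_ r b c)))

    term-ext : ∀ ty (ψ : ℤ → ℚ) → Ext (λ c → χ (rootType es ty r c) * ψ (ℤ.+ whiteEvens es vertices c))
    term-ext ty ψ eq = cong₂ (λ x y → χ x * ψ (ℤ.+ y)) (rootType-ext ty eq) (whiteEvens-ext vertices eq)

  treeColours-black : ∀ p ψ → treeColours blk ψ (a , r , es) ≡ graftedSum true p ψ
  treeColours-black p ψ = ≡.trans (∑-root (term-ext blk ψ)) (∑-cong (cols _≟F_ (nonroots r)) (λ c → begin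
    term (upd _≟F_ r true c) + term (upd _≟F_ r false c)
      ≡⟨ cong₂ _+_ (χ-true* _ (upd-same _≟F_ r true c)) (χ-false* _ (upd-same _≟F_ r false c)) ⟩
    ψ (ℤ.+ whiteEvens es vertices (upd _≟F_ r true c)) + 0ℚ
      ≡⟨ +-identityʳ _ ⟩
    ψ (ℤ.+ whiteEvens es vertices (upd _≟F_ r true c))
      ≡⟨ cong (ψ ∘ ℤ.+_) (≡.trans (whiteEvens-root _) (cong (λ b → bit (not b ∧ even? (bc _≟F_ es (upd _≟F_ r true c) r)) ℕ.+ whiteEvens es (nonroots r) (upd _≟F_ r true c))
           (upd-same _≟F_ r true c))) ⟩
    ψ (ℤ.+ graftedEvens true p (a , r , es) (upd _≟F_ r true c)) ∎))
    where
    term : (Fin (suc a) → Bool) → ℚ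
    term c = χ (c r) * ψ (ℤ.+ whiteEvens es vertices c)

  module _ (p : Bool) (ψ ψ₊ ψ₋ : ℤ → ℚ)
    (even-root : ∀ w → ψ₊ (ℤ.+ suc w) ≡ ψ (ℤ.+ (bit (xnor p true) ℕ.+ w)))
    (odd-root  : ∀ w → ψ₋ (ℤ.+ w) ≡ ψ (ℤ.+ (bit (xnor p false) ℕ.+ w))) where

    -- The origin of the substitution. If the host has an even count outside the tree, the parity of
    -- the root in the tree is the final one. If it is odd, a root that is even in the tree becomes
    -- odd and loses its factor t, and an odd one becomes even and gains it: this gives t⁻¹ and t.
    treeColours-white : treeColours wPlus ψ₊ (a , r , es) + treeColours wMinus ψ₋ (a , r , es) ≡ graftedSum false p ψ
    treeColours-white = ≡.trans (cong₂ _+_ (∑-root (term-ext wPlus ψ₊)) (∑-root (term-ext wMinus ψ₋)))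
      (≡.trans (sym (∑-+ _ _ (cols _≟F_ (nonroots r)))) (∑-cong (cols _≟F_ (nonroots r)) pointwise))
      where
      T₊ T₋ : (Fin (suc a) → Bool) → ℚ
      T₊ c = χ (isWE _≟F_ es c r) * ψ₊ (ℤ.+ whiteEvens es vertices c)
      T₋ c = χ (isWO _≟F_ es c r) * ψ₋ (ℤ.+ whiteEvens es vertices c)
      white : ∀ c → c r ≡ false → T₊ c + T₋ c ≡ ψ (ℤ.+ graftedEvens false p (a , r , es) c)
      white c eq rewrite whiteEvens-root c | eq with even? (bc _≟F_ es c r)
      ... | true  = ≡.trans (cong₂ _+_ (*-identityˡ _) (*-zeroˡ _)) (≡.trans (+-identityʳ _) (even-root _))
      ... | false = ≡.trans (cong₂ _+_ (*-zeroˡ _) (*-identityˡ _)) (≡.trans (+-identityˡ _) (odd-root _))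
      black : ∀ c → c r ≡ true → T₊ c ≡ 0ℚ × T₋ c ≡ 0ℚ
      black c eq rewrite eq = *-zeroˡ _ , *-zeroˡ _
      pointwise : ∀ c → (T₊ (upd _≟F_ r true c) + T₊ (upd _≟F_ r false c)) + (T₋ (upd _≟F_ r true c) + T₋ (upd _≟F_ r false c)) ≡
                        ψ (ℤ.+ graftedEvens false p (a , r , es) (upd _≟F_ r false c))
      pointwise c = ≡.trans
        (cong₂ _+_ (≡.trans (cong (_+ T₊ (upd _≟F_ r false c)) (proj₁ (black _ (upd-same _≟F_ r true c)))) (+-identityˡ _))
                   (≡.trans (cong (_+ T₋ (upd _≟F_ r false c)) (proj₂ (black _ (upd-same _≟F_ r true c)))) (+-identityˡ _)))
        (white _ (upd-same _≟F_ r false c))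

-- All three substituted series are one object: the generating function of the trees that can be
-- grafted on a vertex of colour `b` whose count outside the tree has parity `p`.
vertexS-𝕋 : ∀ b p i ψ → ⟦ vertexS b p i ⟧ ψ ≡
            𝕋 i (λ t@(a , r , es) → ∑ (cols FinP._≟_ (nonroots r)) (λ c → ψ (ℤ.+ graftedEvens b p t (upd FinP._≟_ r b c))))
vertexS-𝕋 true  p     i ψ = ≡.trans (treeSeries-⟦⟧ blk i ψ) (𝕋-cong i (λ (a , r , es) → treeColours-black a r es p ψ))
vertexS-𝕋 false true  i ψ = ≡.trans (∑-++ (𝒯w+ i) (𝒯w- i) _) (≡.trans (cong₂ _+_ (treeSeries-⟦⟧ wPlus i ψ) (treeSeries-⟦⟧ wMinus i ψ))
  (≡.trans (sym (𝕋-+ i _ _)) (𝕋-cong i (λ (a , r , es) → treeColours-white a r es true ψ ψ ψ (λ _ → refl) (λ _ → refl)))))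
vertexS-𝕋 false false i ψ = ≡.trans (∑-++ (shiftP (ℤ.-[1+ 0 ]) (𝒯w+ i)) (shiftP (ℤ.+ 1) (𝒯w- i)) _)
  (≡.trans (cong₂ _+_ (≡.trans (⟦⟧-shiftP (ℤ.-[1+ 0 ]) (𝒯w+ i) ψ) (treeSeries-⟦⟧ wPlus i _)) (≡.trans (⟦⟧-shiftP (ℤ.+ 1) (𝒯w- i) ψ) (treeSeries-⟦⟧ wMinus i _)))
  (≡.trans (sym (𝕋-+ i _ _)) (𝕋-cong i (λ (a , r , es) → treeColours-white a r es false ψ (λ k → ψ (ℤ.-[1+ 0 ] ℤ.+ k)) (λ k → ψ (ℤ.+ 1 ℤ.+ k)) (λ _ → refl) (λ _ → refl)))))

-- Colourings of a graph with attached trees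

module _ (K : Gr) where

  open Gr K

  seriesAt : (V → Bool) → V → Series
  seriesAt c v = vertexS (c v) (even? (bc _≟_ es c v))

  evensIn : List V → (V → Bool) → ℕ
  evensIn ds c = sumℕ (bit ∘ isWE _≟_ es c) ds

graft-inj : ∀ {a} (h : A) (r : Fin (suc a)) → Injective (graft h r)
graft-inj h r {x} {y} eq with x FinP.≟ r | y FinP.≟ r
... | yes refl | yes refl = refl
... | yes _    | no _     with () ← eq
... | no _     | yes _    with () ← eq
... | no _     | no _     = SumP.inj₂-injective eq

module AttachedColours (K : Gr) (h : Gr.V K) (a : ℕ) (r : Fin (suc a)) (tes : List (Fin (suc a) × Fin (suc a)))
  (c : Gr.V K → Bool) (c′ : Fin (suc a) → Bool) where

  open Gr K
  private
    t : Tree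
    t = (a , r , tes)
    Kₜ = attach K h t
    d = Gr._≟_ Kₜ
    c″ : V ⊎ Fin (suc a) → Bool
    c″ = [ c , c′ ]′
    cₜ : Fin (suc a) → Bool
    cₜ = upd FinP._≟_ r (c h) c′

  colour-graft : ∀ x → c″ (graft h r x) ≡ cₜ x
  colour-graft x with x FinP.≟ r
  ... | yes _ = refl
  ... | no _  = refl

  bc-split : ∀ v → bc d (Gr.es Kₜ) c″ v ≡ bc d (map (map² inj₁) es) c″ v ℕ.+ bc d (map (map² (graft h r)) tes) c″ v
  bc-split v = bc-++ d (map (map² inj₁) es) _ c″ v

  bc-old : ∀ u → bc d (map (map² inj₁) es) c″ (inj₁ u) ≡ bc _≟_ es c u
  bc-old u = bc-map _≟_ d inj₁ SumP.inj₁-injective es c″ u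

  bc-tree : ∀ x → bc d (map (map² (graft h r)) tes) c″ (graft h r x) ≡ bc FinP._≟_ tes cₜ x
  bc-tree x = ≡.trans (bc-map FinP._≟_ d (graft h r) (graft-inj h r) tes c″ x) (bc-ext FinP._≟_ tes colour-graft x)

  bc-other : ∀ {u} → u ≢ h → bc d (Gr.es Kₜ) c″ (inj₁ u) ≡ bc _≟_ es c u
  bc-other {u} u≢h = ≡.trans (bc-split (inj₁ u)) (≡.trans (cong₂ ℕ._+_ (bc-old u) (bc-out FinP._≟_ d (graft h r) c″ off tes)) (ℕP.+-identityʳ _))
    where
    off : ∀ x → graft h r x ≢ inj₁ u
    off x eq with x == r
    ... | true  = u≢h (sym (SumP.inj₁-injective eq))
    off x () | false

  bc-root : bc d (Gr.es Kₜ) c″ (inj₁ h) ≡ bc _≟_ es c h ℕ.+ bc FinP._≟_ tes cₜ r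
  bc-root = ≡.trans (bc-split (inj₁ h)) (cong₂ ℕ._+_ (bc-old h)
    (≡.trans (cong (bc d (map (map² (graft h r)) tes) c″) (sym (graft-root h r))) (bc-tree r)))

  bc-nonroot : ∀ {j} → j ≢ r → bc d (Gr.es Kₜ) c″ (inj₂ j) ≡ bc FinP._≟_ tes cₜ j
  bc-nonroot {j} j≢r = ≡.trans (bc-split (inj₂ j)) (cong₂ ℕ._+_ (bc-out _≟_ d inj₁ c″ (λ _ ()) es)
    (≡.trans (cong (bc d (map (map² (graft h r)) tes) c″) (sym (graft-nonroot h j≢r))) (bc-tree j)))

  evens-tree : evensIn Kₜ (Attached.treeVertices K h t) c″ ≡ graftedEvens (c h) (even? (bc _≟_ es c h)) t cₜ
  evens-tree = ≡.trans (sumℕ-↭ (bit ∘ isWE d (Gr.es Kₜ) c″) (Attached.treeVertices-↭ K h t)) (cong₂ ℕ._+_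
    (cong (λ e → bit (not (c h) ∧ e)) (≡.trans (cong even? bc-root) (even?-+ (bc _≟_ es c h) _)))
    (≡.trans (sumℕ-map inj₂ (bit ∘ isWE d (Gr.es Kₜ) c″) (nonroots r)) (≡.trans (sumℕ-map (punchIn r) _ (allFin a))
      (≡.trans (sumℕ-cong (allFin a) (λ i → cong₂ (λ b n → bit (not b ∧ even? n))
        (sym (upd-other FinP._≟_ (c h) c′ (FinP.punchInᵢ≢i r i))) (bc-nonroot (FinP.punchInᵢ≢i r i))))
        (sym (sumℕ-map (punchIn r) (bit ∘ isWE FinP._≟_ tes cₜ) (allFin a)))))))

  evens-old : ∀ ds → All (_≢ h) ds → evensIn Kₜ (map inj₁ ds) c″ ≡ evensIn K ds c
  evens-old ds ne = ≡.trans (sumℕ-map inj₁ (bit ∘ isWE d (Gr.es Kₜ) c″) ds)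
    (sumℕ-cong-All (All.map (λ {u} u≢h → cong (λ n → bit (not (c u) ∧ even? n)) (bc-other u≢h)) ne))

  -- A tree at `h` changes the black-neighbour count of no other old vertex, so the series for the
  -- vertices still waiting depend only on the colouring of `K`. This independence is what makes the
  -- tree sum factor.
  series-old : ∀ (ι : A → V) hs → All (λ b → ι b ≢ h) hs → map (seriesAt Kₜ c″ ∘ inj₁ ∘ ι) hs ≡ map (seriesAt K c ∘ ι) hs
  series-old ι []       []         = refl
  series-old ι (b ∷ hs) (ne ∷ nes) = cong₂ _∷_ (cong (λ n → vertexS (c (ι b)) (even? n)) (bc-other ne)) (series-old ι hs nes)

whiteEvenSum : (ℤ → ℚ) → Gr → ℚ
whiteEvenSum φ = colourSum (λ _ j _ → φ (ℤ.+ j))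

module _ (φ : ℤ → ℚ) where

  -- the generating function of the trees attached to K factors over the vertices of K once K is coloured
  τ-colours : ∀ (hs : List A) K (ι : A → Gr.V K) ds → Partition K ι ds hs → ∀ N →
    τ K ι hs N (whiteEvenSum φ) ≡
    ∑ (cols (Gr._≟_ K) (Gr.vs K)) (λ c → ⟦ prodS (map (seriesAt K c ∘ ι) hs) N ⟧ (λ m → φ (m ℤ.+ ℤ.+ evensIn K ds c)))
  τ-colours [] K ι ds P zero = ∑-cong (cols (Gr._≟_ K) (Gr.vs K)) (λ c → sym (≡.trans (+-identityʳ _) (≡.trans (*-identityˡ _)
    (cong φ (≡.trans (ℤP.+-identityˡ _) (cong ℤ.+_ (sym (sumℕ-↭ (bit ∘ isWE (Gr._≟_ K) (Gr.es K) c)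
      (trans (Partition.split P) (≡⇒↭ (ListP.++-identityʳ ds)))))))))))
  τ-colours [] K ι ds P (suc N) = sym (∑-0 (cols (Gr._≟_ K) (Gr.vs K)) (λ _ → refl))
  τ-colours (k ∷ hs) K ι ds P N = begin
    ⨁ N (λ i j → 𝕋 i (λ t → τ (attach K h t) (inj₁ ∘ ι) hs j (whiteEvenSum φ)))
      -- A colouring of the graph with tree is a colouring of `K` together with one of the vertices
      -- other than the root, the root taking the colour of `h`. Once the colouring of `K` is pulled
      -- out, the sum over trees is the series at `h`.
      ≡⟨ ⨁-cong N (λ i j → 𝕋-cong i (λ t@(a , r , es) → ≡.trans
           (τ-colours hs (attach K h t) (inj₁ ∘ ι) _ (Attached.Partition-attach K h t P refl) j)
           (≡.trans (cols-⊎ K._≟_ FinP._≟_ (Z-ext t j) K.vs (nonroots r))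
                    (∑-cong (cols K._≟_ K.vs) (λ c → ∑-cong (cols FinP._≟_ (nonroots r)) (λ c′ → factor t j c c′)))))) ⟩
    ⨁ N (λ i j → 𝕋 i (λ t → ∑ (cols K._≟_ K.vs) (λ c → grafted c j t)))
      ≡⟨ ≡.trans (⨁-cong N (λ i j → 𝕋-∑ i (cols K._≟_ K.vs) (λ c → grafted c j))) (sym (⨁-∑ N (cols K._≟_ K.vs) _)) ⟩
    ∑ (cols K._≟_ K.vs) (λ c → ⨁ N (λ i j → 𝕋 i (grafted c j)))
      ≡⟨ ∑-cong (cols K._≟_ K.vs) (λ c → ≡.trans
           (⨁-cong N (λ i j → sym (vertexS-𝕋 (c h) (even? (bc K._≟_ K.es c h)) i (ψ c j))))
           (sym (⟦⟧-⊗ (seriesAt K c h) (prodS (map (seriesAt K c ∘ ι) hs)) N _))) ⟩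
    ∑ (cols K._≟_ K.vs) (λ c → ⟦ prodS (map (seriesAt K c ∘ ι) (k ∷ hs)) N ⟧ (λ m → φ (m ℤ.+ ℤ.+ evensIn K ds c))) ∎
    where
    module K = Gr K
    h = ι k
    ψ : (K.V → Bool) → ℕ → ℤ → ℚ
    ψ c j e = ⟦ prodS (map (seriesAt K c ∘ ι) hs) j ⟧ (λ l → φ ((e ℤ.+ l) ℤ.+ ℤ.+ evensIn K ds c))
    grafted : (K.V → Bool) → ℕ → Tree → ℚ
    grafted c j t@(a , r , es) = ∑ (cols FinP._≟_ (nonroots r)) (λ c′ →
      ψ c j (ℤ.+ graftedEvens (c h) (even? (bc K._≟_ K.es c h)) t (upd FinP._≟_ r (c h) c′)))
    done : (t : Tree) → List (Gr.V (attach K h t))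
    done t = Attached.done K h t P refl
    Z : (t : Tree) → ℕ → (Gr.V (attach K h t) → Bool) → ℚ
    Z t j c″ = ⟦ prodS (map (seriesAt (attach K h t) c″ ∘ inj₁ ∘ ι) hs) j ⟧ (λ m → φ (m ℤ.+ ℤ.+ evensIn (attach K h t) (done t) c″))
    Z-ext : ∀ t j → Ext (Z t j)
    Z-ext t j {c} {c′} eq = ≡.trans
      (cong (λ ss → ⟦ prodS ss j ⟧ (λ m → φ (m ℤ.+ ℤ.+ evensIn Kₜ (done t) c))) (ListP.map-cong (λ b →
        cong₂ (λ x n → vertexS x (even? n)) (eq (inj₁ (ι b))) (bc-ext (Gr._≟_ Kₜ) (Gr.es Kₜ) eq (inj₁ (ι b)))) hs))
      (⟦⟧-cong (prodS (map (seriesAt Kₜ c′ ∘ inj₁ ∘ ι) hs) j) (λ m → cong (λ n → φ (m ℤ.+ ℤ.+ n))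
        (sumℕ-cong (done t) (cong bit ∘ isWE-ext (Gr._≟_ Kₜ) (Gr.es Kₜ) eq))))
      where Kₜ = attach K h t
    others : All (λ b → ι b ≢ h) hs
    others = AllP.map⁻ (AllP.++⁻ʳ ds (All.map (λ ne eq → ne (sym eq)) (Unique-head (Unique-↭ (trans (Partition.split P) (↭P.shift h ds (map ι hs))) (Partition.unique P)))))
    factor : ∀ (t : Tree) j c (c′ : Fin (suc (proj₁ t)) → Bool) →
             Z t j [ c , c′ ]′ ≡ ψ c j (ℤ.+ graftedEvens (c h) (even? (bc K._≟_ K.es c h)) t (upd FinP._≟_ (proj₁ (proj₂ t)) (c h) c′))
    factor t@(a , r , es) j c c′ = ≡.trans
      (cong (λ ss → ⟦ prodS ss j ⟧ (λ m → φ (m ℤ.+ ℤ.+ evensIn (attach K h t) (done t) [ c , c′ ]′))) (AC.series-old ι hs others))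
      (⟦⟧-cong (prodS (map (seriesAt K c ∘ ι) hs) j) (λ m → cong φ (begin
        m ℤ.+ ℤ.+ evensIn (attach K h t) (done t) [ c , c′ ]′
          ≡⟨ cong (λ n → m ℤ.+ ℤ.+ n) (≡.trans (sumℕ-++ (bit ∘ isWE (Gr._≟_ (attach K h t)) (Gr.es (attach K h t)) [ c , c′ ]′) (map inj₁ ds) (Attached.treeVertices K h t))
               (cong₂ ℕ._+_ (AC.evens-old ds (Attached.ds≢h K h t P refl)) AC.evens-tree)) ⟩
        m ℤ.+ ℤ.+ (evensIn K ds c ℕ.+ e)
          ≡⟨ cong (λ n → m ℤ.+ ℤ.+ n) (ℕP.+-comm (evensIn K ds c) e) ⟩
        m ℤ.+ (ℤ.+ e ℤ.+ ℤ.+ evensIn K ds c)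
          ≡⟨ sym (ℤP.+-assoc m (ℤ.+ e) (ℤ.+ evensIn K ds c)) ⟩
        (m ℤ.+ ℤ.+ e) ℤ.+ ℤ.+ evensIn K ds c
          ≡⟨ cong (ℤ._+ ℤ.+ evensIn K ds c) (ℤP.+-comm m (ℤ.+ e)) ⟩
        (ℤ.+ e ℤ.+ m) ℤ.+ ℤ.+ evensIn K ds c ∎)))
      where
      module AC = AttachedColours K h a r es c c′
      e = graftedEvens (c h) (even? (bc K._≟_ K.es c h)) t (upd FinP._≟_ r (c h) c′)

-- The two sides of the theorem

∑-tuples : ∀ m k (H : List ℕ → ℚ) → ∑ (tuples m k) (H ∘ tabulate) ≡ ∑ᵗ m k H
∑-tuples zero    zero    H = +-identityʳ _
∑-tuples zero    (suc k) H = refl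
∑-tuples (suc m) k       H = ≡.trans (∑-concatMap-mapᵈ _ (upTo (suc k)) (λ i → tuples m (k ∸ i)) (H ∘ tabulate))
  (≡.trans (∑-cong (upTo (suc k)) (λ i → ∑-tuples m (k ∸ i) (λ ns → H (i ∷ ns))))
           (⨁-upTo k (λ i j → ∑ᵗ m j (λ ns → H (i ∷ ns)))))

concatMap-suc : ∀ {B : Set} m (h : Fin (suc m) → List B) → concatMap h (allFin (suc m)) ≡ h Fin.zero ++ concatMap (h ∘ Fin.suc) (allFin m)
concatMap-suc m h = cong (λ l → h Fin.zero ++ List.concat l)
  (≡.trans (cong (map h) (sym (ListP.map-tabulate id Fin.suc))) (sym (ListP.map-∘ (allFin m))))

map-concatMap : ∀ {A B C : Set} (θ : B → C) (h : A → List B) xs → map θ (concatMap h xs) ≡ concatMap (map θ ∘ h) xs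
map-concatMap θ h []       = refl
map-concatMap θ h (x ∷ xs) = ≡.trans (ListP.map-++ θ (h x) _) (cong (map θ (h x) ++_) (map-concatMap θ h xs))

concatMap-cong : ∀ {A B : Set} {h h′ : A → List B} → (∀ x → h x ≡ h′ x) → ∀ xs → concatMap h xs ≡ concatMap h′ xs
concatMap-cong eq xs = cong List.concat (ListP.map-cong eq xs)

-- The simultaneous subdivision of the statement, over a base graph that may already have edges, so
-- that the first edge can be moved into the base.
subdivideAll : (K : Gr) {m : ℕ} → (Fin m → Gr.V K × Gr.V K) → (Fin m → ℕ) → Gr
subdivideAll K {m} G ns = mkGr (V ⊎ Σ (Fin m) (Fin ∘ ns)) (SumP.≡-dec _≟_ (ProdP.≡-dec FinP._≟_ FinP._≟_))
  (map inj₁ vs ++ concatMap (λ e → map (λ i → inj₂ (e , i)) (allFin (ns e))) (allFin m))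
  (map (map² inj₁) es ++ concatMap (λ e → path (inj₁ (proj₁ (G e))) (ns e) (λ i → inj₂ (e , i)) (inj₁ (proj₂ (G e)))) (allFin m))
  where open Gr K

Ren-subdivideAll-suc : ∀ (K : Gr) {m} (G : Fin (suc m) → Gr.V K × Gr.V K) ns →
  Ren (subdivideAll K G ns)
      (subdivideAll (addPath K (proj₁ (G Fin.zero)) (proj₂ (G Fin.zero)) (ns Fin.zero)) (map² inj₁ ∘ G ∘ Fin.suc) (ns ∘ Fin.suc))
Ren-subdivideAll-suc K {m} G ns = ren θ (λ {x} {y} → θ-inj x y) (≡⇒↭ (sym verts)) (≡⇒≋ (sym edges))
  where
  open Gr K
  i = ns Fin.zero
  θ : V ⊎ Σ (Fin (suc m)) (Fin ∘ ns) → (V ⊎ Fin i) ⊎ Σ (Fin m) (Fin ∘ ns ∘ Fin.suc)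
  θ (inj₁ v)                = inj₁ (inj₁ v)
  θ (inj₂ (Fin.zero , k))   = inj₁ (inj₂ k)
  θ (inj₂ (Fin.suc e , k))  = inj₂ (e , k)
  θ-inj : ∀ x y → θ x ≡ θ y → x ≡ y
  θ-inj (inj₁ v)               (inj₁ w)               refl = refl
  θ-inj (inj₁ v)               (inj₂ (Fin.zero , _))  ()
  θ-inj (inj₁ v)               (inj₂ (Fin.suc _ , _)) ()
  θ-inj (inj₂ (Fin.zero , k))  (inj₁ w)               ()
  θ-inj (inj₂ (Fin.zero , k))  (inj₂ (Fin.zero , l))  refl = refl
  θ-inj (inj₂ (Fin.zero , k))  (inj₂ (Fin.suc _ , _)) ()
  θ-inj (inj₂ (Fin.suc e , k)) (inj₁ w)               ()
  θ-inj (inj₂ (Fin.suc e , k)) (inj₂ (Fin.zero , _))  ()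
  θ-inj (inj₂ (Fin.suc e , k)) (inj₂ (Fin.suc f , l)) refl = refl
  innerAt : ∀ e → List (V ⊎ Σ (Fin (suc m)) (Fin ∘ ns))
  innerAt e = map (λ k → inj₂ (e , k)) (allFin (ns e))
  pathAt : ∀ e → List ((V ⊎ Σ (Fin (suc m)) (Fin ∘ ns)) × (V ⊎ Σ (Fin (suc m)) (Fin ∘ ns)))
  pathAt e = path (inj₁ (proj₁ (G e))) (ns e) (λ k → inj₂ (e , k)) (inj₁ (proj₂ (G e)))
  verts : map θ (map inj₁ vs ++ concatMap innerAt (allFin (suc m))) ≡
          map inj₁ (map inj₁ vs ++ map inj₂ (allFin i)) ++ concatMap (λ e → map (λ k → inj₂ (e , k)) (allFin (ns (Fin.suc e)))) (allFin m)
  verts = begin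
    map θ (map inj₁ vs ++ concatMap innerAt (allFin (suc m)))
      ≡⟨ ≡.trans (ListP.map-++ θ (map inj₁ vs) _) (cong₂ _++_ (sym (ListP.map-∘ vs)) (cong (map θ) (concatMap-suc m innerAt))) ⟩
    map (inj₁ ∘ inj₁) vs ++ map θ (innerAt Fin.zero ++ concatMap (innerAt ∘ Fin.suc) (allFin m))
      ≡⟨ cong (map (inj₁ ∘ inj₁) vs ++_) (≡.trans (ListP.map-++ θ (innerAt Fin.zero) _) (cong₂ _++_ (sym (ListP.map-∘ (allFin i)))
           (≡.trans (map-concatMap θ (innerAt ∘ Fin.suc) (allFin m)) (concatMap-cong (λ e → sym (ListP.map-∘ (allFin (ns (Fin.suc e))))) (allFin m))))) ⟩
    map (inj₁ ∘ inj₁) vs ++ (map (inj₁ ∘ inj₂) (allFin i) ++ concatMap (λ e → map (λ k → inj₂ (e , k)) (allFin (ns (Fin.suc e)))) (allFin m))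
      ≡⟨ ≡.trans (sym (ListP.++-assoc (map (inj₁ ∘ inj₁) vs) _ _)) (cong (_++ concatMap (λ e → map (λ k → inj₂ (e , k)) (allFin (ns (Fin.suc e)))) (allFin m)) (sym (map-++-∘ inj₁ inj₁ inj₂ vs (allFin i)))) ⟩
    map inj₁ (map inj₁ vs ++ map inj₂ (allFin i)) ++ concatMap (λ e → map (λ k → inj₂ (e , k)) (allFin (ns (Fin.suc e)))) (allFin m) ∎
  edges : map (map² θ) (map (map² inj₁) es ++ concatMap pathAt (allFin (suc m))) ≡
          map (map² inj₁) (map (map² inj₁) es ++ path (inj₁ (proj₁ (G Fin.zero))) i inj₂ (inj₁ (proj₂ (G Fin.zero)))) ++
          concatMap (λ e → path (inj₁ (inj₁ (proj₁ (G (Fin.suc e))))) (ns (Fin.suc e)) (λ k → inj₂ (e , k)) (inj₁ (inj₁ (proj₂ (G (Fin.suc e)))))) (allFin m)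
  edges = begin
    map (map² θ) (map (map² inj₁) es ++ concatMap pathAt (allFin (suc m)))
      ≡⟨ ≡.trans (ListP.map-++ (map² θ) (map (map² inj₁) es) _) (cong₂ _++_ (map²-∘ (λ _ → refl) es) (cong (map (map² θ)) (concatMap-suc m pathAt))) ⟩
    map (map² (inj₁ ∘ inj₁)) es ++ map (map² θ) (pathAt Fin.zero ++ concatMap (pathAt ∘ Fin.suc) (allFin m))
      ≡⟨ cong (map (map² (inj₁ ∘ inj₁)) es ++_) (≡.trans (ListP.map-++ (map² θ) (pathAt Fin.zero) _) (cong₂ _++_
           (≡.trans (path-map θ _ i _ _) (sym (path-map inj₁ _ i _ _)))
           (≡.trans (map-concatMap (map² θ) (pathAt ∘ Fin.suc) (allFin m)) (concatMap-cong (λ e → path-map θ _ (ns (Fin.suc e)) _ _) (allFin m))))) ⟩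
    map (map² (inj₁ ∘ inj₁)) es ++ (map (map² inj₁) (path (inj₁ (proj₁ (G Fin.zero))) i inj₂ (inj₁ (proj₂ (G Fin.zero)))) ++ rest)
      ≡⟨ ≡.trans (sym (ListP.++-assoc (map (map² (inj₁ ∘ inj₁)) es) _ rest)) (cong (_++ rest) (≡.trans
           (cong (_++ map (map² inj₁) (path (inj₁ (proj₁ (G Fin.zero))) i inj₂ (inj₁ (proj₂ (G Fin.zero))))) (sym (map²-∘ (λ _ → refl) es)))
           (sym (ListP.map-++ (map² inj₁) (map (map² inj₁) es) _)))) ⟩
    map (map² inj₁) (map (map² inj₁) es ++ path (inj₁ (proj₁ (G Fin.zero))) i inj₂ (inj₁ (proj₂ (G Fin.zero)))) ++ rest ∎
    where
    rest = concatMap (λ e → path (inj₁ (inj₁ (proj₁ (G (Fin.suc e))))) (ns (Fin.suc e)) (λ k → inj₂ (e , k)) (inj₁ (inj₁ (proj₂ (G (Fin.suc e)))))) (allFin m)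

-- Reconciles the simultaneous subdivision with the construction that adds one path at a time, by
-- moving the edges into the base one after another.
subdivideAll-build : ∀ {f : Gr → ℚ} → Inv f → ∀ m K (ι : A → Gr.V K) (G : Fin m → A × A) ns →
  f (subdivideAll K (map² ι ∘ G) ns) ≡ f (build K ι (tabulate G) (tabulate ns))
subdivideAll-build f-inv zero    K ι G ns = sym (f-inv (ren inj₁ SumP.inj₁-injective (≡⇒↭ (ListP.++-identityʳ _)) (≡⇒≋ (ListP.++-identityʳ _))))
subdivideAll-build f-inv (suc m) K ι G ns = ≡.trans (f-inv (Ren-subdivideAll-suc K (map² ι ∘ G) ns))
  (subdivideAll-build f-inv m (addPath K _ _ (ns Fin.zero)) (inj₁ ∘ ι) (G ∘ Fin.suc) (ns ∘ Fin.suc))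

path-positions : ∀ {V : Set} n (p : ℕ → V) (g : Fin n → V) y → (∀ i → p (suc (toℕ i)) ≡ g i) → p (suc n) ≡ y →
  map (λ j → (p (toℕ j) , p (suc (toℕ j)))) (allFin (suc n)) ≡ path (p 0) n g y
path-positions zero    p g y innerAt last = cong (λ z → (p 0 , z) ∷ []) last
path-positions (suc n) p g y innerAt last = ≡.trans (cong (map (λ j → (p (toℕ j) , p (suc (toℕ j))))) (allFin-suc (suc n)))
  (cong₂ (λ z l → (p 0 , z) ∷ l) (innerAt Fin.zero) (≡.trans (sym (ListP.map-∘ (allFin (suc n))))
    (≡.trans (path-positions n (p ∘ suc) (g ∘ Fin.suc) y (innerAt ∘ Fin.suc) last) (cong (λ z → path z n (g ∘ Fin.suc) y) (innerAt Fin.zero)))))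

fromFG-subdivide : ∀ {n m} (G : LGraph n m) ns → fromFG (subdivide G ns) ≡ subdivideAll (gr n []) G ns
fromFG-subdivide {n} {m} G ns = cong (mkGr _ _ _) (≡.trans (map-concatMap _ _ (allFin m)) (concatMap-cong (λ e →
  ≡.trans (sym (ListP.map-∘ (allFin (suc (ns e))))) (path-positions (ns e) (pos G ns e) (λ i → inj₂ (e , i)) _ (inside e) (end e))) (allFin m)))
  where
  inside : ∀ e i → pos G ns e (suc (toℕ i)) ≡ inj₂ (e , i)
  inside e i with toℕ i ℕ.<? ns e
  ... | yes p = cong (λ j → inj₂ (e , j)) (FinP.fromℕ<-toℕ i p)
  ... | no ¬p = ⊥-elim (¬p (FinP.toℕ<n i))
  end : ∀ e → pos G ns e (suc (ns e)) ≡ inj₁ (proj₂ (G e))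
  end e with ns e ℕ.<? ns e
  ... | yes p = ⊥-elim (ℕP.<-irrefl refl p)
  ... | no _  = refl

colourSum-subdivide : ∀ Q {n m} (G : LGraph n m) ns → colourSum Q (fromFG (subdivide G ns)) ≡ colourSum Q (subdivided n (tabulate G) (tabulate ns))
colourSum-subdivide Q {n} {m} G ns = ≡.trans (cong (colourSum Q) (fromFG-subdivide G ns)) (subdivideAll-build (colourSum-Inv Q) m (gr n []) id G ns)

minDeg3≡md3 : ∀ {n m} (G : LGraph n m) → minDeg3 G ≡ md3 n (tabulate G)
minDeg3≡md3 {n} {m} G = allF-cong n (λ u → cong (3 ℕ.≤ᵇ_) (sym (≡.trans
  (cong (deg FinP._≟_ u) (sym (ListP.map-tabulate id G))) (sumℕ-map G (inc FinP._≟_ u) (allFin m)))))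

sumClasses-⟦⟧ : ∀ n m P (F : LGraph n m → LPoly) (p : List (Fin n × Fin n) → Bool) (f : List (Fin n × Fin n) → ℚ) φ →
  (∀ G → P G ≡ p (tabulate G)) → (∀ G → ⟦ F G ⟧ φ ≡ recip (autCount G) * f (tabulate G)) →
  ⟦ sumClasses n m P F ⟧ φ ≡ wt n m * ∑ (lists m (pairs n)) (λ es → χ (p es) * f es)
sumClasses-⟦⟧ n m P F p f φ P≡ F≡ = begin
  ⟦ sumClasses n m P F ⟧ φ
    ≡⟨ ≡.trans (∑-concatMap (λ G → scaleP (recip (classSize G)) (F G)) (filterᵇ P (allGraphs n m)) _) (∑-filter P (allGraphs n m) _) ⟩
  ∑ (allGraphs n m) (λ G → χ (P G) * ⟦ scaleP (recip (classSize G)) (F G) ⟧ φ)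
    ≡⟨ ∑-cong (allGraphs n m) pointwise ⟩
  ∑ (allGraphs n m) (λ G → wt n m * (χ (p (tabulate G)) * f (tabulate G)))
    ≡⟨ ∑-tabulate m (pairs n) (λ es → wt n m * (χ (p es) * f es)) ⟩
  ∑ (lists m (pairs n)) (λ es → wt n m * (χ (p es) * f es))
    ≡⟨ sym (∑-*ˡ (wt n m) _ (lists m (pairs n))) ⟩
  wt n m * ∑ (lists m (pairs n)) (λ es → χ (p es) * f es) ∎
  where
  pointwise : ∀ G → χ (P G) * ⟦ scaleP (recip (classSize G)) (F G) ⟧ φ ≡ wt n m * (χ (p (tabulate G)) * f (tabulate G))
  pointwise G = begin
    χ (P G) * ⟦ scaleP (recip (classSize G)) (F G) ⟧ φ
      ≡⟨ cong₂ _*_ (cong χ (P≡ G)) (≡.trans (⟦⟧-scaleP (recip (classSize G)) (F G) φ) (≡.trans (cong (recip (classSize G) *_) (F≡ G)) (sym (*-assoc (recip (classSize G)) _ _)))) ⟩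
    χ (p (tabulate G)) * ((recip (classSize G) * recip (autCount G)) * f (tabulate G))
      ≡⟨ cong (λ z → χ (p (tabulate G)) * (z * f (tabulate G))) (recip-* (classSize G) (autCount G) (vol≢0 n m) (orbit-stabiliser G)) ⟩
    χ (p (tabulate G)) * (wt n m * f (tabulate G))
      ≡⟨ *-left-comm (χ (p (tabulate G))) (wt n m) _ ⟩
    wt n m * (χ (p (tabulate G)) * f (tabulate G)) ∎

𝒲-Λ : ∀ h N φ → ⟦ 𝒲 (suc (suc h)) N ⟧ φ ≡ Λ h (whiteEvenSum φ) N
𝒲-Λ h N φ = sumClasses-⟦⟧ N (N ℕ.+ suc h) connected (λ G → scaleP (recip (autCount G)) (Wbw (toFG G)))
  (connᵇ N) (λ es → whiteEvenSum φ (gr N es)) φ connected-tabulate (λ G →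
    ≡.trans (⟦⟧-scaleP (recip (autCount G)) (Wbw (toFG G)) φ) (cong (recip (autCount G) *_) (Wbw-sum G)))
  where
  Wbw-sum : ∀ G → ⟦ Wbw (toFG G) ⟧ φ ≡ whiteEvenSum φ (gr N (tabulate G))
  Wbw-sum G = ≡.trans (∑-map _ (colourings (toFG G)) _) (≡.trans (∑-cong (colourings (toFG G)) (λ c → *-identityˡ _))
    (≡.trans (∑-colourings (toFG G) (λ _ j _ → φ (ℤ.+ j))) (cong (λ es → whiteEvenSum φ (gr N es)) (ListP.map-tabulate id G))))

module _ (h N : ℕ) (φ : ℤ → ℚ) where

  private
    Q : ℕ → ℕ → ℕ → ℚ
    Q i j k = ⟦ substMono (i , j , k) N ⟧ φ

  -- Joins the two readings of the right side: the sum over attached trees is a product of series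
  -- over the coloured vertices by `τ-colours`, and this product is the substituted monomial by
  -- `prodS-substMono`.
  trees-colourSum : ∀ v es → length es ≡ v ℕ.+ suc h → T (md3 v es) → ∀ ns → length ns ≡ length es →
    τ (subdivided v es ns) id (Gr.vs (subdivided v es ns)) N (whiteEvenSum φ) ≡ colourSum Q (subdivided v es ns)
  trees-colourSum v es len md ns len′ = ≡.trans
    (τ-colours φ (Gr.vs K) K id [] (partition (≡⇒↭ (sym (ListP.map-id _))) (subdivided-unique v es md ns len′)) N)
    (∑-cong (cols (Gr._≟_ K) (Gr.vs K)) (λ c → ≡.trans
      (⟦⟧-cong (prodS (map (seriesAt K c) (Gr.vs K)) N) (λ m → cong φ (ℤP.+-identityʳ m)))
      (at (prodS-substMono c (λ v → even? (bc (Gr._≟_ K) (Gr.es K) c v)) (Gr.vs K)) N φ)))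
    where K = subdivided v es ns

  𝒳-⟦⟧ : ∀ {n m} (G : LGraph n m) → ⟦ 𝒳 G N ⟧ φ ≡
          recip (autCount G) * ∑ (upTo (suc N)) (λ k → ∑ᵗ m k (λ ns → colourSum Q (subdivided n (tabulate G) ns)))
  𝒳-⟦⟧ {n} {m} G = begin
    ⟦ 𝒳 G N ⟧ φ
      ≡⟨ ∑-concatMap (λ k → concatMap (λ (q , mono) → scaleP q (substMono mono N)) (𝒵 G k)) (upTo (suc N)) _ ⟩
    ∑ (upTo (suc N)) (λ k → ∑ (concatMap (λ (q , mono) → scaleP q (substMono mono N)) (𝒵 G k)) (λ (j , a) → a * φ j))
      ≡⟨ ∑-cong (upTo (suc N)) (λ k → ≡.trans (∑-concatMap _ (𝒵 G k) _) (≡.trans (∑-cong (𝒵 G k) (λ (q , mono) → ⟦⟧-scaleP q (substMono mono N) φ)) (layer k))) ⟩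
    ∑ (upTo (suc N)) (λ k → recip (autCount G) * ∑ᵗ m k (λ ns → colourSum Q (subdivided n (tabulate G) ns)))
      ≡⟨ sym (∑-*ˡ (recip (autCount G)) _ (upTo (suc N))) ⟩
    recip (autCount G) * ∑ (upTo (suc N)) (λ k → ∑ᵗ m k (λ ns → colourSum Q (subdivided n (tabulate G) ns))) ∎
    where
    layer : ∀ k → ∑ (𝒵 G k) (λ (q , mono) → q * ⟦ substMono mono N ⟧ φ) ≡ recip (autCount G) * ∑ᵗ m k (λ ns → colourSum Q (subdivided n (tabulate G) ns))
    layer k = begin
      ∑ (𝒵 G k) (λ (q , mono) → q * ⟦ substMono mono N ⟧ φ)
        ≡⟨ ∑-concatMap (λ ns → map (λ mono → (recip (autCount G) , mono)) (Wfull (subdivide G ns))) (tuples m k) _ ⟩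
      ∑ (tuples m k) (λ ns → ∑ (map (λ mono → (recip (autCount G) , mono)) (Wfull (subdivide G ns))) (λ (q , mono) → q * ⟦ substMono mono N ⟧ φ))
        ≡⟨ ∑-cong (tuples m k) (λ ns → ≡.trans (∑-map _ (Wfull (subdivide G ns)) _) (≡.trans (∑-map _ (colourings (subdivide G ns)) _)
             (≡.trans (sym (∑-*ˡ (recip (autCount G)) _ (colourings (subdivide G ns)))) (cong (recip (autCount G) *_)
               (≡.trans (∑-colourings (subdivide G ns) Q) (colourSum-subdivide Q G ns)))))) ⟩
      ∑ (tuples m k) (λ ns → recip (autCount G) * colourSum Q (subdivided n (tabulate G) (tabulate ns)))
        ≡⟨ sym (∑-*ˡ (recip (autCount G)) _ (tuples m k)) ⟩
      recip (autCount G) * ∑ (tuples m k) (λ ns → colourSum Q (subdivided n (tabulate G) (tabulate ns)))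
        ≡⟨ cong (recip (autCount G) *_) (∑-tuples m k (λ ns → colourSum Q (subdivided n (tabulate G) ns))) ⟩
      recip (autCount G) * ∑ᵗ m k (λ ns → colourSum Q (subdivided n (tabulate G) ns)) ∎

  -- The bound of `Φ` is set to N, because 𝒳 is truncated at N subdivision vertices.
  sumΓ≥3𝒳-Φ : ⟦ sumΓ≥3𝒳 (suc (suc h)) N ⟧ φ ≡ Φ h N (whiteEvenSum φ) N
  sumΓ≥3𝒳-Φ = begin
    ⟦ sumΓ≥3𝒳 (suc (suc h)) N ⟧ φ
      ≡⟨ ∑-concatMap (λ v → sumClasses v (v ℕ.+ suc h) (λ G → connected G ∧ minDeg3 G) (λ G → 𝒳 G N)) (upTo (suc (2 ℕ.* suc (suc h) ∸ 2))) _ ⟩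
    ∑ (upTo (suc (2 ℕ.* suc (suc h) ∸ 2))) (λ v → ⟦ sumClasses v (v ℕ.+ suc h) (λ G → connected G ∧ minDeg3 G) (λ G → 𝒳 G N) ⟧ φ)
      ≡⟨ ∑-cong (upTo (suc (2 ℕ.* suc (suc h) ∸ 2))) (λ v → sumClasses-⟦⟧ v (v ℕ.+ suc h) _ _ (λ es → connᵇ v es ∧ md3 v es) (λ es → polynomial v es) φ
           (λ G → cong₂ _∧_ (connected-tabulate G) (minDeg3≡md3 G)) 𝒳-⟦⟧) ⟩
    Ω h N polynomial
      ≡⟨ Ω-cong h N (λ v es len md → ∑-cong (upTo (suc N)) (λ k → ∑ᵗ-cong (v ℕ.+ suc h) k (λ ns p _ → sym (trees-colourSum v es len md ns (≡.trans p (sym len)))))) ⟩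
    Φ h N (whiteEvenSum φ) N ∎
    where
    polynomial : ∀ v → List (Fin v × Fin v) → ℚ
    polynomial v es = ∑ (upTo (suc N)) (λ k → ∑ᵗ (v ℕ.+ suc h) k (λ ns → colourSum Q (subdivided v es ns)))

theorem4p16 : (g : ℕ) → 2 ≤ g → (N : ℕ) (k : ℤ) →
    coeff k (𝒲 g N) ≡ coeff k (sumΓ≥3𝒳 g N)
theorem4p16 (suc zero)    (s≤s ())
theorem4p16 (suc (suc h)) 2≤g N k = begin
  coeff k (𝒲 (suc (suc h)) N)                     ≡⟨ coeff-⟦⟧ k (𝒲 (suc (suc h)) N) ⟩
  ⟦ 𝒲 (suc (suc h)) N ⟧ (δ k)                     ≡⟨ 𝒲-Λ h N (δ k) ⟩
  -- With both sides written as functionals of a graph invariant, the induction is used at N itself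
  -- with bound N; `δ k` selects the coefficient of t^k.
  Λ h (whiteEvenSum (δ k)) N                      ≡⟨ Λ≡Φ h N N ℕP.≤-refl (whiteEvenSum (δ k)) (colourSum-Inv (λ _ j _ → δ k (ℤ.+ j))) ⟩
  Φ h N (whiteEvenSum (δ k)) N                    ≡⟨ sym (sumΓ≥3𝒳-Φ h N (δ k)) ⟩
  ⟦ sumΓ≥3𝒳 (suc (suc h)) N ⟧ (δ k)               ≡⟨ sym (coeff-⟦⟧ k (sumΓ≥3𝒳 (suc (suc h)) N)) ⟩
  coeff k (sumΓ≥3𝒳 (suc (suc h)) N)               ∎
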